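{- Let $d\geq 5$ and let $\Delta$ be a prime normal $(d-1)$-pseudomanifold with $g_2(\Delta)=1$. Then $\Delta$ is (combinatorially isomorphic to a complex) obtained by centrally retriangulating a stacked $(d-1)$-sphere $S$ along the star $\operatorname{st}_S\tau$ of one of its faces $\tau$, where the dimension $i$ of $\tau$ satisfies $0<i<d-1$. Furthermore, $\Delta\in\mathcal{G}_d$.
   Context: All simplicial complexes are finite. A normal $(d-1)$-pseudomanifold is a $(d-1)$-dimensional simplicial complex that is pure and connected, in which every $(d-2)$-face lies in exactly two facets, and in which the link of every face of dimension $\leq d-3$ is connected. A missing face of $\Delta$ is a subset $\sigma$ of the vertex set with $\sigma\notin\Delta$ but every proper subset of $\sigma$ in $\Delta$; a missing facet of a pure $(d-1)$-dimensional complex is a missing face of dimension $d-1$ (i.e. with $d$ vertices); $\Delta$ is prime if it has no missing facets. For a face $\tau$, $\operatorname{lk}_\Delta\tau=\{\sigma-\tau:\tau\subseteq\sigma\in\Delta\}$ and $\operatorname{st}_\Delta\tau=\{\sigma\in\Delta:\sigma\cup\tau\in\Delta\}$. For a complex $\Gamma$ of dimension $e-1$ with $f_{i}$ faces of dimension $i$ ($f_{ -1}=1$), the $h$-numbers are defined by $\sum_{j=0}^{e}h_j\lambda^{e-j}=\sum_{i=0}^{e}f_{i-1}(\lambda-1)^{e-i}$, and $g_0=1$, $g_i=h_i-h_{i-1}$ for $i\geq1$. $\sigma^k$ denotes a $k$-simplex and $\partial\sigma^k$ its boundary complex. A stacked $(d-1)$-sphere is a complex obtained from $\partial\sigma^d$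 by a finite (possibly empty) sequence of stackings, where a stacking removes a facet $F$ and adds a new vertex $w$ together with all faces $w\cup G$, $G\subsetneq F$ (equivalently, an iterated connected sum of copies of $\partial\sigma^d$). Central retriangulation: if $\Gamma$ is an $m$-dimensional complex and $B\subseteq\Gamma$ is a subcomplex which is an $m$-dimensional (simplicial or homology) ball with boundary complex $\partial B$, then $\operatorname{crtr}_B(\Gamma)$ is obtained by removing all interior faces of $B$ (faces of $B$ not in $\partial B$) and adding a new vertex $u$ together with all faces $\{u\}\cup F$, $F\in\partial B$. $\mathcal{G}_d$ denotes the set of complexes that are either a join $\partial\sigma^i*\partial\sigma^{d-i}$ with $2\leq i\leq d-2$, or a join of $\partial\sigma^{d-2}$ with a cycle (a 1-dimensional complex that is a graph cycle). -}

module Defs where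

open import Data.Nat using (ℕ; zero; suc; _+_; _*_; _∸_; _≤_; _<_; _≤ᵇ_; _≡ᵇ_; NonZero)
open import Data.Nat.DivMod using (_%_; m%n<n)
open import Data.Nat.Combinatorics using (_C_)
open import Data.Integer using (ℤ; +_; -_) renaming (_+_ to _+ℤ_; _*_ to _*ℤ_; _-_ to _-ℤ_)
open import Data.Bool using (Bool; true; false; _∧_; _∨_; not)
open import Data.Bool.Properties using () renaming (_≟_ to _≟B_)
open import Data.Fin using (Fin; zero; suc; toℕ; fromℕ<) renaming (_≟_ to _≟F_)
open import Data.Fin.Subset using (Subset; ⊥; ⊤; ⁅_⁆; _∉_) renaming (_∈_ to _∈S_)
open import Data.Fin.Subset using ( _⊆_; _⊂_; _∪_; _∩_; ∣_∣)
open import Data.Fin.Subset.Properties using (_⊆?_)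
open import Data.Vec using (Vec; []; _∷_; take; drop; tabulate; lookup)
open import Data.Vec.Properties using (≡-dec)
open import Data.List using (List; []; _∷_; map; _++_; filter; length)
open import Data.Bool.ListAction using (any)
open import Data.Product using (Σ; _×_; _,_; ∃; ∃-syntax; Σ-syntax)
open import Data.Sum using (_⊎_)
open import Relation.Nullary using (¬_; does)
open import Relation.Binary.PropositionalEquality using (_≡_; _≢_)

allSubsets : (n : ℕ) → List (Subset n)
allSubsets zero = [] ∷ []
allSubsets (suc n) = map (false ∷_) (allSubsets n) ++ map (true ∷_) (allSubsets n)

allFin : (n : ℕ) → List (Fin n)
allFin zero = []
allFin (suc n) = zero ∷ map suc (allFin n)

_==S_ : {n : ℕ} → Subset n → Subset n → Bool
σ ==S τ = does (≡-dec _≟B_ σ τ)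

_⊆ᵇ_ : {n : ℕ} → Subset n → Subset n → Bool
σ ⊆ᵇ τ = does (σ ⊆? τ)

countS : {n : ℕ} → (Subset n → Bool) → ℕ
countS {n} P = length (filter (λ σ → P σ ≟B true) (allSubsets n))

anyS : {n : ℕ} → (Subset n → Bool) → Bool
anyS {n} P = any P (allSubsets n)

-- Simplicial complexes on the ground set Fin n.
-- A complex is given by its (decidable) face-membership predicate;
-- faces are subsets of Fin n.  Its vertex set is {v | {v} ∈ Δ}.

Cx : ℕ → Set
Cx n = Subset n → Bool

IsComplex : {n : ℕ} → Cx n → Set
IsComplex Δ = (Δ ⊥ ≡ true) × (∀ σ τ → τ ⊆ σ → Δ σ ≡ true → Δ τ ≡ true)

IsVertex : {n : ℕ} → Cx n → Fin n → Set
IsVertex Δ v = Δ ⁅ v ⁆ ≡ true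

data Reach {n : ℕ} (Δ : Cx n) : Fin n → Fin n → Set where
  here : ∀ {u} → Reach Δ u u
  step : ∀ {u v w} → Δ (⁅ u ⁆ ∪ ⁅ v ⁆) ≡ true → Reach Δ v w → Reach Δ u w

Connected : {n : ℕ} → Cx n → Set
Connected Δ = ∀ u v → IsVertex Δ u → IsVertex Δ v → Reach Δ u v

lk : {n : ℕ} → Cx n → Subset n → Cx n
lk Δ τ σ = ((σ ∩ τ) ==S ⊥) ∧ Δ (σ ∪ τ)

st : {n : ℕ} → Cx n → Subset n → Cx n
st Δ τ σ = Δ (σ ∪ τ)

PureDim : {n : ℕ} → ℕ → Cx n → Set
PureDim d Δ = (∀ σ → Δ σ ≡ true → ∣ σ ∣ ≤ d)
            × (∀ σ → Δ σ ≡ true → Σ[ F ∈ _ ] (σ ⊆ F × Δ F ≡ true × ∣ F ∣ ≡ d))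

facetsContaining : {n : ℕ} → ℕ → Cx n → Subset n → ℕ
facetsContaining d Δ τ = countS (λ F → Δ F ∧ (∣ F ∣ ≡ᵇ d) ∧ (τ ⊆ᵇ F))

NormalPM : {n : ℕ} → ℕ → Cx n → Set
NormalPM d Δ = IsComplex Δ × PureDim d Δ × Connected Δ
  × (∀ τ → Δ τ ≡ true → ∣ τ ∣ ≡ d ∸ 1 → facetsContaining d Δ τ ≡ 2)
  × (∀ τ → Δ τ ≡ true → ∣ τ ∣ ≤ d ∸ 2 → Connected (lk Δ τ))

MissingFace : {n : ℕ} → Cx n → Subset n → Set
MissingFace Δ σ = (∀ v → v ∈S σ → IsVertex Δ v) × (Δ σ ≡ false)
                × (∀ τ → τ ⊂ σ → Δ τ ≡ true)

Prime : {n : ℕ} → ℕ → Cx n → Set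
Prime d Δ = ¬ (Σ[ σ ∈ _ ] (MissingFace Δ σ × ∣ σ ∣ ≡ d))

-- fS Δ k = number of faces with k vertices = f_{k-1}
fS : {n : ℕ} → Cx n → ℕ → ℕ
fS Δ k = countS (λ σ → Δ σ ∧ (∣ σ ∣ ≡ᵇ k))

sgn : ℕ → ℤ
sgn zero = + 1
sgn (suc m) = - sgn m

sumTo : ℕ → (ℕ → ℤ) → ℤ
sumTo zero t = t 0
sumTo (suc j) t = sumTo j t +ℤ t (suc j)

-- h-numbers of an (e-1)-dimensional complex: h_j is the coefficient of
-- λ^{e-j} in  Σ_{i=0}^{e} f_{i-1} (λ-1)^{e-i},  i.e.
-- h_j = Σ_{i=0}^{j} (-1)^{j-i} C(e-i, j-i) f_{i-1}.
hNum : {n : ℕ} → ℕ → Cx n → ℕ → ℤ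
hNum e Δ j = sumTo j (λ i → sgn (j ∸ i) *ℤ (+ ((e ∸ i) C (j ∸ i))) *ℤ (+ fS Δ i))

gNum : {n : ℕ} → ℕ → Cx n → ℕ → ℤ
gNum e Δ zero = + 1
gNum e Δ (suc j) = hNum e Δ (suc j) -ℤ hNum e Δ j

image : {n m : ℕ} → (Fin n → Fin m) → Subset n → Subset m
image {n} {m} f σ = tabulate (λ j → any (λ i → lookup σ i ∧ does (f i ≟F j)) (allFin n))

Iso : {n m : ℕ} → Cx n → Cx m → Set
Iso {n} {m} Δ Γ = Σ[ f ∈ (Fin n → Fin m) ]
    ((∀ u v → IsVertex Δ u → IsVertex Δ v → f u ≡ f v → u ≡ v)
   × (∀ σ → Δ σ ≡ true → Γ (image f σ) ≡ true)
   × (∀ τ → Γ τ ≡ true → Σ[ σ ∈ Subset n ] (Δ σ ≡ true × image f σ ≡ τ)))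

bdSimplex : (k : ℕ) → Cx (suc k)
bdSimplex k σ = not (σ ==S ⊤)

join : {a b : ℕ} → Cx a → Cx b → Cx (a + b)
join {a} Γ₁ Γ₂ σ = Γ₁ (take a σ) ∧ Γ₂ (drop a σ)

cnext : {c : ℕ} → .{{NonZero c}} → Fin c → Fin c
cnext {c} i = fromℕ< (m%n<n (suc (toℕ i)) c)

cycleCx : (c : ℕ) → .{{NonZero c}} → Cx c
cycleCx c σ = (∣ σ ∣ ≤ᵇ 1) ∨ any (λ i → σ ==S (⁅ i ⁆ ∪ ⁅ cnext i ⁆)) (allFin c)

InGd : {n : ℕ} → ℕ → Cx n → Set
InGd d Δ =
    (Σ[ i ∈ ℕ ] (2 ≤ i × i ≤ d ∸ 2 × Iso Δ (join (bdSimplex i) (bdSimplex (d ∸ i)))))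
  ⊎ (Σ[ c ∈ ℕ ] (3 ≤ c × Iso Δ (join (bdSimplex (d ∸ 2)) (cycleCx (suc (c ∸ 1))))))

-- Stacked (d-1)-spheres: built from ∂σ^d by stackings; the new vertex of a
-- stacking is placed at position zero of Fin (suc n).

stackAt : {n : ℕ} → Cx n → Subset n → Cx (suc n)
stackAt Γ F (false ∷ σ) = Γ σ ∧ not (σ ==S F)
stackAt Γ F (true ∷ σ) = (σ ⊆ᵇ F) ∧ not (σ ==S F)

data Stacked (d : ℕ) : (n : ℕ) → Cx n → Set where
  base  : Stacked d (suc d) (bdSimplex d)
  stack : ∀ {n Γ} F → Stacked d n Γ → Γ F ≡ true → ∣ F ∣ ≡ d
        → Stacked d (suc n) (stackAt Γ F)

-- Central retriangulation of an m-dimensional complex Γ along a subcomplex B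
-- which is a pure m-dimensional ball; facets have d = m+1 vertices.
-- ∂B = subcomplex generated by the (m-1)-faces of B lying in exactly one
-- facet of B.  The new vertex u is position zero of Fin (suc n).

bdry : {n : ℕ} → ℕ → Cx n → Cx n
bdry d B σ = anyS (λ G → B G ∧ (∣ G ∣ ≡ᵇ d ∸ 1) ∧ (σ ⊆ᵇ G)
                         ∧ (facetsContaining d B G ≡ᵇ 1))

crtr : {n : ℕ} → ℕ → Cx n → Cx n → Cx (suc n)
crtr d B Γ (false ∷ σ) = Γ σ ∧ not (B σ ∧ not (bdry d B σ))
crtr d B Γ (true ∷ σ) = bdry d B σ

-- For a face τ with p = d − ∣τ∣ and a set W of vertices of lk τ put
-- φ(W) = 2 e(W) − 2 p ∣W∣ + p (p + 1), which for the full vertex set is 2 g₂(lk τ).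
-- Rigidity says that φ(W) is at most 2 g₂(lk τ) whenever W contains a facet.  For surface
-- links (p = 3) this is an Euler characteristic bound combined with a parity count on link
-- cycles; for larger p one enlarges W by vertex stars, using that φ is supermodular
-- and that φ of a cone is φ of its base.  Hence g₂ does not increase when passing to links, and
-- each missing triangle at a vertex of lk τ adds to g₂(lk τ).  When g₂(Δ) = 1, these
-- inequalities force a smallest clique σ that is not a face to have between 3 and d − 1
-- elements and lk(σ ∖ z) to be independent of z ∈ σ; strong connectivity then gives
-- Δ = ∂σ * L, where L is the boundary of a simplex or, if ∣σ∣ = d − 1, a cycle.
-- The first join retriangulates the boundary of a simplex along the star of a face with ∣σ∣
-- vertices; the second retriangulates the stacked sphere ∂(σ * path) along the star of σ.

module Submission where

open import Defs
open import Data.Nat using (ℕ; zero; suc; _≤_; _<_; _≡ᵇ_; _≤ᵇ_; z≤n; s≤s; _∸_) renaming (_+_ to _+ℕ_)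
import Data.Nat.Properties as ℕP
open import Data.Nat.DivMod using (_%_; m%n<n; m<n⇒m%n≡m; n%n≡0)
open import Data.Nat.Combinatorics using (nC1≡n; nCk+nC[k+1]≡[n+1]C[k+1]; nCn≡1; nCk≡nC[n∸k]) renaming (_C_ to _choose_)
open import Data.Integer using (ℤ; -_; _+_; _*_; _-_; +≤+; 0ℤ; 1ℤ) renaming (+_ to pos; _≤_ to _≤ℤ_)
import Data.Integer.Properties as ℤP
open import Data.Integer.Tactic.RingSolver using (solve-∀)
open import Data.Nat.Tactic.RingSolver renaming (solve-∀ to ℕ-solve-∀) using ()
open import Data.Bool using (Bool; true; false; _∧_; _∨_; not; if_then_else_)
open import Data.Bool.Properties using (∧-comm; T-≡; ∧-identityʳ; ∧-zeroʳ) renaming (_≟_ to _≟B_)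
open import Data.Fin using (Fin; zero; suc; toℕ; fromℕ<; cast; punchOut) renaming (_≟_ to _≟F_)
open import Data.Fin.Properties using (any?; pigeonhole; toℕ<n; toℕ-injective; toℕ-fromℕ<; splitAt-join; join-splitAt; cast-involutive; cast-is-id; punchIn-punchOut; injective⇒≤; toℕ-cast; toℕ-↑ˡ; toℕ-↑ʳ)
open import Data.Fin.Subset using (Subset; ⊥; ⊤; ⁅_⁆; _∈_; _∉_; _⊆_; _⊂_; _∪_; _∩_; ∁; ∣_∣)
open import Data.Fin.Subset.Properties using (_⊆?_; x∈⁅x⁆; x∈⁅y⁆⇒x≡y; x∈p∪q⁻; x∈p∪q⁺; x∈p∩q⁺; x∈p∩q⁻; ⊆-antisym; ⊆-refl; p⊆q⇒∣p∣≤∣q∣; p⊂q⇒∣p∣<∣q∣; x∈p∧x≢y⇒x∈p-y; p─q⊆p; ∪-comm; ∪-assoc; ∪-identityˡ; ∪-identityʳ; ∉⊥; ∣⊥∣≡0; ∣⁅x⁆∣≡1; ∈⊤; ∣⊤∣≡n; ∣p∣≤n; _∈?_; anySubset?; x∈∁p⇒x∉p; x∉p⇒x∈∁p)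
open import Data.Vec using ([]; _∷_; lookup; tabulate; take; drop; here; there)
open import Data.Vec.Properties using (≡-dec; []=⇒lookup; lookup⇒[]=; lookup∘tabulate)
open import Data.Bool.ListAction using (any)
open import Data.List using (List; []; _∷_; map; _++_; filter; length)
open import Data.Product using (Σ; _×_; _,_; ∃; Σ-syntax; proj₁; proj₂)
open import Data.Sum using (_⊎_; inj₁; inj₂)
open import Data.Empty using (⊥-elim) renaming (⊥ to Empty)
open import Relation.Binary.Definitions using (tri<; tri≈; tri>)
open import Function.Bundles using (module Equivalence)
open import Relation.Nullary using (¬_; Dec; yes; no; does)
open import Relation.Binary.PropositionalEquality using (_≡_; _≢_; refl; sym; trans; cong; cong₂; subst; subst₂)

-- Finite sums and counting

-- With 2 g₂ equal to 2, a link vertex can carry at most one missing triangle, and its own link then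
-- has g₂ = 0. Later contradictions exhibit a second missing triangle, or one where g₂ vanishes. The
-- obstacle is that rigidity starts only at p = 3: an m-cycle has value 6 - 2m, which is negative
-- for m > 3. Arguments that descend through links stop before cycles or use this exact value; a
-- missing face that has as many vertices as a facet is left to primeness. The crux is that a vertex
-- of lk(σ ∖ z) must be adjacent to z. For x, y in σ the stars in lk τ share x, y, their common link
-- and z. Each star has the missing triangle x y z, so supermodularity gives the common part value
-- at least 2, which forces z to have many neighbours in it. That σ exists is where d ≥ 5 enters. If
-- every clique were a face, link cycles would have at least four vertices and value at most -2;
-- comparing two stars turns this deficit into g₂ ≥ 1 for p = 4, then for p = 3 inside p = 5, where
-- the values collide. As to the size of σ, primeness excludes d, and d + 1 would make Δ the
-- boundary of a simplex, where g₂ = 0.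

⟦_⟧ : Bool → ℤ
⟦ true ⟧ = 1ℤ
⟦ false ⟧ = 0ℤ

-- Linear estimates take this form throughout: the hypotheses are added up to one inequality
-- `a ≤ b`, and a ring identity certifies the conclusion.
≤-by : ∀ {a b x y} → a ≤ℤ b → x + b ≡ y + a → x ≤ℤ y
≤-by {a} {b} {x} {y} a≤b e = ℤP.≤-trans (ℤP.≤-reflexive (lem₁ x b))
    (ℤP.≤-trans (ℤP.+-monoˡ-≤ (- b) (ℤP.≤-reflexive e)) (ℤP.≤-trans (ℤP.+-monoʳ-≤ (y + a) (ℤP.neg-mono-≤ a≤b)) (ℤP.≤-reflexive (lem₂ y a))))
  where
  lem₁ : ∀ x b → x ≡ x + b + - b
  lem₁ = solve-∀
  lem₂ : ∀ y a → y + a + - a ≡ y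
  lem₂ = solve-∀

infixl 6 _⊕_
_⊕_ : ∀ {a b c d} → a ≤ℤ b → c ≤ℤ d → a + c ≤ℤ b + d
_⊕_ = ℤP.+-mono-≤

abstract
  ∑ : {n : ℕ} → (Fin n → ℤ) → ℤ
  ∑ {zero} f = 0ℤ
  ∑ {suc n} f = f zero + ∑ (λ i → f (suc i))

  ∑-zero : (f : Fin 0 → ℤ) → ∑ f ≡ 0ℤ
  ∑-zero f = refl

  ∑-suc : ∀ {n} (f : Fin (suc n) → ℤ) → ∑ f ≡ f zero + ∑ (λ i → f (suc i))
  ∑-suc f = refl

  ∑-cong : ∀ {n} {f g : Fin n → ℤ} → (∀ i → f i ≡ g i) → ∑ f ≡ ∑ g
  ∑-cong {zero} h = refl
  ∑-cong {suc n} h = cong₂ _+_ (h zero) (∑-cong (λ i → h (suc i)))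

  ∑-mono : ∀ {n} {f g : Fin n → ℤ} → (∀ i → f i ≤ℤ g i) → ∑ f ≤ℤ ∑ g
  ∑-mono {zero} h = ℤP.≤-refl
  ∑-mono {suc n} h = h zero ⊕ ∑-mono (λ i → h (suc i))

  ∑-0 : ∀ n → ∑ {n} (λ _ → 0ℤ) ≡ 0ℤ
  ∑-0 zero = refl
  ∑-0 (suc n) = trans (ℤP.+-identityˡ _) (∑-0 n)

  ∑-+ : ∀ {n} (f g : Fin n → ℤ) → ∑ (λ i → f i + g i) ≡ ∑ f + ∑ g
  ∑-+ {zero} f g = refl
  ∑-+ {suc n} f g = trans (cong ((f zero + g zero) +_) (∑-+ (λ i → f (suc i)) (λ i → g (suc i)))) (lem (f zero) (g zero) _ _)
    where
    lem : ∀ a b c d → a + b + (c + d) ≡ a + c + (b + d)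
    lem = solve-∀

  ∑-* : ∀ {n} (c : ℤ) (f : Fin n → ℤ) → ∑ (λ i → c * f i) ≡ c * ∑ f
  ∑-* {zero} c f = sym (ℤP.*-zeroʳ c)
  ∑-* {suc n} c f = trans (cong (c * f zero +_) (∑-* c (λ i → f (suc i)))) (sym (ℤP.*-distribˡ-+ c (f zero) _))

  ∑-swap : ∀ {n m} (f : Fin n → Fin m → ℤ) → ∑ (λ i → ∑ (λ j → f i j)) ≡ ∑ (λ j → ∑ (λ i → f i j))
  ∑-swap {zero} {m} f = sym (∑-0 m)
  ∑-swap {suc n} f = trans (cong (∑ (f zero) +_) (∑-swap (λ i → f (suc i))))
                           (sym (∑-+ (f zero) (λ j → ∑ (λ i → f (suc i) j))))

∑-nonneg : ∀ {n} {f : Fin n → ℤ} → (∀ i → 0ℤ ≤ℤ f i) → 0ℤ ≤ℤ ∑ f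
∑-nonneg {n} {f} h = subst (_≤ℤ ∑ f) (∑-0 n) (∑-mono h)

_==_ : ∀ {n} → Fin n → Fin n → Bool
i == j = does (i ≟F j)

==-refl : ∀ {n} (i : Fin n) → (i == i) ≡ true
==-refl i with i ≟F i
... | yes _ = refl
... | no ¬p = ⊥-elim (¬p refl)

==-≢ : ∀ {n} {i j : Fin n} → i ≢ j → (i == j) ≡ false
==-≢ {i = i} {j} h with i ≟F j
... | yes p = ⊥-elim (h p)
... | no _ = refl

==⇒≡ : ∀ {n} {i j : Fin n} → (i == j) ≡ true → i ≡ j
==⇒≡ {i = i} {j} h with i ≟F j
... | yes p = p

0≤⟦⟧ : ∀ b → 0ℤ ≤ℤ ⟦ b ⟧
0≤⟦⟧ true = +≤+ Data.Nat.z≤n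
0≤⟦⟧ false = ℤP.≤-refl

⟦⟧≤1 : ∀ b → ⟦ b ⟧ ≤ℤ 1ℤ
⟦⟧≤1 true = ℤP.≤-refl
⟦⟧≤1 false = +≤+ Data.Nat.z≤n

⟦∧⟧ : ∀ a b → ⟦ a ∧ b ⟧ ≡ ⟦ a ⟧ * ⟦ b ⟧
⟦∧⟧ true b = sym (ℤP.*-identityˡ ⟦ b ⟧)
⟦∧⟧ false b = sym (ℤP.*-zeroˡ ⟦ b ⟧)

off : ∀ {n} → Fin n → (Fin n → ℤ) → Fin n → ℤ
off i f j = ⟦ not (i == j) ⟧ * f j

off-≢ : ∀ {n} {i j : Fin n} (f : Fin n → ℤ) → i ≢ j → off i f j ≡ f j
off-≢ {j = j} f i≢j = trans (cong (λ b → ⟦ not b ⟧ * f j) (==-≢ i≢j)) (ℤP.*-identityˡ _)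

0≤off : ∀ {n} (i : Fin n) {f : Fin n → ℤ} → (∀ j → 0ℤ ≤ℤ f j) → ∀ j → 0ℤ ≤ℤ off i f j
0≤off i {f} h j with i == j
... | true = ℤP.≤-reflexive (sym (ℤP.*-zeroˡ (f j)))
... | false = subst (0ℤ ≤ℤ_) (sym (ℤP.*-identityˡ (f j))) (h j)

∑-off : ∀ {n} (i : Fin n) (f : Fin n → ℤ) → ∑ f ≡ f i + ∑ (off i f)
∑-off zero f = trans (∑-suc f) (cong (f zero +_) (trans (sym (ℤP.+-identityˡ _)) (trans (cong₂ _+_ (sym (ℤP.*-zeroˡ (f zero)))
                 (∑-cong (λ j → sym (ℤP.*-identityˡ (f (suc j)))))) (sym (∑-suc (off zero f))))))
∑-off (suc i) f = trans (∑-suc f) (trans (cong (f zero +_) (∑-off i (λ j → f (suc j))))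
                 (trans (lem (f zero) (f (suc i)) _) (cong (f (suc i) +_) (trans (cong (_+ ∑ (off i (λ j → f (suc j)))) (sym (ℤP.*-identityˡ (f zero)))) (sym (∑-suc (off (suc i) f)))))))
  where
  lem : ∀ a b c → a + (b + c) ≡ b + (a + c)
  lem = solve-∀

∑-δ : ∀ {n} (i : Fin n) (f : Fin n → ℤ) → ∑ (λ j → ⟦ i == j ⟧ * f j) ≡ f i
∑-δ {n} i f = trans (∑-off i _) (trans (cong₂ _+_ (trans (cong (λ b → ⟦ b ⟧ * f i) (==-refl i)) (ℤP.*-identityˡ _))
      (trans (∑-cong z) (∑-0 n))) (ℤP.+-identityʳ _))
  where
  z : ∀ j → off i (λ j → ⟦ i == j ⟧ * f j) j ≡ 0ℤ
  z j with i == j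
  ... | true = ℤP.*-zeroˡ (1ℤ * f j)
  ... | false = trans (ℤP.*-identityˡ _) (ℤP.*-zeroˡ (f j))

∑-≥₁ : ∀ {n} {f : Fin n → ℤ} → (∀ j → 0ℤ ≤ℤ f j) → ∀ i → f i ≤ℤ ∑ f
∑-≥₁ {f = f} h i = subst₂ _≤ℤ_ (ℤP.+-identityʳ _) (sym (∑-off i f)) (ℤP.+-monoʳ-≤ (f i) (∑-nonneg (0≤off i h)))

∑-≥₂ : ∀ {n} {f : Fin n → ℤ} → (∀ j → 0ℤ ≤ℤ f j) → ∀ {i j} → i ≢ j → f i + f j ≤ℤ ∑ f
∑-≥₂ {f = f} h {i} {j} ij = subst₂ _≤ℤ_ (cong (f i +_) (off-≢ f ij)) (sym (∑-off i f))
  (ℤP.+-monoʳ-≤ (f i) (∑-≥₁ (0≤off i h) j))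

∑-≥₃ : ∀ {n} {f : Fin n → ℤ} → (∀ j → 0ℤ ≤ℤ f j) → ∀ {i j k} → i ≢ j → i ≢ k → j ≢ k → f i + (f j + f k) ≤ℤ ∑ f
∑-≥₃ {f = f} h {i} {j} {k} ij ik jk = subst₂ _≤ℤ_ (cong (f i +_) (cong₂ _+_ (off-≢ f ij) (off-≢ f ik))) (sym (∑-off i f))
  (ℤP.+-monoʳ-≤ (f i) (∑-≥₂ (0≤off i h) jk))

∑-≥₄ : ∀ {n} {f : Fin n → ℤ} → (∀ j → 0ℤ ≤ℤ f j) → ∀ {i j k l} → i ≢ j → i ≢ k → i ≢ l → j ≢ k → j ≢ l → k ≢ l
     → f i + (f j + (f k + f l)) ≤ℤ ∑ f
∑-≥₄ {f = f} h {i} ij ik il jk jl kl = subst₂ _≤ℤ_ (cong (f i +_) (cong₂ _+_ (off-≢ f ij) (cong₂ _+_ (off-≢ f ik) (off-≢ f il)))) (sym (∑-off i f))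
  (ℤP.+-monoʳ-≤ (f i) (∑-≥₃ (0≤off i h) jk jl kl))

-- Vertex sets that are summed over are Boolean predicates rather than Subsets.
♯ : ∀ {n} → (Fin n → Bool) → ℤ
♯ w = ∑ (λ i → ⟦ w i ⟧)

false≢true : false ≢ true
false≢true ()

contra : ∀ {a} {A : Set a} {b : Bool} → b ≡ true → b ≡ false → A
contra refl ()

bcase : (b : Bool) → (b ≡ true) ⊎ (b ≡ false)
bcase true = inj₁ refl
bcase false = inj₂ refl

≢true : ∀ {b} → ¬ (b ≡ true) → b ≡ false
≢true {true} h = ⊥-elim (h refl)
≢true {false} h = refl

∧⁺ : ∀ {a b} → a ≡ true → b ≡ true → a ∧ b ≡ true
∧⁺ refl refl = refl

∧ˡ : ∀ a {b} → a ∧ b ≡ true → a ≡ true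
∧ˡ true _ = refl

∧ʳ : ∀ a {b} → a ∧ b ≡ true → b ≡ true
∧ʳ true h = h

bool-ext : ∀ {a b} → (a ≡ true → b ≡ true) → (b ≡ true → a ≡ true) → a ≡ b
bool-ext {true} f g = sym (f refl)
bool-ext {false} {true} f g = ⊥-elim (false≢true (g refl))
bool-ext {false} {false} f g = refl

⟦⟧-mono : ∀ {a b} → (a ≡ true → b ≡ true) → ⟦ a ⟧ ≤ℤ ⟦ b ⟧
⟦⟧-mono {true} h = ℤP.≤-reflexive (cong ⟦_⟧ (sym (h refl)))
⟦⟧-mono {false} {b} h = 0≤⟦⟧ b

1≤0-absurd : ∀ {a} {A : Set a} → 1ℤ ≤ℤ 0ℤ → A
1≤0-absurd (+≤+ ())

find : ∀ {n} (w : Fin n → Bool) → (∃ λ i → w i ≡ true) ⊎ (∀ i → w i ≡ false)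
find w with any? (λ i → w i Data.Bool.≟ true)
... | yes p = inj₁ p
... | no ¬p = inj₂ (λ i → ≢true (λ e → ¬p (i , e)))

♯-∃ : ∀ {n} (w : Fin n → Bool) → 1ℤ ≤ℤ ♯ w → ∃ λ i → w i ≡ true
♯-∃ {n} w h with find w
... | inj₁ p = p
... | inj₂ z = 1≤0-absurd (subst (1ℤ ≤ℤ_) (trans (∑-cong (λ i → cong ⟦_⟧ (z i))) (∑-0 n)) h)

♯-mono : ∀ {n} {w w′ : Fin n → Bool} → (∀ i → w i ≡ true → w′ i ≡ true) → ♯ w ≤ℤ ♯ w′
♯-mono h = ∑-mono (λ i → ⟦⟧-mono (h i))

♯-cong : ∀ {n} {w w′ : Fin n → Bool} → (∀ i → w i ≡ w′ i) → ♯ w ≡ ♯ w′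
♯-cong h = ∑-cong (λ i → cong ⟦_⟧ (h i))

0≤♯ : ∀ {n} (w : Fin n → Bool) → 0ℤ ≤ℤ ♯ w
0≤♯ w = ∑-nonneg (λ i → 0≤⟦⟧ (w i))

-- A point of `w′` outside `w` could be added to `w` without leaving `w′`, so `w′` would be larger
-- by one.
♯-full : ∀ {n} {w w′ : Fin n → Bool} → (∀ i → w i ≡ true → w′ i ≡ true) → ♯ w′ ≤ℤ ♯ w → ∀ i → w′ i ≡ true → w i ≡ true
♯-full {w = w} {w′} h le i wi′ with bcase (w i)
... | inj₁ t = t
... | inj₂ f = 1≤0-absurd (≤-by (le ⊕ le₂) (lem (♯ w) (♯ w′)))
  where
  pt : ∀ j → ⟦ w j ⟧ + ⟦ i == j ⟧ * 1ℤ ≤ℤ ⟦ w′ j ⟧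
  pt j with i ≟F j
  ... | yes refl rewrite f | wi′ = ℤP.≤-refl
  ... | no _ = subst (_≤ℤ ⟦ w′ j ⟧) (sym (ℤP.+-identityʳ _)) (⟦⟧-mono (h j))
  le₂ : ♯ w + 1ℤ ≤ℤ ♯ w′
  le₂ = subst (_≤ℤ ♯ w′) (trans (∑-+ (λ j → ⟦ w j ⟧) (λ j → ⟦ i == j ⟧ * 1ℤ)) (cong (♯ w +_) (∑-δ i (λ _ → 1ℤ)))) (∑-mono pt)
  lem : ∀ a b → 1ℤ + (a + b) ≡ 0ℤ + (b + (a + 1ℤ))
  lem = solve-∀

-- Ordered pairs: every edge of a graph is counted twice.
Q : ∀ {n} → (Fin n → Fin n → Bool) → (Fin n → Bool) → ℤ
Q M w = ∑ (λ u → ∑ (λ v → ⟦ w u ∧ w v ∧ M u v ⟧))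

module _ {n : ℕ} (M : Fin n → Fin n → Bool) where

  Q-cong : {w w′ : Fin n → Bool} → (∀ i → w i ≡ w′ i) → Q M w ≡ Q M w′
  Q-cong h = ∑-cong (λ u → ∑-cong (λ v → cong₂ (λ a b → ⟦ a ∧ b ∧ M u v ⟧) (h u) (h v)))

  Q-mono : {w w′ : Fin n → Bool} → (∀ i → w i ≡ true → w′ i ≡ true) → Q M w ≤ℤ Q M w′
  Q-mono {w} h = ∑-mono (λ u → ∑-mono (λ v → ⟦⟧-mono (λ e → ∧⁺ (h u (∧ˡ (w u) e)) (∧⁺ (h v (∧ˡ (w v) (∧ʳ (w u) e))) (∧ʳ (w v) (∧ʳ (w u) e))))))

  -- A pair with one end only in `w` and the other only in `w′` counts on the right alone; all other
  -- pairs count equally often on both sides.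
  Q-supermod : (w w′ : Fin n → Bool) → Q M w + Q M w′ ≤ℤ Q M (λ i → w i ∨ w′ i) + Q M (λ i → w i ∧ w′ i)
  Q-supermod w w′ = subst₂ _≤ℤ_ (∑∑-+ _ _) (∑∑-+ _ _) (∑-mono (λ u → ∑-mono (λ v → pt (w u) (w′ u) (w v) (w′ v) (M u v))))
    where
    ∑∑-+ : (f g : Fin n → Fin n → ℤ) → ∑ (λ u → ∑ (λ v → f u v + g u v)) ≡ ∑ (λ u → ∑ (f u)) + ∑ (λ u → ∑ (g u))
    ∑∑-+ f g = trans (∑-cong (λ u → ∑-+ (f u) (g u))) (∑-+ (λ u → ∑ (f u)) (λ u → ∑ (g u)))
    pt : ∀ a b c e m → ⟦ a ∧ c ∧ m ⟧ + ⟦ b ∧ e ∧ m ⟧ ≤ℤ ⟦ (a ∨ b) ∧ (c ∨ e) ∧ m ⟧ + ⟦ (a ∧ b) ∧ (c ∧ e) ∧ m ⟧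
    pt true true true true m = ℤP.≤-refl
    pt true true true false m = ℤP.≤-refl
    pt true true false true m = ℤP.≤-reflexive (ℤP.+-comm 0ℤ ⟦ m ⟧)
    pt true true false false m = ℤP.≤-refl
    pt true false true true m = ℤP.≤-refl
    pt true false true false m = ℤP.≤-refl
    pt true false false true m = subst (0ℤ ≤ℤ_) (sym (ℤP.+-identityʳ ⟦ m ⟧)) (0≤⟦⟧ m)
    pt true false false false m = ℤP.≤-refl
    pt false true true true m = ℤP.≤-reflexive (ℤP.+-comm 0ℤ ⟦ m ⟧)
    pt false true true false m = subst (0ℤ ≤ℤ_) (sym (ℤP.+-identityʳ ⟦ m ⟧)) (0≤⟦⟧ m)
    pt false true false true m = ℤP.≤-reflexive (ℤP.+-comm 0ℤ ⟦ m ⟧)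
    pt false true false false m = ℤP.≤-refl
    pt false false c e m = ℤP.≤-refl

  -- The new pairs are `(x , v)` and their mirror images `(u , x)`; irreflexivity excludes
  -- `(x , x)`.
  Q-add : (∀ u v → M u v ≡ M v u) → (∀ u → M u u ≡ false) → ∀ {w w₀ : Fin n → Bool} x → w₀ x ≡ false
        → (∀ i → w i ≡ (x == i) ∨ w₀ i) → Q M w ≡ Q M w₀ + pos 2 * ♯ (λ u → w₀ u ∧ M x u)
  Q-add M-sym M-irr {w} {w₀} x w₀x hw = trans (∑-cong (λ u → ∑-cong (λ v → pt u v))) (trans (∑-cong row)
      (trans (∑-+ _ _) (cong (Q M w₀ +_) (trans (∑-+ _ _) (trans (cong₂ _+_ (∑-δ x (λ _ → ♯ D)) refl) (lem (♯ D)))))))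
    where
    D : Fin n → Bool
    D u = w₀ u ∧ M x u
    lem : ∀ a → a + a ≡ pos 2 * a
    lem = solve-∀
    pt : ∀ u v → ⟦ w u ∧ w v ∧ M u v ⟧ ≡ ⟦ w₀ u ∧ w₀ v ∧ M u v ⟧ + (⟦ x == u ⟧ * ⟦ D v ⟧ + ⟦ x == v ⟧ * ⟦ D u ⟧)
    pt u v rewrite hw u | hw v with x ≟F u | x ≟F v
    ... | yes refl | yes refl rewrite w₀x | M-irr x = refl
    ... | yes refl | no _ rewrite w₀x | ℤP.+-identityʳ (1ℤ * ⟦ w₀ v ∧ M x v ⟧) | ℤP.+-identityˡ (1ℤ * ⟦ w₀ v ∧ M x v ⟧) = sym (ℤP.*-identityˡ _)
    ... | no _ | yes refl rewrite w₀x | M-sym u x with w₀ u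
    ...   | true = sym (trans (ℤP.+-identityˡ _) (trans (ℤP.+-identityˡ _) (ℤP.*-identityˡ _)))
    ...   | false = refl
    pt u v | no _ | no _ = sym (trans (cong (⟦ w₀ u ∧ w₀ v ∧ M u v ⟧ +_) (cong₂ _+_ (ℤP.*-zeroˡ ⟦ D v ⟧) (ℤP.*-zeroˡ ⟦ D u ⟧))) (ℤP.+-identityʳ _))
    row : ∀ u → ∑ (λ v → ⟦ w₀ u ∧ w₀ v ∧ M u v ⟧ + (⟦ x == u ⟧ * ⟦ D v ⟧ + ⟦ x == v ⟧ * ⟦ D u ⟧))
              ≡ ∑ (λ v → ⟦ w₀ u ∧ w₀ v ∧ M u v ⟧) + (⟦ x == u ⟧ * ♯ D + ⟦ D u ⟧)
    row u = trans (∑-+ (λ v → ⟦ w₀ u ∧ w₀ v ∧ M u v ⟧) (λ v → ⟦ x == u ⟧ * ⟦ D v ⟧ + ⟦ x == v ⟧ * ⟦ D u ⟧)) (cong (∑ (λ v → ⟦ w₀ u ∧ w₀ v ∧ M u v ⟧) +_)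
             (trans (∑-+ (λ v → ⟦ x == u ⟧ * ⟦ D v ⟧) (λ v → ⟦ x == v ⟧ * ⟦ D u ⟧)) (cong₂ _+_ (∑-* ⟦ x == u ⟧ (λ v → ⟦ D v ⟧)) (∑-δ x (λ _ → ⟦ D u ⟧)))))

Q-split : ∀ {n} {M M₁ M₂ : Fin n → Fin n → Bool} {w : Fin n → Bool}
        → (∀ u v → w u ≡ true → w v ≡ true → ⟦ M u v ⟧ ≡ ⟦ M₁ u v ⟧ + ⟦ M₂ u v ⟧) → Q M w ≡ Q M₁ w + Q M₂ w
Q-split {n} {M} {M₁} {M₂} {w} h = trans (∑-cong (λ u → trans (∑-cong (λ v → pt u v)) (∑-+ _ _))) (∑-+ _ _)
  where
  pt : ∀ u v → ⟦ w u ∧ w v ∧ M u v ⟧ ≡ ⟦ w u ∧ w v ∧ M₁ u v ⟧ + ⟦ w u ∧ w v ∧ M₂ u v ⟧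
  pt u v with w u | w v | h u v
  ... | true | true | h′ = h′ refl refl
  ... | true | false | _ = refl
  ... | false | _ | _ = refl

Q-congM : ∀ {n} {M M′ : Fin n → Fin n → Bool} {w : Fin n → Bool}
        → (∀ u v → w u ≡ true → w v ≡ true → M u v ≡ M′ u v) → Q M w ≡ Q M′ w
Q-congM {w = w} h = ∑-cong (λ u → ∑-cong (λ v → pt u v))
  where
  pt : ∀ u v → ⟦ w u ∧ w v ∧ _ ⟧ ≡ ⟦ w u ∧ w v ∧ _ ⟧
  pt u v with w u | w v | h u v
  ... | true | true | h′ = cong ⟦_⟧ (h′ refl refl)
  ... | true | false | _ = refl
  ... | false | _ | _ = refl

-- Vertex `zero` is split off with its row and its column, which agree by symmetry. The parity
-- argument around link cycles rests on this.
Q-even : ∀ {n} (M : Fin n → Fin n → Bool) (w : Fin n → Bool) → (∀ u v → M u v ≡ M v u) → (∀ u → M u u ≡ false)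
       → ∃ λ h → Q M w ≡ pos 2 * h
Q-even {zero} M w s i = 0ℤ , ∑-zero _
Q-even {suc n} M w s irr with Q-even (λ u v → M (suc u) (suc v)) (λ u → w (suc u)) (λ u v → s (suc u) (suc v)) (λ u → irr (suc u))
... | h , e = a + h , trans (∑-suc _) (trans (cong₂ _+_ (trans (∑-suc _) (cong (_+ a) z)) (trans (∑-cong (λ u → ∑-suc _)) (trans (∑-+ (λ u → ⟦ w (suc u) ∧ w zero ∧ M (suc u) zero ⟧) _) (cong₂ _+_ (∑-cong flip) e)))) (lem a h))
  where
  a = ∑ (λ v → ⟦ w zero ∧ w (suc v) ∧ M zero (suc v) ⟧)
  z : ⟦ w zero ∧ w zero ∧ M zero zero ⟧ ≡ 0ℤ
  z rewrite irr zero with w zero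
  ... | true = refl
  ... | false = refl
  flip : ∀ u → ⟦ w (suc u) ∧ w zero ∧ M (suc u) zero ⟧ ≡ ⟦ w zero ∧ w (suc u) ∧ M zero (suc u) ⟧
  flip u rewrite s (suc u) zero with w zero | w (suc u)
  ... | true | true = refl
  ... | true | false = refl
  ... | false | true = refl
  ... | false | false = refl
  lem : ∀ a h → 0ℤ + a + (a + pos 2 * h) ≡ pos 2 * (a + h)
  lem = solve-∀

-- Vertex subsets and face numbers

infixl 8 _▸_
_▸_ : ∀ {n} → Subset n → Fin n → Subset n
σ ▸ x = σ ∪ ⁅ x ⁆

infixl 5 _∖_
abstract
  _∖_ : ∀ {n} → Subset n → Fin n → Subset n
  σ ∖ x = Data.Fin.Subset._-_ σ x

  ∈∖⁻ : ∀ {n} {σ : Subset n} {x y} → y ∈ σ ∖ x → y ∈ σ × y ≢ x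
  ∈∖⁻ {n} {σ} {x} {y} h = p─q⊆p σ ⁅ x ⁆ h , λ e → go σ x (subst (_∈ σ ∖ x) e h)
    where
    go : ∀ {m} (σ : Subset m) x → x ∉ σ ∖ x
    go (b ∷ σ) (suc x) (Data.Vec.there h) = go σ x h

  ∈∖⁺ : ∀ {n} {σ : Subset n} {x y} → y ∈ σ → y ≢ x → y ∈ σ ∖ x
  ∈∖⁺ = x∈p∧x≢y⇒x∈p-y

module _ {n : ℕ} where

  ∈▸⁻ : ∀ {σ : Subset n} {x y} → y ∈ σ ▸ x → (y ∈ σ) ⊎ (y ≡ x)
  ∈▸⁻ {σ} {x} h with x∈p∪q⁻ σ ⁅ x ⁆ h
  ... | inj₁ p = inj₁ p
  ... | inj₂ p = inj₂ (x∈⁅y⁆⇒x≡y x p)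

  ∈▸ˡ : ∀ {σ : Subset n} {x y} → y ∈ σ → y ∈ σ ▸ x
  ∈▸ˡ h = x∈p∪q⁺ (inj₁ h)

  ∈▸ʳ : ∀ {σ : Subset n} {x} → x ∈ σ ▸ x
  ∈▸ʳ {σ} {x} = x∈p∪q⁺ {p = σ} (inj₂ (x∈⁅x⁆ x))

  ∉▸ : ∀ {σ : Subset n} {x y} → y ∉ σ → y ≢ x → y ∉ σ ▸ x
  ∉▸ p q h with ∈▸⁻ h
  ... | inj₁ i = p i
  ... | inj₂ e = q e

  ▸-⊆ : ∀ {σ ρ : Subset n} {x} → σ ⊆ ρ → x ∈ ρ → σ ▸ x ⊆ ρ
  ▸-⊆ h i j with ∈▸⁻ j
  ... | inj₁ p = h p
  ... | inj₂ refl = i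

  ▸-mono : ∀ {σ ρ : Subset n} {x} → σ ⊆ ρ → σ ▸ x ⊆ ρ ▸ x
  ▸-mono {σ} {ρ} h = ▸-⊆ (λ i → ∈▸ˡ (h i)) (∈▸ʳ {ρ})

  ▸-comm : ∀ (σ : Subset n) x y → σ ▸ x ▸ y ≡ σ ▸ y ▸ x
  ▸-comm σ x y = trans (∪-assoc σ ⁅ x ⁆ ⁅ y ⁆) (trans (cong (σ ∪_) (∪-comm ⁅ x ⁆ ⁅ y ⁆)) (sym (∪-assoc σ ⁅ y ⁆ ⁅ x ⁆)))

  ∖⊆ : ∀ {σ : Subset n} {x} → σ ∖ x ⊆ σ
  ∖⊆ h = proj₁ (∈∖⁻ h)

  ∉∖ : ∀ {σ : Subset n} {x} → x ∉ σ ∖ x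
  ∉∖ h = proj₂ (∈∖⁻ h) refl

  ∖▸ : ∀ {σ : Subset n} {x} → x ∈ σ → (σ ∖ x) ▸ x ≡ σ
  ∖▸ {σ} {x} h = ⊆-antisym (▸-⊆ ∖⊆ h) f
    where
    f : σ ⊆ (σ ∖ x) ▸ x
    f {y} i with y ≟F x
    ... | yes refl = ∈▸ʳ {σ ∖ x}
    ... | no ne = ∈▸ˡ (∈∖⁺ i ne)

  mem : ∀ {σ : Subset n} {x} → x ∈ σ → lookup σ x ≡ true
  mem = []=⇒lookup

  mem⁻ : ∀ {σ : Subset n} {x} → lookup σ x ≡ true → x ∈ σ
  mem⁻ {σ} {x} = lookup⇒[]= x σ

  nmem : ∀ {σ : Subset n} {x} → x ∉ σ → lookup σ x ≡ false
  nmem h = ≢true (λ e → h (mem⁻ e))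

  nmem⁻ : ∀ {σ : Subset n} {x} → lookup σ x ≡ false → x ∉ σ
  nmem⁻ h i = contra (mem i) h

∣∣-♯ : ∀ {n} (σ : Subset n) → pos ∣ σ ∣ ≡ ♯ (lookup σ)
∣∣-♯ [] = sym (∑-zero _)
∣∣-♯ (true ∷ σ) = trans (cong (1ℤ +_) (∣∣-♯ σ)) (sym (∑-suc _))
∣∣-♯ (false ∷ σ) = trans (trans (∣∣-♯ σ) (sym (ℤP.+-identityˡ _))) (sym (∑-suc _))

pos-inj : ∀ {m n} → pos m ≡ pos n → m ≡ n
pos-inj = ℤP.+-injective

module _ {n : ℕ} where

  ♯-▸ : ∀ {σ : Subset n} {x} → x ∉ σ → ♯ (lookup (σ ▸ x)) ≡ 1ℤ + ♯ (lookup σ)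
  ♯-▸ {σ} {x} h = trans (∑-cong pt) (trans (∑-+ _ _) (cong (_+ ♯ (lookup σ)) (∑-δ x (λ _ → 1ℤ))))
    where
    pt : ∀ i → ⟦ lookup (σ ▸ x) i ⟧ ≡ ⟦ x == i ⟧ * 1ℤ + ⟦ lookup σ i ⟧
    pt i with x ≟F i
    ... | yes refl rewrite nmem h | mem (∈▸ʳ {σ = σ} {x}) = refl
    ... | no ne = trans (cong ⟦_⟧ (bool-ext f g)) (sym (ℤP.+-identityˡ _))
      where
      f : lookup (σ ▸ x) i ≡ true → lookup σ i ≡ true
      f e with ∈▸⁻ (mem⁻ {σ = σ ▸ x} e)
      ... | inj₁ p = mem p
      ... | inj₂ p = ⊥-elim (ne (sym p))
      g : lookup σ i ≡ true → lookup (σ ▸ x) i ≡ true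
      g e = mem (∈▸ˡ {σ = σ} (mem⁻ e))

  ∣▸∣ : ∀ {σ : Subset n} {x} → x ∉ σ → ∣ σ ▸ x ∣ ≡ suc ∣ σ ∣
  ∣▸∣ {σ} {x} h = pos-inj (trans (∣∣-♯ (σ ▸ x)) (trans (♯-▸ h) (cong (1ℤ +_) (sym (∣∣-♯ σ)))))

  ∣∖∣ : ∀ {σ : Subset n} {x} → x ∈ σ → suc ∣ σ ∖ x ∣ ≡ ∣ σ ∣
  ∣∖∣ {σ} {x} h = trans (sym (∣▸∣ {σ ∖ x} {x} ∉∖)) (cong ∣_∣ (∖▸ h))

  extra : ∀ {σ ρ : Subset n} → ∣ σ ∣ < ∣ ρ ∣ → ∃ λ x → x ∈ ρ × x ∉ σ
  extra {σ} {ρ} lt with find (λ i → lookup ρ i ∧ not (lookup σ i))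
  ... | inj₁ (x , e) = x , mem⁻ (∧ˡ (lookup ρ x) e) , λ i → contra (∧ʳ (lookup ρ x) e) (cong not (mem i))
  ... | inj₂ z = ⊥-elim (ℕP.<⇒≱ lt (p⊆q⇒∣p∣≤∣q∣ sub))
    where
    sub : ρ ⊆ σ
    sub {y} i with y ∈? σ
    ... | yes p = p
    ... | no p = contra (∧⁺ (mem i) (cong not (nmem p))) (z y)

  ⊆-full : ∀ {σ ρ : Subset n} → σ ⊆ ρ → ∣ ρ ∣ ≤ ∣ σ ∣ → σ ≡ ρ
  ⊆-full {σ} {ρ} s le = ⊆-antisym s sup
    where
    sup : ρ ⊆ σ
    sup {y} i with y ∈? σ
    ... | yes p = p
    ... | no p = ⊥-elim (ℕP.<⇒≱ (p⊂q⇒∣p∣<∣q∣ (s , y , i , p)) le)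

  ∣∣-0 : ∀ {σ : Subset n} → ∣ σ ∣ ≡ 0 → σ ≡ ⊥
  ∣∣-0 {σ} e = sym (⊆-full (λ i → ⊥-elim (∉⊥ i)) (ℕP.≤-reflexive (trans e (sym (∣⊥∣≡0 n)))))

  inhabited : ∀ {σ : Subset n} {k} → ∣ σ ∣ ≡ suc k → ∃ λ x → x ∈ σ
  inhabited {σ} {k} e with extra {⊥} {σ} (subst₂ _<_ (sym (∣⊥∣≡0 n)) (sym e) (s≤s z≤n))
  ... | x , p , _ = x , p

  ∣∖∣-suc : ∀ {σ : Subset n} {x k} → x ∈ σ → ∣ σ ∣ ≡ suc k → ∣ σ ∖ x ∣ ≡ k
  ∣∖∣-suc h e = ℕP.suc-injective (trans (∣∖∣ h) e)

≡ᵇ⁺ : ∀ {m n} → m ≡ n → (m ≡ᵇ n) ≡ true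
≡ᵇ⁺ {m} {n} e = Equivalence.to T-≡ (ℕP.≡⇒≡ᵇ m n e)

≡ᵇ⁻ : ∀ {m n} → (m ≡ᵇ n) ≡ true → m ≡ n
≡ᵇ⁻ {m} {n} e = ℕP.≡ᵇ⇒≡ m n (Equivalence.from T-≡ e)

module _ {n : ℕ} where

  ⊆ᵇ⁺ : {σ ρ : Subset n} → σ ⊆ ρ → (σ ⊆ᵇ ρ) ≡ true
  ⊆ᵇ⁺ {σ} {ρ} h with σ ⊆? ρ
  ... | yes _ = refl
  ... | no ¬p = ⊥-elim (¬p h)

  ⊆ᵇ⁻ : {σ ρ : Subset n} → (σ ⊆ᵇ ρ) ≡ true → σ ⊆ ρ
  ⊆ᵇ⁻ {σ} {ρ} h with σ ⊆? ρ
  ... | yes p = p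

  ==S⁺ : {σ ρ : Subset n} → σ ≡ ρ → (σ ==S ρ) ≡ true
  ==S⁺ {σ} {ρ} h with ≡-dec _≟B_ σ ρ
  ... | yes _ = refl
  ... | no ¬p = ⊥-elim (¬p h)

  ==S⁻ : {σ ρ : Subset n} → (σ ==S ρ) ≡ true → σ ≡ ρ
  ==S⁻ {σ} {ρ} h with ≡-dec _≟B_ σ ρ
  ... | yes p = p

-- Sums over all subsets and face counts

abstract
  SS : ∀ {n} → (Subset n → ℤ) → ℤ
  SS {zero} f = f []
  SS {suc n} f = SS (λ σ → f (false ∷ σ)) + SS (λ σ → f (true ∷ σ))

  SS-cong : ∀ {n} {f g : Subset n → ℤ} → (∀ σ → f σ ≡ g σ) → SS f ≡ SS g
  SS-cong {zero} h = h []
  SS-cong {suc n} h = cong₂ _+_ (SS-cong (λ σ → h (false ∷ σ))) (SS-cong (λ σ → h (true ∷ σ)))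

  SS-0 : ∀ n → SS {n} (λ _ → 0ℤ) ≡ 0ℤ
  SS-0 zero = refl
  SS-0 (suc n) = cong₂ _+_ (SS-0 n) (SS-0 n)

  SS-∑ : ∀ {n m} (f : Subset n → Fin m → ℤ) → SS (λ σ → ∑ (f σ)) ≡ ∑ (λ i → SS (λ σ → f σ i))
  SS-∑ {zero} f = refl
  SS-∑ {suc n} f = trans (cong₂ _+_ (SS-∑ (λ σ → f (false ∷ σ))) (SS-∑ (λ σ → f (true ∷ σ)))) (sym (∑-+ (λ i → SS (λ σ → f (false ∷ σ) i)) (λ i → SS (λ σ → f (true ∷ σ) i))))

  SS-δ : ∀ {n} (ρ : Subset n) (f : Subset n → ℤ) → (∀ σ → σ ≢ ρ → f σ ≡ 0ℤ) → SS f ≡ f ρ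
  SS-δ [] f h = refl
  SS-δ {suc n} (false ∷ ρ) f h = trans (cong₂ _+_ (SS-δ ρ (λ σ → f (false ∷ σ)) (λ σ ne → h (false ∷ σ) (λ { refl → ne refl })))
     (trans (SS-cong (λ σ → h (true ∷ σ) (λ ()))) (SS-0 n))) (ℤP.+-identityʳ _)
  SS-δ {suc n} (true ∷ ρ) f h = trans (cong₂ _+_ (trans (SS-cong (λ σ → h (false ∷ σ) (λ ()))) (SS-0 n))
     (SS-δ ρ (λ σ → f (true ∷ σ)) (λ σ ne → h (true ∷ σ) (λ { refl → ne refl })))) (ℤP.+-identityˡ _)

  SS-* : ∀ {n} c (f : Subset n → ℤ) → c * SS f ≡ SS (λ σ → c * f σ)
  SS-* {zero} c f = refl
  SS-* {suc n} c f = trans (ℤP.*-distribˡ-+ c _ _) (cong₂ _+_ (SS-* c (λ σ → f (false ∷ σ))) (SS-* c (λ σ → f (true ∷ σ))))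

  SS-zero : (f : Subset 0 → ℤ) → SS f ≡ f []
  SS-zero f = refl

  SS-suc : ∀ {n} (f : Subset (suc n) → ℤ) → SS f ≡ SS (λ σ → f (false ∷ σ)) + SS (λ σ → f (true ∷ σ))
  SS-suc f = refl

countL : ∀ {A : Set} → (A → Bool) → List A → ℕ
countL P xs = length (filter (λ σ → P σ ≟B true) xs)

countL-++ : ∀ {A : Set} (P : A → Bool) xs ys → countL P (xs ++ ys) ≡ countL P xs +ℕ countL P ys
countL-++ P [] ys = refl
countL-++ P (x ∷ xs) ys with P x
... | true = cong suc (countL-++ P xs ys)
... | false = countL-++ P xs ys

countL-map : ∀ {A B : Set} (P : B → Bool) (f : A → B) xs → countL P (map f xs) ≡ countL (λ x → P (f x)) xs
countL-map P f [] = refl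
countL-map P f (x ∷ xs) with P (f x)
... | true = cong suc (countL-map P f xs)
... | false = countL-map P f xs

countS-SS : ∀ {n} (P : Subset n → Bool) → pos (countS P) ≡ SS (λ σ → ⟦ P σ ⟧)
countS-SS {zero} P = trans lem (sym (SS-zero _))
  where
  lem : pos (countS P) ≡ ⟦ P [] ⟧
  lem with P []
  ... | true = refl
  ... | false = refl
countS-SS {suc n} P = trans (cong pos (trans (countL-++ P (map (false ∷_) (allSubsets n)) _)
    (cong₂ _+ℕ_ (countL-map P (false ∷_) (allSubsets n)) (countL-map P (true ∷_) (allSubsets n)))))
  (trans (cong₂ _+_ (countS-SS (λ σ → P (false ∷ σ))) (countS-SS (λ σ → P (true ∷ σ)))) (sym (SS-suc _)))

module _ {n : ℕ} where

  -- A set above `τ` with one more element is `τ ▸ v` for exactly one `v` outside `τ`. This turns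
  -- counts of faces into degrees in links.
  SS-cover : (τ : Subset n) (g : Subset n → Bool) → SS (λ F → ⟦ (τ ⊆ᵇ F) ∧ (∣ F ∣ ≡ᵇ suc ∣ τ ∣) ∧ g F ⟧) ≡ ♯ (λ v → not (lookup τ v) ∧ g (τ ▸ v))
  SS-cover τ g = trans (SS-cong pt) (trans (SS-∑ _) (∑-cong (λ v → trans (SS-δ (τ ▸ v) _ (z v)) (at v))))
    where
    h : Subset n → Fin n → Bool
    h F v = not (lookup τ v) ∧ (F ==S (τ ▸ v)) ∧ g F
    at : ∀ v → ⟦ h (τ ▸ v) v ⟧ ≡ ⟦ not (lookup τ v) ∧ g (τ ▸ v) ⟧
    at v rewrite ==S⁺ {σ = τ ▸ v} refl = refl
    z : ∀ v σ → σ ≢ τ ▸ v → ⟦ h σ v ⟧ ≡ 0ℤ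
    z v σ ne with σ ==S (τ ▸ v) in eq
    ... | true = ⊥-elim (ne (==S⁻ eq))
    ... | false with lookup τ v
    ...   | true = refl
    ...   | false = refl
    zero-sum : ∀ F → (∀ v → h F v ≡ false) → 0ℤ ≡ ♯ (h F)
    zero-sum F e = sym (trans (∑-cong (λ v → cong ⟦_⟧ (e v))) (∑-0 n))
    pt : ∀ F → ⟦ (τ ⊆ᵇ F) ∧ (∣ F ∣ ≡ᵇ suc ∣ τ ∣) ∧ g F ⟧ ≡ ♯ (h F)
    pt F with (τ ⊆ᵇ F) ∧ (∣ F ∣ ≡ᵇ suc ∣ τ ∣) in eq
    ... | false with τ ⊆ᵇ F in eq₁
    ...   | false = zero-sum F λ v → ≢true λ e → contra (⊆ᵇ⁺ {σ = τ} {ρ = F}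
              (λ i → subst (_ ∈_) (sym (==S⁻ (∧ˡ (F ==S (τ ▸ v)) (∧ʳ (not (lookup τ v)) e)))) (∈▸ˡ i))) eq₁
    ...   | true with ∣ F ∣ ≡ᵇ suc ∣ τ ∣ in eq₂
    ...     | false = zero-sum F λ v → ≢true λ e → contra (≡ᵇ⁺ (trans (cong ∣_∣ (==S⁻ {σ = F} {ρ = τ ▸ v} (∧ˡ (F ==S (τ ▸ v)) (∧ʳ (not (lookup τ v)) e))))
                (∣▸∣ {σ = τ} {x = v} (λ i → contra (mem i) (bnot (∧ˡ (not (lookup τ v)) e)))))) eq₂
      where
      bnot : ∀ {b} → not b ≡ true → b ≡ false
      bnot {false} _ = refl
    pt F | true with τ ⊆ᵇ F in eq₁ | ∣ F ∣ ≡ᵇ suc ∣ τ ∣ in eq₂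
    ... | true | true = trans (sym (∑-δ x (λ _ → ⟦ g F ⟧))) (∑-cong pt₂)
      where
      ex = extra {σ = τ} {ρ = F} (ℕP.≤-reflexive (sym (≡ᵇ⁻ eq₂)))
      x = proj₁ ex
      x∉ = proj₂ (proj₂ ex)
      sub : τ ▸ x ⊆ F
      sub = ▸-⊆ (⊆ᵇ⁻ eq₁) (proj₁ (proj₂ ex))
      F≡ : τ ▸ x ≡ F
      F≡ = ⊆-full sub (ℕP.≤-reflexive (trans (≡ᵇ⁻ eq₂) (sym (∣▸∣ x∉))))
      pt₂ : ∀ v → ⟦ x == v ⟧ * ⟦ g F ⟧ ≡ ⟦ h F v ⟧
      pt₂ v with x ≟F v
      ... | yes refl rewrite nmem x∉ | ==S⁺ (sym F≡) = ℤP.*-identityˡ _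
      ... | no ne with lookup τ v in e₃
      ...   | true = refl
      ...   | false with F ==S (τ ▸ v) in e₄
      ...     | false = refl
      ...     | true with ∈▸⁻ (subst (x ∈_) (==S⁻ e₄) (sub (∈▸ʳ {σ = τ})))
      ...       | inj₁ p = ⊥-elim (x∉ p)
      ...       | inj₂ p = ⊥-elim (ne p)

  facets-♯ : ∀ {d} (Γ : Cx n) (τ : Subset n) → suc ∣ τ ∣ ≡ d → pos (facetsContaining d Γ τ) ≡ ♯ (λ v → not (lookup τ v) ∧ Γ (τ ▸ v))
  facets-♯ Γ τ refl = trans (countS-SS (λ F → Γ F ∧ (∣ F ∣ ≡ᵇ suc ∣ τ ∣) ∧ (τ ⊆ᵇ F))) (trans (SS-cong (λ F → cong ⟦_⟧ (re (Γ F) (∣ F ∣ ≡ᵇ suc ∣ τ ∣) (τ ⊆ᵇ F)))) (SS-cover τ Γ))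
    where
    re : ∀ a b c → a ∧ b ∧ c ≡ c ∧ b ∧ a
    re true true true = refl
    re true true false = refl
    re true false c = sym (∧-zeroʳ c)
    re false b c = sym (trans (cong (c ∧_) (∧-zeroʳ b)) (∧-zeroʳ c))

  fS-0 : (Γ : Cx n) → Γ ⊥ ≡ true → fS Γ 0 ≡ 1
  fS-0 Γ e = pos-inj (trans (countS-SS (λ F → Γ F ∧ (∣ F ∣ ≡ᵇ 0))) (trans (SS-δ ⊥ _ z) (cong ⟦_⟧ (∧⁺ e (≡ᵇ⁺ (∣⊥∣≡0 n))))))
    where
    z : ∀ σ → σ ≢ ⊥ → ⟦ Γ σ ∧ (∣ σ ∣ ≡ᵇ 0) ⟧ ≡ 0ℤ
    z σ ne with ∣ σ ∣ ≡ᵇ 0 in eq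
    ... | true = ⊥-elim (ne (∣∣-0 (≡ᵇ⁻ eq)))
    ... | false = cong ⟦_⟧ (∧-zeroʳ (Γ σ))

  fS-1 : (Γ : Cx n) → pos (fS Γ 1) ≡ ♯ (λ v → Γ ⁅ v ⁆)
  fS-1 Γ = trans (countS-SS (λ F → Γ F ∧ (∣ F ∣ ≡ᵇ 1))) (trans (SS-cong pt) (trans (SS-cover ⊥ Γ) (♯-cong at)))
    where
    pt : ∀ F → ⟦ Γ F ∧ (∣ F ∣ ≡ᵇ 1) ⟧ ≡ ⟦ (⊥ ⊆ᵇ F) ∧ (∣ F ∣ ≡ᵇ suc ∣ ⊥ {n} ∣) ∧ Γ F ⟧
    pt F rewrite ⊆ᵇ⁺ {σ = ⊥} {ρ = F} (λ i → ⊥-elim (∉⊥ i)) | ∣⊥∣≡0 n = cong ⟦_⟧ (∧-comm (Γ F) _)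
    at : ∀ v → not (lookup ⊥ v) ∧ Γ (⊥ ▸ v) ≡ Γ ⁅ v ⁆
    at v rewrite nmem (∉⊥ {x = v}) = cong Γ (∪-identityˡ ⁅ v ⁆)

  -- Incidences between vertices and edges are counted from both sides; the factor 2 is the size of
  -- an edge.
  fS-2 : (Γ : Cx n) → pos 2 * pos (fS Γ 2) ≡ ∑ (λ u → ♯ (λ v → not (lookup ⁅ u ⁆ v) ∧ Γ (⁅ u ⁆ ▸ v)))
  fS-2 Γ = trans (cong (pos 2 *_) (countS-SS (λ F → Γ F ∧ (∣ F ∣ ≡ᵇ 2)))) (trans (SS-* (pos 2) _) (trans (SS-cong pt) (trans (SS-∑ _) (∑-cong row))))
    where
    size-1 : ∀ u → ∣ ⁅ u ⁆ ∣ ≡ 1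
    size-1 = Data.Fin.Subset.Properties.∣⁅x⁆∣≡1
    pt : ∀ F → pos 2 * ⟦ Γ F ∧ (∣ F ∣ ≡ᵇ 2) ⟧ ≡ ∑ (λ u → ⟦ (⁅ u ⁆ ⊆ᵇ F) ∧ (∣ F ∣ ≡ᵇ suc ∣ ⁅ u ⁆ ∣) ∧ Γ F ⟧)
    pt F = trans mid (sym (∑-cong (λ u → trans (cong ⟦_⟧ (cong₂ (λ a b → a ∧ (∣ F ∣ ≡ᵇ suc b) ∧ Γ F) (in? u) (size-1 u)))
             (trans (⟦∧⟧ (lookup F u) _) (ℤP.*-comm ⟦ lookup F u ⟧ _)))))
      where
      in? : ∀ u → (⁅ u ⁆ ⊆ᵇ F) ≡ lookup F u
      in? u = bool-ext (λ e → mem (⊆ᵇ⁻ {σ = ⁅ u ⁆} e (x∈⁅x⁆ u)))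
                       (λ e → ⊆ᵇ⁺ {σ = ⁅ u ⁆} {ρ = F} λ i → subst (_∈ F) (sym (x∈⁅y⁆⇒x≡y u i)) (mem⁻ e))
      c = ⟦ (∣ F ∣ ≡ᵇ 2) ∧ Γ F ⟧
      mid : pos 2 * ⟦ Γ F ∧ (∣ F ∣ ≡ᵇ 2) ⟧ ≡ ∑ (λ u → c * ⟦ lookup F u ⟧)
      mid = trans two (sym (trans (∑-* c _) (cong (c *_) (sym (∣∣-♯ F)))))
        where
        two : pos 2 * ⟦ Γ F ∧ (∣ F ∣ ≡ᵇ 2) ⟧ ≡ ⟦ (∣ F ∣ ≡ᵇ 2) ∧ Γ F ⟧ * pos ∣ F ∣
        two with ∣ F ∣ ≡ᵇ 2 in eq
        ... | false rewrite ∧-zeroʳ (Γ F) = refl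
        ... | true rewrite ≡ᵇ⁻ {∣ F ∣} {2} eq | ∧-identityʳ (Γ F) = ℤP.*-comm (pos 2) ⟦ Γ F ⟧
    row : ∀ u → SS (λ F → ⟦ (⁅ u ⁆ ⊆ᵇ F) ∧ (∣ F ∣ ≡ᵇ suc ∣ ⁅ u ⁆ ∣) ∧ Γ F ⟧) ≡ ♯ (λ v → not (lookup ⁅ u ⁆ v) ∧ Γ (⁅ u ⁆ ▸ v))
    row u = SS-cover ⁅ u ⁆ Γ

choose2 : ∀ n → pos 2 * pos (n choose 2) ≡ pos n * (pos n - 1ℤ)
choose2 zero = refl
choose2 (suc n) = trans (cong (λ z → pos 2 * pos z) (sym (nCk+nC[k+1]≡[n+1]C[k+1] n 1)))
  (trans (cong (λ z → pos 2 * (pos z + pos (n choose 2))) (nC1≡n n)) (trans (ℤP.*-distribˡ-+ (pos 2) (pos n) _)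
  (trans (cong (pos 2 * pos n +_) (choose2 n)) (lem (pos n)))))
  where
  lem : ∀ a → pos 2 * a + a * (a - 1ℤ) ≡ (1ℤ + a) * (1ℤ + a - 1ℤ)
  lem = solve-∀

-- Links in normal pseudomanifolds

bnot : ∀ {b} → not b ≡ true → b ≡ false
bnot {false} _ = refl

∪-▸▸ : ∀ {n} (τ : Subset n) u v → (⁅ u ⁆ ∪ ⁅ v ⁆) ∪ τ ≡ τ ▸ u ▸ v
∪-▸▸ τ u v = trans (∪-comm (⁅ u ⁆ ∪ ⁅ v ⁆) τ) (sym (∪-assoc τ ⁅ u ⁆ ⁅ v ⁆))

module Links {n : ℕ} (Δ : Cx n) where

  Face : Subset n → Set
  Face σ = Δ σ ≡ true

  abstract
    -- `N τ` is the vertex set of the link of `τ`, and `E τ` is the graph of that link.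
    N : Subset n → Fin n → Bool
    N τ v = not (lookup τ v) ∧ Δ (τ ▸ v)

    E : Subset n → Fin n → Fin n → Bool
    E τ u v = N τ u ∧ N (τ ▸ u) v

    N⁺ : ∀ {τ v} → v ∉ τ → Face (τ ▸ v) → N τ v ≡ true
    N⁺ h f = ∧⁺ (cong not (nmem h)) f

    N∉ : ∀ {τ v} → N τ v ≡ true → v ∉ τ
    N∉ {τ} {v} e = nmem⁻ (bnot (∧ˡ (not (lookup τ v)) e))

    NF : ∀ {τ v} → N τ v ≡ true → Face (τ ▸ v)
    NF {τ} {v} e = ∧ʳ (not (lookup τ v)) e

    E⁺ : ∀ {τ u v} → N τ u ≡ true → v ∉ τ → v ≢ u → Face (τ ▸ u ▸ v) → E τ u v ≡ true
    E⁺ Nu hv ne f = ∧⁺ Nu (N⁺ (∉▸ hv ne) f)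

    E₁ : ∀ {τ u v} → E τ u v ≡ true → N τ u ≡ true
    E₁ {τ} {u} e = ∧ˡ (N τ u) e

    E₂ : ∀ {τ u v} → E τ u v ≡ true → N (τ ▸ u) v ≡ true
    E₂ {τ} {u} e = ∧ʳ (N τ u) e

    N-def : ∀ τ v → N τ v ≡ not (lookup τ v) ∧ Δ (τ ▸ v)
    N-def τ v = refl

    -- Lets a neighbourhood in one link be read as the vertex set of the next link, and back.
    N-cone : ∀ {τ v} → N τ v ≡ true → ∀ u → N (τ ▸ v) u ≡ E τ v u
    N-cone {τ} {v} e u = cong (_∧ N (τ ▸ v) u) (sym e)

  E▸ : ∀ {τ u v} → E τ u v ≡ true → Face (τ ▸ u ▸ v)
  E▸ e = NF (E₂ e)

  E≢ : ∀ {τ u v} → E τ u v ≡ true → v ≢ u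
  E≢ {τ} {u} e refl = N∉ (E₂ e) (∈▸ʳ {σ = τ})

  E∉ : ∀ {τ u v} → E τ u v ≡ true → v ∉ τ
  E∉ e i = N∉ (E₂ e) (∈▸ˡ i)

  E-irr : ∀ τ u → E τ u u ≡ false
  E-irr τ u = ≢true (λ e → E≢ {τ} e refl)

module PM {n : ℕ} (d : ℕ) (Δ : Cx n) (pm : NormalPM d Δ) where

  open Links Δ public

  down : ∀ {σ ρ} → σ ⊆ ρ → Face ρ → Face σ
  down {σ} {ρ} s f = proj₂ (proj₁ pm) ρ σ s f

  ⊥-face : Face ⊥
  ⊥-face = proj₁ (proj₁ pm)

  dim : ∀ {σ} → Face σ → ∣ σ ∣ ≤ d
  dim {σ} f = proj₁ (proj₁ (proj₂ pm)) σ f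

  pure : ∀ {σ} → Face σ → Σ[ F ∈ Subset n ] (σ ⊆ F × Face F × ∣ F ∣ ≡ d)
  pure {σ} f = proj₂ (proj₁ (proj₂ pm)) σ f

  E⁻ : ∀ {τ u v} → E τ u v ≡ true → N τ v ≡ true
  E⁻ {τ} {u} {v} e = N⁺ (E∉ e) (down (▸-mono {σ = τ} {τ ▸ u} ∈▸ˡ) (E▸ e))

  E-flip : ∀ {τ u v} → E τ u v ≡ true → E τ v u ≡ true
  E-flip {τ} {u} {v} e = E⁺ (E⁻ e) (N∉ (E₁ e)) (λ q → E≢ {τ} e (sym q)) (subst Face (▸-comm τ u v) (E▸ e))

  E-sym : ∀ τ u v → E τ u v ≡ E τ v u
  E-sym τ u v = bool-ext E-flip E-flip

  N-sub : ∀ {τ v u} → N (τ ▸ v) u ≡ true → N τ u ≡ true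
  N-sub {τ} {v} e = N⁺ (λ i → N∉ e (∈▸ˡ i)) (down (▸-mono {σ = τ} {τ ▸ v} ∈▸ˡ) (NF e))

  E-sub : ∀ {τ v u w} → E (τ ▸ v) u w ≡ true → E τ u w ≡ true
  E-sub {τ} {v} {u} {w} e = E⁺ (N-sub {τ} {v} (E₁ e)) (λ i → E∉ e (∈▸ˡ i)) (E≢ {τ ▸ v} e)
    (down (▸-mono {σ = τ ▸ u} {τ ▸ v ▸ u} (▸-mono {σ = τ} {τ ▸ v} ∈▸ˡ)) (E▸ e))

  N-mono : ∀ {τ ρ v} → τ ⊆ ρ → N ρ v ≡ true → N τ v ≡ true
  N-mono {τ} {ρ} s e = N⁺ (λ i → N∉ e (s i)) (down (▸-mono {σ = τ} {ρ} s) (NF e))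

  dim▸ : ∀ {p} {τ : Subset n} {v} → v ∉ τ → suc p +ℕ ∣ τ ∣ ≡ d → p +ℕ ∣ τ ▸ v ∣ ≡ d
  dim▸ {p} {τ} h e = trans (cong (p +ℕ_) (∣▸∣ h)) (trans (ℕP.+-suc p ∣ τ ∣) e)

  ridge : ∀ {τ} → Face τ → 1 +ℕ ∣ τ ∣ ≡ d → ♯ (N τ) ≡ pos 2
  ridge {τ} f e = trans (♯-cong (N-def τ)) (trans (sym (facets-♯ Δ τ e)) (cong pos (proj₁ (proj₂ (proj₂ (proj₂ pm))) τ f (cong (_∸ 1) e))))

  -- Connectedness of a link as an induction principle along its edges, so that paths need not be
  -- handled again.
  conn : ∀ {τ p} → Face τ → suc (suc p) +ℕ ∣ τ ∣ ≡ d → (P : Fin n → Set) → (∀ {u v} → E τ u v ≡ true → P u → P v)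
       → ∀ {u v} → N τ u ≡ true → N τ v ≡ true → P u → P v
  conn {τ} {p} f e P h {u} {v} Nu Nv = walk (proj₂ (proj₂ (proj₂ (proj₂ pm))) τ f le u v (vert Nu) (vert Nv)) Nu
    where
    le : ∣ τ ∣ ≤ d ∸ 2
    le = subst (λ z → ∣ τ ∣ ≤ z ∸ 2) e (ℕP.m≤n+m ∣ τ ∣ p)
    vert : ∀ {u} → N τ u ≡ true → IsVertex (lk Δ τ) u
    vert {u} Nu = ∧⁺ (==S⁺ (⊆-antisym (λ {x} i → let (a , b) = x∈p∩q⁻ ⁅ u ⁆ τ i in ⊥-elim (N∉ Nu (subst (_∈ τ) (x∈⁅y⁆⇒x≡y u a) b))) (λ i → ⊥-elim (∉⊥ i))))
                     (subst Face (∪-comm τ ⁅ u ⁆) (NF Nu))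
    walk : ∀ {u v} → Reach (lk Δ τ) u v → N τ u ≡ true → P u → P v
    walk here Nu Pu = Pu
    walk {u} (step {v = w} s r) Nu Pu with w ≟F u
    -- A step of `Reach` may stand still, because `⁅ u ⁆ ∪ ⁅ u ⁆` is a vertex.
    ... | yes refl = walk r Nu Pu
    ... | no ne = walk r (E⁻ E-uw) (h E-uw Pu)
      where
      w∉ : w ∉ τ
      w∉ i = ∉⊥ (subst (w ∈_) (==S⁻ (∧ˡ (((⁅ u ⁆ ∪ ⁅ w ⁆) ∩ τ) ==S ⊥) s)) (x∈p∩q⁺ (x∈p∪q⁺ {p = ⁅ u ⁆} (inj₂ (x∈⁅x⁆ w)) , i)))
      E-uw : E τ u w ≡ true
      E-uw = E⁺ Nu w∉ ne (subst Face (∪-▸▸ τ u w) (∧ʳ (((⁅ u ⁆ ∪ ⁅ w ⁆) ∩ τ) ==S ⊥) s))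

  next : ∀ {τ F} → τ ⊆ F → Face F → ∣ τ ∣ < ∣ F ∣ → ∃ λ x → x ∈ F × N τ x ≡ true
  next {τ} {F} s f lt with extra {σ = τ} {ρ = F} lt
  ... | x , i , ni = x , i , N⁺ ni (down (▸-⊆ s i) f)

  Closed : Subset n → (Subset n → Set) → Set
  Closed τ P = ∀ {R x y} → τ ⊆ R → Face R → 1 +ℕ ∣ R ∣ ≡ d → N R x ≡ true → N R y ≡ true → P (R ▸ x) → P (R ▸ y)

  lt-dim : ∀ p (F τ : Subset n) → suc p +ℕ ∣ τ ∣ ≡ d → ∣ F ∣ ≡ d → ∣ τ ∣ < ∣ F ∣
  lt-dim p F τ e q = subst (∣ τ ∣ <_) (trans e (sym q)) (s≤s (ℕP.m≤n+m ∣ τ ∣ p))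

  Uniform : Subset n → (Subset n → Set) → Set
  Uniform τ P = ∀ {F F′} → τ ⊆ F → Face F → ∣ F ∣ ≡ d → τ ⊆ F′ → Face F′ → ∣ F′ ∣ ≡ d → P F → P F′

  -- Adjacent link vertices lie in a common facet, which carries `P` from all facets at one to all
  -- facets at the other. Connectedness of the link spreads this to every link vertex.
  uniform-step : ∀ {p τ} (P : Subset n → Set) → Face τ → suc (suc p) +ℕ ∣ τ ∣ ≡ d
    → (∀ {v} → N τ v ≡ true → Uniform (τ ▸ v) P) → Uniform τ P
  uniform-step {p} {τ} P f e ih {F} {F′} s fF eF s′ fF′ eF′ PF
    with next s fF (lt-dim (suc p) F τ e eF) | next s′ fF′ (lt-dim (suc p) F′ τ e eF′)
  ... | x , i , Nx | y , j , Ny = conn f e Good spread Nx Ny (λ {G} a b q → ih Nx (▸-⊆ s i) fF eF a b q PF) (▸-⊆ s′ j) fF′ eF′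
    where
    Good : Fin n → Set
    Good v = ∀ {G} → τ ▸ v ⊆ G → Face G → ∣ G ∣ ≡ d → P G
    spread : ∀ {u v} → E τ u v ≡ true → Good u → Good v
    spread {u} {v} Euv g a b q with pure (E▸ Euv)
    ... | H , sH , fH , eH = ih (E⁻ Euv) (▸-⊆ (λ i → sH (∈▸ˡ (∈▸ˡ i))) (sH (∈▸ʳ {σ = τ ▸ u}))) fH eH a b q
                                (g (λ i → sH (∈▸ˡ i)) fH eH)

  -- Induction on the dimension of the link. For `p` = 1 the face `τ` is itself a ridge and `Closed`
  -- applies directly.
  strongly-connected : ∀ p {τ} (P : Subset n → Set) → Face τ → p +ℕ ∣ τ ∣ ≡ d → Closed τ P → Uniform τ P
  strongly-connected zero P f e c s fF eF s′ fF′ eF′ PF =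
    subst P (trans (sym (⊆-full s (ℕP.≤-reflexive (trans eF (sym e))))) (⊆-full s′ (ℕP.≤-reflexive (trans eF′ (sym e))))) PF
  strongly-connected (suc zero) {τ} P f e c {F₁} {F₂} s fF eF s′ fF′ eF′ PF
    with next s fF (lt-dim 0 F₁ τ e eF) | next s′ fF′ (lt-dim 0 F₂ τ e eF′)
  ... | x , i , Nx | y , j , Ny = subst P (eq s′ j Ny eF′) (c ⊆-refl f e Nx Ny (subst P (sym (eq s i Nx eF)) PF))
    where
    eq : ∀ {F x} → τ ⊆ F → x ∈ F → N τ x ≡ true → ∣ F ∣ ≡ d → τ ▸ x ≡ F
    eq s i Nx eF = ⊆-full (▸-⊆ s i) (ℕP.≤-reflexive (trans eF (trans (sym e) (sym (∣▸∣ (N∉ Nx))))))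
  strongly-connected (suc (suc p)) {τ} P f e c = uniform-step P f e
    (λ {v} Nv → strongly-connected (suc p) P (NF Nv) (dim▸ {suc p} (N∉ Nv) e) (λ {R} {x} {y} s → c {R} {x} {y} (λ i → s (∈▸ˡ {σ = τ} {v} i))))

-- Arcs and forests in link cycles

exists : ∀ {n} → (Fin n → Bool) → Bool
exists w = does (any? (λ i → w i ≟B true))

exists⁺ : ∀ {n} {w : Fin n → Bool} i → w i ≡ true → exists w ≡ true
exists⁺ {w = w} i e with any? (λ i → w i ≟B true)
... | yes _ = refl
... | no ¬p = ⊥-elim (¬p (i , e))

exists⁻ : ∀ {n} (w : Fin n → Bool) → exists w ≡ true → ∃ λ i → w i ≡ true
exists⁻ w e with any? (λ i → w i ≟B true)
... | yes p = p

∑-∃ : ∀ {n} (f : Fin n → ℤ) → 1ℤ ≤ℤ ∑ f → ∃ λ i → 1ℤ ≤ℤ f i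
∑-∃ {n} f h with any? (λ i → 1ℤ ℤP.≤? f i)
... | yes p = p
... | no ¬p = 1≤0-absurd (ℤP.≤-trans h (subst (∑ f ≤ℤ_) (∑-0 n) (∑-mono (λ i → small (λ q → ¬p (i , q))))))
  where
  small : ∀ {a} → ¬ (1ℤ ≤ℤ a) → a ≤ℤ 0ℤ
  small {a} q = ≤-by (ℤP.i<j⇒suc[i]≤j (ℤP.≰⇒> q)) (lem a)
    where
    lem : ∀ a → a + 1ℤ ≡ 0ℤ + (1ℤ + a)
    lem = solve-∀

-- Arcs from `X` to `Y`; for `X` equal to `Y` this is `Q`.
B : ∀ {n} → (Fin n → Fin n → Bool) → (Fin n → Bool) → (Fin n → Bool) → ℤ
B M X Y = ∑ (λ u → ∑ (λ v → ⟦ X u ∧ Y v ∧ M u v ⟧))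

♯-remove : ∀ {n} {w w₀ : Fin n → Bool} x → w₀ x ≡ false → (∀ i → w i ≡ (x == i) ∨ w₀ i) → ♯ w ≡ 1ℤ + ♯ w₀
♯-remove {w = w} {w₀} x e h = trans (∑-cong pt) (trans (∑-+ _ _) (cong (_+ ♯ w₀) (∑-δ x (λ _ → 1ℤ))))
  where
  pt : ∀ i → ⟦ w i ⟧ ≡ ⟦ x == i ⟧ * 1ℤ + ⟦ w₀ i ⟧
  pt i rewrite h i with x ≟F i
  ... | yes refl rewrite e = refl
  ... | no _ = sym (ℤP.+-identityˡ _)

without : ∀ {n} → Fin n → (Fin n → Bool) → Fin n → Bool
without x w i = w i ∧ not (x == i)

without-self : ∀ {n} (x : Fin n) w → without x w x ≡ false
without-self x w rewrite ==-refl x = ∧-zeroʳ (w x)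

without-split : ∀ {n} (x : Fin n) {w} → w x ≡ true → ∀ i → w i ≡ (x == i) ∨ without x w i
without-split x {w} e i with x ≟F i
... | yes refl = e
... | no _ = sym (∧-identityʳ (w i))

without⁻ : ∀ {n} (x : Fin n) w {i} → without x w i ≡ true → w i ≡ true
without⁻ x w {i} e = ∧ˡ (w i) e

B-flip : ∀ {n} {M : Fin n → Fin n → Bool} → (∀ u v → M u v ≡ M v u) → ∀ X Y → B M X Y ≡ B M Y X
B-flip {M = M} s X Y = trans (∑-swap _) (∑-cong (λ v → ∑-cong (λ u → pt u v)))
  where
  pt : ∀ u v → ⟦ X u ∧ Y v ∧ M u v ⟧ ≡ ⟦ Y v ∧ X u ∧ M v u ⟧
  pt u v rewrite s u v with X u | Y v
  ... | true | true = refl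
  ... | true | false = refl
  ... | false | true = refl
  ... | false | false = refl

-- Double counting of the arcs of a 2-regular graph on V that leave X.
B-regular : ∀ {n} {M : Fin n → Fin n → Bool} {V X Y Z : Fin n → Bool} → (∀ {u v} → M u v ≡ true → V u ≡ true) → (∀ u → V u ≡ true → ♯ (M u) ≡ pos 2)
  → (∀ u v → X u ≡ true → M u v ≡ true → ⟦ Y v ⟧ + ⟦ Z v ⟧ ≡ 1ℤ)
  → pos 2 * ♯ (λ u → X u ∧ V u) ≡ B M X Y + B M X Z
B-regular {n} {M} {V} {X} {Y} {Z} hV h2 hYZ = trans (sym (∑-* (pos 2) _)) (trans (∑-cong row) (∑-+ _ _))
  where
  pt : ∀ u v → ⟦ X u ∧ M u v ⟧ ≡ ⟦ X u ∧ Y v ∧ M u v ⟧ + ⟦ X u ∧ Z v ∧ M u v ⟧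
  pt u v with X u | M u v | hYZ u v
  ... | false | _ | _ = refl
  ... | true | false | _ rewrite ∧-zeroʳ (Y v) | ∧-zeroʳ (Z v) = refl
  ... | true | true | e rewrite ∧-identityʳ (Y v) | ∧-identityʳ (Z v) = sym (e refl refl)
  out : ∀ u → pos 2 * ⟦ X u ∧ V u ⟧ ≡ ♯ (λ v → X u ∧ M u v)
  out u with X u | bcase (V u)
  ... | false | _ = sym (∑-0 n)
  ... | true | inj₁ e rewrite e = sym (h2 u e)
  ... | true | inj₂ e rewrite e = sym (trans (♯-cong (λ v → ≢true (λ q → contra (hV {u} {v} q) e))) (∑-0 n))
  row : ∀ u → pos 2 * ⟦ X u ∧ V u ⟧ ≡ ∑ (λ v → ⟦ X u ∧ Y v ∧ M u v ⟧) + ∑ (λ v → ⟦ X u ∧ Z v ∧ M u v ⟧)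
  row u = trans (out u) (trans (∑-cong (pt u)) (∑-+ _ _))

image-of : ∀ {n} → (Fin n → Fin n) → (Fin n → Bool) → Fin n → Bool
image-of ℓ w r = exists (λ v → w v ∧ (ℓ v == r))

pos⊕ : ∀ {a b} → 0ℤ ≤ℤ a → 0ℤ ≤ℤ b → 0ℤ ≤ℤ a + b
pos⊕ p q = p ⊕ q

Q-empty : ∀ {n} (M : Fin n → Fin n → Bool) {w} → (∀ i → w i ≡ false) → Q M w ≡ 0ℤ
Q-empty {n} M {w} z = trans (∑-cong (λ u → trans (∑-cong (λ v → cong (λ b → ⟦ b ∧ w v ∧ M u v ⟧) (z u))) (∑-0 n))) (∑-0 n)

♯-empty : ∀ {n} {w : Fin n → Bool} → (∀ i → w i ≡ false) → ♯ w ≡ 0ℤ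
♯-empty {n} z = trans (∑-cong (λ i → cong ⟦_⟧ (z i))) (∑-0 n)

smaller : ∀ {a b k} → a ≡ 1ℤ + b → a ≤ℤ pos (suc k) → b ≤ℤ pos k
smaller {b = b} {k} refl h = ≤-by h (lem b (pos k))
  where
  lem : ∀ b k → b + (1ℤ + k) ≡ k + (1ℤ + b)
  lem = solve-∀

♯-positive : ∀ {n} (w : Fin n → Bool) {x} → w x ≡ true → 1ℤ ≤ℤ ♯ w
♯-positive w {x} e = subst (_≤ℤ ♯ w) (cong ⟦_⟧ e) (∑-≥₁ (λ i → 0≤⟦⟧ (w i)) x)

module Surface {n : ℕ} (d : ℕ) (Δ : Cx n) (pm : NormalPM d Δ) where

  open PM d Δ pm

  degree2 : ∀ {τ u} → Face τ → 2 +ℕ ∣ τ ∣ ≡ d → N τ u ≡ true → ♯ (E τ u) ≡ pos 2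
  degree2 {τ} {u} f e Nu = trans (♯-cong (λ v → sym (N-cone Nu v))) (ridge (NF Nu) (dim▸ {1} (N∉ Nu) e))

  -- Otherwise `A` would be closed under adjacency, hence everything by connectedness. A vertex with
  -- an edge leaving `A` is the right one to remove in the inductions below: its neighbours in `A`
  -- are not all of its link.
  boundary-vertex : ∀ {τ p} → Face τ → suc (suc p) +ℕ ∣ τ ∣ ≡ d → {A : Fin n → Bool} → (∀ {v} → A v ≡ true → N τ v ≡ true)
    → ∀ {x y} → A x ≡ true → N τ y ≡ true → A y ≡ false
    → ∃ λ u → ∃ λ z → A u ≡ true × E τ u z ≡ true × A z ≡ false
  boundary-vertex {τ} {p} f e {A} sub {x} {y} Ax Ny Ay with find (λ u → A u ∧ exists (λ z → E τ u z ∧ not (A z)))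
  ... | inj₁ (u , q) with exists⁻ (λ z → E τ u z ∧ not (A z)) (∧ʳ (A u) q)
  ...   | z , r = u , z , ∧ˡ (A u) q , ∧ˡ (E τ u z) r , bnot (∧ʳ (E τ u z) r)
  boundary-vertex {τ} {p} f e {A} sub {x} {y} Ax Ny Ay | inj₂ none =
    contra (conn f e (λ v → A v ≡ true) closed (sub Ax) Ny Ax) Ay
    where
    closed : ∀ {u v} → E τ u v ≡ true → A u ≡ true → A v ≡ true
    closed {u} {v} Euv Au with bcase (A v)
    ... | inj₁ t = t
    ... | inj₂ q = contra (∧⁺ Au (exists⁺ v (∧⁺ Euv (cong not q)))) (none u)

  -- In a cycle, a proper set of vertices spans a forest, so it has at least
  -- as many more vertices than edges as it has components.
  cycle-count : ∀ k {τ} → Face τ → 2 +ℕ ∣ τ ∣ ≡ d → (ℓ : Fin n → Fin n) (R A : Fin n → Bool) → ♯ A ≤ℤ pos k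
    → (∀ {v} → A v ≡ true → N τ v ≡ true) → ∀ {y} → N τ y ≡ true → A y ≡ false
    → (∀ {u v} → A u ≡ true → A v ≡ true → E τ u v ≡ true → ℓ u ≡ ℓ v)
    → pos 2 * ♯ (λ r → R r ∧ image-of ℓ A r) + Q (E τ) A ≤ℤ pos 2 * ♯ A
  cycle-count k {τ} f e ℓ R A le sub {y} Ny Ay hℓ with find A
  ... | inj₂ z = ℤP.≤-reflexive (trans (cong₂ (λ a b → pos 2 * a + b) (♯-empty none) (Q-empty (E τ) z)) (cong (pos 2 *_) (sym (♯-empty z))))
    where
    none : ∀ r → (R r ∧ image-of ℓ A r) ≡ false
    none r = ≢true λ q → let (v , t) = exists⁻ (λ v → A v ∧ (ℓ v == r)) (∧ʳ (R r) q) in contra (∧ˡ (A v) t) (z v)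
  cycle-count zero {τ} f e ℓ R A le sub {y} Ny Ay hℓ | inj₁ (x , Ax) =
    1≤0-absurd (ℤP.≤-trans (♯-positive A Ax) le)
  cycle-count (suc k) {τ} f e ℓ R A le sub {y} Ny Ay hℓ | inj₁ (x₀ , Ax₀) with boundary-vertex f e sub Ax₀ Ny Ay
  ... | x , z , Ax , Exz , Az = result (find Dx)
    where
    A₀ = without x A
    sz : ♯ A ≡ 1ℤ + ♯ A₀
    sz = ♯-remove x (without-self x A) (without-split x Ax)
    ih = cycle-count k f e ℓ R A₀ (smaller sz le) (λ q → sub (without⁻ x A q)) Ny (cong (_∧ not (x == y)) Ay)
          (λ a b → hℓ (without⁻ x A a) (without⁻ x A b))
    Dx : Fin n → Bool
    Dx u = A₀ u ∧ E τ x u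
    qz : Q (E τ) A ≡ Q (E τ) A₀ + pos 2 * ♯ Dx
    qz = Q-add (E τ) (E-sym τ) (E-irr τ) x (without-self x A) (without-split x Ax)
    -- Of the two neighbours of `x` on the cycle, one is `z`, which lies outside `A`.
    D≤1 : ♯ Dx + 1ℤ ≤ℤ pos 2
    D≤1 = subst₂ _≤ℤ_ (trans (∑-+ _ _) (cong (♯ Dx +_) (∑-δ z (λ _ → 1ℤ)))) (degree2 f e (sub Ax)) (∑-mono pt)
      where
      pt : ∀ u → ⟦ Dx u ⟧ + ⟦ z == u ⟧ * 1ℤ ≤ℤ ⟦ E τ x u ⟧
      pt u with z ≟F u
      ... | yes refl rewrite Az | Exz = ℤP.≤-refl
      ... | no _ = subst (_≤ℤ ⟦ E τ x u ⟧) (sym (ℤP.+-identityʳ _)) (⟦⟧-mono (∧ʳ (A₀ u)))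
    i = ♯ (λ r → R r ∧ image-of ℓ A r)
    i₀ = ♯ (λ r → R r ∧ image-of ℓ A₀ r)
    goal : Set
    goal = pos 2 * i + Q (E τ) A ≤ℤ pos 2 * ♯ A
    -- `t` bounds the edges from `x` into `A₀`. Restoring `x` adds one vertex, so the number of
    -- labels may rise by at most `1 - t`.
    finish : ∀ {t} → ♯ Dx ≤ℤ t → i + t ≤ℤ i₀ + 1ℤ → goal
    finish {t} h₁ h₂ = arith i (Q (E τ) A₀) (♯ Dx) (♯ A₀) i₀ t qz sz ih h₁ h₂
      where
      arith : ∀ i q D a i₀ t {q′ a′} → q′ ≡ q + pos 2 * D → a′ ≡ 1ℤ + a → pos 2 * i₀ + q ≤ℤ pos 2 * a → D ≤ℤ t → i + t ≤ℤ i₀ + 1ℤ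
            → pos 2 * i + q′ ≤ℤ pos 2 * a′
      arith i q D a i₀ t refl refl h h₁ h₂ = ≤-by (h ⊕ (h₂ ⊕ h₂) ⊕ (h₁ ⊕ h₁)) (lem i q D a i₀ t)
        where
        lem : ∀ i q D a i₀ t → pos 2 * i + (q + pos 2 * D) + (pos 2 * a + (i₀ + 1ℤ + (i₀ + 1ℤ)) + (t + t))
          ≡ pos 2 * (1ℤ + a) + (pos 2 * i₀ + q + (i + t + (i + t)) + (D + D))
        lem = solve-∀
    split : ∀ r → image-of ℓ A r ≡ true → (image-of ℓ A₀ r ≡ true) ⊎ (ℓ x ≡ r)
    split r q with exists⁻ (λ v → A v ∧ (ℓ v == r)) q
    ... | v , t with x ≟F v
    ...   | yes refl = inj₂ (==⇒≡ (∧ʳ (A v) t))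
    ...   | no ne = inj₁ (exists⁺ v (∧⁺ (∧⁺ (∧ˡ (A v) t) (cong not (==-≢ ne))) (∧ʳ (A v) t)))
    -- A neighbour in `A₀` costs one edge but already carries the label of `x`; without such a
    -- neighbour, `x` brings at most the one new label `ℓ x`.
    result : (∃ λ v → Dx v ≡ true) ⊎ (∀ v → Dx v ≡ false) → goal
    result (inj₁ (v , Dv)) = finish {1ℤ} (≤-by D≤1 (lem (♯ Dx))) (ℤP.+-monoˡ-≤ 1ℤ (♯-mono (λ r q → ∧⁺ (∧ˡ (R r) q) (same r (split r (∧ʳ (R r) q))))))
      where
      lem : ∀ D → D + pos 2 ≡ 1ℤ + (D + 1ℤ)
      lem = solve-∀
      same : ∀ r → (image-of ℓ A₀ r ≡ true) ⊎ (ℓ x ≡ r) → image-of ℓ A₀ r ≡ true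
      same r (inj₁ q) = q
      same r (inj₂ refl) = exists⁺ v (∧⁺ (∧ˡ (A₀ v) Dv) (subst (λ s → (ℓ v == s) ≡ true)
         (sym (hℓ Ax (without⁻ x A (∧ˡ (A₀ v) Dv)) (∧ʳ (A₀ v) Dv))) (==-refl (ℓ v))))
    result (inj₂ none) = finish {0ℤ} (ℤP.≤-reflexive (♯-empty none))
       (subst₂ _≤ℤ_ (sym (ℤP.+-identityʳ i)) (trans (∑-+ _ _) (cong (i₀ +_) (∑-δ (ℓ x) (λ _ → 1ℤ)))) (∑-mono pt))
      where
      pt : ∀ r → ⟦ R r ∧ image-of ℓ A r ⟧ ≤ℤ ⟦ R r ∧ image-of ℓ A₀ r ⟧ + ⟦ ℓ x == r ⟧ * 1ℤ
      pt r with bcase (R r ∧ image-of ℓ A r)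
      ... | inj₂ q rewrite q = pos⊕ (0≤⟦⟧ (R r ∧ image-of ℓ A₀ r)) (subst (0ℤ ≤ℤ_) (sym (ℤP.*-identityʳ ⟦ ℓ x == r ⟧)) (0≤⟦⟧ (ℓ x == r)))
      ... | inj₁ q with split r (∧ʳ (R r) q)
      ...   | inj₁ s rewrite q | ∧⁺ (∧ˡ (R r) q) s = subst (1ℤ ≤ℤ_) (cong (1ℤ +_) (sym (ℤP.*-identityʳ ⟦ ℓ x == r ⟧))) (ℤP.+-monoʳ-≤ 1ℤ (0≤⟦⟧ (ℓ x == r)))
      ...   | inj₂ refl rewrite q | ==-refl (ℓ x) = ℤP.+-monoˡ-≤ 1ℤ (0≤⟦⟧ (R (ℓ x) ∧ image-of ℓ A₀ (ℓ x)))

-- Surface links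

B-nonneg : ∀ {n} (M : Fin n → Fin n → Bool) X Y → 0ℤ ≤ℤ B M X Y
B-nonneg M X Y = ∑-nonneg (λ u → ∑-nonneg (λ v → 0≤⟦⟧ (X u ∧ Y v ∧ M u v)))

B-positive : ∀ {n} {M : Fin n → Fin n → Bool} {X Y u v} → X u ≡ true → Y v ≡ true → M u v ≡ true → 1ℤ ≤ℤ B M X Y
B-positive {M = M} {X} {Y} {u} {v} a b c = ℤP.≤-trans (♯-positive (λ v → X u ∧ Y v ∧ M u v) (∧⁺ a (∧⁺ b c)))
  (∑-≥₁ (λ u → ∑-nonneg (λ v → 0≤⟦⟧ (X u ∧ Y v ∧ M u v))) u)

Q-add-isolated : ∀ {n} (M : Fin n → Fin n → Bool) → (∀ u v → M u v ≡ M v u) → ∀ {w w₀ : Fin n → Bool} x → (∀ u → M x u ≡ false) → w₀ x ≡ false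
        → (∀ i → w i ≡ (x == i) ∨ w₀ i) → Q M w ≡ Q M w₀
Q-add-isolated M s {w} {w₀} x z e h = ∑-cong (λ u → ∑-cong (λ v → pt u v))
  where
  pt : ∀ u v → ⟦ w u ∧ w v ∧ M u v ⟧ ≡ ⟦ w₀ u ∧ w₀ v ∧ M u v ⟧
  pt u v rewrite h u | h v with x ≟F u | x ≟F v
  ... | yes refl | _ rewrite z v | e = cong ⟦_⟧ (∧-zeroʳ _)
  ... | no _ | yes refl rewrite trans (s u x) (z u) | e = cong ⟦_⟧ (trans (∧-zeroʳ (w₀ u)) (sym (∧-zeroʳ (w₀ u))))
  ... | no _ | no _ = refl

♯-top : ∀ m → ∑ {m} (λ _ → 1ℤ) ≡ pos m
♯-top zero = ∑-zero _
♯-top (suc m) = trans (∑-suc _) (cong (1ℤ +_) (♯-top m))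

module SurfaceCounts {n : ℕ} (d : ℕ) (Δ : Cx n) (pm : NormalPM d Δ) where

  open PM d Δ pm
  open Surface d Δ pm

  rotate : ∀ {τ u x v} → N τ u ≡ true → E (τ ▸ u) x v ≡ true → E (τ ▸ x) u v ≡ true
  rotate {τ} {u} {x} {v} Nu e = ∧E (subst (λ z → z ≡ true) (sym (N-cone Nx u)) (E-flip Eux)) (subst (λ σ → N σ v ≡ true) (▸-comm τ u x) (E₂ e))
    where
    Eux : E τ u x ≡ true
    Eux = subst (λ z → z ≡ true) (N-cone Nu x) (E₁ e)
    Nx : N τ x ≡ true
    Nx = E⁻ Eux
    ∧E : ∀ {σ a b} → N σ a ≡ true → N (σ ▸ a) b ≡ true → E σ a b ≡ true
    ∧E Na Nb = E⁺ Na (λ i → N∉ Nb (∈▸ˡ i)) (λ { refl → N∉ Nb (∈▸ʳ {σ = _}) }) (NF Nb)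

  E-rotate : ∀ {τ u x v} → N τ u ≡ true → N τ x ≡ true → E (τ ▸ u) x v ≡ E (τ ▸ x) u v
  E-rotate Nu Nx = bool-ext (rotate Nu) (rotate Nx)

  E-base : ∀ {τ x v} → E (τ ▸ x) x v ≡ false
  E-base {τ} {x} {v} = ≢true (λ e → N∉ (E₁ e) (∈▸ʳ {σ = τ}))

  -- For `A` inside the link this is six times the number of its triangles in `A`: three choices of
  -- `u`, two orders of the other corners.
  triangles : Subset n → (Fin n → Bool) → ℤ
  triangles τ A = ∑ (λ u → ⟦ A u ⟧ * Q (E (τ ▸ u)) A)

  -- Triangles through `x` are edges in `A₀` of the link of `τ ▸ x`. The corner `x` sees them once
  -- and the other corners together see them twice.
  triangles-add : ∀ {τ} {A A₀ : Fin n → Bool} x → (∀ {v} → A v ≡ true → N τ v ≡ true) → A x ≡ true → A₀ x ≡ false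
     → (∀ i → A i ≡ (x == i) ∨ A₀ i) → triangles τ A ≡ triangles τ A₀ + pos 3 * Q (E (τ ▸ x)) A₀
  triangles-add {τ} {A} {A₀} x sub Ax A₀x h = trans (∑-cong pt) (trans (∑-+ _ _) (trans (cong₂ _+_ (trans (∑-δ x _) row-x)
       (trans (∑-+ _ _) (cong (triangles τ A₀ +_) (trans (∑-* (pos 2) _) (cong (pos 2 *_) (∑-cong row)))))) (lem (Q (E (τ ▸ x)) A₀) (triangles τ A₀))))
    where
    lem : ∀ q t → q + (t + pos 2 * q) ≡ t + pos 3 * q
    lem = solve-∀
    row-x : Q (E (τ ▸ x)) A ≡ Q (E (τ ▸ x)) A₀
    row-x = Q-add-isolated _ (E-sym (τ ▸ x)) x (λ u → E-base {τ}) A₀x h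
    A₀⊆ : ∀ {v} → A₀ v ≡ true → A v ≡ true
    A₀⊆ {v} e rewrite h v | e with x == v
    ... | true = refl
    ... | false = refl
    D : Fin n → ℤ
    D u = ⟦ A₀ u ⟧ * ♯ (λ v → A₀ v ∧ E (τ ▸ u) x v)
    row : ∀ u → D u ≡ ∑ (λ v → ⟦ A₀ u ∧ A₀ v ∧ E (τ ▸ x) u v ⟧)
    row u with bcase (A₀ u)
    ... | inj₂ e rewrite e = trans (ℤP.*-zeroˡ (♯ (λ v → A₀ v ∧ E (τ ▸ u) x v))) (sym (∑-0 n))
    ... | inj₁ e rewrite e = trans (ℤP.*-identityˡ _) (♯-cong (λ v → cong (A₀ v ∧_) (E-rotate (sub (A₀⊆ e)) (sub Ax))))
    pt : ∀ u → ⟦ A u ⟧ * Q (E (τ ▸ u)) A ≡ ⟦ x == u ⟧ * Q (E (τ ▸ u)) A + (⟦ A₀ u ⟧ * Q (E (τ ▸ u)) A₀ + pos 2 * D u)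
    pt u = trans (cong (_* Q (E (τ ▸ u)) A) ind) (trans (ℤP.*-distribʳ-+ (Q (E (τ ▸ u)) A) ⟦ x == u ⟧ ⟦ A₀ u ⟧)
       (cong (⟦ x == u ⟧ * Q (E (τ ▸ u)) A +_) (trans (cong (⟦ A₀ u ⟧ *_) (Q-add (E (τ ▸ u)) (E-sym (τ ▸ u)) (E-irr (τ ▸ u)) x A₀x h))
       (lem₂ ⟦ A₀ u ⟧ (Q (E (τ ▸ u)) A₀) (♯ (λ v → A₀ v ∧ E (τ ▸ u) x v))))))
      where
      lem₂ : ∀ a q s → a * (q + pos 2 * s) ≡ a * q + pos 2 * (a * s)
      lem₂ = solve-∀
      ind : ⟦ A u ⟧ ≡ ⟦ x == u ⟧ + ⟦ A₀ u ⟧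
      ind rewrite h u with x ≟F u
      ... | yes refl rewrite A₀x = refl
      ... | no _ = sym (ℤP.+-identityˡ _)

  -- `ℓ` labels the vertices of `A` constantly along edges, and `R` collects labels that are fixed
  -- by `ℓ`. The field `euler` is six times V - E + T ≤ `♯ R` for the subcomplex induced on `A`; `Q`
  -- counts each edge twice, so it gets the factor 3.
  record Components (τ : Subset n) (A : Fin n → Bool) : Set where
    field
      ℓ : Fin n → Fin n
      R : Fin n → Bool
      root : ∀ {r} → R r ≡ true → ℓ r ≡ r
      R⊆A : ∀ {r} → R r ≡ true → A r ≡ true
      along : ∀ {u v} → A u ≡ true → A v ≡ true → E τ u v ≡ true → ℓ u ≡ ℓ v
      euler : pos 6 * ♯ A + triangles τ A ≤ℤ pos 3 * Q (E τ) A + pos 6 * ♯ R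

  -- The Euler characteristic of a proper induced subcomplex of a surface is
  -- at most its number of components.
  components : ∀ k {τ} → Face τ → 3 +ℕ ∣ τ ∣ ≡ d → (A : Fin n → Bool) → ♯ A ≤ℤ pos k
     → (∀ {v} → A v ≡ true → N τ v ≡ true) → ∀ {y} → N τ y ≡ true → A y ≡ false → Components τ A
  components k {τ} f e A le sub {y} Ny Ay with find A
  ... | inj₂ z = record
    { ℓ = λ v → v ; R = λ _ → false ; root = λ _ → refl ; R⊆A = λ () ; along = λ {u} a → contra a (z u)
    ; euler = ℤP.≤-reflexive (cong₂ _+_ (trans (cong (pos 6 *_) (♯-empty z)) (sym (cong (pos 3 *_) (Q-empty (E τ) z))))
        (trans (trans (∑-cong (λ u → trans (cong (λ b → ⟦ b ⟧ * Q (E (τ ▸ u)) A) (z u)) (ℤP.*-zeroˡ (Q (E (τ ▸ u)) A)))) (∑-0 n)) (sym (cong (pos 6 *_) (∑-0 n))))) }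
  components zero {τ} f e A le sub Ny Ay | inj₁ (x , Ax) = 1≤0-absurd (ℤP.≤-trans (♯-positive A Ax) le)
  components (suc k) {τ} f e A le sub {y} Ny Ay | inj₁ (x₀ , Ax₀) with boundary-vertex f e sub Ax₀ Ny Ay
  ... | x , z , Ax , Exz , Az = record { ℓ = ℓ′ ; R = R′ ; root = root′ ; R⊆A = R′⊆A ; along = along′
         ; euler = arith (♯ A₀) (triangles τ A₀) (Q (E τ) A₀) (♯ C.R) (Q (E (τ ▸ x)) A₀) (♯ Dx) (♯ J) sz
              (triangles-add x sub Ax A₀x split) (Q-add (E τ) (E-sym τ) (E-irr τ) x A₀x split) C.euler cyc count }
    where
    A₀ = without x A
    A₀x = without-self x A
    split = without-split x Ax
    sz : ♯ A ≡ 1ℤ + ♯ A₀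
    sz = ♯-remove x A₀x split
    module C = Components (components k f e A₀ (smaller sz le) (λ q → sub (without⁻ x A q)) Ny (cong (_∧ not (x == y)) Ay))
    Dx : Fin n → Bool
    Dx u = A₀ u ∧ E τ x u
    -- `I` holds the labels seen by `x`, and `J` the roots among them. Restoring `x` fuses the
    -- classes with labels in `I` into one with root `x`.
    I J : Fin n → Bool
    I = image-of C.ℓ Dx
    J r = C.R r ∧ I r
    pick : Bool → Fin n → Fin n
    pick b w = if b ∨ I w then x else w
    ℓ′ : Fin n → Fin n
    ℓ′ v = pick (x == v) (C.ℓ v)
    ℓ′-x : ∀ {v} → (x == v) ∨ I (C.ℓ v) ≡ true → ℓ′ v ≡ x
    ℓ′-x {v} q = cong (λ b → if b then x else C.ℓ v) q
    ℓ′-old : ∀ {v} → (x == v) ∨ I (C.ℓ v) ≡ false → ℓ′ v ≡ C.ℓ v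
    ℓ′-old {v} q = cong (λ b → if b then x else C.ℓ v) q
    R′ : Fin n → Bool
    R′ r = (x == r) ∨ (C.R r ∧ not (I r))
    A₀≢ : ∀ {r} → A₀ r ≡ true → (x == r) ≡ false
    A₀≢ {r} q = bnot (∧ʳ (A r) q)
    root′ : ∀ {r} → R′ r ≡ true → ℓ′ r ≡ r
    root′ {r} q with bcase (x == r)
    ... | inj₁ t = trans (ℓ′-x (cong (_∨ I (C.ℓ r)) t)) (==⇒≡ t)
    ... | inj₂ t = trans (ℓ′-old (trans (cong₂ (λ a b → a ∨ I b) t (C.root Rr)) (bnot (∧ʳ (C.R r) q′)))) (C.root Rr)
      where
      q′ : C.R r ∧ not (I r) ≡ true
      q′ = trans (cong (_∨ (C.R r ∧ not (I r))) (sym t)) q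
      Rr : C.R r ≡ true
      Rr = ∧ˡ (C.R r) q′
    R′⊆A : ∀ {r} → R′ r ≡ true → A r ≡ true
    R′⊆A {r} q with x ≟F r
    ... | yes refl = Ax
    ... | no _ = without⁻ x A (C.R⊆A (∧ˡ (C.R r) q))
    I-nbr : ∀ {v} → A₀ v ≡ true → E τ x v ≡ true → I (C.ℓ v) ≡ true
    I-nbr {v} a q = exists⁺ v (∧⁺ (∧⁺ a q) (==-refl (C.ℓ v)))
    along₀ : ∀ {u v} → A₀ u ≡ true → A₀ v ≡ true → E τ u v ≡ true → ℓ′ u ≡ ℓ′ v
    along₀ {u} {v} a b q = cong₂ pick (trans (A₀≢ a) (sym (A₀≢ b))) (C.along a b q)
    to-x : ∀ {v} → A₀ v ≡ true → E τ x v ≡ true → ℓ′ v ≡ x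
    to-x {v} a q = ℓ′-x (trans (cong (_∨ I (C.ℓ v)) (A₀≢ a)) (I-nbr a q))
    at-x : ℓ′ x ≡ x
    at-x = ℓ′-x (cong (_∨ I (C.ℓ x)) (==-refl x))
    along′ : ∀ {u v} → A u ≡ true → A v ≡ true → E τ u v ≡ true → ℓ′ u ≡ ℓ′ v
    along′ {u} {v} a b q with bcase (x == u) | bcase (x == v)
    ... | inj₁ s | inj₁ t = contra (subst₂ (λ u v → E τ u v ≡ true) (sym (==⇒≡ s)) (sym (==⇒≡ t)) q) (E-irr τ x)
    ... | inj₁ s | inj₂ t = trans (trans (cong ℓ′ (sym (==⇒≡ s))) at-x)
                              (sym (to-x (∧⁺ b (cong not t)) (subst (λ u → E τ u v ≡ true) (sym (==⇒≡ s)) q)))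
    ... | inj₂ s | inj₁ t = trans (to-x (∧⁺ a (cong not s)) (subst (λ v → E τ v u ≡ true) (sym (==⇒≡ t)) (E-flip q)))
                              (sym (trans (cong ℓ′ (sym (==⇒≡ t))) at-x))
    ... | inj₂ s | inj₂ t = along₀ (∧⁺ a (cong not s)) (∧⁺ b (cong not t)) q
    Nx : N τ x ≡ true
    Nx = sub Ax
    -- The neighbours of `x` in `A₀` miss `z`, so in the link cycle of `x` their vertices exceed
    -- their edges by at least `♯ J`. Adding `x` changes V - E + T by one minus this excess, and the
    -- number of roots by `1 - ♯ J`.
    cyc : pos 2 * ♯ J + Q (E (τ ▸ x)) A₀ ≤ℤ pos 2 * ♯ Dx
    cyc = subst (λ q → pos 2 * ♯ J + q ≤ℤ pos 2 * ♯ Dx) restrict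
      (cycle-count n {τ ▸ x} (NF Nx) (dim▸ {2} (N∉ Nx) e) C.ℓ C.R Dx (subst (♯ Dx ≤ℤ_) (♯-top n) (∑-mono (λ i → ⟦⟧≤1 (Dx i))))
        (λ {v} q → subst (λ b → b ≡ true) (sym (N-cone Nx v)) (∧ʳ (A₀ v) q)) {z} (subst (λ b → b ≡ true) (sym (N-cone Nx z)) Exz)
        (cong (λ b → (b ∧ not (x == z)) ∧ E τ x z) Az) (λ {u} {v} a b q → C.along (∧ˡ (A₀ u) a) (∧ˡ (A₀ v) b) (E-sub q)))
      where
      restrict : Q (E (τ ▸ x)) Dx ≡ Q (E (τ ▸ x)) A₀
      restrict = ∑-cong (λ u → ∑-cong (λ v → cong ⟦_⟧ (bool-ext
          (λ q → ∧⁺ (∧ˡ (A₀ u) (∧ˡ (Dx u) q)) (∧⁺ (∧ˡ (A₀ v) (∧ˡ (Dx v) (∧ʳ (Dx u) q))) (∧ʳ (Dx v) (∧ʳ (Dx u) q))))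
          (λ q → let a = ∧ˡ (A₀ u) q ; b = ∧ˡ (A₀ v) (∧ʳ (A₀ u) q) ; c = ∧ʳ (A₀ v) (∧ʳ (A₀ u) q) in
             ∧⁺ (∧⁺ a (trans (sym (N-cone Nx u)) (E₁ c))) (∧⁺ (∧⁺ b (trans (sym (N-cone Nx v)) (E⁻ c))) c)))))
    count : ♯ R′ + ♯ J ≡ 1ℤ + ♯ C.R
    count = trans (sym (∑-+ _ _)) (trans (∑-cong pt) (trans (∑-+ _ _) (cong (_+ ♯ C.R) (∑-δ x (λ _ → 1ℤ)))))
      where
      pt : ∀ r → ⟦ R′ r ⟧ + ⟦ J r ⟧ ≡ ⟦ x == r ⟧ * 1ℤ + ⟦ C.R r ⟧
      pt r with x ≟F r
      ... | yes refl rewrite ≢true {C.R x} (λ q → contra (C.R⊆A q) A₀x) = refl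
      ... | no _ with C.R r | I r
      ...   | true | true = refl
      ...   | true | false = refl
      ...   | false | _ = refl
    arith : ∀ a t q r s m j {a′ t′ q′ r′} → a′ ≡ 1ℤ + a → t′ ≡ t + pos 3 * s → q′ ≡ q + pos 2 * m
          → pos 6 * a + t ≤ℤ pos 3 * q + pos 6 * r → pos 2 * j + s ≤ℤ pos 2 * m → r′ + j ≡ 1ℤ + r
          → pos 6 * a′ + t′ ≤ℤ pos 3 * q′ + pos 6 * r′
    arith a t q r s m j {r′ = r′} refl refl refl h₁ h₂ h₃ = ≤-by (h₁ ⊕ (h₂ ⊕ h₂ ⊕ h₂) ⊕ ℤP.≤-reflexive (cong (pos 6 *_) (sym h₃))) (lem a t q r s m j r′)
      where
      lem : ∀ a t q r s m j r′ → pos 6 * (1ℤ + a) + (t + pos 3 * s) + (pos 3 * q + pos 6 * r + (pos 2 * m + pos 2 * m + pos 2 * m) + pos 6 * (r′ + j))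
          ≡ pos 3 * (q + pos 2 * m) + pos 6 * r′ + (pos 6 * a + t + (pos 2 * j + s + (pos 2 * j + s) + (pos 2 * j + s)) + pos 6 * (1ℤ + r))
      lem = solve-∀

+-complement : ∀ {n} {V W : Fin n → Bool} → (∀ {v} → W v ≡ true → V v ≡ true) → ∀ {v} → V v ≡ true → ⟦ V v ∧ not (W v) ⟧ + ⟦ W v ⟧ ≡ 1ℤ
+-complement {W = W} s {v} e rewrite e with W v
... | true = refl
... | false = refl

⟦true⟧* : ∀ {b} x → b ≡ true → ⟦ b ⟧ * x ≡ x
⟦true⟧* x refl = ℤP.*-identityˡ x

⟦false⟧* : ∀ {b} x → b ≡ false → ⟦ b ⟧ * x ≡ 0ℤ
⟦false⟧* x refl = ℤP.*-zeroˡ x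

indicator-bound : ∀ a b c x → 0ℤ ≤ℤ x → ⟦ a ⟧ * (⟦ b ∧ c ⟧ * x) ≤ℤ ⟦ c ⟧ * (⟦ b ⟧ * x)
indicator-bound true true true x h = ℤP.≤-refl
indicator-bound true true false x h = ℤP.≤-reflexive (ℤP.*-identityˡ (0ℤ * x))
indicator-bound true false true x h = ℤP.≤-refl
indicator-bound true false false x h = ℤP.≤-reflexive (ℤP.*-identityˡ (0ℤ * x))
indicator-bound false true true x h = subst (0ℤ ≤ℤ_) (sym (trans (ℤP.*-identityˡ (1ℤ * x)) (ℤP.*-identityˡ x))) h
indicator-bound false true false x h = ℤP.≤-refl
indicator-bound false false true x h = subst (0ℤ ≤ℤ_) (sym (ℤP.*-identityˡ (0ℤ * x))) ℤP.≤-refl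
indicator-bound false false false x h = ℤP.≤-refl

0≤⟦⟧* : ∀ b {x} → 0ℤ ≤ℤ x → 0ℤ ≤ℤ ⟦ b ⟧ * x
0≤⟦⟧* true {x} h = subst (0ℤ ≤ℤ_) (sym (ℤP.*-identityˡ x)) h
0≤⟦⟧* false {x} h = ℤP.≤-reflexive (sym (ℤP.*-zeroˡ x))

-- Here `q` is twice a number of edges and `m` a number of vertices. The constant term is the one
-- for which a simplex on `p` vertices has value 0, and for which coning keeps the value when `p` is
-- raised by one.
ring-φ : ℤ → ℤ → ℤ → ℤ
ring-φ p q m = q - pos 2 * p * m + p * (p + 1ℤ)

abstract
  φ : ∀ {n} → (Fin n → Fin n → Bool) → ℕ → (Fin n → Bool) → ℤ
  φ M p w = ring-φ (pos p) (Q M w) (♯ w)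

  φ-def : ∀ {n} (M : Fin n → Fin n → Bool) p w → φ M p w ≡ ring-φ (pos p) (Q M w) (♯ w)
  φ-def M p w = refl

-- Rigidity of surface links

module Base {n : ℕ} (d : ℕ) (Δ : Cx n) (pm : NormalPM d Δ) {τ : Subset n} (f : PM.Face d Δ pm τ) (e : 3 +ℕ ∣ τ ∣ ≡ d)
   (W : Fin n → Bool) (W⊆ : ∀ {v} → W v ≡ true → PM.N d Δ pm τ v ≡ true) where

  open PM d Δ pm
  open Surface d Δ pm
  open SurfaceCounts d Δ pm

  A : Fin n → Bool
  A v = N τ v ∧ not (W v)

  A⊆ : ∀ {v} → A v ≡ true → N τ v ≡ true
  A⊆ {v} q = ∧ˡ (N τ v) q

  W∉A : ∀ {v} → W v ≡ true → A v ≡ false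
  W∉A {v} q rewrite q = ∧-zeroʳ (N τ v)

  -- For `X` inside `A`, twice the number of triangles with one corner in `X` and the opposite edge
  -- in `W`.
  outer : (Fin n → Bool) → ℤ
  outer X = ∑ (λ u → ⟦ X u ⟧ * Q (E (τ ▸ u)) W)

  slice : ∀ {X Y : Fin n → Bool} → (∀ {v} → X v ≡ true → N τ v ≡ true) → B (E τ) X Y ≡ ∑ (λ u → ⟦ X u ⟧ * ♯ (λ v → Y v ∧ N (τ ▸ u) v))
  slice {X} {Y} h = ∑-cong row
    where
    row : ∀ u → ∑ (λ v → ⟦ X u ∧ Y v ∧ E τ u v ⟧) ≡ ⟦ X u ⟧ * ♯ (λ v → Y v ∧ N (τ ▸ u) v)
    row u with bcase (X u)
    ... | inj₁ q rewrite q = trans (♯-cong (λ v → cong (Y v ∧_) (sym (N-cone (h q) v)))) (sym (ℤP.*-identityˡ _))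
    ... | inj₂ q rewrite q = trans (∑-0 n) (sym (ℤP.*-zeroˡ (♯ (λ v → Y v ∧ N (τ ▸ u) v))))

  -- The link cycle of each `u` in `A` is split into its parts in `A` and in `W`. The arcs between
  -- the parts can be counted from either side; eliminating them relates the edges inside the two
  -- parts.
  outer-A : outer A + pos 2 * Q (E τ) A ≡ pos 2 * B (E τ) A W + triangles τ A
  outer-A = trans (cong (λ q → outer A + pos 2 * q) (slice {A} {A} A⊆)) (trans (cong (outer A +_) (sym (∑-* (pos 2) _)))
    (trans (sym (∑-+ _ _)) (trans (∑-cong row) (trans (∑-+ _ _) (cong (_+ triangles τ A) (trans (∑-* (pos 2) _) (cong (pos 2 *_) (sym (slice {A} {W} A⊆)))))))))
    where
    row : ∀ u → ⟦ A u ⟧ * Q (E (τ ▸ u)) W + pos 2 * (⟦ A u ⟧ * ♯ (λ v → A v ∧ N (τ ▸ u) v))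
              ≡ pos 2 * (⟦ A u ⟧ * ♯ (λ v → W v ∧ N (τ ▸ u) v)) + ⟦ A u ⟧ * Q (E (τ ▸ u)) A
    row u with bcase (A u)
    ... | inj₂ q rewrite q = refl-zero (Q (E (τ ▸ u)) W) (♯ (λ v → A v ∧ N (τ ▸ u) v)) (♯ (λ v → W v ∧ N (τ ▸ u) v)) (Q (E (τ ▸ u)) A)
      where
      refl-zero : ∀ a b c e → 0ℤ * a + pos 2 * (0ℤ * b) ≡ pos 2 * (0ℤ * c) + 0ℤ * e
      refl-zero = solve-∀
    ... | inj₁ q rewrite q = arith (Q (E (τ ▸ u)) W) (♯ (λ v → A v ∧ N (τ ▸ u) v)) (♯ (λ v → W v ∧ N (τ ▸ u) v)) (Q (E (τ ▸ u)) A) (B (E (τ ▸ u)) A W)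
        (B-regular {M = E (τ ▸ u)} {N (τ ▸ u)} {A} {A} {W} E₁ deg (λ _ v _ t → compl (E⁻ t)))
        (trans (B-regular {M = E (τ ▸ u)} {N (τ ▸ u)} {W} {A} {W} E₁ deg (λ _ v _ t → compl (E⁻ t))) (cong (_+ Q (E (τ ▸ u)) W) (B-flip (E-sym (τ ▸ u)) W A)))
      where
      compl : ∀ {v} → N (τ ▸ u) v ≡ true → ⟦ A v ⟧ + ⟦ W v ⟧ ≡ 1ℤ
      compl {v} t = +-complement {V = N τ} {W} (λ {x} → W⊆ {x}) {v} (N-sub {τ} {u} {v} t)
      deg : ∀ v → N (τ ▸ u) v ≡ true → ♯ (E (τ ▸ u) v) ≡ pos 2
      deg v = degree2 (NF (A⊆ q)) (dim▸ {2} (N∉ (A⊆ q)) e)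
      arith : ∀ qW a w qA x → pos 2 * a ≡ qA + x → pos 2 * w ≡ x + qW → 1ℤ * qW + pos 2 * (1ℤ * a) ≡ pos 2 * (1ℤ * w) + 1ℤ * qA
      arith qW a w qA x h₁ h₂ = trans (l₁ qW a) (trans (cong (qW +_) h₁) (trans (l₂ qW qA x) (trans (cong (_+ qA) (sym h₂)) (l₃ w qA))))
        where
        l₁ : ∀ qW a → 1ℤ * qW + pos 2 * (1ℤ * a) ≡ qW + pos 2 * a
        l₁ = solve-∀
        l₂ : ∀ qW qA x → qW + (qA + x) ≡ x + qW + qA
        l₂ = solve-∀
        l₃ : ∀ w qA → pos 2 * w + qA ≡ pos 2 * (1ℤ * w) + 1ℤ * qA
        l₃ = solve-∀

  Q-total : Q (E τ) (N τ) ≡ Q (E τ) A + pos 2 * B (E τ) A W + Q (E τ) W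
  Q-total = trans (∑-cong (λ u → trans (∑-cong (pt u)) (trans (∑-+ _ _) (cong₂ _+_ (∑-+ _ _) (∑-+ _ _)))))
     (trans (∑-+ _ _) (trans (cong₂ _+_ (∑-+ _ _) (∑-+ _ _)) (trans (cong (λ z → Q (E τ) A + B (E τ) A W + (z + Q (E τ) W)) (B-flip (E-sym τ) W A))
        (lem (Q (E τ) A) (B (E τ) A W) (Q (E τ) W)))))
    where
    lem : ∀ a b c → a + b + (b + c) ≡ a + pos 2 * b + c
    lem = solve-∀
    pt : ∀ u v → ⟦ N τ u ∧ N τ v ∧ E τ u v ⟧ ≡ ⟦ A u ∧ A v ∧ E τ u v ⟧ + ⟦ A u ∧ W v ∧ E τ u v ⟧ + (⟦ W u ∧ A v ∧ E τ u v ⟧ + ⟦ W u ∧ W v ∧ E τ u v ⟧)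
    pt u v with E τ u v in q
    ... | false rewrite ∧-zeroʳ (A v) | ∧-zeroʳ (W v) | ∧-zeroʳ (A u) | ∧-zeroʳ (W u) | ∧-zeroʳ (N τ v) | ∧-zeroʳ (N τ u) = refl
    ... | true rewrite E₁ q | E⁻ q with W u | W v
    ...   | true | true = refl
    ...   | true | false = refl
    ...   | false | true = refl
    ...   | false | false = refl

  ♯-total : ♯ (N τ) ≡ ♯ A + ♯ W
  ♯-total = trans (∑-cong pt) (∑-+ _ _)
    where
    pt : ∀ v → ⟦ N τ v ⟧ ≡ ⟦ A v ⟧ + ⟦ W v ⟧
    pt v with bcase (N τ v)
    ... | inj₁ q = trans (cong ⟦_⟧ q) (sym (+-complement {V = N τ} {W} (λ {x} → W⊆ {x}) {v} q))
    ... | inj₂ q rewrite q | ≢true {W v} (λ t → contra (W⊆ t) q) = refl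

  -- Each component of A sees at least three triangles with exactly one vertex in A:
  -- around a vertex v outside A, the link edges leaving C are even in number.
  module Class (C : Fin n → Bool) (C⊆A : ∀ {v} → C v ≡ true → A v ≡ true)
    (closed : ∀ {u v} → C u ≡ true → A v ≡ true → E τ u v ≡ true → C v ≡ true) where

    g : Fin n → ℤ
    g v = B (E (τ ▸ v)) C W

    outer-swap : outer C ≡ ∑ (λ v → ⟦ W v ⟧ * g v)
    outer-swap = trans (∑-cong (λ u → expand ⟦ C u ⟧ (λ v w → ⟦ W v ∧ W w ∧ E (τ ▸ u) v w ⟧))) (trans (∑-swap _)
       (∑-cong (λ v → trans (∑-cong (λ u → ∑-cong (λ w → pt u v w))) (sym (expand ⟦ W v ⟧ (λ u w → ⟦ C u ∧ W w ∧ E (τ ▸ v) u w ⟧))))))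
      where
      expand : ∀ c (h : Fin n → Fin n → ℤ) → c * ∑ (λ v → ∑ (h v)) ≡ ∑ (λ v → ∑ (λ w → c * h v w))
      expand c h = trans (sym (∑-* c _)) (∑-cong (λ v → sym (∑-* c (h v))))
      pt : ∀ u v w → ⟦ C u ⟧ * ⟦ W v ∧ W w ∧ E (τ ▸ u) v w ⟧ ≡ ⟦ W v ⟧ * ⟦ C u ∧ W w ∧ E (τ ▸ v) u w ⟧
      pt u v w with bcase (C u) | bcase (W v)
      ... | inj₁ a | inj₁ b rewrite a | b | E-rotate {v = w} (A⊆ (C⊆A a)) (W⊆ b) = refl
      ... | inj₁ a | inj₂ b rewrite a | b = sym (ℤP.*-zeroˡ ⟦ W w ∧ E (τ ▸ v) u w ⟧)
      ... | inj₂ a | inj₁ b rewrite a | b = ℤP.*-zeroˡ ⟦ W w ∧ E (τ ▸ u) v w ⟧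
      ... | inj₂ a | inj₂ b rewrite a | b = refl

    C∌W : ∀ {v} → W v ≡ true → C v ≡ false
    C∌W q = ≢true (λ c → contra (C⊆A c) (W∉A q))

    near : ∀ {c v} → C c ≡ true → E τ c v ≡ true → ⟦ C v ⟧ + ⟦ W v ⟧ ≡ 1ℤ
    near {c} {v} a q with bcase (W v)
    ... | inj₁ t rewrite t | C∌W t = refl
    ... | inj₂ t rewrite t | closed a (∧⁺ (E⁻ q) (cong not t)) q = refl

    -- `g v` counts the arcs from `C` to `W` in the link cycle of `v`. All arcs leaving vertices of
    -- `C` are even in number, and so are those that stay in `C`; hence `g v` is even.
    g≥2 : ∀ {v} → W v ≡ true → 1ℤ ≤ℤ g v → pos 2 ≤ℤ g v
    g≥2 {v} Wv h with Q-even (E (τ ▸ v)) C (E-sym (τ ▸ v)) (E-irr (τ ▸ v))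
    ... | k , q = arith (♯ (λ u → C u ∧ N (τ ▸ v) u)) k (g v)
         (trans (B-regular {M = E (τ ▸ v)} {N (τ ▸ v)} {C} {C} {W} E₁ (λ u → degree2 (NF Nv) (dim▸ {2} (N∉ Nv) e)) (λ u w a t → near a (E-sub t))) (cong (_+ g v) q)) h
      where
      Nv = W⊆ Wv
      arith : ∀ a k g → pos 2 * a ≡ pos 2 * k + g → 1ℤ ≤ℤ g → pos 2 ≤ℤ g
      arith a k g q h = half (a - k) g (trans (l₂ k g) (trans (cong (_- pos 2 * k) (sym q)) (l₁ a k))) h
        where
        l₂ : ∀ k g → g ≡ pos 2 * k + g - pos 2 * k
        l₂ = solve-∀
        l₁ : ∀ a k → pos 2 * a - pos 2 * k ≡ pos 2 * (a - k)
        l₁ = solve-∀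
        half : ∀ j g → g ≡ pos 2 * j → 1ℤ ≤ℤ g → pos 2 ≤ℤ g
        half (pos zero) g refl (+≤+ ())
        half (pos (suc j)) g refl _ = +≤+ (s≤s (ℕP.≤-trans (s≤s z≤n) (ℕP.m≤n+m (suc (j +ℕ 0)) j)))
        half (ℤ.negsuc j) g refl ()

    -- In the link cycle of `w`, the vertex `w′` has at most one neighbour in `C`, as `u` is the
    -- other neighbour. By parity a second vertex of `W` must be adjacent to `C` there.
    third : ∀ {w w′ c u} → C c ≡ true → C u ≡ false → W w ≡ true → W w′ ≡ true → E (τ ▸ w) c w′ ≡ true → E (τ ▸ w) u w′ ≡ true
      → ∃ λ w″ → ∃ λ c″ → w′ ≢ w″ × C c″ ≡ true × W w″ ≡ true × E (τ ▸ w) c″ w″ ≡ true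
    third {w} {w′} {c} {u} Cc Cu Ww Ww′ Ec Eu = pick (∑-∃ (off w′ k) rest)
      where
      M = E (τ ▸ w)
      k : Fin n → ℤ
      k v = ♯ (λ c → C c ∧ W v ∧ M c v)
      k≤1 : k w′ + 1ℤ ≤ℤ pos 2
      k≤1 = subst₂ _≤ℤ_ (trans (∑-+ _ _) (cong (k w′ +_) (∑-δ u (λ _ → 1ℤ))))
              (trans (♯-cong (λ x → E-sym (τ ▸ w) x w′)) (degree2 (NF (W⊆ Ww)) (dim▸ {2} (N∉ (W⊆ Ww)) e) (E⁻ Ec))) (∑-mono pt)
        where
        pt : ∀ x → ⟦ C x ∧ W w′ ∧ M x w′ ⟧ + ⟦ u == x ⟧ * 1ℤ ≤ℤ ⟦ M x w′ ⟧
        pt x with u ≟F x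
        ... | yes refl rewrite Cu | Eu = ℤP.≤-refl
        ... | no _ = subst (_≤ℤ ⟦ M x w′ ⟧) (sym (ℤP.+-identityʳ _)) (⟦⟧-mono (λ q → ∧ʳ (W w′) (∧ʳ (C x) q)))
      rest : 1ℤ ≤ℤ ∑ (off w′ k)
      rest = ≤-by (subst (pos 2 ≤ℤ_) (trans (∑-swap _) (∑-off w′ k)) (g≥2 Ww (B-positive {M = M} {C} {W} Cc Ww′ Ec)) ⊕ k≤1) (lem (k w′) (∑ (off w′ k)))
        where
        lem : ∀ a b → 1ℤ + (a + b + pos 2) ≡ b + (pos 2 + (a + 1ℤ))
        lem = solve-∀
      pick : (∃ λ v → 1ℤ ≤ℤ off w′ k v) → ∃ λ w″ → ∃ λ c″ → w′ ≢ w″ × C c″ ≡ true × W w″ ≡ true × M c″ w″ ≡ true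
      pick (w″ , h) with bcase (w′ == w″)
      ... | inj₁ t = 1≤0-absurd (subst (1ℤ ≤ℤ_) (trans (cong (λ b → ⟦ not b ⟧ * k w″) t) (ℤP.*-zeroˡ (k w″))) h)
      ... | inj₂ t with ♯-∃ (λ c → C c ∧ W w″ ∧ M c w″) (subst (1ℤ ≤ℤ_) (trans (cong (λ b → ⟦ not b ⟧ * k w″) t) (ℤP.*-identityˡ (k w″))) h)
      ...   | c″ , q = w″ , c″ , (λ eq → contra (trans (cong (w′ ==_) (sym eq)) (==-refl w′)) t)
                      , ∧ˡ (C c″) q , ∧ˡ (W w″) (∧ʳ (C c″) q) , ∧ʳ (W w″) (∧ʳ (C c″) q)

    -- The vertices `w`, `w′` and `w″` are distinct, and by parity each of them contributes at least
    -- 2 to `outer C`.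
    six : ∀ {w w′ c u} → C c ≡ true → C u ≡ false → W w ≡ true → W w′ ≡ true → E (τ ▸ w) c w′ ≡ true → E (τ ▸ w) u w′ ≡ true → pos 6 ≤ℤ outer C
    six {w} {w′} {c} {u} Cc Cu Ww Ww′ Ec Eu = go (third Cc Cu Ww Ww′ Ec Eu)
      where
      w≢ : ∀ {v} → N (τ ▸ w) v ≡ true → w ≢ v
      w≢ t eq = N∉ t (subst (_∈ τ ▸ w) eq (∈▸ʳ {σ = τ}))
      turn : ∀ {c v} → C c ≡ true → W v ≡ true → E (τ ▸ w) c v ≡ true → pos 2 ≤ℤ g v
      turn {v = v} a b t = g≥2 b (B-positive {M = E (τ ▸ v)} {C} {W} a Ww (E-flip (rotate {τ} (W⊆ Ww) (E-flip t))))
      at : ∀ {v} → W v ≡ true → pos 2 ≤ℤ g v → pos 2 ≤ℤ ⟦ W v ⟧ * g v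
      at {v} a t = subst (pos 2 ≤ℤ_) (sym (⟦true⟧* (g v) a)) t
      nonneg : ∀ v → 0ℤ ≤ℤ ⟦ W v ⟧ * g v
      nonneg v = 0≤⟦⟧* (W v) (B-nonneg (E (τ ▸ v)) C W)
      go : (∃ λ w″ → ∃ λ c″ → w′ ≢ w″ × C c″ ≡ true × W w″ ≡ true × E (τ ▸ w) c″ w″ ≡ true) → pos 6 ≤ℤ outer C
      go (w″ , c″ , ne , Cc″ , Ww″ , Ec″) = subst (pos 6 ≤ℤ_) (sym outer-swap) (ℤP.≤-trans
           (at {w} Ww (g≥2 Ww (B-positive {M = E (τ ▸ w)} {C} {W} Cc Ww′ Ec)) ⊕ (at {w′} Ww′ (turn Cc Ww′ Ec) ⊕ at {w″} Ww″ (turn Cc″ Ww″ Ec″)))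
           (∑-≥₃ {f = λ v → ⟦ W v ⟧ * g v} nonneg {w} {w′} {w″} (w≢ (E⁻ Ec)) (w≢ (E⁻ Ec″)) ne))

    -- If fewer than three such triangles existed, facets avoiding C would be
    -- closed under crossing ridges.
    outer≥6 : ∀ {F} → τ ⊆ F → Face F → ∣ F ∣ ≡ d → (∀ {v} → v ∈ F → C v ≡ false) → ∀ {r} → C r ≡ true → pos 6 ≤ℤ outer C
    outer≥6 {F} s fF eF out {r} Cr with pos 6 ℤP.≤? outer C
    ... | yes h = h
    ... | no ¬h with pure (NF (A⊆ (C⊆A Cr)))
    ...   | G , sG , fG , eG = contra Cr (strongly-connected 3 Avoids f e cross s fF eF (λ i → sG (∈▸ˡ i)) fG eG out (sG (∈▸ʳ {σ = τ})))
      where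
      Avoids : Subset n → Set
      Avoids F = ∀ {v} → v ∈ F → C v ≡ false
      avoid : ∀ {w c} → N τ w ≡ true → C c ≡ true → C w ≡ false → E τ c w ≡ true → W w ≡ true
      avoid {w} Nw Cc Cw q with bcase (W w)
      ... | inj₁ t = t
      ... | inj₂ t = contra (closed Cc (∧⁺ Nw (cong not t)) q) Cw
      -- Entering `C` across the ridge `R` exhibits the configuration of `six`: the edge `w w′` of
      -- `R` lies in `W`, with `y` in `C` on one side and `x` outside `C` on the other.
      cross : Closed τ Avoids
      cross {R} {x} {y} sR fR eR Nx Ny avx {v} i with ∈▸⁻ i
      ... | inj₁ j = avx (∈▸ˡ j)
      ... | inj₂ refl with bcase (C y)
      ...   | inj₂ q = q
      ...   | inj₁ Cy with next {τ} {R} sR fR (ℕP.≤-pred (ℕP.<-≤-trans (subst (λ z → suc ∣ τ ∣ < z) (trans e (sym eR)) (s≤s (s≤s (ℕP.n≤1+n _)))) ℕP.≤-refl))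
      ...     | w , iw , Nw with next {τ ▸ w} {R} (▸-⊆ sR iw) fR (subst₂ _<_ (sym (∣▸∣ (N∉ Nw))) (ℕP.suc-injective (trans e (sym eR))) ℕP.≤-refl)
      ...       | w′ , iw′ , Nw′ = ⊥-elim (¬h (six Cy (avx (∈▸ʳ {σ = R})) (avoid Nw Cy (avx (∈▸ˡ iw)) Ecw) (avoid (N-sub Nw′) Cy (avx (∈▸ˡ iw′)) Ecw′) (tri Ny) (tri Nx)))
        where
        R≡ : R ≡ τ ▸ w ▸ w′
        R≡ = sym (⊆-full (▸-⊆ (▸-⊆ sR iw) iw′) (ℕP.≤-reflexive (trans (sym (ℕP.suc-injective (trans e (sym eR)))) (sym (trans (∣▸∣ (N∉ Nw′)) (cong suc (∣▸∣ (N∉ Nw))))))))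
        tri : ∀ {z} → N R z ≡ true → E (τ ▸ w) z w′ ≡ true
        tri {z} Nz = E-flip (subst (λ b → b ≡ true) (N-cone Nw′ z) (subst (λ ρ → N ρ z ≡ true) R≡ Nz))
        Ecw : E τ y w ≡ true
        Ecw = E-flip (subst (λ b → b ≡ true) (N-cone Nw y) (E₁ (tri Ny)))
        Ecw′ : E τ y w′ ≡ true
        Ecw′ = E-sub (tri Ny)

  -- What has to be shown is that at least `3 ♯ A` edges meet `A`. The Euler bound for `A`, six
  -- units of `outer` for each class, and `outer-A` add up to exactly this.
  base-count : ∀ {F} → τ ⊆ F → Face F → ∣ F ∣ ≡ d → (∀ {v} → v ∈ F → A v ≡ false) → (∃ λ x → A x ≡ true) ⊎ (∀ x → A x ≡ false)
    → ring-φ (pos 3) (Q (E τ) W) (♯ W) ≤ℤ ring-φ (pos 3) (Q (E τ) (N τ)) (♯ (N τ))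
  base-count {F} s fF eF out (inj₂ z) = arith (Q (E τ) A) (B (E τ) A W) (Q (E τ) W) (♯ A) (♯ W) Q-total ♯-total (♯-empty z)
         (subst (λ q → 0ℤ ≤ℤ q + pos 2 * B (E τ) A W) (sym (Q-empty (E τ) z)) (0ℤ≤2 (B-nonneg (E τ) A W)))
    where
    0ℤ≤2 : ∀ {b} → 0ℤ ≤ℤ b → 0ℤ ≤ℤ 0ℤ + pos 2 * b
    0ℤ≤2 {b} h = ≤-by (h ⊕ h) (lem b)
      where
      lem : ∀ b → 0ℤ + (b + b) ≡ 0ℤ + pos 2 * b + (0ℤ + 0ℤ)
      lem = solve-∀
    arith : ∀ a b c x w {t m} → t ≡ a + pos 2 * b + c → m ≡ x + w → x ≡ 0ℤ → 0ℤ ≤ℤ a + pos 2 * b → ring-φ (pos 3) c w ≤ℤ ring-φ (pos 3) t m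
    arith a b c x w refl refl refl h = ≤-by h (lem a b c w)
      where
      lem : ∀ a b c w → c - pos 2 * pos 3 * w + pos 3 * (pos 3 + 1ℤ) + (a + pos 2 * b) ≡ (a + pos 2 * b + c) - pos 2 * pos 3 * (0ℤ + w) + pos 3 * (pos 3 + 1ℤ) + 0ℤ
      lem = solve-∀
  base-count {F} s fF eF out (inj₁ (x , Ax)) = arith (Q (E τ) A) (B (E τ) A W) (Q (E τ) W) (♯ A) (♯ W) (outer A) (triangles τ A) (♯ R) Q-total ♯-total outer-A euler classes
    where
    -- A link vertex of the given facet lies outside `A`, so `A` is a proper set, as `components`
    -- requires.
    seed : ∃ λ y → y ∈ F × N τ y ≡ true
    seed = next s fF (lt-dim 2 F τ e eF)
    open Components (components n f e A (subst (♯ A ≤ℤ_) (♯-top n) (∑-mono (λ i → ⟦⟧≤1 (A i)))) A⊆ (proj₂ (proj₂ seed)) (out (proj₁ (proj₂ seed))))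
    C : Fin n → Fin n → Bool
    C r v = A v ∧ (ℓ v == r)
    each : ∀ r → ⟦ R r ⟧ * pos 6 ≤ℤ ⟦ R r ⟧ * outer (C r)
    each r with bcase (R r)
    ... | inj₂ q = ℤP.≤-reflexive (trans (⟦false⟧* (pos 6) q) (sym (⟦false⟧* (outer (C r)) q)))
    ... | inj₁ q = subst₂ _≤ℤ_ (sym (⟦true⟧* (pos 6) q)) (sym (⟦true⟧* (outer (C r)) q)) (Class.outer≥6 (C r) (λ {v} t → ∧ˡ (A v) t)
        (λ {u} {v} a b t → ∧⁺ b (trans (cong (_== r) (sym (along (∧ˡ (A u) a) b t))) (∧ʳ (A u) a)))
        s fF eF (λ {v} i → cong (_∧ (ℓ v == r)) (out i)) {r} (∧⁺ (R⊆A q) (trans (cong (_== r) (root q)) (==-refl r))))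
    classes : pos 6 * ♯ R ≤ℤ outer A
    classes = ℤP.≤-trans (ℤP.≤-reflexive (trans (ℤP.*-comm (pos 6) (♯ R)) (trans (comm-sum) refl))) (ℤP.≤-trans (∑-mono each)
        (ℤP.≤-trans (ℤP.≤-reflexive (trans (∑-cong (λ r → sym (∑-* ⟦ R r ⟧ _))) (∑-swap _))) (∑-mono col)))
      where
      comm-sum : ♯ R * pos 6 ≡ ∑ (λ r → ⟦ R r ⟧ * pos 6)
      comm-sum = trans (ℤP.*-comm (♯ R) (pos 6)) (trans (sym (∑-* (pos 6) _)) (∑-cong (λ r → ℤP.*-comm (pos 6) ⟦ R r ⟧)))
      col : ∀ u → ∑ (λ r → ⟦ R r ⟧ * (⟦ C r u ⟧ * Q (E (τ ▸ u)) W)) ≤ℤ ⟦ A u ⟧ * Q (E (τ ▸ u)) W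
      col u = ℤP.≤-trans (∑-mono pt) (ℤP.≤-reflexive (∑-δ (ℓ u) (λ _ → ⟦ A u ⟧ * q)))
        where
        q = Q (E (τ ▸ u)) W
        q≥0 : 0ℤ ≤ℤ q
        q≥0 = B-nonneg (E (τ ▸ u)) W W
        pt : ∀ r → ⟦ R r ⟧ * (⟦ A u ∧ (ℓ u == r) ⟧ * q) ≤ℤ ⟦ ℓ u == r ⟧ * (⟦ A u ⟧ * q)
        pt r = indicator-bound (R r) (A u) (ℓ u == r) q q≥0
    arith : ∀ a b c x w o t r {tot m} → tot ≡ a + pos 2 * b + c → m ≡ x + w → o + pos 2 * a ≡ pos 2 * b + t
          → pos 6 * x + t ≤ℤ pos 3 * a + pos 6 * r → pos 6 * r ≤ℤ o → ring-φ (pos 3) c w ≤ℤ ring-φ (pos 3) tot m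
    arith a b c x w o t r refl refl q h₁ h₂ = ≤-by (h₁ ⊕ h₂ ⊕ ℤP.≤-reflexive q) (lem a b c x w o t r)
      where
      lem : ∀ a b c x w o t r → c - pos 2 * pos 3 * w + pos 3 * (pos 3 + 1ℤ) + (pos 3 * a + pos 6 * r + o + (pos 2 * b + t))
          ≡ a + pos 2 * b + c - pos 2 * pos 3 * (x + w) + pos 3 * (pos 3 + 1ℤ) + (pos 6 * x + t + pos 6 * r + (o + pos 2 * a))
      lem = solve-∀

  base-rigid : ∀ {F} → τ ⊆ F → Face F → ∣ F ∣ ≡ d → (∀ {v} → v ∈ F → A v ≡ false) → φ (E τ) 3 W ≤ℤ φ (E τ) 3 (N τ)
  base-rigid s fF eF out = subst₂ _≤ℤ_ (sym (φ-def (E τ) 3 W)) (sym (φ-def (E τ) 3 (N τ))) (base-count s fF eF out (find A))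

-- Rigidity

module _ {n : ℕ} {M : Fin n → Fin n → Bool} where

  φ-cong : ∀ {p w w′} → (∀ i → w i ≡ w′ i) → φ M p w ≡ φ M p w′
  φ-cong {p} {w} {w′} h = trans (φ-def M p w) (trans (cong₂ (ring-φ (pos p)) (Q-cong M h) (♯-cong h)) (sym (φ-def M p w′)))

  φ-add : (∀ u v → M u v ≡ M v u) → (∀ u → M u u ≡ false) → ∀ p {w w₀ : Fin n → Bool} x → w₀ x ≡ false
     → (∀ i → w i ≡ (x == i) ∨ w₀ i) → φ M p w ≡ φ M p w₀ + pos 2 * ♯ (λ u → w₀ u ∧ M x u) - pos 2 * pos p
  φ-add s irr p {w} {w₀} x e h = trans (φ-def M p w) (trans (arith {q₀ = Q M w₀} {♯ (λ u → w₀ u ∧ M x u)} {m₀ = ♯ w₀} (Q-add M s irr x e h) (♯-remove x e h))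
      (cong (λ z → z + pos 2 * ♯ (λ u → w₀ u ∧ M x u) - pos 2 * pos p) (sym (φ-def M p w₀))))
    where
    arith : ∀ {q q₀ r m m₀} → q ≡ q₀ + pos 2 * r → m ≡ 1ℤ + m₀ → ring-φ (pos p) q m ≡ ring-φ (pos p) q₀ m₀ + pos 2 * r - pos 2 * pos p
    arith {q₀ = q₀} {r} {m₀ = m₀} refl refl = lem (pos p) q₀ r m₀
      where
      lem : ∀ p q r m → q + pos 2 * r - pos 2 * p * (1ℤ + m) + p * (p + 1ℤ) ≡ q - pos 2 * p * m + p * (p + 1ℤ) + pos 2 * r - pos 2 * p
      lem = solve-∀

  φ-cone : (∀ u v → M u v ≡ M v u) → (∀ u → M u u ≡ false) → ∀ p {w w₀ : Fin n → Bool} x → w₀ x ≡ false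
     → (∀ i → w i ≡ (x == i) ∨ w₀ i) → (∀ {u} → w₀ u ≡ true → M x u ≡ true) → φ M (suc p) w ≡ φ M p w₀
  φ-cone s irr p {w} {w₀} x e h all = trans (φ-add s irr (suc p) x e h)
      (trans (cong₂ (λ a b → a + pos 2 * b - pos 2 * pos (suc p)) (φ-def M (suc p) w₀) (♯-cong same)) (trans (lem (pos p) (Q M w₀) (♯ w₀)) (sym (φ-def M p w₀))))
    where
    same : ∀ u → (w₀ u ∧ M x u) ≡ w₀ u
    same u = bool-ext (∧ˡ (w₀ u)) (λ q → ∧⁺ q (all q))
    lem : ∀ p q m → q - pos 2 * (1ℤ + p) * m + (1ℤ + p) * ((1ℤ + p) + 1ℤ) + pos 2 * m - pos 2 * (1ℤ + p) ≡ q - pos 2 * p * m + p * (p + 1ℤ)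
    lem = solve-∀

  -- The edge count is supermodular, the vertex count is modular, and the constants agree.
  φ-supermod : ∀ p (w w′ : Fin n → Bool) → φ M p w + φ M p w′ ≤ℤ φ M p (λ i → w i ∨ w′ i) + φ M p (λ i → w i ∧ w′ i)
  φ-supermod p w w′ = subst₂ _≤ℤ_ (cong₂ _+_ (sym (φ-def M p w)) (sym (φ-def M p w′)))
      (cong₂ _+_ (sym (φ-def M p (λ i → w i ∨ w′ i))) (sym (φ-def M p (λ i → w i ∧ w′ i))))
      (arith (pos p) (Q M w) (Q M w′) (Q M (λ i → w i ∨ w′ i)) (Q M (λ i → w i ∧ w′ i)) (♯ w) (♯ w′) (♯ (λ i → w i ∨ w′ i)) (♯ (λ i → w i ∧ w′ i)) (Q-supermod M w w′) modular)
    where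
    modular : ♯ w + ♯ w′ ≡ ♯ (λ i → w i ∨ w′ i) + ♯ (λ i → w i ∧ w′ i)
    modular = trans (sym (∑-+ _ _)) (trans (∑-cong (λ i → pt (w i) (w′ i))) (∑-+ _ _))
      where
      pt : ∀ a b → ⟦ a ⟧ + ⟦ b ⟧ ≡ ⟦ a ∨ b ⟧ + ⟦ a ∧ b ⟧
      pt true b = refl
      pt false b = ℤP.+-comm 0ℤ ⟦ b ⟧
    arith : ∀ p q q′ a b m m′ x y → q + q′ ≤ℤ a + b → m + m′ ≡ x + y
          → ring-φ p q m + ring-φ p q′ m′ ≤ℤ ring-φ p a x + ring-φ p b y
    arith p q q′ a b m m′ x y h e = ≤-by h (trans (l₁ p q q′ a b m m′) (trans (cong (λ z → q + q′ + (a + b) - pos 2 * p * z + (p * (p + 1ℤ) + p * (p + 1ℤ))) e) (l₂ p q q′ a b x y)))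
      where
      l₁ : ∀ p q q′ a b m m′ → q - pos 2 * p * m + p * (p + 1ℤ) + (q′ - pos 2 * p * m′ + p * (p + 1ℤ)) + (a + b)
         ≡ q + q′ + (a + b) - pos 2 * p * (m + m′) + (p * (p + 1ℤ) + p * (p + 1ℤ))
      l₁ = solve-∀
      l₂ : ∀ p q q′ a b x y → q + q′ + (a + b) - pos 2 * p * (x + y) + (p * (p + 1ℤ) + p * (p + 1ℤ))
         ≡ a - pos 2 * p * x + p * (p + 1ℤ) + (b - pos 2 * p * y + p * (p + 1ℤ)) + (q + q′)
      l₂ = solve-∀

φ-split : ∀ {n} {M M₁ M₂ : Fin n → Fin n → Bool} p {w} → (∀ u v → w u ≡ true → w v ≡ true → ⟦ M u v ⟧ ≡ ⟦ M₁ u v ⟧ + ⟦ M₂ u v ⟧)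
        → φ M p w ≡ φ M₁ p w + Q M₂ w
φ-split {M = M} {M₁} {M₂} p {w} h = trans (φ-def M p w) (trans (cong (λ q → ring-φ (pos p) q (♯ w)) (Q-split {M = M} {M₁} {M₂} h))
   (trans (lem (pos p) (Q M₁ w) (Q M₂ w) (♯ w)) (cong (_+ Q M₂ w) (sym (φ-def M₁ p w)))))
  where
  lem : ∀ p a b m → a + b - pos 2 * p * m + p * (p + 1ℤ) ≡ a - pos 2 * p * m + p * (p + 1ℤ) + b
  lem = solve-∀

φ-congM : ∀ {n} {M M′ : Fin n → Fin n → Bool} p {w} → (∀ u v → w u ≡ true → w v ≡ true → M u v ≡ M′ u v) → φ M p w ≡ φ M′ p w
φ-congM {M = M} {M′} p {w} h = trans (φ-def M p w) (trans (cong (λ q → ring-φ (pos p) q (♯ w)) (Q-congM {M = M} {M′} h)) (sym (φ-def M′ p w)))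

φ-empty : ∀ {n} {M : Fin n → Fin n → Bool} {w} → (∀ i → w i ≡ false) → φ M 0 w ≡ 0ℤ
φ-empty {M = M} {w} z = trans (φ-def M 0 w) (cong₂ (ring-φ (pos 0)) (Q-empty M z) (♯-empty z))

module Rigidity {n : ℕ} (d : ℕ) (Δ : Cx n) (pm : NormalPM d Δ) where

  open PM d Δ pm

  -- Twice the g₂-number of the link of τ, where p - 1 is the dimension of that link.
  γ : Subset n → ℕ → ℤ
  γ τ p = φ (E τ) p (N τ)

  Covers : Subset n → (Fin n → Bool) → Subset n → Set
  Covers τ W F = ∀ {v} → v ∈ F → (v ∈ τ) ⊎ (W v ≡ true)

  -- `W` has to cover a facet to start from: the empty set has the value `p * (p + 1)`.
  Rigid : Subset n → ℕ → Set
  Rigid τ p = ∀ {W F} → (∀ {v} → W v ≡ true → N τ v ≡ true) → τ ⊆ F → Face F → ∣ F ∣ ≡ d → Covers τ W F → φ (E τ) p W ≤ℤ γ τ p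

  star : Subset n → Fin n → Fin n → Bool
  star τ v u = (v == u) ∨ N (τ ▸ v) u

  star-self : ∀ τ v → star τ v v ≡ true
  star-self τ v = cong (_∨ N (τ ▸ v) v) (==-refl v)

  star-nbr : ∀ {τ v u} → N (τ ▸ v) u ≡ true → star τ v u ≡ true
  star-nbr {τ} {v} {u} e with v == u
  ... | true = refl
  ... | false = e

  star⁻ : ∀ {τ v u} → star τ v u ≡ true → (v ≡ u) ⊎ (N (τ ▸ v) u ≡ true)
  star⁻ {τ} {v} {u} e with v ≟F u
  ... | yes q = inj₁ q
  ... | no _ = inj₂ e

  star⊆ : ∀ {τ v u} → N τ v ≡ true → star τ v u ≡ true → N τ u ≡ true
  star⊆ Nv e with star⁻ e
  ... | inj₁ refl = Nv
  ... | inj₂ q = N-sub q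

  apex∉ : ∀ {τ v} → N (τ ▸ v) v ≡ false
  apex∉ {τ} {v} = ≢true (λ q → N∉ q (∈▸ʳ {σ = τ}))

  -- For neighbours `a` and `b` of `v` in the link of `τ`, this says that `v a b` is a missing
  -- triangle there. `miss` counts such edges in both orders.
  missing : Subset n → Fin n → Fin n → Fin n → Bool
  missing τ v a b = E τ a b ∧ not (E (τ ▸ v) a b)

  miss : Subset n → Fin n → ℤ
  miss τ v = Q (missing τ v) (N (τ ▸ v))

  E-split : ∀ τ v a b → ⟦ E τ a b ⟧ ≡ ⟦ E (τ ▸ v) a b ⟧ + ⟦ missing τ v a b ⟧
  E-split τ v a b with bcase (E (τ ▸ v) a b)
  ... | inj₁ q rewrite q | E-sub q = refl
  ... | inj₂ q rewrite q | ∧-identityʳ (E τ a b) = sym (ℤP.+-identityˡ _)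

  -- The cone is taken in the graph of the link of `τ`. Among neighbours of `v` that graph exceeds
  -- the graph of the link of `τ ▸ v` by the missing triangles at `v`.
  cone-φ : ∀ {τ v p w w₀} → N τ v ≡ true → (∀ {u} → w₀ u ≡ true → N (τ ▸ v) u ≡ true) → (∀ u → w u ≡ (v == u) ∨ w₀ u)
         → φ (E τ) (suc p) w ≡ φ (E (τ ▸ v)) p w₀ + Q (missing τ v) w₀
  cone-φ {τ} {v} {p} {w} {w₀} Nv sub h = trans (φ-cone (E-sym τ) (E-irr τ) p v (≢true (λ q → contra (sub q) apex∉)) h
      (λ {u} q → subst (λ b → b ≡ true) (N-cone Nv u) (sub q)))
      (φ-split p (λ a b _ _ → E-split τ v a b))

  star-φ : ∀ {τ v p} → N τ v ≡ true → φ (E τ) (suc p) (star τ v) ≡ γ (τ ▸ v) p + miss τ v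
  star-φ Nv = cone-φ Nv (λ q → q) (λ _ → refl)

  -- By supermodularity the star of v may be added to W as soon as φ of the star
  -- dominates φ of its part in W; both are cones over v, so this is rigidity of the link of v.
  absorb : ∀ {τ v p W F} → N τ v ≡ true → Rigid (τ ▸ v) p → W v ≡ true → τ ▸ v ⊆ F → Face F → ∣ F ∣ ≡ d → Covers τ W F
         → φ (E τ) (suc p) W ≤ℤ φ (E τ) (suc p) (λ u → W u ∨ star τ v u)
  absorb {τ} {v} {p} {W} {F} Nv rig Wv s fF eF cov = arith (φ-supermod (suc p) W (star τ v)) small
    where
    w₀ : Fin n → Bool
    w₀ u = W u ∧ N (τ ▸ v) u
    split : ∀ u → (W u ∧ star τ v u) ≡ (v == u) ∨ w₀ u
    split u with v ≟F u
    ... | yes refl = ∧⁺ Wv refl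
    ... | no _ = refl
    cover : Covers (τ ▸ v) w₀ F
    cover {u} i with u ∈? τ ▸ v
    ... | yes j = inj₁ j
    ... | no j with cov i
    ...   | inj₁ k = ⊥-elim (j (∈▸ˡ k))
    ...   | inj₂ k = inj₂ (∧⁺ k (N⁺ j (down (▸-⊆ s i) fF)))
    small : φ (E τ) (suc p) (λ u → W u ∧ star τ v u) ≤ℤ φ (E τ) (suc p) (star τ v)
    small = subst₂ _≤ℤ_ (sym (cone-φ {τ} {v} {p} {_} {w₀} Nv (λ {u} q → ∧ʳ (W u) q) split)) (sym (star-φ Nv))
       (rig {w₀} (λ {u} q → ∧ʳ (W u) q) s fF eF cover ⊕ Q-mono (missing τ v) (λ u q → ∧ʳ (W u) q))
    arith : ∀ {a b c e} → a + b ≤ℤ c + e → e ≤ℤ b → a ≤ℤ c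
    arith {a} {b} {c} {e} h k = ≤-by (h ⊕ k) (lem a b c e)
      where
      lem : ∀ a b c e → a + (c + e + b) ≡ c + (a + b + e)
      lem = solve-∀

  -- While `W` misses a link vertex, some covered facet is adjacent to an uncovered one. Absorbing
  -- the star of a vertex of their common ridge does not lower `φ`, and it reduces the number of
  -- vertices left out, which `k` bounds.
  rigid-step : ∀ {τ p} → Face τ → suc (suc p) +ℕ ∣ τ ∣ ≡ d → (∀ {v} → N τ v ≡ true → Rigid (τ ▸ v) (suc p)) → ∀ k {W F} → ♯ (λ v → N τ v ∧ not (W v)) ≤ℤ pos k
    → (∀ {v} → W v ≡ true → N τ v ≡ true) → τ ⊆ F → Face F → ∣ F ∣ ≡ d → Covers τ W F → φ (E τ) (suc (suc p)) W ≤ℤ γ τ (suc (suc p))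
  rigid-step {τ} {p} f e rig k {W} {F} le W⊆ s fF eF cov = decide (φ (E τ) (suc (suc p)) W ℤP.≤? γ τ (suc (suc p)))
    where
    Goal : Set
    Goal = φ (E τ) (suc (suc p)) W ≤ℤ γ τ (suc (suc p))
    grow : ∀ k {v y G} → ♯ (λ v → N τ v ∧ not (W v)) ≤ℤ pos k → W v ≡ true → E τ v y ≡ true → W y ≡ false
         → τ ▸ v ⊆ G → Face G → ∣ G ∣ ≡ d → Covers τ W G → Goal
    grow zero {v} {y} le Wv Evy Wy sG fG eG cG = 1≤0-absurd (ℤP.≤-trans (♯-positive (λ v → N τ v ∧ not (W v)) {y} (∧⁺ (E⁻ Evy) (cong not Wy))) le)
    grow (suc k) {v} {y} {G} le Wv Evy Wy sG fG eG cG = ℤP.≤-trans (absorb (W⊆ Wv) (rig (W⊆ Wv)) Wv sG fG eG cG)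
        (rigid-step f e rig k {W₂} {G} fewer W₂⊆ (λ i → sG (∈▸ˡ i)) fG eG cover)
      where
      W₂ : Fin n → Bool
      W₂ u = W u ∨ star τ v u
      W₂⊆ : ∀ {u} → W₂ u ≡ true → N τ u ≡ true
      W₂⊆ {u} q with bcase (W u)
      ... | inj₁ t = W⊆ t
      ... | inj₂ t = star⊆ (W⊆ Wv) (trans (cong (_∨ star τ v u) (sym t)) q)
      cover : Covers τ W₂ G
      cover {u} i with cG i
      ... | inj₁ j = inj₁ j
      ... | inj₂ j = inj₂ (cong (_∨ star τ v u) j)
      fewer : ♯ (λ v → N τ v ∧ not (W₂ v)) ≤ℤ pos k
      fewer = arith (subst (_≤ℤ ♯ (λ v → N τ v ∧ not (W v))) (trans (∑-+ _ _) (cong (♯ (λ v → N τ v ∧ not (W₂ v)) +_) (∑-δ y (λ _ → 1ℤ)))) (∑-mono pt)) le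
        where
        arith : ∀ {a b k} → a + 1ℤ ≤ℤ b → b ≤ℤ pos (suc k) → a ≤ℤ pos k
        arith {a} {b} {k} h h′ = ≤-by (h ⊕ h′) (lem a b (pos k))
          where
          lem : ∀ a b k → a + (b + (1ℤ + k)) ≡ k + (a + 1ℤ + b)
          lem = solve-∀
        at-y : W₂ y ≡ true
        at-y = trans (cong (_∨ star τ v y) Wy) (star-nbr (subst (λ b → b ≡ true) (sym (N-cone (W⊆ Wv) y)) Evy))
        pt : ∀ u → ⟦ N τ u ∧ not (W₂ u) ⟧ + ⟦ y == u ⟧ * 1ℤ ≤ℤ ⟦ N τ u ∧ not (W u) ⟧
        pt u with y ≟F u
        ... | yes refl rewrite at-y | Wy | E⁻ Evy = ℤP.≤-refl
        ... | no _ = subst (_≤ℤ ⟦ N τ u ∧ not (W u) ⟧) (sym (ℤP.+-identityʳ _)) (⟦⟧-mono {N τ u ∧ not (W₂ u)} (λ q → ∧⁺ (∧ˡ (N τ u) q) (weaken (∧ʳ (N τ u) q))))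
          where
          weaken : not (W₂ u) ≡ true → not (W u) ≡ true
          weaken q with W u
          ... | false = refl
    decide : Dec Goal → Goal
    decide (yes h) = h
    -- Under the negated goal, covered facets are closed under crossing ridges, because an uncovered
    -- `y` would let `grow` prove the goal. Strong connectivity then makes `W` the whole vertex set,
    -- where equality holds.
    decide (no ¬h) = ℤP.≤-reflexive (φ-cong (λ v → bool-ext W⊆ (all v)))
      where
      cross : Closed τ (Covers τ W)
      cross {R} {x} {y} sR fR eR Nx Ny cx {v} i with ∈▸⁻ i
      ... | inj₁ j = cx (∈▸ˡ j)
      ... | inj₂ refl with bcase (W y)
      ...   | inj₁ q = inj₂ q
      ...   | inj₂ q with next {τ} {R} sR fR (ℕP.≤-trans (s≤s (ℕP.m≤n+m ∣ τ ∣ p)) (ℕP.≤-reflexive (ℕP.suc-injective (trans e (sym eR)))))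
      ...     | w , iw , Nw with cx (∈▸ˡ iw)
      ...       | inj₁ j = ⊥-elim (N∉ Nw j)
      ...       | inj₂ Ww = ⊥-elim (¬h (grow k le Ww
                      (E⁺ Nw (λ j → N∉ Ny (sR j)) (λ eq → N∉ Ny (subst (_∈ R) (sym eq) iw)) (down (▸-⊆ (▸-⊆ (λ j → ∈▸ˡ (sR j)) (∈▸ˡ iw)) (∈▸ʳ {σ = R})) (NF Ny))) q
                      (▸-⊆ (λ j → ∈▸ˡ (sR j)) (∈▸ˡ iw)) (NF Nx) (trans (∣▸∣ (N∉ Nx)) eR) cx))
      all : ∀ v → N τ v ≡ true → W v ≡ true
      all v Nv with pure (NF Nv)
      ... | G , sG , fG , eG with strongly-connected (suc (suc p)) (Covers τ W) f e cross s fF eF (λ i → sG (∈▸ˡ i)) fG eG cov (sG (∈▸ʳ {σ = τ}))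
      ...   | inj₁ j = ⊥-elim (N∉ Nv j)
      ...   | inj₂ q = q

  -- The induction cannot start lower than surfaces: for a cycle with more than three vertices `γ`
  -- is negative, whereas an edge of it has value 0.
  rigid : ∀ p {τ} → Face τ → 3 +ℕ p +ℕ ∣ τ ∣ ≡ d → Rigid τ (3 +ℕ p)
  rigid zero {τ} f e {W} {F} W⊆ s fF eF cov = Base.base-rigid d Δ pm f e W W⊆ s fF eF out
    where
    out : ∀ {v} → v ∈ F → (N τ v ∧ not (W v)) ≡ false
    out {v} i with cov i
    ... | inj₁ j = ≢true (λ q → N∉ (∧ˡ (N τ v) q) j)
    ... | inj₂ q rewrite q = ∧-zeroʳ (N τ v)
  rigid (suc p) {τ} f e {W} W⊆ = rigid-step f e (λ {v} Nv → rigid p (NF Nv) (dim▸ {3 +ℕ p} (N∉ Nv) e)) n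
     (subst (♯ (λ v → N τ v ∧ not (W v)) ≤ℤ_) (♯-top n) (∑-mono (λ i → ⟦⟧≤1 (N τ i ∧ not (W i))))) W⊆

-- Consequences of rigidity for missing faces

Disjoint : ∀ {n} → Subset n → Subset n → Set
Disjoint σ ρ = ∀ {x} → x ∈ σ → x ∉ ρ

∉∪ : ∀ {n} {σ ρ : Subset n} {x} → x ∉ σ → x ∉ ρ → x ∉ σ ∪ ρ
∉∪ {σ = σ} {ρ} a b q with x∈p∪q⁻ σ ρ q
... | inj₁ r = a r
... | inj₂ r = b r

∣∪∣ : ∀ {n} {σ ρ : Subset n} → Disjoint σ ρ → ∣ σ ∪ ρ ∣ ≡ ∣ σ ∣ +ℕ ∣ ρ ∣
∣∪∣ {σ = σ} {ρ} dis = pos-inj (trans (∣∣-♯ (σ ∪ ρ)) (trans (∑-cong pt) (trans (∑-+ _ _) (cong₂ _+_ (sym (∣∣-♯ σ)) (sym (∣∣-♯ ρ))))))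
  where
  pt : ∀ i → ⟦ lookup (σ ∪ ρ) i ⟧ ≡ ⟦ lookup σ i ⟧ + ⟦ lookup ρ i ⟧
  pt i with i ∈? σ | i ∈? ρ
  ... | yes a | yes b = ⊥-elim (dis a b)
  ... | yes a | no b rewrite mem a | nmem b | mem (x∈p∪q⁺ {p = σ} {q = ρ} (inj₁ a)) = refl
  ... | no a | yes b rewrite nmem a | mem b | mem (x∈p∪q⁺ {p = σ} {q = ρ} (inj₂ b)) = refl
  ... | no a | no b rewrite nmem a | nmem b | nmem (∉∪ {σ = σ} {ρ} a b) = refl

∪-⊆ : ∀ {n} {σ ρ π : Subset n} → σ ⊆ π → ρ ⊆ π → σ ∪ ρ ⊆ π
∪-⊆ {σ = σ} {ρ} a b i with x∈p∪q⁻ σ ρ i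
... | inj₁ j = a j
... | inj₂ j = b j

∈∪ˡ : ∀ {n} {σ ρ : Subset n} {x} → x ∈ σ → x ∈ σ ∪ ρ
∈∪ˡ i = x∈p∪q⁺ (inj₁ i)

∈∪ʳ : ∀ {n} {σ ρ : Subset n} {x} → x ∈ ρ → x ∈ σ ∪ ρ
∈∪ʳ {σ = σ} i = x∈p∪q⁺ {p = σ} (inj₂ i)

∪-mono : ∀ {n} {σ σ′ ρ ρ′ : Subset n} → σ ⊆ σ′ → ρ ⊆ ρ′ → σ ∪ ρ ⊆ σ′ ∪ ρ′
∪-mono {σ = σ} {σ′} {ρ} {ρ′} a b = ∪-⊆ (λ i → ∈∪ˡ (a i)) (λ i → ∈∪ʳ {σ = σ′} (b i))

2≤0-absurd : ∀ {a b : ℤ} {A : Set} → a + b ≤ℤ 0ℤ → 0ℤ ≤ℤ a → pos 2 ≤ℤ b → A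
2≤0-absurd {a} {b} h h₁ h₂ = 1≤0-absurd (ℤP.≤-trans (+≤+ (s≤s z≤n)) (ℤP.≤-trans (≤-by (h ⊕ h₁ ⊕ h₂) (lem a b)) (ℤP.≤-refl {0ℤ})))
  where
  lem : ∀ a b → pos 2 + (0ℤ + a + b) ≡ 0ℤ + (a + b + 0ℤ + pos 2)
  lem = solve-∀

4≤2-absurd : ∀ {a b : ℤ} {A : Set} → a + b ≤ℤ pos 2 → 0ℤ ≤ℤ a → pos 4 ≤ℤ b → A
4≤2-absurd {a} {b} h h₁ h₂ = 2≤0-absurd {a} {b - pos 2} (≤-by h (l₁ a b)) h₁ (≤-by h₂ (l₂ b))
  where
  l₁ : ∀ a b → a + (b - pos 2) + pos 2 ≡ 0ℤ + (a + b)
  l₁ = solve-∀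
  l₂ : ∀ b → pos 2 + b ≡ b - pos 2 + pos 4
  l₂ = solve-∀

module Bounds {n : ℕ} (d : ℕ) (Δ : Cx n) (pm : NormalPM d Δ) where

  open PM d Δ pm public
  open Rigidity d Δ pm public

  -- A facet of the link is an iterated cone over the empty set, and no triangles are missing inside
  -- it.
  facet-φ : ∀ p {τ F} → p +ℕ ∣ τ ∣ ≡ d → τ ⊆ F → Face F → ∣ F ∣ ≡ d → φ (E τ) p (λ v → lookup F v ∧ not (lookup τ v)) ≡ 0ℤ
  facet-φ zero {τ} {F} e s fF eF = φ-empty (λ v → ≢true (λ q → contra (mem {σ = τ} (subst (v ∈_) (sym τ≡F) (mem⁻ (∧ˡ (lookup F v) q)))) (bnot (∧ʳ (lookup F v) q))))
    where
    τ≡F : τ ≡ F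
    τ≡F = ⊆-full s (ℕP.≤-reflexive (trans eF (sym e)))
  facet-φ (suc p) {τ} {F} e s fF eF with next s fF (lt-dim p F τ e eF)
  ... | x , i , Nx = trans (cone-φ {τ} {x} {p} {_} {w₀} Nx (λ {u} q → inside q) split) (trans (cong₂ _+_ (facet-φ p (dim▸ {p} (N∉ Nx) e) (▸-⊆ s i) fF eF) none) refl)
    where
    w₀ : Fin n → Bool
    w₀ v = lookup F v ∧ not (lookup (τ ▸ x) v)
    inside : ∀ {u} → w₀ u ≡ true → N (τ ▸ x) u ≡ true
    inside {u} q = N⁺ (nmem⁻ (bnot (∧ʳ (lookup F u) q))) (down (▸-⊆ (▸-⊆ s i) (mem⁻ (∧ˡ (lookup F u) q))) fF)
    split : ∀ u → (lookup F u ∧ not (lookup τ u)) ≡ (x == u) ∨ w₀ u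
    split u with x ≟F u
    ... | yes refl rewrite mem i | nmem (N∉ Nx) = refl
    ... | no ne = cong (λ b → lookup F u ∧ not b) (bool-ext (λ q → mem (∈▸ˡ {σ = τ} (mem⁻ q))) back)
      where
      back : lookup (τ ▸ x) u ≡ true → lookup τ u ≡ true
      back q with ∈▸⁻ (mem⁻ {σ = τ ▸ x} q)
      ... | inj₁ j = mem j
      ... | inj₂ eq = ⊥-elim (ne (sym eq))
    none : Q (missing τ x) w₀ ≡ 0ℤ
    none = trans (∑-cong (λ a → trans (∑-cong (λ b → cong ⟦_⟧ (≢true (gone a b)))) (∑-0 n))) (∑-0 n)
      where
      gone : ∀ a b → ¬ ((w₀ a ∧ w₀ b ∧ missing τ x a b) ≡ true)
      gone a b q = contra (E⁺ (inside wa) (N∉ (inside wb)) (E≢ Eab) (down (▸-⊆ (▸-⊆ (▸-⊆ s i) (mem⁻ (∧ˡ (lookup F a) wa))) (mem⁻ (∧ˡ (lookup F b) wb))) fF))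
                      (bnot (∧ʳ (E τ a b) h))
        where
        wa = ∧ˡ (w₀ a) q
        wb = ∧ˡ (w₀ b) (∧ʳ (w₀ a) q)
        h = ∧ʳ (w₀ b) (∧ʳ (w₀ a) q)
        Eab = ∧ˡ (E τ a b) h

  -- Rigidity for a single facet: the lower bound inequality for links.
  γ-nonneg : ∀ p {τ} → Face τ → 3 +ℕ p +ℕ ∣ τ ∣ ≡ d → 0ℤ ≤ℤ γ τ (3 +ℕ p)
  γ-nonneg p {τ} f e with pure f
  ... | F , s , fF , eF = subst (_≤ℤ γ τ (3 +ℕ p)) (facet-φ (3 +ℕ p) e s fF eF) (rigid p f e {W} {F} W⊆ s fF eF cover)
    where
    W : Fin n → Bool
    W v = lookup F v ∧ not (lookup τ v)
    W⊆ : ∀ {v} → W v ≡ true → N τ v ≡ true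
    W⊆ {v} q = N⁺ (nmem⁻ (bnot (∧ʳ (lookup F v) q))) (down (▸-⊆ s (mem⁻ (∧ˡ (lookup F v) q))) fF)
    cover : Covers τ W F
    cover {v} i with v ∈? τ
    ... | yes j = inj₁ j
    ... | no j = inj₂ (∧⁺ (mem i) (cong not (nmem j)))

  star-covers : ∀ {τ v F} → τ ▸ v ⊆ F → Face F → Covers τ (star τ v) F
  star-covers {τ} {v} {F} s fF {u} i with u ∈? τ ▸ v
  ... | no j = inj₂ (star-nbr (N⁺ j (down (▸-⊆ s i) fF)))
  ... | yes j with ∈▸⁻ j
  ...   | inj₁ k = inj₁ k
  ...   | inj₂ refl = inj₂ (star-self τ v)

  -- Rigidity for the star of `v`, a cone whose value also records the missing triangles at `v`.
  star-bound : ∀ p {τ v} → Face τ → 3 +ℕ p +ℕ ∣ τ ∣ ≡ d → N τ v ≡ true → γ (τ ▸ v) (2 +ℕ p) + miss τ v ≤ℤ γ τ (3 +ℕ p)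
  star-bound p {τ} {v} f e Nv with pure (NF Nv)
  ... | F , s , fF , eF = subst (_≤ℤ γ τ (3 +ℕ p)) (star-φ Nv) (rigid p f e {star τ v} {F} (star⊆ Nv) (λ i → s (∈▸ˡ i)) fF eF (star-covers s fF))

  Q-nonneg : ∀ (M : Fin n → Fin n → Bool) w → 0ℤ ≤ℤ Q M w
  Q-nonneg M w = B-nonneg M w w

  γ-mono : ∀ k p {τ ρ} → Face ρ → τ ⊆ ρ → k +ℕ ∣ τ ∣ ≡ ∣ ρ ∣ → 3 +ℕ p +ℕ ∣ ρ ∣ ≡ d → γ ρ (3 +ℕ p) ≤ℤ γ τ (3 +ℕ (k +ℕ p))
  γ-mono zero p {τ} {ρ} f s ek e = ℤP.≤-reflexive (cong (λ z → γ z (3 +ℕ p)) (sym (⊆-full s (ℕP.≤-reflexive (sym ek)))))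
  γ-mono (suc k) p {τ} {ρ} f s ek e with next s f (subst (∣ τ ∣ <_) ek (s≤s (ℕP.m≤n+m ∣ τ ∣ k)))
  ... | v , i , Nv = ℤP.≤-trans (γ-mono k p {τ ▸ v} f (▸-⊆ s i) ek′ e) (≤-by (star-bound (suc (k +ℕ p)) {τ} {v} (down s f) e′ Nv ⊕ Q-nonneg (missing τ v) (N (τ ▸ v)))
        (lem (γ (τ ▸ v) (3 +ℕ (k +ℕ p))) (miss τ v) (γ τ (4 +ℕ (k +ℕ p)))))
    where
    lem : ∀ a m g → a + (g + m) ≡ g + (a + m + 0ℤ)
    lem = solve-∀
    ek′ : k +ℕ ∣ τ ▸ v ∣ ≡ ∣ ρ ∣
    ek′ = trans (cong (k +ℕ_) (∣▸∣ (N∉ Nv))) (trans (ℕP.+-suc k ∣ τ ∣) ek)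
    e′ : 3 +ℕ suc (k +ℕ p) +ℕ ∣ τ ∣ ≡ d
    e′ = trans (cong (3 +ℕ_) (trans (cong (λ z → suc (z +ℕ ∣ τ ∣)) (ℕP.+-comm k p)) (trans (cong suc (ℕP.+-assoc p k ∣ τ ∣)) (trans (sym (ℕP.+-suc p (k +ℕ ∣ τ ∣))) (cong (p +ℕ_) ek))))) e

  -- A missing triangle `v a b` in the link of `τ`, attributed to its corner `v`.
  record Hole (τ : Subset n) (v a b : Fin n) : Set where
    field
      va : N (τ ▸ v) a ≡ true
      vb : N (τ ▸ v) b ≡ true
      ab : E τ a b ≡ true
      gap : Δ (τ ▸ v ▸ a ▸ b) ≡ false

  flip-hole : ∀ {τ v a b} → Hole τ v a b → Hole τ v b a
  flip-hole {τ} {v} {a} {b} h = record { va = vb ; vb = va ; ab = E-flip ab ; gap = trans (cong Δ (▸-comm (τ ▸ v) b a)) gap }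
    where open Hole h

  hole-missing : ∀ {τ v a b} → Hole τ v a b → (N (τ ▸ v) a ∧ N (τ ▸ v) b ∧ missing τ v a b) ≡ true
  hole-missing {τ} {v} h = ∧⁺ va (∧⁺ vb (∧⁺ ab (cong not (≢true (λ q → contra (E▸ {τ ▸ v} q) gap)))))
    where open Hole h

  row : Subset n → Fin n → Fin n → ℤ
  row τ v a = ♯ (λ b → N (τ ▸ v) a ∧ N (τ ▸ v) b ∧ missing τ v a b)

  row≥0 : ∀ τ v a → 0ℤ ≤ℤ row τ v a
  row≥0 τ v a = 0≤♯ _

  row≥1 : ∀ {τ v a b} → Hole τ v a b → 1ℤ ≤ℤ row τ v a
  row≥1 h = ♯-positive _ (hole-missing h)

  miss≥2 : ∀ {τ v a b} → Hole τ v a b → pos 2 ≤ℤ miss τ v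
  miss≥2 {τ} {v} {a} {b} h = ℤP.≤-trans (row≥1 h ⊕ row≥1 (flip-hole h)) (∑-≥₂ (row≥0 τ v) (λ eq → E≢ (Hole.ab h) (sym eq)))

  miss≥4 : ∀ {τ v a b c} → Hole τ v a b → Hole τ v c b → a ≢ c → pos 4 ≤ℤ miss τ v
  miss≥4 {τ} {v} {a} {b} {c} h k ne = ℤP.≤-trans (row≥1 h ⊕ (row≥1 k ⊕ row≥2)) (∑-≥₃ (row≥0 τ v) ne (λ eq → E≢ (Hole.ab h) (sym eq)) (λ eq → E≢ (Hole.ab k) (sym eq)))
    where
    row≥2 : pos 2 ≤ℤ row τ v b
    row≥2 = ℤP.≤-trans (ℤP.≤-reflexive (sym (cong₂ _+_ (cong ⟦_⟧ (hole-missing (flip-hole h))) (cong ⟦_⟧ (hole-missing (flip-hole k))))))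
      (∑-≥₂ {f = λ z → ⟦ N (τ ▸ v) b ∧ N (τ ▸ v) z ∧ missing τ v b z ⟧} (λ z → 0≤⟦⟧ (N (τ ▸ v) b ∧ N (τ ▸ v) z ∧ missing τ v b z)) {a} {c} ne)

  miss≥4′ : ∀ {τ v a b a′ b′} → Hole τ v a b → Hole τ v a′ b′ → a ≢ a′ → a ≢ b′ → b ≢ a′ → b ≢ b′ → pos 4 ≤ℤ miss τ v
  miss≥4′ {τ} {v} {a} {b} {a′} {b′} h k p q r s = ℤP.≤-trans (row≥1 h ⊕ (row≥1 (flip-hole h) ⊕ (row≥1 k ⊕ row≥1 (flip-hole k))))
    (∑-≥₄ (row≥0 τ v) (λ eq → E≢ (Hole.ab h) (sym eq)) p q r s (λ eq → E≢ (Hole.ab k) (sym eq)))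

  -- The missing triangle uses up the whole bound 2 at `τ`, so nothing is left for the link of `v`.
  hole-flat : ∀ p {τ v a b} → Face τ → 3 +ℕ p +ℕ ∣ τ ∣ ≡ d → N τ v ≡ true → γ τ (3 +ℕ p) ≤ℤ pos 2 → Hole τ v a b → γ (τ ▸ v) (2 +ℕ p) ≤ℤ 0ℤ
  hole-flat p {τ} {v} f e Nv g h = ≤-by (star-bound p f e Nv ⊕ g ⊕ miss≥2 h) (lem (γ (τ ▸ v) (2 +ℕ p)) (miss τ v) (γ τ (3 +ℕ p)))
    where
    lem : ∀ a m g → a + (g + pos 2 + m) ≡ 0ℤ + (a + m + g + pos 2)
    lem = solve-∀

  -- Two missing triangles at `v` cost 4, but only 2 is available. The index `4 +ℕ p` keeps the link
  -- of `τ ▸ v` in the range where `γ` is nonnegative.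
  crowded : ∀ p {τ v} → Face τ → 4 +ℕ p +ℕ ∣ τ ∣ ≡ d → N τ v ≡ true → γ τ (4 +ℕ p) ≤ℤ pos 2 → pos 4 ≤ℤ miss τ v → Empty
  crowded p {τ} {v} f e Nv g m = 4≤2-absurd (ℤP.≤-trans (star-bound (suc p) f e Nv) g) (γ-nonneg p (NF Nv) (dim▸ {3 +ℕ p} (N∉ Nv) e)) m

  flat-no-hole : ∀ p {τ v a b} → Face τ → 4 +ℕ p +ℕ ∣ τ ∣ ≡ d → N τ v ≡ true → γ τ (4 +ℕ p) ≤ℤ 0ℤ → Hole τ v a b → Empty
  flat-no-hole p {τ} {v} f e Nv g h = 2≤0-absurd (ℤP.≤-trans (star-bound (suc p) f e Nv) g) (γ-nonneg p (NF Nv) (dim▸ {3 +ℕ p} (N∉ Nv) e)) (miss≥2 h)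

  -- Passing to the link of all but three vertices of `ν` leaves a missing triangle, while `γ` stays
  -- at most 0.
  flat-no-missing : ∀ p j {ρ ν} → 4 +ℕ p +ℕ (j +ℕ ∣ ρ ∣) ≡ d → γ ρ (4 +ℕ (j +ℕ p)) ≤ℤ 0ℤ → ∣ ν ∣ ≡ 3 +ℕ j → Disjoint ρ ν
    → (∀ {x} → x ∈ ν → Face (ρ ∪ (ν ∖ x))) → Δ (ρ ∪ ν) ≡ false → Empty
  flat-no-missing p j {ρ} {ν} e g sz dis faces gap with inhabited sz
  ... | a , ia with inhabited (∣∖∣-suc ia sz)
  ...   | b , ib with inhabited (∣∖∣-suc ib (∣∖∣-suc ia sz))
  ...     | c , ic = flat-no-hole p {θ} {a} {b} {c} fθ eθ (N⁺ a∉ (down (▸-⊆ (fit ic′ (λ i → proj₂ (∈∖⁻ i))) (at ia (λ q → c≢a (sym q)))) (faces ic′)))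
        (ℤP.≤-trans (subst (λ z → γ θ (4 +ℕ p) ≤ℤ γ ρ (3 +ℕ z)) (ℕP.+-suc j p) (γ-mono j (suc p) fθ (λ i → ∈∪ˡ i) (sym szθ) eθ)) g) hole
    where
    ν′ = ν ∖ a ∖ b ∖ c
    θ = ρ ∪ ν′
    ib′ = ∖⊆ {σ = ν} ib
    ic′ = ∖⊆ {σ = ν} (∖⊆ {σ = ν ∖ a} ic)
    b≢a = proj₂ (∈∖⁻ {σ = ν} ib)
    c≢b = proj₂ (∈∖⁻ {σ = ν ∖ a} ic)
    c≢a = proj₂ (∈∖⁻ {σ = ν} (∖⊆ {σ = ν ∖ a} ic))
    ν′⊆ : ν′ ⊆ ν
    ν′⊆ i = ∖⊆ {σ = ν} (∖⊆ {σ = ν ∖ a} (∖⊆ {σ = ν ∖ a ∖ b} i))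
    disθ : Disjoint ρ ν′
    disθ i j = dis i (ν′⊆ j)
    szθ : ∣ θ ∣ ≡ j +ℕ ∣ ρ ∣
    szθ = trans (∣∪∣ disθ) (trans (cong (∣ ρ ∣ +ℕ_) (∣∖∣-suc ic (∣∖∣-suc ib (∣∖∣-suc ia sz)))) (ℕP.+-comm ∣ ρ ∣ j))
    eθ : 4 +ℕ p +ℕ ∣ θ ∣ ≡ d
    eθ = trans (cong (4 +ℕ p +ℕ_) szθ) e
    fit : ∀ {x} → x ∈ ν → (∀ {y} → y ∈ ν′ → y ≢ x) → θ ⊆ ρ ∪ (ν ∖ x)
    fit ix h = ∪-⊆ (λ i → ∈∪ˡ i) (λ i → ∈∪ʳ {σ = ρ} (∈∖⁺ (ν′⊆ i) (h i)))
    at : ∀ {x y} → y ∈ ν → y ≢ x → y ∈ ρ ∪ (ν ∖ x)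
    at i ne = ∈∪ʳ {σ = ρ} (∈∖⁺ i ne)
    ≢b : ∀ {y} → y ∈ ν′ → y ≢ b
    ≢b i = proj₂ (∈∖⁻ {σ = ν ∖ a} (∖⊆ {σ = ν ∖ a ∖ b} i))
    ≢a : ∀ {y} → y ∈ ν′ → y ≢ a
    ≢a i = proj₂ (∈∖⁻ {σ = ν} (∖⊆ {σ = ν ∖ a} (∖⊆ {σ = ν ∖ a ∖ b} i)))
    out : ∀ {x} → x ∈ ν → x ∉ ν′ → x ∉ θ
    out ix nx i with x∈p∪q⁻ ρ ν′ i
    ... | inj₁ k = dis k ix
    ... | inj₂ k = nx k
    a∉ = out ia (λ i → ≢a i refl)
    b∉ = out ib′ (λ i → ≢b i refl)
    c∉ = out ic′ (λ i → proj₂ (∈∖⁻ {σ = ν ∖ a ∖ b} i) refl)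
    fθ : Face θ
    fθ = down (fit ia ≢a) (faces ia)
    cover : ρ ∪ ν ⊆ θ ▸ a ▸ b ▸ c
    cover = ∪-⊆ (λ i → ∈▸ˡ (∈▸ˡ (∈▸ˡ (∈∪ˡ i)))) go
      where
      go : ν ⊆ θ ▸ a ▸ b ▸ c
      go {y} i with y ≟F a | y ≟F b | y ≟F c
      ... | yes refl | _ | _ = ∈▸ˡ (∈▸ˡ (∈▸ʳ {σ = θ}))
      ... | no _ | yes refl | _ = ∈▸ˡ (∈▸ʳ {σ = θ ▸ a})
      ... | no _ | no _ | yes refl = ∈▸ʳ {σ = θ ▸ a ▸ b}
      ... | no p | no q | no r = ∈▸ˡ (∈▸ˡ (∈▸ˡ (∈∪ʳ {σ = ρ} (∈∖⁺ (∈∖⁺ (∈∖⁺ i p) q) r))))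
    hole : Hole θ a b c
    hole = record
      { va = N⁺ (∉▸ b∉ b≢a) (down (▸-⊆ (▸-⊆ (fit ic′ (λ i → proj₂ (∈∖⁻ i))) (at ia (λ q → c≢a (sym q)))) (at ib′ (λ q → c≢b (sym q)))) (faces ic′))
      ; vb = N⁺ (∉▸ c∉ c≢a) (down (▸-⊆ (▸-⊆ (fit ib′ ≢b) (at ia (λ q → b≢a (sym q)))) (at ic′ c≢b)) (faces ib′))
      ; ab = E⁺ (N⁺ b∉ (down (▸-⊆ (fit ia ≢a) (at ib′ b≢a)) (faces ia))) c∉ c≢b (down (▸-⊆ (▸-⊆ (fit ia ≢a) (at ib′ b≢a)) (at ic′ c≢a)) (faces ia))
      ; gap = ≢true (λ q → contra (down cover q) gap) }

  -- The stars of two link vertices, by supermodularity.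
  two-stars : ∀ p {τ x y} → Face τ → 3 +ℕ p +ℕ ∣ τ ∣ ≡ d → N τ x ≡ true → N τ y ≡ true
    → γ (τ ▸ x) (2 +ℕ p) + miss τ x + (γ (τ ▸ y) (2 +ℕ p) + miss τ y) ≤ℤ γ τ (3 +ℕ p) + φ (E τ) (3 +ℕ p) (λ u → star τ x u ∧ star τ y u)
  two-stars p {τ} {x} {y} f e Nx Ny with pure (NF Nx)
  ... | F , s , fF , eF = ℤP.≤-trans (ℤP.≤-reflexive (cong₂ _+_ (sym (star-φ Nx)) (sym (star-φ Ny)))) (ℤP.≤-trans (φ-supermod (3 +ℕ p) (star τ x) (star τ y))
      (ℤP.+-monoˡ-≤ (φ (E τ) (3 +ℕ p) (λ u → star τ x u ∧ star τ y u)) (rigid p f e {λ u → star τ x u ∨ star τ y u} {F} sub (λ i → s (∈▸ˡ i)) fF eF cov)))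
    where
    sub : ∀ {v} → (star τ x v ∨ star τ y v) ≡ true → N τ v ≡ true
    sub {v} q with bcase (star τ x v)
    ... | inj₁ t = star⊆ Nx t
    ... | inj₂ t = star⊆ Ny (trans (cong (_∨ star τ y v) (sym t)) q)
    cov : Covers τ (λ u → star τ x u ∨ star τ y u) F
    cov i with star-covers s fF i
    ... | inj₁ j = inj₁ j
    ... | inj₂ q = inj₂ (cong (_∨ _) q)

  -- When the graph of the link of `τ` has no additional edges on the common link, `w` is a double
  -- cone over the link of `τ ▸ x ▸ y`.
  edge-star-φ : ∀ p {τ x y w} → N τ x ≡ true → N (τ ▸ x) y ≡ true
    → (∀ u → w u ≡ (x == u) ∨ (y == u) ∨ N (τ ▸ x ▸ y) u)
    → (∀ u v → N (τ ▸ x ▸ y) u ≡ true → N (τ ▸ x ▸ y) v ≡ true → E τ u v ≡ E (τ ▸ x ▸ y) u v)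
    → φ (E τ) (2 +ℕ p) w ≡ γ (τ ▸ x ▸ y) p
  edge-star-φ p {τ} {x} {y} {w} Nx Ny h full =
    trans (φ-cone (E-sym τ) (E-irr τ) (suc p) x x∉ h (λ {u} q → nbr-x q)) (trans (φ-cone (E-sym τ) (E-irr τ) p y apex∉ (λ _ → refl) nbr-y)
      (φ-congM p full))
    where
    w₀ : Fin n → Bool
    w₀ u = (y == u) ∨ N (τ ▸ x ▸ y) u
    nbr-x : ∀ {u} → w₀ u ≡ true → E τ x u ≡ true
    nbr-x {u} q with star⁻ {τ ▸ x} {y} q
    ... | inj₁ refl = subst (λ b → b ≡ true) (N-cone Nx y) Ny
    ... | inj₂ t = subst (λ b → b ≡ true) (N-cone Nx u) (N-sub {τ ▸ x} {y} t)
    x∉ : w₀ x ≡ false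
    x∉ = ≢true (λ q → contra (nbr-x q) (E-irr τ x))
    nbr-y : ∀ {u} → N (τ ▸ x ▸ y) u ≡ true → E τ y u ≡ true
    nbr-y {u} q = E-sub {τ} {x} (subst (λ b → b ≡ true) (N-cone Ny u) q)

  cycle-edges : ∀ {τ} → Face τ → 2 +ℕ ∣ τ ∣ ≡ d → Q (E τ) (N τ) ≡ pos 2 * ♯ (N τ)
  cycle-edges {τ} f e = trans (∑-cong row-u) (∑-* (pos 2) _)
    where
    row-u : ∀ u → ∑ (λ v → ⟦ N τ u ∧ N τ v ∧ E τ u v ⟧) ≡ pos 2 * ⟦ N τ u ⟧
    row-u u with bcase (N τ u)
    ... | inj₂ q = trans (trans (∑-cong (λ v → cong (λ b → ⟦ b ∧ N τ v ∧ E τ u v ⟧) q)) (∑-0 n)) (cong (λ b → pos 2 * ⟦ b ⟧) (sym q))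
    ... | inj₁ q = trans (∑-cong (λ v → cong ⟦_⟧ (bool-ext (λ h → ∧ʳ (N τ v) (∧ʳ (N τ u) h)) (λ h → ∧⁺ q (∧⁺ (E⁻ h) h)))))
                     (trans (Surface.degree2 d Δ pm f e q) (cong (λ b → pos 2 * ⟦ b ⟧) (sym q)))

-- Identification of `γ` with g₂ computed from face numbers

module _ {n : ℕ} (Δ : Cx n) (⊥-face : Δ ⊥ ≡ true) where

  -- 2 g₂ = 2 f₁ - 2 d f₀ + d (d + 1)
  twice-g₂ : ∀ d → pos 2 * gNum (suc d) Δ 2 ≡ ring-φ (pos (suc d)) (pos 2 * pos (fS Δ 2)) (pos (fS Δ 1))
  twice-g₂ d = trans (cong (pos 2 *_) (cong₂ _-_ h₂ h₁)) (trans (l₁ (pos (suc d choose 2)) (pos d) (pos (fS Δ 1)) (pos (fS Δ 2)))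
      (trans (cong (_+ (pos 2 * (1ℤ + pos d) - pos 2 * (1ℤ + pos d) * pos (fS Δ 1) + pos 2 * pos (fS Δ 2))) (choose2 (suc d))) (l₂ (pos d) (pos (fS Δ 1)) (pos (fS Δ 2)))))
    where
    nC0 : ∀ m → m choose 0 ≡ 1
    nC0 m = trans (nCk≡nC[n∸k] {0} {m} z≤n) (nCn≡1 m)
    h₂ : hNum (suc d) Δ 2 ≡ 1ℤ * pos (suc d choose 2) * 1ℤ + (- 1ℤ) * pos d * pos (fS Δ 1) + 1ℤ * 1ℤ * pos (fS Δ 2)
    h₂ = cong₂ _+_ (cong₂ _+_ (cong (λ z → 1ℤ * pos (suc d choose 2) * pos z) (fS-0 Δ ⊥-face)) (cong (λ z → (- 1ℤ) * pos z * pos (fS Δ 1)) (nC1≡n d)))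
                   (cong (λ z → 1ℤ * pos z * pos (fS Δ 2)) (nC0 (d ∸ 1)))
    h₁ : hNum (suc d) Δ 1 ≡ (- 1ℤ) * pos (suc d) * 1ℤ + 1ℤ * 1ℤ * pos (fS Δ 1)
    h₁ = cong₂ _+_ (cong₂ (λ y z → (- 1ℤ) * pos y * pos z) (nC1≡n (suc d)) (fS-0 Δ ⊥-face)) (cong (λ z → 1ℤ * pos z * pos (fS Δ 1)) (nC0 d))
    l₁ : ∀ c d f₁ f₂ → pos 2 * (1ℤ * c * 1ℤ + (- 1ℤ) * d * f₁ + 1ℤ * 1ℤ * f₂ - ((- 1ℤ) * (1ℤ + d) * 1ℤ + 1ℤ * 1ℤ * f₁))
        ≡ pos 2 * c + (pos 2 * (1ℤ + d) - pos 2 * (1ℤ + d) * f₁ + pos 2 * f₂)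
    l₁ = solve-∀
    l₂ : ∀ d f₁ f₂ → (1ℤ + d) * (1ℤ + d - 1ℤ) + (pos 2 * (1ℤ + d) - pos 2 * (1ℤ + d) * f₁ + pos 2 * f₂)
        ≡ pos 2 * f₂ - pos 2 * (1ℤ + d) * f₁ + (1ℤ + d) * (1ℤ + d + 1ℤ)
    l₂ = solve-∀

module _ {n : ℕ} {d : ℕ} {Δ : Cx n} (pm : NormalPM (suc d) Δ) where

  open Bounds (suc d) Δ pm

  γ-g₂ : γ ⊥ (suc d) ≡ pos 2 * gNum (suc d) Δ 2
  γ-g₂ = trans (φ-def (E ⊥) (suc d) (N ⊥)) (trans (cong₂ (ring-φ (pos (suc d))) edges vertices) (sym (twice-g₂ Δ ⊥-face d)))
    where
    vertex : ∀ v → N ⊥ v ≡ Δ ⁅ v ⁆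
    vertex v = bool-ext (λ q → subst Face (∪-identityˡ ⁅ v ⁆) (NF q)) (λ q → N⁺ ∉⊥ (subst Face (sym (∪-identityˡ ⁅ v ⁆)) q))
    vertices : ♯ (N ⊥) ≡ pos (fS Δ 1)
    vertices = trans (♯-cong vertex) (sym (fS-1 Δ))
    edges : Q (E ⊥) (N ⊥) ≡ pos 2 * pos (fS Δ 2)
    edges = trans (∑-cong (λ u → ∑-cong (λ v → cong ⟦_⟧ (bool-ext (to u v) (from u v))))) (sym (fS-2 Δ))
      where
      to : ∀ u v → (N ⊥ u ∧ N ⊥ v ∧ E ⊥ u v) ≡ true → (not (lookup ⁅ u ⁆ v) ∧ Δ (⁅ u ⁆ ▸ v)) ≡ true
      to u v q = trans (sym (N-def ⁅ u ⁆ v)) (subst (λ σ → N σ v ≡ true) (∪-identityˡ ⁅ u ⁆) (E₂ (∧ʳ (N ⊥ v) (∧ʳ (N ⊥ u) q))))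
      from : ∀ u v → (not (lookup ⁅ u ⁆ v) ∧ Δ (⁅ u ⁆ ▸ v)) ≡ true → (N ⊥ u ∧ N ⊥ v ∧ E ⊥ u v) ≡ true
      from u v q = ∧⁺ Nu (∧⁺ (E⁻ Euv) Euv)
        where
        Nuv : N (⊥ ▸ u) v ≡ true
        Nuv = subst (λ σ → N σ v ≡ true) (sym (∪-identityˡ ⁅ u ⁆)) (trans (N-def ⁅ u ⁆ v) q)
        Nu : N ⊥ u ≡ true
        Nu = N⁺ ∉⊥ (down (λ i → ∈▸ˡ i) (NF Nuv))
        Euv : E ⊥ u v ≡ true
        Euv = E⁺ Nu ∉⊥ (λ { refl → N∉ Nuv (∈▸ʳ {σ = ⊥}) }) (NF Nuv)

-- Minimal non-faces

module Join {n : ℕ} (d : ℕ) (Δ : Cx n) (pm : NormalPM d Δ) {σ : Subset n} {z₀ : Fin n} (z₀∈ : z₀ ∈ σ) (gap : Δ σ ≡ false)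
  (root : PM.Face d Δ pm (σ ∖ z₀)) (0<d : 1 ≤ d)
  (exchange : ∀ {z y π} → z ∈ σ → y ∈ σ → Disjoint σ π → PM.Face d Δ pm ((σ ∖ z) ∪ π) → PM.Face d Δ pm ((σ ∖ y) ∪ π)) where

  open PM d Δ pm

  rest : Subset n → Subset n
  rest ρ = ρ ∩ ∁ σ

  rest⊆ : ∀ {ρ} → rest ρ ⊆ ρ
  rest⊆ {ρ} i = proj₁ (x∈p∩q⁻ ρ (∁ σ) i)

  rest-disjoint : ∀ {ρ} → Disjoint σ (rest ρ)
  rest-disjoint {ρ} i j = x∈∁p⇒x∉p (proj₂ (x∈p∩q⁻ ρ (∁ σ) j)) i

  ∈rest : ∀ {ρ x} → x ∈ ρ → x ∉ σ → x ∈ rest ρ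
  ∈rest i j = x∈p∩q⁺ (i , x∉p⇒x∈∁p j)

  split⊆ : ∀ {ρ z} → z ∉ ρ → ρ ⊆ (σ ∖ z) ∪ rest ρ
  split⊆ {ρ} {z} nz {x} i with x ∈? σ
  ... | yes j = ∈∪ˡ (∈∖⁺ j (λ { refl → nz i }))
  ... | no j = ∈∪ʳ {σ = σ ∖ z} (∈rest i j)

  Deficient : Subset n → Set
  Deficient F = ∃ λ z → z ∈ σ × σ ∖ z ⊆ F

  -- The property passes over ridges. If crossing `R` loses the vertex `x` of `σ ∖ z`, then
  -- `exchange` makes `R ▸ z` a face, so `x` and `z` are the only two neighbours of `R`, and
  -- crossing either changes nothing or leads to a facet above `σ ∖ x`.
  deficient : ∀ {F} → Face F → ∣ F ∣ ≡ d → Deficient F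
  deficient {F} fF eF with pure root
  ... | G , sG , fG , eG = strongly-connected d {⊥} Deficient ⊥-face (trans (cong (d +ℕ_) (∣⊥∣≡0 n)) (ℕP.+-identityʳ d)) cross
          (λ i → ⊥-elim (∉⊥ i)) fG eG (λ i → ⊥-elim (∉⊥ i)) fF eF (z₀ , z₀∈ , sG)
    where
    cross : Closed ⊥ Deficient
    cross {R} {x} {y} _ fR eR Nx Ny (z , iz , s) with x ∈? σ ∖ z | y ≟F x | y ≟F z
    ... | no nx | _ | _ = z , iz , λ i → ∈▸ˡ (stay i)
      where
      stay : σ ∖ z ⊆ R
      stay i with ∈▸⁻ (s i)
      ... | inj₁ j = j
      ... | inj₂ refl = ⊥-elim (nx i)
    ... | yes ix | yes refl | _ = z , iz , s
    ... | yes ix | no _ | yes refl = x , ∖⊆ ix , move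
      where
      move : σ ∖ x ⊆ R ▸ y
      move {u} i with u ≟F y
      ... | yes refl = ∈▸ʳ {σ = R}
      ... | no ne with ∈▸⁻ (s (∈∖⁺ (∖⊆ {σ = σ} i) ne))
      ...   | inj₁ j = ∈▸ˡ j
      ...   | inj₂ eq = ⊥-elim (proj₂ (∈∖⁻ {σ = σ} i) eq)
    ... | yes ix | no y≢x | no y≢z = ⊥-elim (three (ℤP.≤-trans (ℤP.≤-reflexive (sym (cong₂ _+_ (cong ⟦_⟧ Nx) (cong₂ _+_ (cong ⟦_⟧ Ny) (cong ⟦_⟧ Nz)))))
            (∑-≥₃ {f = λ v → ⟦ N R v ⟧} (λ v → 0≤⟦⟧ (N R v)) {x} {y} {z} (λ q → y≢x (sym q)) (λ q → proj₂ (∈∖⁻ {σ = σ} ix) q) y≢z)) (ridge fR eR))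
      where
      three : ∀ {a} → pos 3 ≤ℤ a → a ≡ pos 2 → Empty
      three h refl with h
      ... | +≤+ (s≤s (s≤s ()))
      z∉ : z ∉ R ▸ x
      z∉ i = contra (down whole (NF Nx)) gap
        where
        whole : σ ⊆ R ▸ x
        whole {u} j with u ≟F z
        ... | yes refl = i
        ... | no ne = s (∈∖⁺ j ne)
      Nz : N R z ≡ true
      Nz = N⁺ (λ i → z∉ (∈▸ˡ i)) (down cover (exchange iz (∖⊆ ix) rest-disjoint (down (∪-⊆ s rest⊆) (NF Nx))))
        where
        cover : R ▸ z ⊆ (σ ∖ x) ∪ rest (R ▸ x)
        cover {u} i with u ∈? σ
        ... | yes j = ∈∪ˡ (∈∖⁺ j (bad (∈▸⁻ i)))
          where
          bad : (u ∈ R) ⊎ (u ≡ z) → u ≢ x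
          bad (inj₁ k) eq = N∉ Nx (subst (_∈ R) eq k)
          bad (inj₂ q) eq = proj₂ (∈∖⁻ {σ = σ} ix) (trans (sym eq) q)
        ... | no j with ∈▸⁻ i
        ...   | inj₁ k = ∈∪ʳ {σ = σ ∖ x} (∈rest (∈▸ˡ k) j)
        ...   | inj₂ refl = ⊥-elim (j iz)

  face⁻ : ∀ {ρ} → Face ρ → Σ[ z ∈ Fin n ] (z ∈ σ × z ∉ ρ × Face ((σ ∖ z₀) ∪ rest ρ))
  face⁻ {ρ} f with pure f
  ... | F , s , fF , eF with deficient fF eF
  ...   | z , iz , sz = z , iz , (λ i → contra (down (whole i) fF) gap) , exchange iz z₀∈ rest-disjoint (down (∪-⊆ sz (λ i → s (rest⊆ i))) fF)
    where
    whole : z ∈ ρ → σ ⊆ F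
    whole i {u} j with u ≟F z
    ... | yes refl = s i
    ... | no ne = sz (∈∖⁺ j ne)

  face⁺ : ∀ {ρ z} → z ∈ σ → z ∉ ρ → Face ((σ ∖ z₀) ∪ rest ρ) → Face ρ
  face⁺ iz nz f = down (split⊆ nz) (exchange z₀∈ iz rest-disjoint f)

module Minimal {n : ℕ} (d : ℕ) (Δ : Cx n) (pm : NormalPM d Δ) (prime : Prime d Δ) (γ⊥≤2 : Rigidity.γ d Δ pm ⊥ d ≤ℤ pos 2) where

  open Bounds d Δ pm

  -- The case of `u` equal to `v` is included, so the elements of a clique are vertices.
  Clique : Subset n → Set
  Clique ν = ∀ {u v} → u ∈ ν → v ∈ ν → Face (⁅ u ⁆ ∪ ⁅ v ⁆)

  pair⊆ : ∀ {u v} {ρ : Subset n} → u ∈ ρ → v ∈ ρ → ⁅ u ⁆ ∪ ⁅ v ⁆ ⊆ ρ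
  pair⊆ {u} {v} a b = ∪-⊆ (λ i → subst (_∈ _) (sym (x∈⁅y⁆⇒x≡y u i)) a) (λ i → subst (_∈ _) (sym (x∈⁅y⁆⇒x≡y v i)) b)

  face-clique : ∀ {ν} → Face ν → Clique ν
  face-clique f a b = down (pair⊆ a b) f

  swap-pair : ∀ {u v} → Face (⁅ u ⁆ ∪ ⁅ v ⁆) → Face (⁅ v ⁆ ∪ ⁅ u ⁆)
  swap-pair {u} {v} = subst Face (∪-comm ⁅ u ⁆ ⁅ v ⁆)

  clique-∪ : ∀ {ν μ} → Clique ν → Clique μ → (∀ {u v} → u ∈ ν → v ∈ μ → Face (⁅ u ⁆ ∪ ⁅ v ⁆)) → Clique (ν ∪ μ)
  clique-∪ {ν} {μ} a b c i j with x∈p∪q⁻ ν μ i | x∈p∪q⁻ ν μ j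
  ... | inj₁ p | inj₁ q = a p q
  ... | inj₁ p | inj₂ q = c p q
  ... | inj₂ p | inj₁ q = swap-pair (c q p)
  ... | inj₂ p | inj₂ q = b p q

  γ≤2 : ∀ p {τ} → Face τ → 3 +ℕ p +ℕ ∣ τ ∣ ≡ d → γ τ (3 +ℕ p) ≤ℤ pos 2
  γ≤2 p {τ} f e = ℤP.≤-trans (γ-mono ∣ τ ∣ p {⊥} {τ} f (λ i → ⊥-elim (∉⊥ i)) (trans (cong (∣ τ ∣ +ℕ_) (∣⊥∣≡0 n)) (ℕP.+-identityʳ _)) e)
     (subst (λ z → γ ⊥ z ≤ℤ pos 2) (trans (sym e) (cong (3 +ℕ_) (ℕP.+-comm p ∣ τ ∣))) γ⊥≤2)

  -- Links of the facets of ∂σ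

  module Core {σ : Subset n} {s r : ℕ} (size : ∣ σ ∣ ≡ 3 +ℕ s) (dims : 4 +ℕ r +ℕ s ≡ d) (cl : Clique σ) (gap : Δ σ ≡ false)
    (min : ∀ {ν} → Clique ν → ∣ ν ∣ ≤ 2 +ℕ s → Face ν) where

    proper : ∀ {π w} → π ⊆ σ → w ∈ σ → w ∉ π → Face π
    proper {π} {w} sub iw nw = down (λ {x} i → ∈∖⁺ (sub i) (λ { refl → nw i })) (min (λ a b → cl (∖⊆ a) (∖⊆ b)) (ℕP.≤-reflexive (∣∖∣-suc iw size)))

    whole : ∀ {π} → σ ⊆ π → Δ π ≡ false
    whole s = ≢true (λ f → contra (down s f) gap)

    -- With the other `s` vertices of `σ` fixed as `ρ`, the three remaining ones form a missing
    -- triangle in the link of `ρ`. The link of `σ ∖ z` has facets with `2 +ℕ r` vertices.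
    record Triple (x y z : Fin n) : Set where
      field
        ix : x ∈ σ
        iy : y ∈ σ
        iz : z ∈ σ
        xy : x ≢ y
        xz : x ≢ z
        yz : y ≢ z
      ρ : Subset n
      ρ = σ ∖ z ∖ y ∖ x
      ρ⊆ : ρ ⊆ σ
      ρ⊆ i = ∖⊆ (∖⊆ {σ = σ ∖ z} (∖⊆ {σ = σ ∖ z ∖ y} i))
      x∉ : x ∉ ρ
      x∉ i = proj₂ (∈∖⁻ {σ = σ ∖ z ∖ y} i) refl
      y∉ : y ∉ ρ
      y∉ i = proj₂ (∈∖⁻ {σ = σ ∖ z} (∖⊆ {σ = σ ∖ z ∖ y} i)) refl
      z∉ : z ∉ ρ
      z∉ i = proj₂ (∈∖⁻ {σ = σ} (∖⊆ {σ = σ ∖ z} (∖⊆ {σ = σ ∖ z ∖ y} i))) refl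
      iy′ : y ∈ σ ∖ z
      iy′ = ∈∖⁺ iy yz
      ix′ : x ∈ σ ∖ z ∖ y
      ix′ = ∈∖⁺ (∈∖⁺ ix xz) xy
      size-ρ : ∣ ρ ∣ ≡ s
      size-ρ = ∣∖∣-suc ix′ (∣∖∣-suc iy′ (∣∖∣-suc iz size))
      cover : ∀ {u} → u ∈ σ → (u ≡ x) ⊎ (u ≡ y) ⊎ (u ≡ z) ⊎ (u ∈ ρ)
      cover {u} i with u ≟F x | u ≟F y | u ≟F z
      ... | yes p | _ | _ = inj₁ p
      ... | no _ | yes p | _ = inj₂ (inj₁ p)
      ... | no _ | no _ | yes p = inj₂ (inj₂ (inj₁ p))
      ... | no p | no q | no t = inj₂ (inj₂ (inj₂ (∈∖⁺ (∈∖⁺ (∈∖⁺ i t) q) p)))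
      fρ : Face ρ
      fρ = proper ρ⊆ ix x∉
      Nx : N ρ x ≡ true
      Nx = N⁺ x∉ (proper (▸-⊆ ρ⊆ ix) iy (∉▸ y∉ (λ q → xy (sym q))))
      hole : Hole ρ x y z
      hole = record
        { va = N⁺ (∉▸ y∉ (λ q → xy (sym q))) (proper (▸-⊆ (▸-⊆ ρ⊆ ix) iy) iz (∉▸ (∉▸ z∉ (λ q → xz (sym q))) (λ q → yz (sym q))))
        ; vb = N⁺ (∉▸ z∉ (λ q → xz (sym q))) (proper (▸-⊆ (▸-⊆ ρ⊆ ix) iz) iy (∉▸ (∉▸ y∉ (λ q → xy (sym q))) yz))
        ; ab = E⁺ (N⁺ y∉ (proper (▸-⊆ ρ⊆ iy) ix (∉▸ x∉ xy))) z∉ (λ q → yz (sym q)) (proper (▸-⊆ (▸-⊆ ρ⊆ iy) iz) ix (∉▸ (∉▸ x∉ xy) xz))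
        ; gap = whole full }
        where
        full : σ ⊆ ρ ▸ x ▸ y ▸ z
        full i with cover i
        ... | inj₁ refl = ∈▸ˡ (∈▸ˡ (∈▸ʳ {σ = ρ}))
        ... | inj₂ (inj₁ refl) = ∈▸ˡ (∈▸ʳ {σ = ρ ▸ x})
        ... | inj₂ (inj₂ (inj₁ refl)) = ∈▸ʳ {σ = ρ ▸ x ▸ y}
        ... | inj₂ (inj₂ (inj₂ j)) = ∈▸ˡ (∈▸ˡ (∈▸ˡ j))

    pick-x : ∀ {y z} → y ∈ σ → z ∈ σ → y ≢ z → ∃ λ x → Triple x y z
    pick-x {y} {z} iy iz ne with inhabited (∣∖∣-suc (∈∖⁺ iy ne) (∣∖∣-suc iz size))
    ... | x , i = x , record { ix = ∖⊆ (∖⊆ {σ = σ ∖ z} i) ; iy = iy ; iz = iz ; xy = proj₂ (∈∖⁻ {σ = σ ∖ z} i) ; xz = proj₂ (∈∖⁻ {σ = σ} (∖⊆ {σ = σ ∖ z} i)) ; yz = ne }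

    -- The set `σ ∖ z ∖ y` is `ρ ▸ x`, and `x` carries a missing triangle in the link of `ρ`.
    flat : ∀ {y z} → y ∈ σ → z ∈ σ → y ≢ z → γ (σ ∖ z ∖ y) (3 +ℕ r) ≤ℤ 0ℤ
    flat iy iz ne with pick-x iy iz ne
    ... | x , T = subst (λ τ → γ τ (3 +ℕ r) ≤ℤ 0ℤ) (∖▸ ix′) (hole-flat (suc r) fρ e Nx (γ≤2 (suc r) fρ e) hole)
      where
      open Triple T
      e : 4 +ℕ r +ℕ ∣ ρ ∣ ≡ d
      e = trans (cong (4 +ℕ r +ℕ_) size-ρ) dims

    join-clique : ∀ {z ν} → z ∈ σ → Clique ν → (∀ {a} → a ∈ ν → N (σ ∖ z) a ≡ true) → Clique ((σ ∖ z) ∪ ν)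
    join-clique {z} iz cν nb = clique-∪ (λ a b → cl (∖⊆ a) (∖⊆ b)) cν (λ i j → down (pair⊆ (∈▸ˡ i) (∈▸ʳ {σ = σ ∖ z})) (NF (nb j)))

    outside : ∀ {z a} → z ∈ σ → N (σ ∖ z) a ≡ true → a ∉ σ
    outside {z} {a} iz Na i with a ≟F z
    ... | yes refl = contra (NF Na) (whole (λ {u} j → subst (u ∈_) (sym (∖▸ i)) j))
    ... | no ne = N∉ Na (∈∖⁺ i ne)

    two-cover : ∀ {n} {ν : Subset n} {a b} → ∣ ν ∖ a ∖ b ∣ ≡ 0 → ∀ {u} → u ∈ ν → (u ≡ a) ⊎ (u ≡ b)
    two-cover {n} {ν} {a} {b} e {u} i with u ≟F a | u ≟F b
    ... | yes p | _ = inj₁ p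
    ... | no _ | yes p = inj₂ p
    ... | no p | no q = ⊥-elim (∉⊥ (subst (u ∈_) (∣∣-0 e) (∈∖⁺ (∈∖⁺ i p) q)))

    -- Two missing triangles at one vertex contradict g₂ ≤ 1.
    no-short-chord : ∀ {z t a b} → z ∈ σ → t ∈ σ ∖ z → N (σ ∖ z) a ≡ true → N (σ ∖ z) b ≡ true → b ≢ a → Face (⁅ a ⁆ ∪ ⁅ b ⁆)
      → Δ ((σ ∖ z ∖ t) ▸ a ▸ b) ≡ false → Empty
    no-short-chord {z} {t} {a} {b} iz it Na Nb b≢a fab gp with pick-x (∖⊆ it) iz (proj₂ (∈∖⁻ it))
    -- The edges `t z` and `a b` both complete missing triangles at `w`; they are disjoint because
    -- `a` and `b` lie outside `σ`.
    ... | w , T = crowded r fρ e Nx (γ≤2 (suc r) fρ e) (miss≥4′ hole hole′ (λ q → a∉σ (subst (_∈ σ) q iy)) (λ q → b∉σ (subst (_∈ σ) q iy)) (λ q → a∉σ (subst (_∈ σ) q iz)) (λ q → b∉σ (subst (_∈ σ) q iz)))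
      where
      open Triple T hiding (iz)
      e : 4 +ℕ r +ℕ ∣ ρ ∣ ≡ d
      e = trans (cong (4 +ℕ r +ℕ_) size-ρ) dims
      a∉σ = outside iz Na
      b∉σ = outside iz Nb
      ρw⊆ : ρ ▸ w ⊆ σ ∖ z
      ρw⊆ i = ∖⊆ (subst (_ ∈_) (∖▸ ix′) i)
      ∉ρ : ∀ {c} → c ∉ σ → c ∉ ρ
      ∉ρ h i = h (ρ⊆ i)
      hole′ : Hole ρ w a b
      hole′ = record
        { va = N-mono {ρ ▸ w} ρw⊆ Na
        ; vb = N-mono {ρ ▸ w} ρw⊆ Nb
        ; ab = E⁺ (N-sub (N-mono {ρ ▸ w} ρw⊆ Na)) (∉ρ b∉σ) b≢a (min clq (ℕP.≤-reflexive (trans (∣▸∣ (∉▸ (∉ρ b∉σ) b≢a)) (cong suc (trans (∣▸∣ (∉ρ a∉σ)) (cong suc size-ρ))))))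
        ; gap = trans (cong (λ τ → Δ (τ ▸ a ▸ b)) (∖▸ ix′)) gp }
        where
        clq : Clique (ρ ▸ a ▸ b)
        clq = clique-∪ (clique-∪ (λ i j → cl (ρ⊆ i) (ρ⊆ j)) (point fab) (λ i j → toward Na i j))
               (point (swap-pair fab)) (λ i j → both i j)
          where
          point : ∀ {u v} → Face (⁅ u ⁆ ∪ ⁅ v ⁆) → Clique ⁅ u ⁆
          point f = face-clique (down (λ k → ∈∪ˡ k) f)
          toward : ∀ {c u v} → N (σ ∖ z) c ≡ true → u ∈ ρ → v ∈ ⁅ c ⁆ → Face (⁅ u ⁆ ∪ ⁅ v ⁆)
          toward {c} {u} Nc i j = subst (λ q → Face (⁅ u ⁆ ∪ ⁅ q ⁆)) (sym (x∈⁅y⁆⇒x≡y c j)) (down (pair⊆ (∈▸ˡ (ρw⊆ (∈▸ˡ i))) (∈▸ʳ {σ = σ ∖ z})) (NF Nc))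
          both : ∀ {u v} → u ∈ ρ ▸ a → v ∈ ⁅ b ⁆ → Face (⁅ u ⁆ ∪ ⁅ v ⁆)
          both i j with ∈▸⁻ i
          ... | inj₁ k = toward Nb k j
          ... | inj₂ refl = subst (λ q → Face (⁅ a ⁆ ∪ ⁅ q ⁆)) (sym (x∈⁅y⁆⇒x≡y b j)) fab

    -- If `ν` stays missing after some `t` is dropped from `σ ∖ z`, this contradicts `flat`, or
    -- `no-short-chord` when `ν` is an edge. Otherwise `(σ ∖ z) ∪ ν` is a missing face. With `d`
    -- vertices it contradicts primeness; with fewer, moving one vertex of `σ ∖ z` over to `ν` gives
    -- a missing face in a link where `γ` is at most 0.
    no-chord : ∀ j {z ν} → z ∈ σ → ∣ ν ∣ ≡ 2 +ℕ j → j ≤ r → Clique ν → (∀ {a} → a ∈ ν → N (σ ∖ z) a ≡ true)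
      → (∀ {x} → x ∈ ν → Face ((σ ∖ z) ∪ (ν ∖ x))) → Δ ((σ ∖ z) ∪ ν) ≡ false → Empty
    no-chord j {z} {ν} iz sz le cν nb faces gp = cases j sz le (find (λ t → lookup (σ ∖ z) t ∧ not (Δ ((σ ∖ z ∖ t) ∪ ν))))
      where
      Broken : Fin n → Bool
      Broken t = lookup (σ ∖ z) t ∧ not (Δ ((σ ∖ z ∖ t) ∪ ν))
      size-t : ∀ {t} → t ∈ σ ∖ z → ∣ σ ∖ z ∖ t ∣ ≡ 1 +ℕ s
      size-t it = ∣∖∣-suc it (∣∖∣-suc iz size)
      dis : ∀ {ρ} → ρ ⊆ σ → Disjoint ρ ν
      dis h i k = outside iz (nb k) (h i)
      sum₁ : ∀ i {ρ : Subset n} → suc i ≤ r → ∣ ρ ∣ ≡ 1 +ℕ s → 4 +ℕ (r ∸ suc i) +ℕ (i +ℕ ∣ ρ ∣) ≡ d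
      sum₁ i h e = trans (cong (λ q → 4 +ℕ (r ∸ suc i) +ℕ (i +ℕ q)) e) (trans (lem i (r ∸ suc i) s) (trans (cong (λ q → 4 +ℕ q +ℕ s) (ℕP.m+[n∸m]≡n h)) dims))
        where
        lem : ∀ i p s → 4 +ℕ p +ℕ (i +ℕ (1 +ℕ s)) ≡ 4 +ℕ (suc i +ℕ p) +ℕ s
        lem = ℕ-solve-∀
      flat₁ : ∀ i {t} → suc i ≤ r → t ∈ σ ∖ z → γ (σ ∖ z ∖ t) (4 +ℕ (i +ℕ (r ∸ suc i))) ≤ℤ 0ℤ
      flat₁ i {t} h it = subst (λ q → γ (σ ∖ z ∖ t) (3 +ℕ q) ≤ℤ 0ℤ) (sym (ℕP.m+[n∸m]≡n h)) (flat (∖⊆ it) iz (proj₂ (∈∖⁻ it)))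
      cases : ∀ j → ∣ ν ∣ ≡ 2 +ℕ j → j ≤ r → (∃ λ t → Broken t ≡ true) ⊎ (∀ t → Broken t ≡ false) → Empty
      cases zero sz le (inj₁ (t , q)) = pairs (inhabited sz)
        where
        it : t ∈ σ ∖ z
        it = mem⁻ (∧ˡ (lookup (σ ∖ z) t) q)
        pairs : (∃ λ a → a ∈ ν) → Empty
        pairs (a , ia) with inhabited (∣∖∣-suc ia sz)
        ... | b , ib = no-short-chord iz it (nb ia) (nb (∖⊆ ib)) (proj₂ (∈∖⁻ ib)) (cν ia (∖⊆ ib))
              (≢true (λ f → contra (down cover f) (bnot (∧ʳ (lookup (σ ∖ z) t) q))))
          where
          cover : (σ ∖ z ∖ t) ∪ ν ⊆ (σ ∖ z ∖ t) ▸ a ▸ b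
          cover = ∪-⊆ (λ i → ∈▸ˡ (∈▸ˡ i)) sub
            where
            sub : ν ⊆ (σ ∖ z ∖ t) ▸ a ▸ b
            sub i with two-cover (∣∖∣-suc ib (∣∖∣-suc ia sz)) i
            ... | inj₁ refl = ∈▸ˡ (∈▸ʳ {σ = σ ∖ z ∖ t})
            ... | inj₂ refl = ∈▸ʳ {σ = (σ ∖ z ∖ t) ▸ a}
      cases (suc i) sz le (inj₁ (t , q)) = flat-no-missing (r ∸ suc i) i {σ ∖ z ∖ t} {ν} (sum₁ i {σ ∖ z ∖ t} le (size-t it)) (flat₁ i le it) sz
          (dis (λ k → ∖⊆ (∖⊆ {σ = σ ∖ z} k))) (λ ix → down (∪-mono ∖⊆ (λ k → k)) (faces ix)) (bnot (∧ʳ (lookup (σ ∖ z) t) q))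
        where
        it : t ∈ σ ∖ z
        it = mem⁻ (∧ˡ (lookup (σ ∖ z) t) q)
      cases j sz le (inj₂ none) = top (ℕP.m≤n⇒m<n∨m≡n le)
        where
        facet : ∀ {t} → t ∈ σ ∖ z → Face ((σ ∖ z ∖ t) ∪ ν)
        facet {t} it with bcase (Δ ((σ ∖ z ∖ t) ∪ ν))
        ... | inj₁ f = f
        ... | inj₂ f = contra (∧⁺ (mem it) (cong not f)) (none t)
        top : (j < r) ⊎ (j ≡ r) → Empty
        top (inj₂ e) = prime ((σ ∖ z) ∪ ν , ((λ v i → down (λ k → ∈∪ˡ k) (join-clique iz cν nb i i)) , gp , below)
                    , trans (∣∪∣ (dis ∖⊆)) (trans (cong₂ _+ℕ_ (∣∖∣-suc iz size) (trans sz (cong (2 +ℕ_) e))) (trans (lem s r) dims)))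
          where
          lem : ∀ s r → 2 +ℕ s +ℕ (2 +ℕ r) ≡ 4 +ℕ r +ℕ s
          lem = ℕ-solve-∀
          below : ∀ τ → τ ⊂ (σ ∖ z) ∪ ν → Face τ
          below τ (sub , w , iw , nw) with x∈p∪q⁻ (σ ∖ z) ν iw
          ... | inj₁ k = down (λ {u} i → part u (sub i) (λ { refl → nw i })) (facet k)
            where
            part : ∀ u → u ∈ (σ ∖ z) ∪ ν → u ≢ w → u ∈ (σ ∖ z ∖ w) ∪ ν
            part u i ne with x∈p∪q⁻ (σ ∖ z) ν i
            ... | inj₁ h = ∈∪ˡ (∈∖⁺ h ne)
            ... | inj₂ h = ∈∪ʳ {σ = σ ∖ z ∖ w} h
          ... | inj₂ k = down (λ {u} i → part u (sub i) (λ { refl → nw i })) (faces k)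
            where
            part : ∀ u → u ∈ (σ ∖ z) ∪ ν → u ≢ w → u ∈ (σ ∖ z) ∪ (ν ∖ w)
            part u i ne with x∈p∪q⁻ (σ ∖ z) ν i
            ... | inj₁ h = ∈∪ˡ h
            ... | inj₂ h = ∈∪ʳ {σ = σ ∖ z} (∈∖⁺ h ne)
        top (inj₁ lt) with inhabited (∣∖∣-suc iz size)
        ... | x , ix = flat-no-missing (r ∸ suc j) j {σ ∖ z ∖ x} {ν ▸ x} (sum₁ j {σ ∖ z ∖ x} lt (size-t ix)) (flat₁ j lt ix) (trans (∣▸∣ x∉ν) (cong suc sz))
              disx facesx (≢true (λ f → contra (down all f) gp))
          where
          x∉ν : x ∉ ν
          x∉ν i = outside iz (nb i) (∖⊆ ix)
          disx : Disjoint (σ ∖ z ∖ x) (ν ▸ x)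
          disx i k with ∈▸⁻ k
          ... | inj₁ h = dis (λ k → ∖⊆ (∖⊆ {σ = σ ∖ z} k)) i h
          ... | inj₂ refl = proj₂ (∈∖⁻ {σ = σ ∖ z} i) refl
          all : (σ ∖ z) ∪ ν ⊆ (σ ∖ z ∖ x) ∪ (ν ▸ x)
          all {u} i with x∈p∪q⁻ (σ ∖ z) ν i | u ≟F x
          ... | inj₂ h | _ = ∈∪ʳ {σ = σ ∖ z ∖ x} (∈▸ˡ h)
          ... | inj₁ h | yes refl = ∈∪ʳ {σ = σ ∖ z ∖ x} (∈▸ʳ {σ = ν})
          ... | inj₁ h | no ne = ∈∪ˡ (∈∖⁺ h ne)
          facesx : ∀ {y} → y ∈ ν ▸ x → Face ((σ ∖ z ∖ x) ∪ ((ν ▸ x) ∖ y))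
          facesx {y} iy with ∈▸⁻ iy
          ... | inj₂ refl = down (∪-mono (λ k → k) sub) (facet ix)
            where
            sub : (ν ▸ x) ∖ x ⊆ ν
            sub k with ∈▸⁻ (∖⊆ {σ = ν ▸ x} k)
            ... | inj₁ h = h
            ... | inj₂ h = ⊥-elim (proj₂ (∈∖⁻ {σ = ν ▸ x} k) h)
          ... | inj₁ h = down (∪-⊆ (λ k → ∈∪ˡ (∖⊆ k)) sub) (faces h)
            where
            sub : (ν ▸ x) ∖ y ⊆ (σ ∖ z) ∪ (ν ∖ y)
            sub k with ∈▸⁻ (∖⊆ {σ = ν ▸ x} k)
            ... | inj₁ h = ∈∪ʳ {σ = σ ∖ z} (∈∖⁺ h (proj₂ (∈∖⁻ {σ = ν ▸ x} k)))
            ... | inj₂ refl = ∈∪ˡ ix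

    -- Induction on the size, with `no-chord` excluding a first failure; `2 +ℕ r` is the size of a
    -- facet of this link.
    chord : ∀ j {z ν} → z ∈ σ → ∣ ν ∣ ≡ j → j ≤ 2 +ℕ r → Clique ν → (∀ {a} → a ∈ ν → N (σ ∖ z) a ≡ true) → Face ((σ ∖ z) ∪ ν)
    chord zero {z} {ν} iz e le cν nb = down (∪-⊆ (λ i → i) (λ {u} i → ⊥-elim (∉⊥ (subst (u ∈_) (∣∣-0 e) i)))) (proper (∖⊆ {σ = σ}) iz ∉∖)
    chord (suc zero) {z} {ν} iz e le cν nb with inhabited e
    ... | a , ia = down (∪-⊆ (λ i → ∈▸ˡ i) sub) (NF (nb ia))
      where
      sub : ν ⊆ (σ ∖ z) ▸ a
      sub {u} i with u ≟F a
      ... | yes refl = ∈▸ʳ {σ = σ ∖ z}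
      ... | no ne = ⊥-elim (∉⊥ (subst (u ∈_) (∣∣-0 (∣∖∣-suc ia e)) (∈∖⁺ i ne)))
    chord (suc (suc j)) {z} {ν} iz e le cν nb = decide (bcase (Δ ((σ ∖ z) ∪ ν)))
       (λ {x} ix → chord (suc j) iz (∣∖∣-suc ix e) (ℕP.<⇒≤ le) (λ a b → cν (∖⊆ a) (∖⊆ b)) (λ i → nb (∖⊆ i)))
      where
      decide : (Δ ((σ ∖ z) ∪ ν) ≡ true) ⊎ (Δ ((σ ∖ z) ∪ ν) ≡ false) → (∀ {x} → x ∈ ν → Face ((σ ∖ z) ∪ (ν ∖ x))) → Face ((σ ∖ z) ∪ ν)
      decide (inj₁ f) _ = f
      decide (inj₂ gp) faces = ⊥-elim (no-chord j iz e (ℕP.≤-pred (ℕP.≤-pred le)) cν nb faces gp)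

    -- A common vertex of the links of all facets of ∂σ. The goal is that every vertex of one such
    -- link is of this kind.
    Shared : Fin n → Set
    Shared a = a ∉ σ × (∀ {t} → t ∈ σ → Face ((σ ∖ t) ▸ a))

    shared-nbr : ∀ {a z} → Shared a → z ∈ σ → N (σ ∖ z) a ≡ true
    shared-nbr (na , f) iz = N⁺ (λ i → na (∖⊆ i)) (f iz)

    -- Adjacency to `z` makes `σ ▸ a` a clique, so its subsets with at most `2 +ℕ s` elements are
    -- faces. If `(σ ∖ t) ▸ a` were not a face, `x` would carry the missing triangle with `y` and
    -- `a` besides the one with `y` and `t`.
    shared : ∀ {z a} → z ∈ σ → N (σ ∖ z) a ≡ true → Face (⁅ z ⁆ ∪ ⁅ a ⁆) → Shared a
    shared {z} {a} iz Na fza = a∉ , full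
      where
      a∉ : a ∉ σ
      a∉ = outside iz Na
      clq : Clique (σ ▸ a)
      clq = clique-∪ cl (face-clique (down (λ k → ∈∪ʳ {σ = ⁅ z ⁆} k) fza)) to-a
        where
        to-a : ∀ {u v} → u ∈ σ → v ∈ ⁅ a ⁆ → Face (⁅ u ⁆ ∪ ⁅ v ⁆)
        to-a {u} {v} i j with x∈⁅y⁆⇒x≡y a j | u ≟F z
        ... | refl | yes refl = fza
        ... | refl | no ne = down (pair⊆ (∈▸ˡ (∈∖⁺ i ne)) (∈▸ʳ {σ = σ ∖ z})) (NF Na)
      small : ∀ {μ} → μ ⊆ σ ▸ a → ∣ μ ∣ ≤ 2 +ℕ s → Face μ
      small h le = min (λ i j → clq (h i) (h j)) le
      full : ∀ {t} → t ∈ σ → Face ((σ ∖ t) ▸ a)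
      full {t} it with bcase (Δ ((σ ∖ t) ▸ a)) | inhabited (∣∖∣-suc it size)
      ... | inj₁ f | _ = f
      ... | inj₂ gp | y , iy with pick-x (∖⊆ iy) it (proj₂ (∈∖⁻ iy))
      ...   | x , T = ⊥-elim (crowded r fρ e Nx (γ≤2 (suc r) fρ e) (miss≥4 (flip-hole hole) hole′ (λ q → a∉ (subst (_∈ σ) q it))))
        where
        open Triple T renaming (iy to iy₀)
        e : 4 +ℕ r +ℕ ∣ ρ ∣ ≡ d
        e = trans (cong (4 +ℕ r +ℕ_) size-ρ) dims
        a∉ρ : a ∉ ρ
        a∉ρ i = a∉ (ρ⊆ i)
        ρ⊆a : ρ ⊆ σ ▸ a
        ρ⊆a i = ∈▸ˡ (ρ⊆ i)
        a≢ : ∀ {c} → c ∈ σ → a ≢ c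
        a≢ i q = a∉ (subst (_∈ σ) (sym q) i)
        szx : ∣ ρ ▸ x ▸ a ∣ ≡ 2 +ℕ s
        szx = trans (∣▸∣ (∉▸ a∉ρ (a≢ ix))) (cong suc (trans (∣▸∣ x∉) (cong suc size-ρ)))
        sza : ∣ ρ ▸ a ∣ ≡ 1 +ℕ s
        sza = trans (∣▸∣ a∉ρ) (cong suc size-ρ)
        szy : ∣ ρ ▸ a ▸ y ∣ ≡ 2 +ℕ s
        szy = trans (∣▸∣ (∉▸ y∉ (λ q → a≢ iy₀ (sym q)))) (cong suc sza)
        hole′ : Hole ρ x a y
        hole′ = record
          { va = N⁺ (∉▸ a∉ρ (a≢ ix)) (small (▸-⊆ (▸-⊆ ρ⊆a (∈▸ˡ ix)) (∈▸ʳ {σ = σ})) (ℕP.≤-reflexive szx))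
          ; vb = Hole.va hole
          ; ab = E⁺ (N⁺ a∉ρ (small (▸-⊆ ρ⊆a (∈▸ʳ {σ = σ})) (ℕP.≤-trans (ℕP.≤-reflexive sza) (ℕP.n≤1+n _)))) y∉ (λ q → a≢ iy₀ (sym q))
                   (small (▸-⊆ (▸-⊆ ρ⊆a (∈▸ʳ {σ = σ})) (∈▸ˡ iy₀)) (ℕP.≤-reflexive szy))
          ; gap = ≢true (λ f → contra (down cov f) gp) }
          where
          cov : (σ ∖ t) ▸ a ⊆ ρ ▸ x ▸ a ▸ y
          cov = ▸-⊆ sub (∈▸ˡ (∈▸ʳ {σ = ρ ▸ x}))
            where
            sub : σ ∖ t ⊆ ρ ▸ x ▸ a ▸ y
            sub i with cover (∖⊆ i)
            ... | inj₁ refl = ∈▸ˡ (∈▸ˡ (∈▸ʳ {σ = ρ}))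
            ... | inj₂ (inj₁ refl) = ∈▸ʳ {σ = ρ ▸ x ▸ a}
            ... | inj₂ (inj₂ (inj₁ refl)) = ⊥-elim (proj₂ (∈∖⁻ {σ = σ} i) refl)
            ... | inj₂ (inj₂ (inj₂ j)) = ∈▸ˡ (∈▸ˡ (∈▸ˡ j))

    -- Counting edges in the common part of the stars of x and y in lk τ, where
    -- σ = ρ ∪ {x, y, z} and τ = ρ ∪ α.
    module Count {x y z : Fin n} (T : Triple x y z) {α : Subset n} {q : ℕ} (sz : ∣ α ∣ +ℕ q ≡ r)
      (sh : ∀ {a} → a ∈ α → Shared a) (fα : Face ((σ ∖ z) ∪ α)) where

      open Triple T

      τ : Subset n
      τ = ρ ∪ α

      ∉τ : ∀ {c} → c ∈ σ → c ∉ ρ → c ∉ τ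
      ∉τ ic h = ∉∪ h (λ i → proj₁ (sh i) ic)

      size-τ : 4 +ℕ q +ℕ ∣ τ ∣ ≡ d
      size-τ = trans (cong (4 +ℕ q +ℕ_) (trans (∣∪∣ (λ i j → proj₁ (sh j) (ρ⊆ i))) (cong (_+ℕ ∣ α ∣) size-ρ)))
          (trans (lem q s ∣ α ∣) (trans (cong (λ w → 4 +ℕ w +ℕ s) sz) dims))
        where
        lem : ∀ q s a → 4 +ℕ q +ℕ (s +ℕ a) ≡ 4 +ℕ (a +ℕ q) +ℕ s
        lem = ℕ-solve-∀

      α≤ : ∀ {k} → k +ℕ ∣ α ∣ ≤ k +ℕ r
      α≤ {k} = ℕP.+-monoʳ-≤ k (ℕP.≤-trans (ℕP.m≤m+n ∣ α ∣ q) (ℕP.≤-reflexive sz))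

      face-at : ∀ {w} → w ∈ σ → Face ((σ ∖ w) ∪ α)
      face-at {w} iw = chord ∣ α ∣ iw refl (ℕP.≤-trans (ℕP.m≤n+m ∣ α ∣ 2) (α≤ {2})) (face-clique (down (λ k → ∈∪ʳ {σ = σ ∖ z} k) fα)) (λ i → shared-nbr (sh i) iw)

      in-face : ∀ {w} → w ∉ ρ → τ ⊆ (σ ∖ w) ∪ α
      in-face nw = ∪-mono (λ i → ∈∖⁺ (ρ⊆ i) (λ { refl → nw i })) (λ k → k)

      hole-at : ∀ {u v w} → u ∈ σ → v ∈ σ → w ∈ σ → u ∉ ρ → v ∉ ρ → w ∉ ρ → u ≢ v → u ≢ w → v ≢ w → σ ⊆ τ ▸ u ▸ v ▸ w → Hole τ u v w
      hole-at iu iv iw nu nv nw uv uw vw full = record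
        { va = N⁺ (∉▸ (∉τ iv nv) (λ q → uv (sym q))) (down (▸-⊆ (▸-⊆ (in-face nw) (∈∪ˡ (∈∖⁺ iu uw))) (∈∪ˡ (∈∖⁺ iv vw))) (face-at iw))
        ; vb = N⁺ (∉▸ (∉τ iw nw) (λ q → uw (sym q))) (down (▸-⊆ (▸-⊆ (in-face nv) (∈∪ˡ (∈∖⁺ iu uv))) (∈∪ˡ (∈∖⁺ iw (λ q → vw (sym q))))) (face-at iv))
        ; ab = E⁺ (N⁺ (∉τ iv nv) (down (▸-⊆ (in-face nu) (∈∪ˡ (∈∖⁺ iv (λ q → uv (sym q))))) (face-at iu))) (∉τ iw nw) (λ q → vw (sym q))
                 (down (▸-⊆ (▸-⊆ (in-face nu) (∈∪ˡ (∈∖⁺ iv (λ q → uv (sym q))))) (∈∪ˡ (∈∖⁺ iw (λ q → uw (sym q))))) (face-at iu))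
        ; gap = whole full }

      full : σ ⊆ τ ▸ x ▸ y ▸ z
      full i with cover i
      ... | inj₁ refl = ∈▸ˡ (∈▸ˡ (∈▸ʳ {σ = τ}))
      ... | inj₂ (inj₁ refl) = ∈▸ˡ (∈▸ʳ {σ = τ ▸ x})
      ... | inj₂ (inj₂ (inj₁ refl)) = ∈▸ʳ {σ = τ ▸ x ▸ y}
      ... | inj₂ (inj₂ (inj₂ j)) = ∈▸ˡ (∈▸ˡ (∈▸ˡ (∈∪ˡ j)))

      hole-x : Hole τ x y z
      hole-x = hole-at ix iy iz x∉ y∉ z∉ xy xz yz full

      hole-y : Hole τ y x z
      hole-y = hole-at iy ix iz y∉ x∉ z∉ (λ q → xy (sym q)) yz xz (λ {u} i → subst (λ ρ → u ∈ ρ ▸ z) (▸-comm τ x y) (full i))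

      fτ : Face τ
      fτ = down (in-face x∉) (face-at ix)

      N-x : N τ x ≡ true
      N-x = N⁺ (∉τ ix x∉) (down (▸-⊆ (in-face z∉) (∈∪ˡ (∈∖⁺ ix xz))) (face-at iz))

      N-y : N τ y ≡ true
      N-y = N-sub (Hole.va hole-x)

      N-xy : N (τ ▸ x) y ≡ true
      N-xy = Hole.va hole-x

      base≡ : τ ▸ x ▸ y ≡ (σ ∖ z) ∪ α
      base≡ = ⊆-antisym (▸-⊆ (▸-⊆ (in-face z∉) (∈∪ˡ (∈∖⁺ ix xz))) (∈∪ˡ (∈∖⁺ iy yz))) (∪-⊆ sub (λ i → ∈▸ˡ (∈▸ˡ (∈∪ʳ {σ = ρ} i))))
        where
        sub : σ ∖ z ⊆ τ ▸ x ▸ y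
        sub i with ∈▸⁻ (full (∖⊆ i))
        ... | inj₁ j = j
        ... | inj₂ refl = ⊥-elim (proj₂ (∈∖⁻ {σ = σ} i) refl)

      V : Fin n → Bool
      V = N (τ ▸ x ▸ y)

      V-nbr : ∀ {u} → V u ≡ true → N (σ ∖ z) u ≡ true
      V-nbr {u} e = N-mono {σ ∖ z} {τ ▸ x ▸ y} (λ i → subst (_ ∈_) (sym base≡) (∈∪ˡ i)) e

      adjacent : ∀ {u} → V u ≡ true → E τ z u ≡ true → Shared u
      adjacent {u} e h = shared iz (V-nbr e) (down (pair⊆ (∈▸ˡ (∈▸ʳ {σ = τ})) (∈▸ʳ {σ = τ ▸ z})) (E▸ h))

      -- This is `chord` for the clique `α ▸ u ▸ v`, whose size is admissible because `∣ α ∣` is at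
      -- most `r`.
      induced : ∀ u v → V u ≡ true → V v ≡ true → E τ u v ≡ E (τ ▸ x ▸ y) u v
      induced u v a b = bool-ext to (λ e → E-sub (E-sub e))
        where
        nα : ∀ {c} → V c ≡ true → c ∉ α
        nα e i = N∉ e (∈▸ˡ (∈▸ˡ (∈∪ʳ {σ = ρ} i)))
        to : E τ u v ≡ true → E (τ ▸ x ▸ y) u v ≡ true
        to e = E⁺ a (N∉ b) (E≢ e) (down sub (chord (2 +ℕ ∣ α ∣) iz (trans (∣▸∣ (∉▸ (nα b) (E≢ e))) (cong suc (∣▸∣ (nα a)))) (α≤ {2}) clq nbr))
          where
          clq : Clique (α ▸ u ▸ v)
          clq = clique-∪ (face-clique (down (▸-mono (λ i → ∈▸ˡ (∈▸ˡ (∈∪ʳ {σ = ρ} i)))) (NF a))) (face-clique (down (λ k → ∈∪ʳ {σ = τ ▸ x ▸ y} k) (NF b))) edge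
            where
            edge : ∀ {c c′} → c ∈ α ▸ u → c′ ∈ ⁅ v ⁆ → Face (⁅ c ⁆ ∪ ⁅ c′ ⁆)
            edge {c} {c′} i j with x∈⁅y⁆⇒x≡y v j | ∈▸⁻ i
            ... | refl | inj₁ k = down (pair⊆ (∈▸ˡ (∈▸ˡ (∈▸ˡ (∈∪ʳ {σ = ρ} k)))) (∈▸ʳ {σ = τ ▸ x ▸ y})) (NF b)
            ... | refl | inj₂ refl = down (pair⊆ (∈▸ˡ (∈▸ʳ {σ = τ})) (∈▸ʳ {σ = τ ▸ u})) (E▸ e)
          nbr : ∀ {c} → c ∈ α ▸ u ▸ v → N (σ ∖ z) c ≡ true
          nbr i with ∈▸⁻ i
          ... | inj₂ refl = V-nbr b
          ... | inj₁ j with ∈▸⁻ j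
          ...   | inj₂ refl = V-nbr a
          ...   | inj₁ k = shared-nbr (sh k) iz
          sub : τ ▸ x ▸ y ▸ u ▸ v ⊆ (σ ∖ z) ∪ (α ▸ u ▸ v)
          sub = ▸-⊆ (▸-⊆ (λ {c} i → ∪-mono {σ = σ ∖ z} (λ k → k) (λ k → ∈▸ˡ (∈▸ˡ k)) (subst (c ∈_) base≡ i)) (∈∪ʳ {σ = σ ∖ z} (∈▸ˡ (∈▸ʳ {σ = α})))) (∈∪ʳ {σ = σ ∖ z} (∈▸ʳ {σ = α ▸ u}))

      K w₁ : Fin n → Bool
      K u = star τ x u ∧ star τ y u
      w₁ u = (x == u) ∨ (y == u) ∨ V u

      w₁-x : w₁ x ≡ true
      w₁-x = cong (_∨ ((y == x) ∨ V x)) (==-refl x)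

      w₁-V : ∀ {u} → (y == u) ∨ V u ≡ true → w₁ u ≡ true
      w₁-V {u} e with x == u
      ... | true = refl
      ... | false = e

      w₁⁻ : ∀ {u} → w₁ u ≡ true → (x ≡ u) ⊎ (y ≡ u) ⊎ (V u ≡ true)
      w₁⁻ {u} e with x ≟F u | y ≟F u
      ... | yes p | _ = inj₁ p
      ... | no _ | yes p = inj₂ (inj₁ p)
      ... | no _ | no _ = inj₂ (inj₂ e)

      w₁-z : w₁ z ≡ false
      w₁-z = ≢true (λ e → bad (w₁⁻ e))
        where
        bad : (x ≡ z) ⊎ (y ≡ z) ⊎ (V z ≡ true) → Empty
        bad (inj₁ p) = xz p
        bad (inj₂ (inj₁ p)) = yz p
        bad (inj₂ (inj₂ e)) = contra (NF e) (whole full)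

      -- A further vertex `u` common to both stars would make `x y u` a second missing triangle at
      -- `x`, next to `x y z`.
      K-split : ∀ u → K u ≡ (z == u) ∨ w₁ u
      K-split u = bool-ext to from
        where
        new : ∀ {u} → w₁ u ≡ true → (z == u) ∨ w₁ u ≡ true
        new {u} e with z == u
        ... | true = refl
        ... | false = e
        to : K u ≡ true → (z == u) ∨ w₁ u ≡ true
        to e with star⁻ {τ} {x} (∧ˡ (star τ x u) e) | star⁻ {τ} {y} (∧ʳ (star τ x u) e)
        ... | inj₁ refl | _ = new w₁-x
        ... | inj₂ _ | inj₁ refl = new {y} (w₁-V (cong (_∨ V y) (==-refl y)))
        ... | inj₂ a | inj₂ b with z ≟F u | bcase (Δ (τ ▸ x ▸ y ▸ u))
        ...   | yes refl | _ = refl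
        ...   | no _ | inj₁ f = w₁-V (star-nbr {τ ▸ x} {y} (N⁺ (∉▸ (N∉ a) (λ { refl → N∉ b (∈▸ʳ {σ = τ}) })) f))
        ...   | no ne | inj₂ gp = ⊥-elim (crowded q fτ size-τ N-x (γ≤2 (suc q) fτ size-τ) (miss≥4 (flip-hole hole-x) hole-u ne))
          where
          hole-u : Hole τ x u y
          hole-u = record { va = a ; vb = N-xy ; ab = E-flip (subst (λ c → c ≡ true) (N-cone N-y u) b) ; gap = trans (cong Δ (▸-comm (τ ▸ x) u y)) gp }
        from : (z == u) ∨ w₁ u ≡ true → K u ≡ true
        from e with z ≟F u
        ... | yes refl = ∧⁺ (star-nbr (Hole.vb hole-x)) (star-nbr (Hole.vb hole-y))
        ... | no _ with w₁⁻ {u} e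
        ...   | inj₁ refl = ∧⁺ (star-self τ x) (star-nbr (Hole.va hole-y))
        ...   | inj₂ (inj₁ refl) = ∧⁺ (star-nbr N-xy) (star-self τ y)
        ...   | inj₂ (inj₂ h) = ∧⁺ (star-nbr (N-sub {τ ▸ x} {y} h)) (star-nbr (N-mono {τ ▸ y} {τ ▸ x ▸ y} (▸-mono {σ = τ} {τ ▸ x} ∈▸ˡ) h))

      D : Fin n → Bool
      D u = V u ∧ E τ z u

      E-zx : E τ z x ≡ true
      E-zx = E-flip (subst (λ c → c ≡ true) (N-cone N-x z) (Hole.vb hole-x))

      E-zy : E τ z y ≡ true
      E-zy = E-flip (subst (λ c → c ≡ true) (N-cone N-y z) (Hole.vb hole-y))

      degree : ♯ (λ u → w₁ u ∧ E τ z u) ≡ 1ℤ + (1ℤ + ♯ D)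
      degree = trans (♯-remove x (cong (_∧ E τ z x) x∉w) (λ u → pt x u E-zx)) (cong (1ℤ +_) (♯-remove y (cong (_∧ E τ z y) apex∉) (λ u → pt y u E-zy)))
        where
        x∉w : (y == x) ∨ V x ≡ false
        x∉w = trans (cong (_∨ V x) (==-≢ (λ q → xy (sym q)))) (≢true (λ e → N∉ e (∈▸ˡ (∈▸ʳ {σ = τ}))))
        pt : ∀ c u {b} → E τ z c ≡ true → (((c == u) ∨ b) ∧ E τ z u) ≡ (c == u) ∨ (b ∧ E τ z u)
        pt c u e with c ≟F u
        ... | yes refl = e
        ... | no _ = refl

      -- The double cone `w₁` has the value of the link of `τ ▸ x ▸ y`. Adding `z` contributes its
      -- edges to `x`, `y` and `D`, each counted twice, and costs twice the index.
      K-φ : φ (E τ) (4 +ℕ q) K ≡ γ (τ ▸ x ▸ y) (2 +ℕ q) + pos 2 * (1ℤ + (1ℤ + ♯ D)) - pos 2 * pos (4 +ℕ q)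
      K-φ = trans (φ-add (E-sym τ) (E-irr τ) (4 +ℕ q) z w₁-z K-split)
            (cong₂ (λ a b → a + pos 2 * b - pos 2 * pos (4 +ℕ q)) (edge-star-φ (2 +ℕ q) N-x N-xy (λ _ → refl) induced) degree)

      -- Rigidity applied to the common part itself bounds its value by 2, in the direction opposite
      -- to `count`.
      few : 0ℤ ≤ℤ γ (τ ▸ x ▸ y) (2 +ℕ q) → pos 2 * ♯ D ≤ℤ pos 2 * (pos q + pos 3)
      few h with pure (NF N-xy)
      ... | F , s′ , fF , eF = arith (rigid (suc q) fτ size-τ {K} {F} (λ {u} e → star⊆ N-x (∧ˡ (star τ x u) e)) (λ i → s′ (∈▸ˡ (∈▸ˡ i))) fF eF cov) (γ≤2 (suc q) fτ size-τ) h K-φ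
        where
        cov : Covers τ K F
        cov {u} i with u ∈? τ
        ... | yes j = inj₁ j
        ... | no j = inj₂ (trans (K-split u) (inside (x ≟F u) (y ≟F u)))
          where
          inside : Dec (x ≡ u) → Dec (y ≡ u) → (z == u) ∨ w₁ u ≡ true
          new : w₁ u ≡ true → (z == u) ∨ w₁ u ≡ true
          new e with z == u
          ... | true = refl
          ... | false = e
          inside (yes refl) _ = new w₁-x
          inside (no _) (yes refl) = new (w₁-V (cong (_∨ V y) (==-refl y)))
          inside (no p) (no q) = new (w₁-V (star-nbr {τ ▸ x} {y} (N⁺ (∉▸ (∉▸ j (λ e → p (sym e))) (λ e → q (sym e))) (down (▸-⊆ s′ i) fF))))
        arith : ∀ {k c g D} → k ≤ℤ c → c ≤ℤ pos 2 → 0ℤ ≤ℤ g → k ≡ g + pos 2 * (1ℤ + (1ℤ + D)) - pos 2 * pos (4 +ℕ q) → pos 2 * D ≤ℤ pos 2 * (pos q + pos 3)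
        arith {c = c} {g} {D} h₁ h₂ h₃ refl = ≤-by (h₁ ⊕ h₂ ⊕ h₃) (lem (pos q) c g D)
          where
          lem : ∀ q c g D → pos 2 * D + (c + pos 2 + g) ≡ pos 2 * (q + pos 3) + (g + pos 2 * (1ℤ + (1ℤ + D)) - pos 2 * (pos 4 + q) + c + 0ℤ)
          lem = solve-∀

      -- Each star contains the missing triangle `x y z`, worth 2, and their union is worth at most
      -- 2 by rigidity. So the common part has value at least 2, which `K-φ` translates into a bound
      -- on `D`.
      count : pos 2 * pos q + pos 6 ≤ℤ γ (τ ▸ x ▸ y) (2 +ℕ q) + pos 2 * ♯ D
      count = arith {g = γ (τ ▸ x ▸ y) (2 +ℕ q)} {♯ D} (two-stars (suc q) fτ size-τ N-x N-y) (γ-nonneg q (NF N-x) (dim▸ {3 +ℕ q} (N∉ N-x) size-τ)) (γ-nonneg q (NF N-y) (dim▸ {3 +ℕ q} (N∉ N-y) size-τ))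
          (miss≥2 hole-x) (miss≥2 hole-y) (γ≤2 (suc q) fτ size-τ)
          K-φ
        where
        arith : ∀ {a b c m m′ k g D} → a + m + (b + m′) ≤ℤ c + k → 0ℤ ≤ℤ a → 0ℤ ≤ℤ b → pos 2 ≤ℤ m → pos 2 ≤ℤ m′ → c ≤ℤ pos 2
           → k ≡ g + pos 2 * (1ℤ + (1ℤ + D)) - pos 2 * pos (4 +ℕ q) → pos 2 * pos q + pos 6 ≤ℤ g + pos 2 * D
        arith {a} {b} {c} {m} {m′} {k} {g} {D} h ha hb hm hm′ hc refl = ≤-by (h ⊕ ha ⊕ hb ⊕ hm ⊕ hm′ ⊕ hc) (lem (pos q) a b c m m′ g D)
          where
          lem : ∀ q a b c m m′ g D → pos 2 * q + pos 6 + (c + (g + pos 2 * (1ℤ + (1ℤ + D)) - pos 2 * (pos 4 + q)) + a + b + m + m′ + pos 2)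
              ≡ g + pos 2 * D + (a + m + (b + m′) + 0ℤ + 0ℤ + pos 2 + pos 2 + c)
          lem = solve-∀

    triple-of : ∀ {z} → z ∈ σ → ∃ λ x → ∃ λ y → Triple x y z
    triple-of iz with inhabited (∣∖∣-suc iz size)
    ... | y , iy with pick-x (∖⊆ iy) iz (proj₂ (∈∖⁻ iy))
    ...   | x , T = x , y , T

    halve : ∀ {a b} → pos 2 * a ≤ℤ pos 2 * b → a ≤ℤ b
    halve {a} {b} = ℤP.*-cancelˡ-≤-pos a b (pos 2)

    module _ {x y z : Fin n} (T : Triple x y z) {α : Subset n} (sh : ∀ {a} → a ∈ α → Shared a) (fα : Face ((σ ∖ z) ∪ α)) where

      open Triple T

      -- The link of `τ ▸ x ▸ y` is now a cycle with value `6 - 2 ♯ V`, so `count` reads `♯ V ≤ ♯ D`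
      -- and `z` is adjacent to all of `V`.
      all-adjacent : ∣ α ∣ +ℕ 0 ≡ r → ∀ {b} → N ((σ ∖ z) ∪ α) b ≡ true → Shared b
      all-adjacent sz {b} Nb = adjacent Vb (∧ʳ (V b) (♯-full {w = D} {V} (λ u h → ∧ˡ (V u) h) (arith (subst (λ g → pos 2 * pos 0 + pos 6 ≤ℤ g + pos 2 * ♯ D) cyc count)) b Vb))
        where
        open Count T sz sh fα
        Vb : V b ≡ true
        Vb = subst (λ σ → N σ b ≡ true) (sym base≡) Nb
        cyc : γ (τ ▸ x ▸ y) 2 ≡ ring-φ (pos 2) (pos 2 * ♯ V) (♯ V)
        cyc = trans (φ-def (E (τ ▸ x ▸ y)) 2 V) (cong (λ w → ring-φ (pos 2) w (♯ V)) (cycle-edges (NF N-xy) (dim▸ {2} (N∉ N-xy) (dim▸ {3} (N∉ N-x) size-τ))))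
        arith : ∀ {m D} → pos 2 * pos 0 + pos 6 ≤ℤ ring-φ (pos 2) (pos 2 * m) m + pos 2 * D → m ≤ℤ D
        arith {m} {D} h = halve {m} {D} (≤-by h (lem m D))
          where
          lem : ∀ m D → pos 2 * m + (pos 2 * m - pos 2 * pos 2 * m + pos 2 * (pos 2 + 1ℤ) + pos 2 * D) ≡ pos 2 * D + (pos 2 * pos 0 + pos 6)
          lem = solve-∀

      -- By `flat` and monotonicity the value at `τ ▸ x ▸ y` is at most 0, so `count` makes `D`
      -- nonempty.
      some-adjacent : ∀ q → ∣ α ∣ +ℕ suc q ≡ r → ∃ λ a → N ((σ ∖ z) ∪ α) a ≡ true × Shared a
      some-adjacent q sz = from (♯-∃ D (arith (pos q) (♯ D) (0≤pos q) count thin))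
        where
        open Count T sz sh fα
        0≤pos : ∀ k → 0ℤ ≤ℤ pos k
        0≤pos k = +≤+ z≤n
        from : (∃ λ a → D a ≡ true) → ∃ λ a → N ((σ ∖ z) ∪ α) a ≡ true × Shared a
        from (a , h) = a , subst (λ σ → N σ a ≡ true) base≡ (∧ˡ (V a) h) , adjacent (∧ˡ (V a) h) (∧ʳ (V a) h)
        thin : γ (τ ▸ x ▸ y) (3 +ℕ q) ≤ℤ 0ℤ
        thin = ℤP.≤-trans (γ-mono (suc ∣ α ∣) q {σ ∖ z ∖ y} (NF N-xy) sub szs (dim▸ {3 +ℕ q} (N∉ N-xy) (dim▸ {4 +ℕ q} (N∉ N-x) size-τ)))
                 (subst (λ k → γ (σ ∖ z ∖ y) (3 +ℕ k) ≤ℤ 0ℤ) (trans (sym sz) (ℕP.+-suc ∣ α ∣ q)) (flat iy iz yz))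
          where
          sub : σ ∖ z ∖ y ⊆ τ ▸ x ▸ y
          sub {u} i = subst (u ∈_) (sym base≡) (∈∪ˡ (∖⊆ i))
          szs : suc ∣ α ∣ +ℕ ∣ σ ∖ z ∖ y ∣ ≡ ∣ τ ▸ x ▸ y ∣
          szs = trans (cong (suc ∣ α ∣ +ℕ_) (∣∖∣-suc iy′ (∣∖∣-suc iz size)))
                  (trans (lem ∣ α ∣ s) (sym (trans (∣▸∣ (N∉ N-xy)) (cong suc (trans (∣▸∣ (N∉ N-x)) (cong suc (trans (∣∪∣ (λ i j → proj₁ (sh j) (ρ⊆ i))) (cong (_+ℕ ∣ α ∣) size-ρ))))))))
            where
            lem : ∀ a s → suc a +ℕ (1 +ℕ s) ≡ suc (suc (s +ℕ a))
            lem = ℕ-solve-∀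
        arith : ∀ q D {g} → 0ℤ ≤ℤ q → pos 2 * (1ℤ + q) + pos 6 ≤ℤ g + pos 2 * D → g ≤ℤ 0ℤ → 1ℤ ≤ℤ D
        arith q D {g} hq h hg = halve {1ℤ} {D} (≤-by (h ⊕ hg ⊕ hq ⊕ hq ⊕ 0≤pos 6) (lem q D g))
          where
          lem : ∀ q D g → pos 2 * 1ℤ + (g + pos 2 * D + 0ℤ + q + q + pos 6) ≡ pos 2 * D + (pos 2 * (1ℤ + q) + pos 6 + g + 0ℤ + 0ℤ + 0ℤ)
          lem = solve-∀

    -- Being shared propagates along link edges: if `u` is shared, its neighbours lie in the link of
    -- the larger face with `α ▸ u`, where the induction hypothesis applies. `some-adjacent`
    -- provides a starting vertex, and cycles end the induction.
    spread : ∀ q {z α} → z ∈ σ → ∣ α ∣ +ℕ q ≡ r → (∀ {a} → a ∈ α → Shared a) → Face ((σ ∖ z) ∪ α)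
      → ∀ {b} → N ((σ ∖ z) ∪ α) b ≡ true → Shared b
    spread zero iz sz sh fα = all-adjacent (proj₂ (proj₂ (triple-of iz))) sh fα sz
    spread (suc q) {z} {α} iz sz sh fα {b} Nb = from (some-adjacent (proj₂ (proj₂ (triple-of iz))) sh fα q sz)
        (λ {u} {v} Euv Su → spread q {z} {α ▸ u} iz (grow-size Euv) (grow-shared Su) (subst Face (∪-assoc (σ ∖ z) α ⁅ u ⁆) (NF (E₁ Euv)))
            (subst (λ τ → N τ v ≡ true) (∪-assoc (σ ∖ z) α ⁅ u ⁆) (E₂ Euv)))
      where
      τ₂ = (σ ∖ z) ∪ α
      grow-size : ∀ {u v} → E τ₂ u v ≡ true → ∣ α ▸ u ∣ +ℕ q ≡ r
      grow-size Euv = trans (cong (_+ℕ q) (∣▸∣ (λ i → N∉ (E₁ Euv) (∈∪ʳ {σ = σ ∖ z} i)))) (trans (sym (ℕP.+-suc ∣ α ∣ q)) sz)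
      grow-shared : ∀ {u} → Shared u → ∀ {a} → a ∈ α ▸ u → Shared a
      grow-shared Su i with ∈▸⁻ i
      ... | inj₁ j = sh j
      ... | inj₂ refl = Su
      dim₂ : suc (suc (suc q)) +ℕ ∣ τ₂ ∣ ≡ d
      dim₂ = trans (cong (3 +ℕ q +ℕ_) (trans (∣∪∣ (λ i j → proj₁ (sh j) (∖⊆ i))) (cong (_+ℕ ∣ α ∣) (∣∖∣-suc iz size))))
               (trans (lem q s ∣ α ∣) (trans (cong (λ w → 4 +ℕ w +ℕ s) sz) dims))
        where
        lem : ∀ q s a → 3 +ℕ q +ℕ (2 +ℕ s +ℕ a) ≡ 4 +ℕ (a +ℕ suc q) +ℕ s
        lem = ℕ-solve-∀
      from : (∃ λ a → N τ₂ a ≡ true × Shared a) → (∀ {u v} → E τ₂ u v ≡ true → Shared u → Shared v) → Shared b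
      from (a , Na , Sa) move = conn {τ₂} {suc q} fα dim₂ Shared (λ {u} {v} → move {u} {v}) Na Nb Sa

    shared-link : ∀ {z b} → z ∈ σ → N (σ ∖ z) b ≡ true → Shared b
    shared-link {z} {b} iz Nb = spread r {z} {⊥} iz (cong (_+ℕ r) (∣⊥∣≡0 n)) (λ i → ⊥-elim (∉⊥ i))
      (subst Face (sym (∪-identityʳ (σ ∖ z))) (proper (∖⊆ {σ = σ}) iz ∉∖)) (subst (λ τ → N τ b ≡ true) (sym (∪-identityʳ (σ ∖ z))) Nb)

    -- The vertices of `π` are shared and form a clique, so `chord` puts `π` into the link of
    -- `σ ∖ y` as well.
    exchange : ∀ {z y π} → z ∈ σ → y ∈ σ → Disjoint σ π → Face ((σ ∖ z) ∪ π) → Face ((σ ∖ y) ∪ π)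
    exchange {z} {y} {π} iz iy dis f = chord ∣ π ∣ iy refl le (face-clique (down (λ k → ∈∪ʳ {σ = σ ∖ z} k) f))
        (λ i → shared-nbr (shared-link iz (N⁺ (λ k → dis (∖⊆ k) i) (down (▸-⊆ (λ k → ∈∪ˡ k) (∈∪ʳ {σ = σ ∖ z} i)) f))) iy)
      where
      le : ∣ π ∣ ≤ 2 +ℕ r
      le = ℕP.+-cancelˡ-≤ (2 +ℕ s) ∣ π ∣ (2 +ℕ r) (ℕP.≤-trans (ℕP.≤-reflexive (trans (cong (_+ℕ ∣ π ∣) (sym (∣∖∣-suc iz size))) (sym (∣∪∣ (λ i j → dis (∖⊆ i) j)))))
             (ℕP.≤-trans (dim f) (ℕP.≤-reflexive (trans (sym dims) (lem r s)))))
        where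
        lem : ∀ r s → 4 +ℕ r +ℕ s ≡ 2 +ℕ s +ℕ (2 +ℕ r)
        lem = ℕ-solve-∀

-- The flag case

another : ∀ {n} (w : Fin n → Bool) {i} → ♯ w ≡ pos 2 → w i ≡ true → ∃ λ j → w j ≡ true × i ≢ j
another w {i} e wi = from (♯-∃ (without i w) (arith (trans (sym (♯-remove i (without-self i w) (without-split i wi))) e)))
  where
  arith : ∀ {a} → 1ℤ + a ≡ pos 2 → 1ℤ ≤ℤ a
  arith {a} h = ≤-by (ℤP.≤-reflexive (sym h)) (lem a)
    where
    lem : ∀ a → 1ℤ + (1ℤ + a) ≡ a + pos 2
    lem = solve-∀
  from : (∃ λ j → without i w j ≡ true) → ∃ λ j → w j ≡ true × i ≢ j
  from (j , q) = j , without⁻ i w q , λ { refl → contra (==-refl i) (bnot (∧ʳ (w i) q)) }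

module Flag {n : ℕ} (d : ℕ) (Δ : Cx n) (pm : NormalPM d Δ) (prime : Prime d Δ) (γ⊥≤2 : Rigidity.γ d Δ pm ⊥ d ≤ℤ pos 2) where

  open Bounds d Δ pm
  open Minimal d Δ pm prime γ⊥≤2

  module _ (flag : ∀ {ν} → Clique ν → Face ν) where

    cone-face : ∀ {τ u} → Face τ → (∀ {c} → c ∈ τ → Face (⁅ c ⁆ ∪ ⁅ u ⁆)) → Face ⁅ u ⁆ → Face (τ ▸ u)
    cone-face {τ} {u} f h fu = flag (clique-∪ (face-clique f) (face-clique fu) (λ {c} i j → subst (λ z → Face (⁅ c ⁆ ∪ ⁅ z ⁆)) (sym (x∈⁅y⁆⇒x≡y u j)) (h i)))

    -- As cliques are faces, the stars of `x` and `y` meet exactly in the double cone over the link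
    -- of `τ ▸ x ▸ y`. Supermodularity thus compares four values of `γ`.
    star-pair : ∀ p {τ x y} → Face τ → 3 +ℕ p +ℕ ∣ τ ∣ ≡ d → N τ x ≡ true → N (τ ▸ x) y ≡ true
      → γ (τ ▸ x) (2 +ℕ p) + γ (τ ▸ y) (2 +ℕ p) ≤ℤ γ τ (3 +ℕ p) + γ (τ ▸ x ▸ y) (1 +ℕ p)
    star-pair p {τ} {x} {y} f e Nx Nxy = arith {γ (τ ▸ x) (2 +ℕ p)} {γ (τ ▸ y) (2 +ℕ p)} {γ τ (3 +ℕ p)} {miss τ x} {miss τ y} (two-stars p f e Nx Ny) (Q-nonneg (missing τ x) (N (τ ▸ x))) (Q-nonneg (missing τ y) (N (τ ▸ y)))
        (edge-star-φ (1 +ℕ p) Nx Nxy K-split full)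
      where
      Ny : N τ y ≡ true
      Ny = N-sub Nxy
      Nyx : N (τ ▸ y) x ≡ true
      Nyx = trans (N-cone Ny x) (E-flip (trans (sym (N-cone Nx y)) Nxy))
      arith : ∀ {a b c m m′ k g} → a + m + (b + m′) ≤ℤ c + k → 0ℤ ≤ℤ m → 0ℤ ≤ℤ m′ → k ≡ g → a + b ≤ℤ c + g
      arith {a} {b} {c} {m} {m′} {k} h h₁ h₂ refl = ≤-by (h ⊕ h₁ ⊕ h₂) (lem a b c m m′ k)
        where
        lem : ∀ a b c m m′ k → a + b + (c + k + m + m′) ≡ c + k + (a + m + (b + m′) + 0ℤ + 0ℤ)
        lem = solve-∀
      full : ∀ u v → N (τ ▸ x ▸ y) u ≡ true → N (τ ▸ x ▸ y) v ≡ true → E τ u v ≡ E (τ ▸ x ▸ y) u v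
      full u v a b = bool-ext (λ q → E⁺ a (N∉ b) (E≢ q) (cone-face (NF a) (edge q) (down (λ i → ∈∪ʳ {σ = τ ▸ x ▸ y} i) (NF b)))) (λ q → E-sub (E-sub q))
        where
        edge : E τ u v ≡ true → ∀ {c} → c ∈ τ ▸ x ▸ y ▸ u → Face (⁅ c ⁆ ∪ ⁅ v ⁆)
        edge q i with ∈▸⁻ i
        ... | inj₁ j = down (pair⊆ (∈▸ˡ j) (∈▸ʳ {σ = τ ▸ x ▸ y})) (NF b)
        ... | inj₂ refl = down (pair⊆ (∈▸ˡ (∈▸ʳ {σ = τ})) (∈▸ʳ {σ = τ ▸ u})) (E▸ q)
      K-split : ∀ u → (star τ x u ∧ star τ y u) ≡ (x == u) ∨ (y == u) ∨ N (τ ▸ x ▸ y) u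
      K-split u = bool-ext to from
        where
        to : (star τ x u ∧ star τ y u) ≡ true → (x == u) ∨ (y == u) ∨ N (τ ▸ x ▸ y) u ≡ true
        to q with x ≟F u | y ≟F u
        ... | yes _ | _ = refl
        ... | no _ | yes _ = refl
        ... | no ne | no ne′ = N⁺ (∉▸ (N∉ a) (λ eq → ne′ (sym eq))) (cone-face (NF Nxy) edge (down (λ i → ∈∪ʳ {σ = τ ▸ x} i) (NF a)))
          where
          a : N (τ ▸ x) u ≡ true
          a = ∧ˡ (N (τ ▸ x) u) q
          edge : ∀ {c} → c ∈ τ ▸ x ▸ y → Face (⁅ c ⁆ ∪ ⁅ u ⁆)
          edge i with ∈▸⁻ i
          ... | inj₁ j = down (pair⊆ (∈▸ˡ j) (∈▸ʳ {σ = τ ▸ x})) (NF a)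
          ... | inj₂ refl = down (pair⊆ (∈▸ˡ (∈▸ʳ {σ = τ})) (∈▸ʳ {σ = τ ▸ y})) (NF (∧ʳ (N (τ ▸ x) u) q))
        from : (x == u) ∨ (y == u) ∨ N (τ ▸ x ▸ y) u ≡ true → (star τ x u ∧ star τ y u) ≡ true
        from q with x ≟F u | y ≟F u
        ... | yes _ | yes _ = refl
        ... | yes refl | no _ = Nyx
        ... | no _ | yes refl = ∧⁺ Nxy refl
        ... | no _ | no _ = ∧⁺ (N-sub {τ ▸ x} {y} q) (N-mono {τ ▸ y} {τ ▸ x ▸ y} (▸-mono {σ = τ} {τ ▸ x} ∈▸ˡ) q)

    -- A cycle of length three would be a clique and, joined to `τ`, a face with `suc d` vertices.
    long-cycle : ∀ {τ a} → Face τ → 2 +ℕ ∣ τ ∣ ≡ d → N τ a ≡ true → pos 4 ≤ℤ ♯ (N τ)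
    long-cycle {τ} {a} f e Na with ♯-∃ (E τ a) (subst (1ℤ ≤ℤ_) (sym (Surface.degree2 d Δ pm f e Na)) (+≤+ (s≤s z≤n)))
    ... | b , ab with another (E τ a) (Surface.degree2 d Δ pm f e Na) ab | another (E τ b) (Surface.degree2 d Δ pm f e (E⁻ ab)) (E-flip ab)
    ...   | c , ac , b≢c | c′ , bc′ , a≢c′ = ℤP.≤-trans (ℤP.≤-reflexive (sym (cong₂ _+_ (cong ⟦_⟧ Na) (cong₂ _+_ (cong ⟦_⟧ (E⁻ ab)) (cong₂ _+_ (cong ⟦_⟧ (E⁻ ac)) (cong ⟦_⟧ (E⁻ bc′)))))))
        (∑-≥₄ {f = λ v → ⟦ N τ v ⟧} (λ v → 0≤⟦⟧ (N τ v)) (λ q → E≢ ab (sym q)) (λ q → E≢ ac (sym q)) a≢c′ b≢c (λ q → E≢ bc′ (sym q)) c≢c′)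
      where
      c≢c′ : c ≢ c′
      c≢c′ refl = ℕP.1+n≰n (ℕP.≤-trans (ℕP.≤-reflexive (sym big)) (dim triangle))
        where
        big : ∣ τ ▸ a ▸ b ▸ c ∣ ≡ suc d
        big = trans (∣▸∣ (∉▸ (∉▸ (E∉ ac) (E≢ ac)) (E≢ bc′))) (cong suc (trans (∣▸∣ (∉▸ (E∉ ab) (E≢ ab))) (trans (cong suc (∣▸∣ (N∉ Na))) e)))
        edge : ∀ {v} → v ∈ τ ▸ a ▸ b → Face (⁅ v ⁆ ∪ ⁅ c ⁆)
        edge i with ∈▸⁻ i
        ... | inj₂ refl = down (pair⊆ (∈▸ˡ (∈▸ʳ {σ = τ})) (∈▸ʳ {σ = τ ▸ b})) (E▸ bc′)
        ... | inj₁ j = down (pair⊆ (∈▸ˡ j) (∈▸ʳ {σ = τ ▸ a})) (E▸ ac)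
        triangle : Face (τ ▸ a ▸ b ▸ c)
        triangle = cone-face (E▸ ab) edge (down (λ i → ∈∪ʳ {σ = τ ▸ a} i) (E▸ ac))

    -- The value `6 - 2 m` is at most -2 once the cycle has four vertices.
    cycle-γ : ∀ {τ a} → Face τ → 2 +ℕ ∣ τ ∣ ≡ d → N τ a ≡ true → γ τ 2 + pos 2 ≤ℤ 0ℤ
    cycle-γ {τ} f e Na = subst (λ g → g + pos 2 ≤ℤ 0ℤ) (sym (trans (φ-def (E τ) 2 (N τ)) (cong (λ q → ring-φ (pos 2) q (♯ (N τ))) (cycle-edges f e)))) (arith (long-cycle f e Na))
      where
      arith : ∀ {m} → pos 4 ≤ℤ m → ring-φ (pos 2) (pos 2 * m) m + pos 2 ≤ℤ 0ℤ
      arith {m} h = ≤-by (h ⊕ h) (lem m)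
        where
        lem : ∀ m → pos 2 * m - pos 2 * pos 2 * m + pos 2 * (pos 2 + 1ℤ) + pos 2 + (m + m) ≡ 0ℤ + (pos 4 + pos 4)
        lem = solve-∀

    dim▸▸ : ∀ {p τ x y} → Face (τ ▸ x ▸ y) → x ∉ τ → y ∉ τ ▸ x → suc (suc p) +ℕ ∣ τ ∣ ≡ d → p +ℕ ∣ τ ▸ x ▸ y ∣ ≡ d
    dim▸▸ {p} f nx ny e = dim▸ {p} ny (dim▸ {suc p} nx e)

    -- In `star-pair` both surface values are nonnegative and the cycle contributes at most -2, so
    -- the link of `τ` has to make up for it.
    γ≥2 : ∀ {τ x y z} → Face τ → 4 +ℕ ∣ τ ∣ ≡ d → N τ x ≡ true → N (τ ▸ x) y ≡ true → N (τ ▸ x ▸ y) z ≡ true → pos 2 ≤ℤ γ τ 4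
    γ≥2 {τ} {x} {y} f e Nx Nxy Nz = arith (star-pair 1 f e Nx Nxy) (γ-nonneg 0 (NF Nx) (dim▸ {3} (N∉ Nx) e)) (γ-nonneg 0 (NF Ny) (dim▸ {3} (N∉ Ny) e))
        (cycle-γ (NF Nxy) (dim▸▸ {2} (NF Nxy) (N∉ Nx) (N∉ Nxy) e) Nz)
      where
      Ny : N τ y ≡ true
      Ny = N-sub Nxy
      arith : ∀ {a b c g} → a + b ≤ℤ c + g → 0ℤ ≤ℤ a → 0ℤ ≤ℤ b → g + pos 2 ≤ℤ 0ℤ → pos 2 ≤ℤ c
      arith {a} {b} {c} {g} h h₁ h₂ h₃ = ≤-by (h ⊕ h₁ ⊕ h₂ ⊕ h₃) (lem a b c g)
        where
        lem : ∀ a b c g → pos 2 + (c + g + a + b + 0ℤ) ≡ c + (a + b + 0ℤ + 0ℤ + (g + pos 2))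
        lem = solve-∀

    -- With all missing faces edges, links of dimension 3 would have g₂ ≥ 1 and then
    -- surfaces in links of dimension 4 would too, forcing g₂ ≥ 2 in between.
    contradictory : ∀ {τ u v w x} → Face τ → 5 +ℕ ∣ τ ∣ ≡ d → N τ u ≡ true → N (τ ▸ u) v ≡ true → N (τ ▸ u ▸ v) w ≡ true → N (τ ▸ u ▸ v ▸ w) x ≡ true → Empty
    contradictory {τ} {u} {v} {w} {x} f e Nu Nv Nw Nx = arith (pair Nu Nv (γ≥ Nu Nv Nw) (γ≥ Nv₀ (flipN Nu Nv) (subst (λ σ → N σ w ≡ true) (▸-comm τ u v) Nw)))
         (pair Nu Nuw (γ≥ Nu Nv Nw) (γ≥ (N-sub Nuw) (flipN Nu Nuw) (subst (λ σ → N σ v ≡ true) (▸-comm τ u w) (trans (N-cone Nuw v) (E-flip (trans (sym (N-cone Nv w)) Nw))))))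
         (star-pair 1 (NF Nu) e₁ Nv Nw) (γ≤2 1 (NF Nu) e₁)
         (cycle-γ (NF Nw) (dim▸▸ {2} (NF Nw) (N∉ Nv) (N∉ Nw) e₁) Nx)
      where
      e₁ = dim▸ {4} (N∉ Nu) e
      Nv₀ : N τ v ≡ true
      Nv₀ = N-sub Nv
      Nuw : N (τ ▸ u) w ≡ true
      Nuw = N-sub Nw
      flipN : ∀ {a b} → N τ a ≡ true → N (τ ▸ a) b ≡ true → N (τ ▸ b) a ≡ true
      flipN {a} {b} Na Nb = trans (N-cone (N-sub Nb) a) (E-flip (trans (sym (N-cone Na b)) Nb))
      γ≥ : ∀ {a b c} → N τ a ≡ true → N (τ ▸ a) b ≡ true → N (τ ▸ a ▸ b) c ≡ true → pos 2 ≤ℤ γ (τ ▸ a) 4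
      γ≥ {a} {b} {c} Na Nb Nc = γ≥2′ (pure (NF Nc))
        where
        ea = dim▸ {4} (N∉ Na) e
        γ≥2′ : Σ[ F ∈ Subset n ] (τ ▸ a ▸ b ▸ c ⊆ F × Face F × ∣ F ∣ ≡ d) → pos 2 ≤ℤ γ (τ ▸ a) 4
        γ≥2′ (F , s , fF , eF) with next s fF (lt-dim 1 F (τ ▸ a ▸ b ▸ c) (dim▸ {2} (N∉ Nc) (dim▸ {3} (N∉ Nb) ea)) eF)
        ... | y , _ , Ny = γ≥2 (NF Na) ea Nb Nc Ny
      pair : ∀ {a b} → N τ a ≡ true → N (τ ▸ a) b ≡ true → pos 2 ≤ℤ γ (τ ▸ a) 4 → pos 2 ≤ℤ γ (τ ▸ b) 4 → pos 2 ≤ℤ γ (τ ▸ a ▸ b) 3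
      pair {a} {b} Na Nb h₁ h₂ = arith₁ (star-pair 2 f e Na Nb) (γ≤2 2 f e) h₁ h₂
        where
        arith₁ : ∀ {a b c g} → a + b ≤ℤ c + g → c ≤ℤ pos 2 → pos 2 ≤ℤ a → pos 2 ≤ℤ b → pos 2 ≤ℤ g
        arith₁ {a} {b} {c} {g} h k h₁ h₂ = ≤-by (h ⊕ k ⊕ h₁ ⊕ h₂) (lem a b c g)
          where
          lem : ∀ a b c g → pos 2 + (c + g + pos 2 + a + b) ≡ g + (a + b + c + pos 2 + pos 2)
          lem = solve-∀
      arith : ∀ {a b c g} → pos 2 ≤ℤ a → pos 2 ≤ℤ b → a + b ≤ℤ c + g → c ≤ℤ pos 2 → g + pos 2 ≤ℤ 0ℤ → Empty
      arith {a} {b} {c} {g} h₁ h₂ h k m = 2≤0-absurd {0ℤ} {pos 4} (≤-by (h ⊕ k ⊕ h₁ ⊕ h₂ ⊕ m) (lem a b c g)) ℤP.≤-refl (+≤+ (s≤s (s≤s z≤n)))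
        where
        lem : ∀ a b c g → 0ℤ + pos 4 + (c + g + pos 2 + a + b + 0ℤ) ≡ 0ℤ + (a + b + c + pos 2 + pos 2 + (g + pos 2))
        lem = solve-∀

-- Existence and size of a minimal clique that is not a face

module Search {n : ℕ} (d : ℕ) (5≤d : 5 ≤ d) (Δ : Cx n) (pm : NormalPM d Δ) (prime : Prime d Δ) (γ⊥≡2 : Rigidity.γ d Δ pm ⊥ d ≡ pos 2) where

  open Bounds d Δ pm

  γ⊥≤2 : γ ⊥ d ≤ℤ pos 2
  γ⊥≤2 = ℤP.≤-reflexive γ⊥≡2

  open Minimal d Δ pm prime γ⊥≤2

  subface : ∀ j → j ≤ d → ∃ λ τ → Face τ × j +ℕ ∣ τ ∣ ≡ d
  subface zero le with pure ⊥-face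
  ... | F , _ , f , e = F , f , e
  subface (suc j) le with subface j (ℕP.<⇒≤ le)
  ... | τ , f , e with extra {σ = ⊥} {ρ = τ} (subst₂ _<_ (sym (∣⊥∣≡0 n)) refl (ℕP.+-cancelˡ-< j 0 ∣ τ ∣ (subst₂ _<_ (sym (ℕP.+-identityʳ j)) (sym e) le)))
  ...   | x , ix , _ = τ ∖ x , down ∖⊆ f , trans (sym (ℕP.+-suc j ∣ τ ∖ x ∣)) (trans (cong (j +ℕ_) (∣∖∣ ix)) e)

  link-vertex : ∀ p {τ} → Face τ → suc p +ℕ ∣ τ ∣ ≡ d → ∃ λ v → N τ v ≡ true
  link-vertex p {τ} f e with pure f
  ... | F , s , fF , eF with next s fF (lt-dim p F τ e eF)
  ...   | v , _ , Nv = v , Nv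

  -- `contradictory` works in a link whose facets have five vertices. Such a link exists because
  -- `5 ≤ d`; for `d` = 5 it is the whole complex.
  not-flag : ¬ (∀ {ν} → Clique ν → Face ν)
  not-flag flag = start (subface 5 5≤d)
    where
    start : (∃ λ τ → Face τ × 5 +ℕ ∣ τ ∣ ≡ d) → Empty
    start (τ , f , e) = step₁ (link-vertex 4 f e)
      where
      step₄ : ∀ {u v w} → N τ u ≡ true → N (τ ▸ u) v ≡ true → N (τ ▸ u ▸ v) w ≡ true → (∃ λ x → N (τ ▸ u ▸ v ▸ w) x ≡ true) → Empty
      step₄ {u} {v} {w} Nu Nv Nw (x , Nx) = Flag.contradictory d Δ pm prime γ⊥≤2 (λ {ν} → flag {ν}) {τ} {u} {v} {w} {x} f e Nu Nv Nw Nx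
      step₃ : ∀ {u v} → N τ u ≡ true → N (τ ▸ u) v ≡ true → (∃ λ w → N (τ ▸ u ▸ v) w ≡ true) → Empty
      step₃ Nu Nv (w , Nw) = step₄ Nu Nv Nw (link-vertex 1 (NF Nw) (dim▸ {2} (N∉ Nw) (dim▸ {3} (N∉ Nv) (dim▸ {4} (N∉ Nu) e))))
      step₂ : ∀ {u} → N τ u ≡ true → (∃ λ v → N (τ ▸ u) v ≡ true) → Empty
      step₂ Nu (v , Nv) = step₃ Nu Nv (link-vertex 2 (NF Nv) (dim▸ {3} (N∉ Nv) (dim▸ {4} (N∉ Nu) e)))
      step₁ : (∃ λ u → N τ u ≡ true) → Empty
      step₁ (u , Nu) = step₂ Nu (link-vertex 3 (NF Nu) (dim▸ {4} (N∉ Nu) e))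

  defect : Subset n → Fin n → Bool
  defect ν u = lookup ν u ∧ exists (λ v → lookup ν v ∧ not (Δ (⁅ u ⁆ ∪ ⁅ v ⁆)))

  cliqueᵇ : Subset n → Bool
  cliqueᵇ ν = not (exists (defect ν))

  clique⁻ : ∀ {ν} → cliqueᵇ ν ≡ true → Clique ν
  clique⁻ {ν} e {u} {v} iu iv with bcase (Δ (⁅ u ⁆ ∪ ⁅ v ⁆))
  ... | inj₁ f = f
  ... | inj₂ q = contra (exists⁺ {w = defect ν} u (∧⁺ (mem iu) (exists⁺ v (∧⁺ (mem iv) (cong not q))))) (bnot e)

  clique⁺ : ∀ {ν} → Clique ν → cliqueᵇ ν ≡ true
  clique⁺ {ν} c = cong not (≢true bad)
    where
    bad : ¬ (exists (defect ν) ≡ true)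
    bad e with exists⁻ (defect ν) e
    ... | u , q with exists⁻ (λ v → lookup ν v ∧ not (Δ (⁅ u ⁆ ∪ ⁅ v ⁆))) (∧ʳ (lookup ν u) q)
    ...   | v , t = contra (c (mem⁻ (∧ˡ (lookup ν u) q)) (mem⁻ (∧ˡ (lookup ν v) t))) (bnot (∧ʳ (lookup ν v) t))

  record MinimalNonface : Set where
    field
      σ : Subset n
      cl : Clique σ
      gap : Δ σ ≡ false
      min : ∀ {ν} → Clique ν → ∣ ν ∣ < ∣ σ ∣ → Face ν

  -- Sizes are searched upwards, so that the first failure found is minimal.
  search : ∀ k → MinimalNonface ⊎ (∀ {ν} → Clique ν → ∣ ν ∣ < k → Face ν)
  search zero = inj₂ (λ _ ())
  search (suc k) with search k
  ... | inj₁ m = inj₁ m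
  ... | inj₂ h with anySubset? (λ ν → (cliqueᵇ ν ∧ not (Δ ν) ∧ (∣ ν ∣ ≡ᵇ k)) ≟B true)
  ...   | yes (ν , q) = inj₁ (record { σ = ν ; cl = clique⁻ {ν} (∧ˡ (cliqueᵇ ν) q) ; gap = bnot (∧ˡ (not (Δ ν)) (∧ʳ (cliqueᵇ ν) q))
       ; min = λ c lt → h c (ℕP.<-≤-trans lt (ℕP.≤-reflexive (≡ᵇ⁻ (∧ʳ (not (Δ ν)) (∧ʳ (cliqueᵇ ν) q))))) })
  ...   | no none = inj₂ all
    where
    all : ∀ {ν} → Clique ν → ∣ ν ∣ < suc k → Face ν
    all {ν} c (s≤s le) with bcase (Δ ν) | ℕP.m≤n⇒m<n∨m≡n le
    ... | inj₁ f | _ = f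
    ... | inj₂ _ | inj₁ lt = h c lt
    ... | inj₂ q | inj₂ e = ⊥-elim (none (ν , ∧⁺ (clique⁺ c) (∧⁺ (cong not q) (≡ᵇ⁺ e))))

  minimal : MinimalNonface
  minimal with search (suc n)
  ... | inj₁ m = m
  ... | inj₂ h = ⊥-elim (not-flag (λ {ν} c → h c (s≤s (Data.Fin.Subset.Properties.∣p∣≤n ν))))

  module Sized (m : MinimalNonface) where

   open MinimalNonface m

   ∖-face : ∀ {z} → z ∈ σ → Face (σ ∖ z)
   ∖-face iz = min (λ a b → cl (∖⊆ a) (∖⊆ b)) (ℕP.≤-reflexive (∣∖∣ iz))

   at-least-3 : 3 ≤ ∣ σ ∣
   at-least-3 = go ∣ σ ∣ refl
     where
     go : ∀ k → ∣ σ ∣ ≡ k → 3 ≤ ∣ σ ∣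
     go zero e = contra (subst Face (sym (∣∣-0 e)) ⊥-face) gap
     go (suc zero) e with inhabited e
     ... | a , ia = contra (down sub (cl ia ia)) gap
       where
       sub : σ ⊆ ⁅ a ⁆ ∪ ⁅ a ⁆
       sub {u} i with u ≟F a
       ... | yes refl = ∈∪ˡ (x∈⁅x⁆ u)
       ... | no ne = ⊥-elim (∉⊥ (subst (u ∈_) (∣∣-0 (∣∖∣-suc ia e)) (∈∖⁺ i ne)))
     go (suc (suc zero)) e with inhabited e
     ... | a , ia with inhabited (∣∖∣-suc ia e)
     ...   | b , ib = contra (down sub (cl ia (∖⊆ ib))) gap
       where
       sub : σ ⊆ ⁅ a ⁆ ∪ ⁅ b ⁆
       sub {u} i with u ≟F a | u ≟F b
       ... | yes refl | _ = ∈∪ˡ (x∈⁅x⁆ u)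
       ... | no _ | yes refl = ∈∪ʳ {σ = ⁅ a ⁆} (x∈⁅x⁆ u)
       ... | no p | no q = ⊥-elim (∉⊥ (subst (u ∈_) (∣∣-0 (∣∖∣-suc ib (∣∖∣-suc ia e))) (∈∖⁺ (∈∖⁺ i p) q)))
     go (suc (suc (suc k))) e = subst (3 ≤_) (sym e) (s≤s (s≤s (s≤s z≤n)))

   abstract
    member : ∃ λ z → z ∈ σ × z ∉ ⊥
    member = extra {σ = ⊥} {ρ = σ} (subst (_< ∣ σ ∣) (sym (∣⊥∣≡0 n)) (ℕP.≤-trans (s≤s z≤n) at-least-3))

   z : Fin n
   z = proj₁ member

   iz : z ∈ σ
   iz = proj₁ (proj₂ member)

   -- At this size `σ` would be a missing facet.
   not-d : ∣ σ ∣ ≢ d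
   not-d e = prime (σ , ((λ v i → down (λ k → ∈∪ˡ k) (cl i i)) , gap , λ { τ (sub , w , iw , nw) → down (λ {u} i → ∈∖⁺ (sub i) (λ { refl → nw i })) (∖-face iw) }) , e)

   -- Here `Δ` would have exactly the vertices of `σ`. Adding `z` to a facet, whose value is 0,
   -- changes the value by `2 d - 2 d`, so `γ ⊥` would be 0 and not 2.
   not-simplex : ∣ σ ∣ ≢ suc d
   not-simplex e = 2≢0 (trans (sym γ⊥≡2) (trans (φ-cong same) (trans (φ-add (E-sym ⊥) (E-irr ⊥) d z z∉ split) (trans (cong₂ (λ a b → a + pos 2 * b - pos 2 * pos d) facet-0 deg) (lem (pos d))))))
     where
     2≢0 : pos 2 ≢ 0ℤ
     2≢0 ()
     lem : ∀ d → 0ℤ + pos 2 * d - pos 2 * d ≡ 0ℤ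
     lem = solve-∀
     size-F : ∀ {y} → y ∈ σ → ∣ σ ∖ y ∣ ≡ d
     size-F iy = ∣∖∣-suc iy e
     -- Each `σ ∖ z` already has the size of a facet, so `π` is empty.
     exchange′ : ∀ {z y π} → z ∈ σ → y ∈ σ → Disjoint σ π → Face ((σ ∖ z) ∪ π) → Face ((σ ∖ y) ∪ π)
     exchange′ {z} {y} {π} iz iy dis f = down (∪-⊆ (λ i → i) (λ {u} i → ⊥-elim (∉⊥ (subst (u ∈_) (∣∣-0 π0) i)))) (∖-face iy)
       where
       π0 : ∣ π ∣ ≡ 0
       π0 = ℕP.n≤0⇒n≡0 (ℕP.+-cancelˡ-≤ d ∣ π ∣ 0 (ℕP.≤-trans (ℕP.≤-reflexive (trans (cong (_+ℕ ∣ π ∣) (sym (size-F iz))) (sym (∣∪∣ (λ i j → dis (∖⊆ i) j)))))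
              (ℕP.≤-trans (dim f) (ℕP.≤-reflexive (sym (ℕP.+-identityʳ d))))))
     module J = Join d Δ pm iz gap (∖-face iz) (ℕP.≤-trans (s≤s z≤n) 5≤d) exchange′
     same : ∀ v → N ⊥ v ≡ lookup σ v
     same v = bool-ext to (λ q → N⁺ ∉⊥ (down (▸-⊆ (λ i → ⊥-elim (∉⊥ i)) (∈∪ˡ (x∈⁅x⁆ v))) (cl (mem⁻ q) (mem⁻ q))))
       where
       to : N ⊥ v ≡ true → lookup σ v ≡ true
       to q = at (v ∈? σ) (J.face⁻ (NF q))
        where
        at : Dec (v ∈ σ) → Σ[ y ∈ Fin n ] (y ∈ σ × y ∉ ⊥ ▸ v × Face ((σ ∖ z) ∪ J.rest (⊥ ▸ v))) → lookup σ v ≡ true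
        at (yes i) _ = mem i
        at (no ni) (_ , _ , _ , f) = ⊥-elim (ℕP.1+n≰n (ℕP.≤-trans (ℕP.≤-reflexive (trans (cong suc (sym (size-F iz))) (sym (∣▸∣ (λ i → ni (∖⊆ i))))))
              (ℕP.≤-trans (p⊆q⇒∣p∣≤∣q∣ (▸-⊆ (λ i → ∈∪ˡ i) (∈∪ʳ {σ = σ ∖ z} (J.∈rest (∈▸ʳ {σ = ⊥}) ni)))) (dim f))))
     w₀ : Fin n → Bool
     w₀ v = lookup (σ ∖ z) v ∧ not (lookup ⊥ v)
     w₀≡ : ∀ v → w₀ v ≡ lookup (σ ∖ z) v
     w₀≡ v = trans (cong (λ b → lookup (σ ∖ z) v ∧ not b) (nmem {σ = ⊥} {x = v} ∉⊥)) (∧-identityʳ _)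
     z∉ : w₀ z ≡ false
     z∉ = trans (w₀≡ z) (nmem (∉∖ {σ = σ}))
     split : ∀ v → lookup σ v ≡ (z == v) ∨ w₀ v
     split v with z ≟F v
     ... | yes refl = mem iz
     ... | no ne = trans (bool-ext (λ q → mem (∈∖⁺ (mem⁻ q) (λ eq → ne (sym eq)))) (λ q → mem (∖⊆ (mem⁻ {σ = σ ∖ z} q)))) (sym (w₀≡ v))
     facet-0 : φ (E ⊥) d w₀ ≡ 0ℤ
     facet-0 = facet-φ d (trans (cong (d +ℕ_) (∣⊥∣≡0 n)) (ℕP.+-identityʳ d)) (λ i → ⊥-elim (∉⊥ i)) (∖-face iz) (size-F iz)
     deg : ♯ (λ u → w₀ u ∧ E ⊥ z u) ≡ pos d
     deg = trans (♯-cong (λ u → bool-ext (λ q → trans (sym (w₀≡ u)) (∧ˡ (w₀ u) q)) (λ q → ∧⁺ (trans (w₀≡ u) q) (adj u (mem⁻ q))))) (trans (sym (∣∣-♯ (σ ∖ z))) (cong pos (size-F iz)))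
       where
       adj : ∀ u → u ∈ σ ∖ z → E ⊥ z u ≡ true
       adj u i = E⁺ (trans (same z) (mem iz)) ∉⊥ (proj₂ (∈∖⁻ i)) (down (▸-⊆ (▸-⊆ (λ i → ⊥-elim (∉⊥ i)) (∈∪ˡ (x∈⁅x⁆ z))) (∈∪ʳ {σ = ⁅ z ⁆} (x∈⁅x⁆ u))) (cl iz (∖⊆ i)))

   at-most : ∣ σ ∣ < d
   at-most = ℕP.≤∧≢⇒< (ℕP.≤-pred (ℕP.≤∧≢⇒< (ℕP.≤-trans (ℕP.≤-reflexive (sym (∣∖∣ iz))) (s≤s (dim (∖-face iz)))) not-simplex)) not-d

   abstract
    s r : ℕ
    s = ∣ σ ∣ ∸ 3
    r = d ∸ suc ∣ σ ∣

    size : ∣ σ ∣ ≡ 3 +ℕ s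
    size = sym (ℕP.m+[n∸m]≡n at-least-3)

    dims : 4 +ℕ r +ℕ s ≡ d
    dims = trans (lem r s) (trans (cong (λ k → suc k +ℕ r) (sym size)) (ℕP.m+[n∸m]≡n at-most))
      where
      lem : ∀ r s → 4 +ℕ r +ℕ s ≡ suc (3 +ℕ s) +ℕ r
      lem = ℕ-solve-∀

   min-core : ∀ {ν} → Clique ν → ∣ ν ∣ ≤ 2 +ℕ s → Face ν
   min-core c le = min c (ℕP.≤-trans (s≤s le) (ℕP.≤-reflexive (sym size)))

   module C = Core {σ} {s} {r} size dims cl gap min-core
   module J = Join d Δ pm iz gap (∖-face iz) (ℕP.≤-trans (s≤s z≤n) 5≤d) C.exchange

-- The shape of the complex

-- The cyclic successor below `c`, kept on natural numbers because a walk along the cycle is indexed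
-- by them before its length is known.
Next : ℕ → ℕ → ℕ → Set
Next c i j = (suc i ≡ j × j < c) ⊎ (suc i ≡ c × j ≡ 0)

next-of : ∀ {c i} → i < c → ∃ λ j → Next c i j × j < c
next-of {c} {i} lt with ℕP.m≤n⇒m<n∨m≡n lt
... | inj₁ l = suc i , inj₁ (refl , l) , l
... | inj₂ e = 0 , inj₂ (e , refl) , ℕP.≤-trans (s≤s z≤n) lt

record Polygon {n : ℕ} (M : Fin n → Fin n → Bool) : Set where
  field
    w : ℕ → Fin n
    c : ℕ
    3≤c : 3 ≤ c
    distinct : ∀ {i j} → i < j → j < c → w i ≢ w j
    side : ∀ {i j} → Next c i j → M (w i) (w j) ≡ true
    sides : ∀ {i v} → i < c → M (w i) v ≡ true → ∃ λ j → (Next c i j ⊎ Next c j i) × j < c × v ≡ w j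

record TwoBoundaries {n : ℕ} (d : ℕ) (Δ : Cx n) : Set where
  field
    σ U : Subset n
    s r : ℕ
    size-σ : ∣ σ ∣ ≡ 3 +ℕ s
    size-U : ∣ U ∣ ≡ 3 +ℕ r
    dims : 4 +ℕ r +ℕ s ≡ d
    disjoint : Disjoint σ U
    face⁻ : ∀ {ρ} → Δ ρ ≡ true → ρ ⊆ σ ∪ U × ¬ (σ ⊆ ρ) × ¬ (U ⊆ ρ)
    face⁺ : ∀ {ρ} → ρ ⊆ σ ∪ U → ¬ (σ ⊆ ρ) → ¬ (U ⊆ ρ) → Δ ρ ≡ true

record BoundaryPolygon {n : ℕ} (d : ℕ) (Δ : Cx n) (c : ℕ) : Set where
  field
    σ : Subset n
    s : ℕ
    size-σ : ∣ σ ∣ ≡ 3 +ℕ s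
    dims : 4 +ℕ s ≡ d
    w : ℕ → Fin n
    distinct : ∀ {i j} → i < j → j < c → w i ≢ w j
    w∉σ : ∀ {i} → i < c → w i ∉ σ
    face⁻ : ∀ {ρ} → Δ ρ ≡ true → ¬ (σ ⊆ ρ) × ∃ λ i → ∃ λ j → i < c × Next c i j × (∀ {x} → x ∈ ρ → x ∈ σ ⊎ x ≡ w i ⊎ x ≡ w j)
    face⁺ : ∀ {ρ i j} → ¬ (σ ⊆ ρ) → i < c → Next c i j → (∀ {x} → x ∈ ρ → x ∈ σ ⊎ x ≡ w i ⊎ x ≡ w j) → Δ ρ ≡ true

not-⊆ : ∀ {n} {σ ρ : Subset n} → ¬ (σ ⊆ ρ) → ∃ λ x → x ∈ σ × x ∉ ρ
not-⊆ {σ = σ} {ρ} h with find (λ x → lookup σ x ∧ not (lookup ρ x))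
... | inj₁ (x , e) = x , mem⁻ (∧ˡ (lookup σ x) e) , nmem⁻ (bnot (∧ʳ (lookup σ x) e))
... | inj₂ z = ⊥-elim (h sub)
  where
  sub : σ ⊆ ρ
  sub {x} i with x ∈? ρ
  ... | yes j = j
  ... | no j = contra (∧⁺ (mem i) (cong not (nmem j))) (z x)

-- Tracing a link cycle

module Trace {n : ℕ} (d : ℕ) (Δ : Cx n) (pm : NormalPM d Δ) {τ : Subset n} (f : PM.Face d Δ pm τ) (e : 2 +ℕ ∣ τ ∣ ≡ d) where

  open PM d Δ pm
  open Surface d Δ pm using (degree2)

  Arc : Set
  Arc = Σ[ a ∈ Fin n ] Σ[ b ∈ Fin n ] E τ a b ≡ true

  abstract
   onward : (q : Arc) → ∃ λ c → E τ (proj₁ (proj₂ q)) c ≡ true × proj₁ q ≢ c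
   onward (a , b , ab) = another (E τ b) (degree2 f e (E⁻ ab)) (E-flip ab)

  turn : Arc → Arc
  turn q = proj₁ (proj₂ q) , proj₁ (onward q) , proj₁ (proj₂ (onward q))

  only-two : ∀ {b x y u} → E τ b x ≡ true → E τ b y ≡ true → E τ b u ≡ true → x ≢ y → u ≡ x ⊎ u ≡ y
  only-two {b} {x} {y} {u} bx by bu x≢y with u ≟F x | u ≟F y
  ... | yes p | _ = inj₁ p
  ... | no _ | yes p = inj₂ p
  ... | no p | no q = ⊥-elim (three (ℤP.≤-trans (ℤP.≤-reflexive (sym (cong₂ _+_ (cong ⟦_⟧ bx) (cong₂ _+_ (cong ⟦_⟧ by) (cong ⟦_⟧ bu)))))
       (∑-≥₃ {f = λ v → ⟦ E τ b v ⟧} (λ v → 0≤⟦⟧ (E τ b v)) x≢y (λ eq → p (sym eq)) (λ eq → q (sym eq)))) (degree2 f e (E₁ bx)))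
    where
    three : ∀ {a} → pos 3 ≤ℤ a → a ≡ pos 2 → Empty
    three (+≤+ (s≤s (s≤s ()))) refl

  module From (start : Arc) where

    walk : ℕ → Arc
    walk zero = start
    walk (suc i) = turn (walk i)

    w : ℕ → Fin n
    w i = proj₁ (walk i)

    forth : ∀ i → E τ (w i) (w (suc i)) ≡ true
    forth i = proj₂ (proj₂ (walk i))

    back : ∀ i → E τ (w (suc i)) (w i) ≡ true
    back i = E-flip (forth i)

    straight : ∀ i → w i ≢ w (suc (suc i))
    straight i = proj₂ (proj₂ (onward (walk i)))

    Distinct : ℕ → Set
    Distinct c = ∀ {i j} → i < j → j < c → w i ≢ w j

    Closes : Set
    Closes = ∃ λ c → 3 ≤ c × Distinct c × w c ≡ w 0

    -- The neighbours of `w (suc i)` are `w i` and `w (suc (suc i))`. If the walk came back to it,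
    -- the predecessor of `w c` would have to be one of them, which distinctness or `straight`
    -- excludes. So the walk can close up only at `w 0`.
    no-return : ∀ {i c} → Distinct c → suc i < c → w (suc i) ≢ w c
    no-return {i} {suc c} dis (s≤s lt) eq with only-two (back i) (forth (suc i)) (subst (λ v → E τ v (w c) ≡ true) (sym eq) (back c)) (straight i)
    ... | inj₁ q = dis lt ℕP.≤-refl (sym q)
    ... | inj₂ q with ℕP.m≤n⇒m<n∨m≡n lt
    ...   | inj₂ refl = E≢ (forth (suc i)) (sym eq)
    ...   | inj₁ l with ℕP.m≤n⇒m<n∨m≡n l
    ...     | inj₂ refl = straight (suc i) eq
    ...     | inj₁ l′ = dis l′ ℕP.≤-refl (sym q)

    close : ∀ c → Distinct c → w 0 ≡ w c → 1 ≤ c → Closes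
    close (suc zero) dis eq _ = ⊥-elim (E≢ (forth 0) (sym eq))
    close (suc (suc zero)) dis eq _ = ⊥-elim (straight 0 eq)
    close (suc (suc (suc c))) dis eq _ = suc (suc (suc c)) , s≤s (s≤s (s≤s z≤n)) , dis , sym eq

    extend : ∀ c → 1 ≤ c → Distinct c → Closes ⊎ Distinct (suc c)
    extend c c≥1 dis with w 0 ≟F w c
    ... | yes eq = inj₁ (close c dis eq c≥1)
    ... | no ne = inj₂ more
      where
      more : Distinct (suc c)
      more {i} {j} lt (s≤s le) with ℕP.m≤n⇒m<n∨m≡n le
      ... | inj₁ l = dis lt l
      more {zero} {j} lt (s≤s le) | inj₂ refl = ne
      more {suc i} {j} lt (s≤s le) | inj₂ refl = no-return dis lt

    iterate : ∀ k → Closes ⊎ Distinct (suc k)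
    iterate zero = inj₂ (λ { {i} {zero} () _ ; {i} {suc j} _ (s≤s ()) })
    iterate (suc k) with iterate k
    ... | inj₁ q = inj₁ q
    ... | inj₂ dis = extend (suc k) (s≤s z≤n) dis

    abstract
     -- By the pigeonhole principle, `suc n` positions of the walk cannot all be distinct.
     closes : Closes
     closes with iterate n
     ... | inj₁ q = q
     ... | inj₂ dis with pigeonhole (ℕP.n<1+n n) (λ i → w (toℕ i))
     ...   | i , j , lt , eq = ⊥-elim (dis lt (toℕ<n j) eq)

    polygon : Polygon (E τ)
    polygon = record { w = w ; c = c ; 3≤c = proj₁ (proj₂ closes) ; distinct = dis ; side = side ; sides = sides }
      where
      c = proj₁ closes
      dis = proj₁ (proj₂ (proj₂ closes))
      wc : w c ≡ w 0
      wc = proj₂ (proj₂ (proj₂ closes))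
      side : ∀ {i j} → Next c i j → E τ (w i) (w j) ≡ true
      side {i} (inj₁ (refl , _)) = forth i
      side {i} (inj₂ (p , refl)) = subst (λ v → E τ (w i) v ≡ true) (trans (cong w p) wc) (forth i)
      up : ∀ {i v} → i < c → v ≡ w (suc i) → ∃ λ j → (Next c i j ⊎ Next c j i) × j < c × v ≡ w j
      up {i} lt q with ℕP.m≤n⇒m<n∨m≡n lt
      ... | inj₁ l = suc i , inj₁ (inj₁ (refl , l)) , l , q
      ... | inj₂ p = 0 , inj₁ (inj₂ (p , refl)) , ℕP.≤-trans (s≤s z≤n) lt , trans q (trans (cong w p) wc)
      sides : ∀ {i v} → i < c → E τ (w i) v ≡ true → ∃ λ j → (Next c i j ⊎ Next c j i) × j < c × v ≡ w j
      sides {suc i} lt h with only-two (back i) (forth (suc i)) h (straight i)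
      ... | inj₁ q = i , inj₂ (inj₁ (refl , lt)) , ℕP.<⇒≤ lt , q
      ... | inj₂ q = up lt q
      sides {zero} {v} lt h = first (c ∸ 1) (ℕP.m+[n∸m]≡n (ℕP.≤-trans (s≤s z≤n) (proj₁ (proj₂ closes))))
        where
        -- The other neighbour of `w 0` is the last vertex `w c′`, which differs from `w 1` because
        -- `3 ≤ c`.
        first : ∀ c′ → suc c′ ≡ c → ∃ λ j → (Next c 0 j ⊎ Next c j 0) × j < c × v ≡ w j
        first c′ p with only-two (forth 0) (E-flip (subst (λ u → E τ (w c′) u ≡ true) (trans (cong w p) wc) (forth c′))) h
             (dis {1} {c′} (ℕP.≤-pred (ℕP.≤-trans (proj₁ (proj₂ closes)) (ℕP.≤-reflexive (sym p)))) (ℕP.≤-reflexive p))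
        ... | inj₁ q = up lt q
        ... | inj₂ q = c′ , inj₂ (inj₂ (p , refl)) , ℕP.≤-reflexive p , q

module Shapes {n : ℕ} (d : ℕ) (5≤d : 5 ≤ d) (Δ : Cx n) (pm : NormalPM d Δ) (prime : Prime d Δ) (γ⊥≡2 : Rigidity.γ d Δ pm ⊥ d ≡ pos 2) where

  open Bounds d Δ pm
  open Search d 5≤d Δ pm prime γ⊥≡2
  open Minimal d Δ pm prime γ⊥≤2

  module _ (m : MinimalNonface) where

    open MinimalNonface m
    open Sized m
    open C using (exchange; shared-link; triple-of; Shared; shared-nbr; proper; outside)

    ζ : Subset n
    ζ = σ ∖ z

    size-ζ : ∣ ζ ∣ ≡ 2 +ℕ s
    size-ζ = ∣∖∣-suc iz size

    fζ : Face ζ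
    fζ = ∖-face iz

    σ⊈ : ∀ {ρ} → (∃ λ y → y ∈ σ × y ∉ ρ) → ¬ (σ ⊆ ρ)
    σ⊈ (y , i , k) h = k (h i)

    U : Subset n
    U = tabulate (N ζ)

    ∈U : ∀ {u} → N ζ u ≡ true → u ∈ U
    ∈U {u} e = mem⁻ (trans (lookup∘tabulate (N ζ) u) e)

    ∈U⁻ : ∀ {u} → u ∈ U → N ζ u ≡ true
    ∈U⁻ {u} i = trans (sym (lookup∘tabulate (N ζ) u)) (mem i)

    U-disjoint : Disjoint σ U
    U-disjoint i j = outside iz (∈U⁻ j) i

    rest-N : ∀ {ρ u} → Face (ζ ∪ J.rest ρ) → u ∈ J.rest ρ → N ζ u ≡ true
    rest-N {ρ} f i = N⁺ (λ k → J.rest-disjoint {ρ} (∖⊆ k) i) (down (▸-⊆ (λ k → ∈∪ˡ k) (∈∪ʳ {σ = ζ} i)) f)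

    disjoint-ζ : ∀ {π} → Disjoint σ π → Disjoint ζ π
    disjoint-ζ h i = h (∖⊆ i)

    join-size : ∀ {π} → Disjoint σ π → ∣ ζ ∪ π ∣ ≡ 2 +ℕ s +ℕ ∣ π ∣
    join-size {π} h = trans (∣∪∣ (disjoint-ζ h)) (cong (_+ℕ ∣ π ∣) size-ζ)

    dims-ζ : 2 +ℕ s +ℕ (2 +ℕ r) ≡ d
    dims-ζ = trans (lem s r) dims
      where
      lem : ∀ s r → 2 +ℕ s +ℕ (2 +ℕ r) ≡ 4 +ℕ r +ℕ s
      lem = ℕ-solve-∀

    module Big (0<r : 1 ≤ r) where

      -- Every link vertex is shared and hence adjacent to `z`, so `D` for empty `α` is all of `U`.
      -- The assumption `1 ≤ r` ensures the nonnegative `γ` that `few` requires.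
      few-vertices : ∣ U ∣ ≤ 3 +ℕ r
      few-vertices = from (triple-of iz)
        where
        from : (∃ λ x → ∃ λ y → C.Triple x y z) → ∣ U ∣ ≤ 3 +ℕ r
        from (x , y , T) = ℤP.drop‿+≤+ (subst₂ _≤ℤ_ (trans (♯-cong same) (sym (∣∣-♯ U))) (cong pos (ℕP.+-comm r 3)) (C.halve {♯ K.D} {pos r + pos 3} (K.few nonneg)))
          where
          module K = C.Count T {⊥} {r} (cong (_+ℕ r) (∣⊥∣≡0 n)) (λ i → ⊥-elim (∉⊥ i)) (subst Face (sym (∪-identityʳ ζ)) fζ)
          base′ : K.τ ▸ x ▸ y ≡ ζ
          base′ = trans K.base≡ (∪-identityʳ ζ)
          nonneg : 0ℤ ≤ℤ γ (K.τ ▸ x ▸ y) (2 +ℕ r)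
          nonneg = subst₂ (λ τ k → 0ℤ ≤ℤ γ τ k) (sym base′) (cong (2 +ℕ_) (ℕP.m+[n∸m]≡n 0<r))
             (γ-nonneg (r ∸ 1) fζ (trans (cong (λ k → 2 +ℕ k +ℕ ∣ ζ ∣) (ℕP.m+[n∸m]≡n 0<r)) (trans (cong (2 +ℕ r +ℕ_) size-ζ) (trans (ℕP.+-comm (2 +ℕ r) (2 +ℕ s)) dims-ζ))))
          same : ∀ u → K.D u ≡ lookup U u
          same u = bool-ext (λ q → mem (∈U (K.V-nbr (∧ˡ (K.V u) q)))) (λ q → close (∈U⁻ (mem⁻ q)))
            where
            close : N ζ u ≡ true → K.D u ≡ true
            close Nu = ∧⁺ (subst (λ τ → N τ u ≡ true) (sym base′) Nu)
               (E⁺ (E₁ K.E-zx) (λ i → proj₁ S (∈τ i)) (λ eq → proj₁ S (subst (_∈ σ) (sym eq) iz))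
                  (down (▸-⊆ (▸-⊆ (λ i → ∈▸ˡ (∈∖⁺ (∈τ i) (λ { refl → x∉τ i }))) (∈▸ˡ (∈∖⁺ iz (λ q → T.xz (sym q))))) (∈▸ʳ {σ = σ ∖ x})) (proj₂ S T.ix)))
              where
              module T = C.Triple T
              S : Shared u
              S = shared-link iz Nu
              ∈τ : ∀ {v} → v ∈ K.τ → v ∈ σ
              ∈τ i = T.ρ⊆ (subst (_ ∈_) (∪-identityʳ T.ρ) i)
              x∉τ : x ∉ K.τ
              x∉τ i = T.x∉ (subst (_ ∈_) (∪-identityʳ T.ρ) i)

      abstract
       seed : Σ[ F ∈ Subset n ] (ζ ⊆ F × Face F × ∣ F ∣ ≡ d)
       seed = pure fζ

      F π : Subset n
      F = proj₁ seed
      π = J.rest F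

      z∉F : z ∉ F
      z∉F i = contra (down whole (proj₁ (proj₂ (proj₂ seed)))) gap
        where
        whole : σ ⊆ F
        whole {u} j with u ≟F z
        ... | yes refl = i
        ... | no ne = proj₁ (proj₂ seed) (∈∖⁺ j ne)

      ζπ-face : Face (ζ ∪ π)
      ζπ-face = down (∪-⊆ (proj₁ (proj₂ seed)) J.rest⊆) (proj₁ (proj₂ (proj₂ seed)))

      size-π : ∣ π ∣ ≡ 2 +ℕ r
      size-π = ℕP.+-cancelˡ-≡ (2 +ℕ s) ∣ π ∣ (2 +ℕ r) (trans (sym (join-size (J.rest-disjoint {F})))
         (trans (cong ∣_∣ (⊆-antisym (∪-⊆ (proj₁ (proj₂ seed)) J.rest⊆) (J.split⊆ z∉F))) (trans (proj₂ (proj₂ (proj₂ seed))) (sym dims-ζ))))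

      π⊆U : π ⊆ U
      π⊆U i = ∈U (rest-N {F} ζπ-face i)

      abstract
       -- The ridge opposite `b` in the facet `ζ ∪ π` lies in a second facet.
       other : ∀ {b} → b ∈ π → ∃ λ c → c ∈ U × c ∉ π × Face ((ζ ∪ (π ∖ b)) ▸ c)
       other {b} ib = from (another (N R) (ridge fR eR) Nb)
         where
         R : Subset n
         R = ζ ∪ (π ∖ b)
         fR : Face R
         fR = down (∪-mono {σ = ζ} (λ i → i) ∖⊆) ζπ-face
         eR : 1 +ℕ ∣ R ∣ ≡ d
         eR = trans (cong suc (join-size {π ∖ b} (λ i j → J.rest-disjoint {F} i (∖⊆ j)))) (trans (sym (ℕP.+-suc (2 +ℕ s) ∣ π ∖ b ∣)) (trans (cong (2 +ℕ s +ℕ_) (trans (∣∖∣ ib) size-π)) dims-ζ))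
         Nb : N R b ≡ true
         Nb = N⁺ (∉∪ (λ i → J.rest-disjoint {F} (∖⊆ i) ib) (∉∖ {σ = π})) (down (▸-⊆ (∪-mono {σ = ζ} (λ i → i) ∖⊆) (∈∪ʳ {σ = ζ} ib)) ζπ-face)
         from : (∃ λ c → N R c ≡ true × b ≢ c) → ∃ λ c → c ∈ U × c ∉ π × Face (R ▸ c)
         from (c , Nc , ne) = c , ∈U (N-mono {ζ} {R} (λ i → ∈∪ˡ i) Nc) , (λ i → N∉ Nc (∈∪ʳ {σ = ζ} (∈∖⁺ i (λ eq → ne (sym eq))))) , NF Nc

      abstract
       apex : ∃ λ a → a ∈ U × a ∉ π
       apex = from (inhabited size-π)
        where
        from : (∃ λ b → b ∈ π) → ∃ λ a → a ∈ U × a ∉ π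
        from (b , ib) = proj₁ (other ib) , proj₁ (proj₂ (other ib)) , proj₁ (proj₂ (proj₂ (other ib)))

      a : Fin n
      a = proj₁ apex

      a∉π : a ∉ π
      a∉π = proj₂ (proj₂ apex)

      U≡ : π ▸ a ≡ U
      U≡ = ⊆-full (▸-⊆ π⊆U (proj₁ (proj₂ apex))) (ℕP.≤-trans few-vertices (ℕP.≤-reflexive (sym (trans (∣▸∣ a∉π) (cong suc size-π)))))

      U⁻ : ∀ {v} → v ∈ U → v ∈ π ⊎ v ≡ a
      U⁻ {v} i = ∈▸⁻ (subst (v ∈_) (sym U≡) i)

      -- All the vertices supplied by `other` coincide with `a`, the only vertex of `U` outside `π`;
      -- hence the link of `ζ` contains the whole boundary of the simplex on `U`.
      U-facet : ∀ {b} → b ∈ U → Face (ζ ∪ (U ∖ b))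
      U-facet {b} ib = cases (U⁻ ib)
        where
        from : ∀ {b} → (∃ λ c → c ∈ U × c ∉ π × Face ((ζ ∪ (π ∖ b)) ▸ c)) → Face (ζ ∪ (U ∖ b))
        from {b} (c , ic , nc , f) = down (∪-⊆ (λ i → ∈▸ˡ (∈∪ˡ i)) (λ i → sub (∈∖⁻ {σ = U} i) (U⁻ (∖⊆ i)))) f
          where
          c≡a : c ∈ π ⊎ c ≡ a → c ≡ a
          c≡a (inj₁ j) = ⊥-elim (nc j)
          c≡a (inj₂ eq) = eq
          sub : ∀ {v} → v ∈ U × v ≢ b → v ∈ π ⊎ v ≡ a → v ∈ (ζ ∪ (π ∖ b)) ▸ c
          sub (_ , ne) (inj₁ j) = ∈▸ˡ (∈∪ʳ {σ = ζ} (∈∖⁺ j ne))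
          sub _ (inj₂ eq) = subst (_∈ (ζ ∪ (π ∖ b)) ▸ c) (trans (c≡a (U⁻ ic)) (sym eq)) (∈▸ʳ {σ = ζ ∪ (π ∖ b)})
        cases : b ∈ π ⊎ b ≡ a → Face (ζ ∪ (U ∖ b))
        cases (inj₁ j) = from (other j)
        cases (inj₂ eq) = down (∪-mono {σ = ζ} (λ i → i) (λ i → sub (∈∖⁻ {σ = U} i) (U⁻ (∖⊆ i)))) ζπ-face
          where
          sub : ∀ {v} → v ∈ U × v ≢ b → v ∈ π ⊎ v ≡ a → v ∈ π
          sub _ (inj₁ j) = j
          sub (_ , ne) (inj₂ eq′) = ⊥-elim (ne (trans eq′ (sym eq)))

      size-U : ∣ U ∣ ≡ 3 +ℕ r
      size-U = trans (cong ∣_∣ (sym U≡)) (trans (∣▸∣ a∉π) (cong suc size-π))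

      two-boundaries : TwoBoundaries d Δ
      two-boundaries = record
        { σ = σ ; U = U ; s = s ; r = r ; size-σ = size ; size-U = size-U ; dims = dims ; disjoint = U-disjoint
        ; face⁻ = λ {ρ} f → from {ρ} (J.face⁻ f)
        ; face⁺ = λ {ρ} sub hσ hU → to {ρ} sub (not-⊆ hσ) (not-⊆ hU) }
        where
        from : ∀ {ρ} → Σ[ y ∈ Fin n ] (y ∈ σ × y ∉ ρ × Face (ζ ∪ J.rest ρ)) → ρ ⊆ σ ∪ U × ¬ (σ ⊆ ρ) × ¬ (U ⊆ ρ)
        from {ρ} (y , iy , ny , f) = sub , σ⊈ (y , iy , ny) , λ h → ℕP.1+n≰n (ℕP.≤-trans (ℕP.≤-reflexive (sym big)) (dim (down (∪-mono {σ = ζ} (λ i → i) (λ {v} i → J.∈rest (h i) (λ j → U-disjoint j i))) f)))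
          where
          place : ∀ {v} → v ∈ ρ → Dec (v ∈ σ) → v ∈ σ ∪ U
          place i (yes j) = ∈∪ˡ j
          place i (no j) = ∈∪ʳ {σ = σ} (∈U (rest-N {ρ} f (J.∈rest i j)))
          sub : ρ ⊆ σ ∪ U
          sub {v} i = place i (v ∈? σ)
          big : ∣ ζ ∪ U ∣ ≡ suc d
          big = trans (join-size U-disjoint) (trans (cong (2 +ℕ s +ℕ_) size-U) (trans (ℕP.+-suc (2 +ℕ s) (2 +ℕ r)) (cong suc dims-ζ)))
        to : ∀ {ρ} → ρ ⊆ σ ∪ U → (∃ λ y → y ∈ σ × y ∉ ρ) → (∃ λ b → b ∈ U × b ∉ ρ) → Face ρ
        to {ρ} sub (y , iy , ny) (b , ib , nb) = J.face⁺ iy ny (down (∪-mono {σ = ζ} (λ i → i) small) (U-facet ib))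
          where
          place : ∀ {v} → v ∈ J.rest ρ → v ∈ σ ⊎ v ∈ U → v ∈ U ∖ b
          place i (inj₁ j) = ⊥-elim (J.rest-disjoint {ρ} j i)
          place i (inj₂ j) = ∈∖⁺ j (λ eq → nb (subst (_∈ ρ) eq (J.rest⊆ i)))
          small : J.rest ρ ⊆ U ∖ b
          small i = place i (x∈p∪q⁻ σ U (sub (J.rest⊆ i)))

    module Small (r≡0 : r ≡ 0) where

      dim-ζ : 2 +ℕ ∣ ζ ∣ ≡ d
      dim-ζ = trans (cong (2 +ℕ_) size-ζ) (trans (cong (λ k → 4 +ℕ k +ℕ s) (sym r≡0)) dims)

      module Tr = Trace d Δ pm fζ dim-ζ

      abstract
       polygon : Polygon (E ζ)
       polygon = Tr.From.polygon (proj₁ arc , proj₁ (proj₂ arc) , proj₂ (proj₂ arc))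
         where
         arc : Σ[ a ∈ Fin n ] Σ[ b ∈ Fin n ] E ζ a b ≡ true
         arc with link-vertex 1 fζ dim-ζ
         ... | u , Nu with ♯-∃ (E ζ u) (subst (1ℤ ≤ℤ_) (sym (Surface.degree2 d Δ pm fζ dim-ζ Nu)) (+≤+ (s≤s z≤n)))
         ...   | v , Ev = u , v , Ev

      open Polygon polygon

      -- The traced polygon is closed under adjacency and the link is connected, so no second cycle
      -- remains.
      reached : ∀ {v} → N ζ v ≡ true → ∃ λ i → i < c × v ≡ w i
      reached Nv = conn {ζ} {0} fζ dim-ζ (λ v → ∃ λ i → i < c × v ≡ w i) along (E₁ (side {0} {1} (inj₁ (refl , ℕP.≤-trans (s≤s (s≤s z≤n)) 3≤c)))) Nv
         (0 , ℕP.≤-trans (s≤s z≤n) 3≤c , refl)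
        where
        along : ∀ {u v} → E ζ u v ≡ true → (∃ λ i → i < c × u ≡ w i) → ∃ λ i → i < c × v ≡ w i
        along h (i , lt , refl) with sides lt h
        ... | j , _ , lt′ , q = j , lt′ , q

      N-w : ∀ {i} → i < c → N ζ (w i) ≡ true
      N-w lt with next-of lt
      ... | j , nx , _ = E₁ (side nx)

      cover-rest : ∀ {ρ i j} → (∀ {x} → x ∈ J.rest ρ → x ≡ w i ⊎ x ≡ w j) → ∀ {x} → x ∈ ρ → x ∈ σ ⊎ x ≡ w i ⊎ x ≡ w j
      cover-rest h {x} i with x ∈? σ
      ... | yes k = inj₁ k
      ... | no k = inj₂ (h (J.∈rest i k))

      small-rest : ∀ {ρ} → Face (ζ ∪ J.rest ρ) → ∣ J.rest ρ ∣ ≤ 2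
      small-rest {ρ} f = ℕP.+-cancelˡ-≤ (2 +ℕ s) ∣ J.rest ρ ∣ 2 (ℕP.≤-trans (ℕP.≤-reflexive (sym (join-size (J.rest-disjoint {ρ})))) (ℕP.≤-trans (dim f)
         (ℕP.≤-reflexive (trans (sym dims-ζ) (cong (λ k → 2 +ℕ s +ℕ (2 +ℕ k)) r≡0)))))

      Side : (Fin n → Set) → Set
      Side P = ∃ λ i → ∃ λ j → i < c × Next c i j × (∀ {x} → P x → x ≡ w i ⊎ x ≡ w j)

      -- At most two vertices lie outside `σ`. If there are two they form a link edge, so they are
      -- cyclic neighbours; a single vertex is placed on the side to its successor, and no vertex on
      -- the side from 0 to 1.
      in-side : ∀ {ρ} → Face (ζ ∪ J.rest ρ) → Side (_∈ J.rest ρ)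
      in-side {ρ} f = start (find (lookup (J.rest ρ)))
        where
        pair : ∀ {i q} → i < c → w i ∈ J.rest ρ → q ∈ J.rest ρ ∖ w i → Side (_∈ J.rest ρ)
        pair {i} {q} lt p∈ q∈ = from (sides lt (E⁺ (N-w lt) (N∉ Nq) (proj₂ (∈∖⁻ q∈)) (down (▸-⊆ (▸-⊆ (λ k → ∈∪ˡ k) (∈∪ʳ {σ = ζ} p∈)) (∈∪ʳ {σ = ζ} (∖⊆ q∈))) f)))
          where
          Nq : N ζ q ≡ true
          Nq = rest-N {ρ} f (∖⊆ q∈)
          two′ : ∀ {x} → x ∈ J.rest ρ → Dec (x ≡ w i) → Dec (x ≡ q) → x ≡ w i ⊎ x ≡ q
          two′ k (yes e) _ = inj₁ e
          two′ k (no _) (yes e) = inj₂ e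
          two′ {x} k (no e) (no e′) = ⊥-elim (ℕP.1+n≰n (ℕP.≤-trans three (small-rest {ρ} f)))
            where
            one : 1 ≤ ∣ J.rest ρ ∖ w i ∖ q ∣
            one = ℕP.≤-trans (s≤s z≤n) (ℕP.≤-reflexive (∣∖∣ {σ = J.rest ρ ∖ w i ∖ q} {x} (∈∖⁺ (∈∖⁺ k e) e′)))
            three : 3 ≤ ∣ J.rest ρ ∣
            three = ℕP.≤-trans (s≤s (s≤s one)) (ℕP.≤-reflexive (trans (cong suc (∣∖∣ q∈)) (∣∖∣ p∈)))
          two : ∀ {x} → x ∈ J.rest ρ → x ≡ w i ⊎ x ≡ q
          two {x} k = two′ k (x ≟F w i) (x ≟F q)
          from : (∃ λ j → (Next c i j ⊎ Next c j i) × j < c × q ≡ w j) → Side (_∈ J.rest ρ)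
          from (j , inj₁ nx , lt′ , eq) = i , j , lt , nx , λ k → turn (two k)
            where
            turn : ∀ {x} → x ≡ w i ⊎ x ≡ q → x ≡ w i ⊎ x ≡ w j
            turn (inj₁ e) = inj₁ e
            turn (inj₂ e) = inj₂ (trans e eq)
          from (j , inj₂ nx , lt′ , eq) = j , i , lt′ , nx , λ k → turn (two k)
            where
            turn : ∀ {x} → x ≡ w i ⊎ x ≡ q → x ≡ w j ⊎ x ≡ w i
            turn (inj₁ e) = inj₂ e
            turn (inj₂ e) = inj₁ (trans e eq)
        single : ∀ {p} → p ∈ J.rest ρ → (∃ λ i → i < c × p ≡ w i) → (∃ λ q → lookup (J.rest ρ ∖ p) q ≡ true) ⊎ (∀ q → lookup (J.rest ρ ∖ p) q ≡ false) → Side (_∈ J.rest ρ)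
        single ip (i , lt , refl) (inj₁ (q , iq)) = pair lt ip (mem⁻ iq)
        single ip (i , lt , refl) (inj₂ none) = i , proj₁ (next-of lt) , lt , proj₁ (proj₂ (next-of lt)) , λ {x} k → only k (x ≟F w i)
          where
          only : ∀ {x} → x ∈ J.rest ρ → Dec (x ≡ w i) → x ≡ w i ⊎ x ≡ w (proj₁ (next-of lt))
          only k (yes q) = inj₁ q
          only {x} k (no ne) = contra (mem (∈∖⁺ k ne)) (none x)
        start : (∃ λ p → lookup (J.rest ρ) p ≡ true) ⊎ (∀ p → lookup (J.rest ρ) p ≡ false) → Side (_∈ J.rest ρ)
        start (inj₂ none) = 0 , 1 , ℕP.≤-trans (s≤s z≤n) 3≤c , inj₁ (refl , ℕP.≤-trans (s≤s (s≤s z≤n)) 3≤c) , λ {x} i → contra (mem i) (none x)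
        start (inj₁ (p , ip)) = single (mem⁻ ip) (reached (rest-N {ρ} f (mem⁻ ip))) (find (lookup (J.rest ρ ∖ p)))

      boundary-polygon : BoundaryPolygon d Δ c
      boundary-polygon = record
        { σ = σ ; s = s ; size-σ = size ; dims = trans (cong (λ k → 4 +ℕ k +ℕ s) (sym r≡0)) dims ; w = w ; distinct = distinct
        ; w∉σ = λ lt → outside iz (N-w lt)
        ; face⁻ = λ {ρ} f → from {ρ} (J.face⁻ f)
        ; face⁺ = λ {ρ} h lt nx cov → to {ρ} (not-⊆ h) nx cov }
        where
        from : ∀ {ρ} → Σ[ y ∈ Fin n ] (y ∈ σ × y ∉ ρ × Face (ζ ∪ J.rest ρ)) → ¬ (σ ⊆ ρ) × ∃ λ i → ∃ λ j → i < c × Next c i j × (∀ {x} → x ∈ ρ → x ∈ σ ⊎ x ≡ w i ⊎ x ≡ w j)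
        from {ρ} (y , iy , ny , f) = σ⊈ (y , iy , ny) , widen (in-side {ρ} f)
          where
          widen : Side (_∈ J.rest ρ) → ∃ λ i → ∃ λ j → i < c × Next c i j × (∀ {x} → x ∈ ρ → x ∈ σ ⊎ x ≡ w i ⊎ x ≡ w j)
          widen (i , j , lt , nx , h) = i , j , lt , nx , cover-rest {ρ} h
        to : ∀ {ρ i j} → (∃ λ y → y ∈ σ × y ∉ ρ) → Next c i j → (∀ {x} → x ∈ ρ → x ∈ σ ⊎ x ≡ w i ⊎ x ≡ w j) → Face ρ
        to {ρ} {i} {j} (y , iy , ny) nx cov = J.face⁺ iy ny (down (∪-⊆ (λ k → ∈▸ˡ (∈▸ˡ k)) (λ k → place k (cov (J.rest⊆ k)))) (E▸ (side nx)))
          where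
          place : ∀ {x} → x ∈ J.rest ρ → x ∈ σ ⊎ x ≡ w i ⊎ x ≡ w j → x ∈ ζ ▸ w i ▸ w j
          place k (inj₁ l) = ⊥-elim (J.rest-disjoint {ρ} l k)
          place k (inj₂ (inj₁ refl)) = ∈▸ˡ (∈▸ʳ {σ = ζ})
          place k (inj₂ (inj₂ refl)) = ∈▸ʳ {σ = ζ ▸ w i}

  shape : TwoBoundaries d Δ ⊎ (∃ λ c → 3 ≤ c × BoundaryPolygon d Δ c)
  shape = from minimal
    where
    from : MinimalNonface → TwoBoundaries d Δ ⊎ (∃ λ c → 3 ≤ c × BoundaryPolygon d Δ c)
    from m = cases (ℕP.m≤n⇒m<n∨m≡n (z≤n {Sized.r m}))
      where
      cases : (0 < Sized.r m) ⊎ (0 ≡ Sized.r m) → TwoBoundaries d Δ ⊎ (∃ λ c → 3 ≤ c × BoundaryPolygon d Δ c)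
      cases (inj₁ lt) = inj₁ (Big.two-boundaries m lt)
      cases (inj₂ eq) = inj₂ (_ , Polygon.3≤c (Small.polygon m (sym eq)) , Small.boundary-polygon m (sym eq))

-- Isomorphisms and central retriangulations

any-map : ∀ {A A′ : Set} (P : A′ → Bool) (f : A → A′) xs → any P (map f xs) ≡ any (λ x → P (f x)) xs
any-map P f [] = refl
any-map P f (x ∷ xs) = cong (P (f x) ∨_) (any-map P f xs)

any-++ : ∀ {A : Set} (P : A → Bool) xs ys → any P (xs ++ ys) ≡ any P xs ∨ any P ys
any-++ P [] ys = refl
any-++ P (x ∷ xs) ys with P x
... | true = refl
... | false = any-++ P xs ys

∨-true : ∀ a {b} → a ∨ b ≡ true → (a ≡ true) ⊎ (b ≡ true)
∨-true true _ = inj₁ refl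
∨-true false h = inj₂ h

∨ʳ : ∀ a {b} → b ≡ true → a ∨ b ≡ true
∨ʳ true _ = refl
∨ʳ false h = h

any-allFin⁺ : ∀ {n} (P : Fin n → Bool) i → P i ≡ true → any P (allFin n) ≡ true
any-allFin⁺ P zero h = cong (_∨ any P (map suc (allFin _))) h
any-allFin⁺ P (suc i) h = ∨ʳ (P zero) (trans (any-map P suc (allFin _)) (any-allFin⁺ (λ i → P (suc i)) i h))

any-allFin⁻ : ∀ {n} (P : Fin n → Bool) → any P (allFin n) ≡ true → ∃ λ i → P i ≡ true
any-allFin⁻ {suc n} P h with ∨-true (P zero) h
... | inj₁ q = zero , q
... | inj₂ q with any-allFin⁻ (λ i → P (suc i)) (trans (sym (any-map P suc (allFin n))) q)
...   | i , r = suc i , r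

anyS⁺ : ∀ {n} (P : Subset n → Bool) σ → P σ ≡ true → anyS P ≡ true
anyS⁺ P [] h = cong (_∨ false) h
anyS⁺ {suc n} P (false ∷ σ) h = trans (any-++ P (map (false ∷_) (allSubsets n)) _) (cong (_∨ any P (map (true ∷_) (allSubsets n))) (trans (any-map P (false ∷_) (allSubsets n)) (anyS⁺ (λ σ → P (false ∷ σ)) σ h)))
anyS⁺ {suc n} P (true ∷ σ) h = trans (any-++ P (map (false ∷_) (allSubsets n)) _) (∨ʳ (any P (map (false ∷_) (allSubsets n))) (trans (any-map P (true ∷_) (allSubsets n)) (anyS⁺ (λ σ → P (true ∷ σ)) σ h)))

anyS⁻ : ∀ {n} (P : Subset n → Bool) → anyS P ≡ true → ∃ λ σ → P σ ≡ true
anyS⁻ {zero} P h with ∨-true (P []) h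
... | inj₁ q = [] , q
anyS⁻ {suc n} P h with ∨-true (any P (map (false ∷_) (allSubsets n))) (trans (sym (any-++ P (map (false ∷_) (allSubsets n)) _)) h)
... | inj₁ q with anyS⁻ (λ σ → P (false ∷ σ)) (trans (sym (any-map P (false ∷_) (allSubsets n))) q)
...   | σ , r = false ∷ σ , r
anyS⁻ {suc n} P h | inj₂ q with anyS⁻ (λ σ → P (true ∷ σ)) (trans (sym (any-map P (true ∷_) (allSubsets n))) q)
...   | σ , r = true ∷ σ , r

∈tab : ∀ {n} (P : Fin n → Bool) {i} → P i ≡ true → i ∈ tabulate P
∈tab P {i} h = mem⁻ (trans (lookup∘tabulate P i) h)

∈tab⁻ : ∀ {n} (P : Fin n → Bool) {i} → i ∈ tabulate P → P i ≡ true
∈tab⁻ P {i} h = trans (sym (lookup∘tabulate P i)) (mem h)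

∈image⁺ : ∀ {n m} (f : Fin n → Fin m) {σ i} → i ∈ σ → f i ∈ image f σ
∈image⁺ f {σ} {i} h = ∈tab _ (any-allFin⁺ (λ k → lookup σ k ∧ (f k == f i)) i (∧⁺ (mem h) (==-refl (f i))))

∈image⁻ : ∀ {n m} (f : Fin n → Fin m) {σ j} → j ∈ image f σ → ∃ λ i → i ∈ σ × f i ≡ j
∈image⁻ f {σ} {j} h with any-allFin⁻ (λ k → lookup σ k ∧ (f k == j)) (∈tab⁻ (λ j → any (λ i → lookup σ i ∧ (f i == j)) (allFin _)) h)
... | i , q = i , mem⁻ (∧ˡ (lookup σ i) q) , ==⇒≡ (∧ʳ (lookup σ i) q)

record Enumeration {n : ℕ} (X : Subset n) (k : ℕ) : Set where
  field
    at : Fin k → Fin n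
    at∈ : ∀ i → at i ∈ X
    at-inj : ∀ {i j} → at i ≡ at j → i ≡ j
    onto : ∀ {x} → x ∈ X → ∃ λ i → at i ≡ x

enumerate : ∀ k {n} {X : Subset n} → ∣ X ∣ ≡ k → Enumeration X k
enumerate zero {X = X} e = record { at = λ () ; at∈ = λ () ; at-inj = λ { {()} } ; onto = λ {x} i → ⊥-elim (∉⊥ (subst (x ∈_) (∣∣-0 e) i)) }
enumerate (suc k) {n} {X} e = from (inhabited e)
  where
  from : (∃ λ a → a ∈ X) → Enumeration X (suc k)
  from (a , ia) = record { at = at′ ; at∈ = at∈′ ; at-inj = inj ; onto = onto′ }
    where
    open Enumeration (enumerate k {X = X ∖ a} (∣∖∣-suc ia e))
    at′ : Fin (suc k) → Fin n
    at′ zero = a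
    at′ (suc i) = at i
    at∈′ : ∀ i → at′ i ∈ X
    at∈′ zero = ia
    at∈′ (suc i) = ∖⊆ (at∈ i)
    inj : ∀ {i j} → at′ i ≡ at′ j → i ≡ j
    inj {zero} {zero} _ = refl
    inj {zero} {suc j} q = ⊥-elim (proj₂ (∈∖⁻ (at∈ j)) (sym q))
    inj {suc i} {zero} q = ⊥-elim (proj₂ (∈∖⁻ (at∈ i)) q)
    inj {suc i} {suc j} q = cong suc (at-inj q)
    onto′ : ∀ {x} → x ∈ X → ∃ λ i → at′ i ≡ x
    onto′ {x} i with x ≟F a
    ... | yes refl = zero , refl
    ... | no ne with onto (∈∖⁺ i ne)
    ...   | j , q = suc j , q

module _ {n M : ℕ} (Δ : Cx n) (Γ : Cx (suc M)) (p : Fin (suc M) → Fin n) (inj : ∀ {i j} → p i ≡ p j → i ≡ j)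
  (covered : ∀ {σ x} → Δ σ ≡ true → x ∈ σ → ∃ λ i → p i ≡ x)
  (push : ∀ {ρ} → Γ ρ ≡ true → Δ (image p ρ) ≡ true)
  (pull : ∀ {σ} → Δ σ ≡ true → Γ (tabulate (λ i → lookup σ (p i))) ≡ true) where

  inverse : Fin n → Fin (suc M)
  inverse x with any? (λ i → p i ≟F x)
  ... | yes (i , _) = i
  -- A default value: by `covered`, points outside the range of `p` are not vertices of `Δ`.
  ... | no _ = zero

  inverse-p : ∀ i → inverse (p i) ≡ i
  inverse-p i with any? (λ j → p j ≟F p i)
  ... | yes (j , q) = inj q
  ... | no none = ⊥-elim (none (i , refl))

  pulled : Subset n → Subset (suc M)
  pulled σ = tabulate (λ i → lookup σ (p i))

  image-pulled : ∀ {σ} → Δ σ ≡ true → image p (pulled σ) ≡ σ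
  image-pulled {σ} f = ⊆-antisym to from
    where
    to : image p (pulled σ) ⊆ σ
    to h with ∈image⁻ p {pulled σ} h
    ... | i , q , refl = mem⁻ {σ = σ} (∈tab⁻ (λ i → lookup σ (p i)) q)
    from : σ ⊆ image p (pulled σ)
    from h with covered f h
    ... | i , refl = ∈image⁺ p (∈tab (λ i → lookup σ (p i)) (mem h))

  inverse-image : ∀ ρ → image inverse (image p ρ) ≡ ρ
  inverse-image ρ = ⊆-antisym to from
    where
    to : image inverse (image p ρ) ⊆ ρ
    to h with ∈image⁻ inverse {image p ρ} h
    ... | x , q , refl with ∈image⁻ p {ρ} q
    ...   | i , r , refl = subst (_∈ ρ) (sym (inverse-p i)) r
    from : ρ ⊆ image inverse (image p ρ)
    from {i} h = subst (_∈ image inverse (image p ρ)) (inverse-p i) (∈image⁺ inverse (∈image⁺ p h))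

  -- Models are compared by placing their positions in `Δ`. The required map runs the other way, so
  -- the placement is inverted on its range.
  iso-from : Iso Δ Γ
  iso-from = inverse , injective
    , (λ σ f → subst (λ ρ → Γ ρ ≡ true) (sym (trans (cong (image inverse) (sym (image-pulled {σ} f))) (inverse-image (pulled σ)))) (pull {σ} f))
    , (λ τ g → image p τ , push {τ} g , inverse-image τ)
    where
    injective : ∀ u v → IsVertex Δ u → IsVertex Δ v → inverse u ≡ inverse v → u ≡ v
    injective u v fu fv q with covered {⁅ u ⁆} fu (x∈⁅x⁆ u) | covered {⁅ v ⁆} fv (x∈⁅x⁆ v)
    ... | i , refl | j , refl = cong p (trans (sym (inverse-p i)) (trans q (inverse-p j)))

-- Cuts the positions of a model into two blocks without prescribing their order, so that one
-- comparison serves both the join and the retriangulation.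
record Labelling (M a b : ℕ) : Set where
  field
    lab : Fin M → Fin a ⊎ Fin b
    unlab : Fin a ⊎ Fin b → Fin M
    lab-unlab : ∀ y → lab (unlab y) ≡ y
    unlab-lab : ∀ i → unlab (lab i) ≡ i

swap-labels : ∀ {M a b} → Labelling M a b → Labelling M b a
swap-labels L = record { lab = λ i → sw (lab i) ; unlab = λ y → unlab (sw y)
    ; lab-unlab = λ y → trans (cong sw (lab-unlab (sw y))) (sw-sw y) ; unlab-lab = λ i → trans (cong unlab (sw-sw (lab i))) (unlab-lab i) }
  where
  open Labelling L
  sw : ∀ {A A′ : Set} → A ⊎ A′ → A′ ⊎ A
  sw (inj₁ x) = inj₂ x
  sw (inj₂ y) = inj₁ y
  sw-sw : ∀ {A A′ : Set} (y : A ⊎ A′) → sw (sw y) ≡ y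
  sw-sw (inj₁ x) = refl
  sw-sw (inj₂ y) = refl

split-labels : ∀ {M} a b → M ≡ a +ℕ b → Labelling M a b
split-labels a b eq = record
  { lab = λ i → Data.Fin.splitAt a (cast eq i) ; unlab = λ y → cast (sym eq) (Data.Fin.join a b y)
  ; lab-unlab = λ y → trans (cong (Data.Fin.splitAt a) (cast-involutive eq (sym eq) (Data.Fin.join a b y))) (splitAt-join a b y)
  ; unlab-lab = λ i → trans (cong (cast (sym eq)) (join-splitAt a b (cast eq i))) (cast-involutive (sym eq) eq i) }

module Labelled {n M a b : ℕ} (L : Labelling (suc M) a b) (e : Fin a → Fin n) (e-inj : ∀ {i j} → e i ≡ e j → i ≡ j)
  (f : Fin b → Fin n) (f-inj : ∀ {i j} → f i ≡ f j → i ≡ j) (apart : ∀ i j → e i ≢ f j) where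

  open Labelling L

  value : Fin a ⊎ Fin b → Fin n
  value (inj₁ i) = e i
  value (inj₂ j) = f j

  value-inj : ∀ {y y′} → value y ≡ value y′ → y ≡ y′
  value-inj {inj₁ i} {inj₁ j} q = cong inj₁ (e-inj q)
  value-inj {inj₁ i} {inj₂ j} q = ⊥-elim (apart i j q)
  value-inj {inj₂ i} {inj₁ j} q = ⊥-elim (apart j i (sym q))
  value-inj {inj₂ i} {inj₂ j} q = cong inj₂ (f-inj q)

  p : Fin (suc M) → Fin n
  p i = value (lab i)

  p-inj : ∀ {i j} → p i ≡ p j → i ≡ j
  p-inj {i} {j} q = trans (sym (unlab-lab i)) (trans (cong unlab (value-inj q)) (unlab-lab j))

  p-unlab : ∀ y → p (unlab y) ≡ value y
  p-unlab y = cong value (lab-unlab y)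

  ∈push⁻ : ∀ {ρ} y → value y ∈ image p ρ → unlab y ∈ ρ
  ∈push⁻ {ρ} y h with ∈image⁻ p {ρ} h
  ... | i , q , r = subst (_∈ ρ) (p-inj (trans r (sym (p-unlab y)))) q

  ∈pull⁻ : ∀ {σ} y → unlab y ∈ tabulate (λ i → lookup σ (p i)) → value y ∈ σ
  ∈pull⁻ {σ} y h = subst (_∈ σ) (p-unlab y) (mem⁻ {σ = σ} (∈tab⁻ (λ i → lookup σ (p i)) h))

  reach : ∀ {x} y → value y ≡ x → ∃ λ i → p i ≡ x
  reach y q = unlab y , trans (p-unlab y) q

-- Faces of a central retriangulation along a star

module Retriangulation {M : ℕ} (d : ℕ) (S : Cx M) (τ : Subset M)
  (mono : ∀ {ρ G} → ρ ⊆ G → S (G ∪ τ) ≡ true → S (ρ ∪ τ) ≡ true)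
  (extend : ∀ {ρ} → S (ρ ∪ τ) ≡ true → Σ[ F ∈ Subset M ] (ρ ∪ τ ⊆ F × S F ≡ true × ∣ F ∣ ≡ suc d))
  (bounded : ∀ {F} → τ ⊆ F → S F ≡ true → ∣ F ∣ ≤ suc d)
  (interior : ∀ {G} → τ ⊆ G → S G ≡ true → ∣ G ∣ ≡ d → ♯ (λ v → not (lookup G v) ∧ S (G ▸ v)) ≢ 1ℤ) where

  ∪-absorb : ∀ {ρ} → τ ⊆ ρ → ρ ∪ τ ≡ ρ
  ∪-absorb s = ⊆-antisym (∪-⊆ (λ i → i) s) (λ i → ∈∪ˡ i)

  fits : Subset M → Subset M → Bool
  fits ρ G = st S τ G ∧ (∣ G ∣ ≡ᵇ d) ∧ (ρ ⊆ᵇ G) ∧ (facetsContaining (suc d) (st S τ) G ≡ᵇ 1)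

  facets-at : ∀ {G} → ∣ G ∣ ≡ d → pos (facetsContaining (suc d) (st S τ) G) ≡ ♯ (λ v → not (lookup G v) ∧ S ((G ▸ v) ∪ τ))
  facets-at {G} e = facets-♯ (st S τ) G (cong suc e)

  -- Delete from a facet of the star a vertex `t` of `τ` outside `ρ`. In the star the resulting
  -- ridge lies in no other facet: joining `τ` restores `t`, and any further vertex would exceed the
  -- size bound.
  bdry⁺ : ∀ {ρ} → S (ρ ∪ τ) ≡ true → ¬ (τ ⊆ ρ) → bdry (suc d) (st S τ) ρ ≡ true
  bdry⁺ {ρ} h nt = from (not-⊆ nt) (extend {ρ} h)
    where
    from : (∃ λ t → t ∈ τ × t ∉ ρ) → Σ[ F ∈ Subset M ] (ρ ∪ τ ⊆ F × S F ≡ true × ∣ F ∣ ≡ suc d) → bdry (suc d) (st S τ) ρ ≡ true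
    from (t , it , nt) (F , s , fF , eF) = anyS⁺ (fits ρ) G (∧⁺ (trans (cong S G∪τ) fF) (∧⁺ (≡ᵇ⁺ eG) (∧⁺ (⊆ᵇ⁺ ρ⊆G) (≡ᵇ⁺ (pos-inj (trans (facets-at eG) one))))))
      where
      G = F ∖ t
      iF : t ∈ F
      iF = s (∈∪ʳ {σ = ρ} it)
      eG : ∣ G ∣ ≡ d
      eG = ∣∖∣-suc iF eF
      ρ⊆G : ρ ⊆ G
      ρ⊆G i = ∈∖⁺ (s (∈∪ˡ i)) (λ { refl → nt i })
      back : F ⊆ G ∪ τ
      back {u} i with u ≟F t
      ... | yes refl = ∈∪ʳ {σ = G} it
      ... | no ne = ∈∪ˡ (∈∖⁺ i ne)
      G∪τ : G ∪ τ ≡ F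
      G∪τ = ⊆-antisym (∪-⊆ ∖⊆ (λ i → s (∈∪ʳ {σ = ρ} i))) back
      only : ∀ v → (not (lookup G v) ∧ S ((G ▸ v) ∪ τ)) ≡ (t == v)
      only v = bool-ext to fr
        where
        to : (not (lookup G v) ∧ S ((G ▸ v) ∪ τ)) ≡ true → (t == v) ≡ true
        to q with t ≟F v
        ... | yes _ = refl
        ... | no ne = ⊥-elim (ℕP.1+n≰n (ℕP.≤-trans (ℕP.≤-reflexive (trans (cong suc (sym eF)) (sym (∣▸∣ v∉F))))
               (ℕP.≤-trans (p⊆q⇒∣p∣≤∣q∣ big) (bounded {(G ▸ v) ∪ τ} (λ i → ∈∪ʳ {σ = G ▸ v} i) (∧ʳ (not (lookup G v)) q)))))
          where
          v∉F : v ∉ F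
          v∉F i = nmem⁻ (bnot (∧ˡ (not (lookup G v)) q)) (∈∖⁺ i (λ eq → ne (sym eq)))
          big : F ▸ v ⊆ (G ▸ v) ∪ τ
          big = ▸-⊆ (λ i → ∪-mono {σ = G} {G ▸ v} (λ k → ∈▸ˡ k) (λ k → k) (back i)) (∈∪ˡ (∈▸ʳ {σ = G}))
        fr : (t == v) ≡ true → (not (lookup G v) ∧ S ((G ▸ v) ∪ τ)) ≡ true
        fr q = subst (λ v → (not (lookup G v) ∧ S ((G ▸ v) ∪ τ)) ≡ true) (==⇒≡ q)
           (∧⁺ (cong not (nmem (∉∖ {σ = F}))) (trans (cong S (trans (cong (_∪ τ) (∖▸ iF)) (∪-absorb (λ i → s (∈∪ʳ {σ = ρ} i))))) fF))
      one : ♯ (λ v → not (lookup G v) ∧ S ((G ▸ v) ∪ τ)) ≡ 1ℤ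
      one = trans (♯-cong only) (trans (∑-cong (λ v → sym (ℤP.*-identityʳ ⟦ t == v ⟧))) (∑-δ t (λ _ → 1ℤ)))

  -- A boundary ridge does not contain `τ`: above `τ` the star agrees with `S`, where `interior`
  -- forbids a ridge in exactly one facet.
  bdry⁻ : ∀ {ρ} → bdry (suc d) (st S τ) ρ ≡ true → S (ρ ∪ τ) ≡ true × ¬ (τ ⊆ ρ)
  bdry⁻ {ρ} h = from (anyS⁻ (fits ρ) h)
    where
    from : (∃ λ G → fits ρ G ≡ true) → S (ρ ∪ τ) ≡ true × ¬ (τ ⊆ ρ)
    from (G , q) = mono {ρ} {G} ρ⊆G SG , λ s → interior (λ i → ρ⊆G (s i)) (trans (cong S (sym (∪-absorb (λ i → ρ⊆G (s i))))) SG) eG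
        (trans (♯-cong (λ v → cong (λ F → not (lookup G v) ∧ S F) (sym (∪-absorb {G ▸ v} (λ i → ∈▸ˡ (ρ⊆G (s i))))))) (trans (sym (facets-at eG)) (cong pos (≡ᵇ⁻ (∧ʳ (ρ ⊆ᵇ G) q₂)))))
      where
      SG = ∧ˡ (st S τ G) q
      q₁ = ∧ʳ (st S τ G) q
      q₂ = ∧ʳ (∣ G ∣ ≡ᵇ d) q₁
      eG : ∣ G ∣ ≡ d
      eG = ≡ᵇ⁻ (∧ˡ (∣ G ∣ ≡ᵇ d) q₁)
      ρ⊆G : ρ ⊆ G
      ρ⊆G = ⊆ᵇ⁻ (∧ˡ (ρ ⊆ᵇ G) q₂)

  C : Cx (suc M)
  C = crtr (suc d) (st S τ) S

  old⁻ : ∀ {ρ} → C (false ∷ ρ) ≡ true → S ρ ≡ true × ¬ (τ ⊆ ρ)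
  old⁻ {ρ} h = Sρ , λ s → contra (trans (cong S (∪-absorb s)) Sρ) (fst (bnot (∧ʳ (S ρ) h)) (≢true (λ b → proj₂ (bdry⁻ {ρ} b) s)))
    where
    Sρ = ∧ˡ (S ρ) h
    fst : ∀ {a b} → (a ∧ not b) ≡ false → b ≡ false → a ≡ false
    fst {false} _ _ = refl
    fst {true} h refl = h

  old⁺ : ∀ {ρ} → S ρ ≡ true → ¬ (τ ⊆ ρ) → C (false ∷ ρ) ≡ true
  old⁺ {ρ} h nt = ∧⁺ h (cong not (kill (bcase (S (ρ ∪ τ)))))
    where
    kill : (S (ρ ∪ τ) ≡ true) ⊎ (S (ρ ∪ τ) ≡ false) → (S (ρ ∪ τ) ∧ not (bdry (suc d) (st S τ) ρ)) ≡ false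
    kill (inj₁ q) = trans (cong (S (ρ ∪ τ) ∧_) (cong not (bdry⁺ {ρ} q nt))) (∧-zeroʳ (S (ρ ∪ τ)))
    kill (inj₂ q) = cong (_∧ not (bdry (suc d) (st S τ) ρ)) q

two-iso : ∀ {n M a b} {Δ : Cx n} {X Y : Subset n} (L : Labelling (suc M) a b) → Enumeration X a → Enumeration Y b → Disjoint X Y
  → (∀ {ρ} → Δ ρ ≡ true → ρ ⊆ X ∪ Y × ¬ (X ⊆ ρ) × ¬ (Y ⊆ ρ)) → (∀ {ρ} → ρ ⊆ X ∪ Y → ¬ (X ⊆ ρ) → ¬ (Y ⊆ ρ) → Δ ρ ≡ true)
  → let open Labelling L in (Γ : Cx (suc M)) → (∀ {ρ} → Γ ρ ≡ true → ¬ (∀ i → unlab (inj₁ i) ∈ ρ) × ¬ (∀ j → unlab (inj₂ j) ∈ ρ))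
  → (∀ {ρ} → ¬ (∀ i → unlab (inj₁ i) ∈ ρ) → ¬ (∀ j → unlab (inj₂ j) ∈ ρ) → Γ ρ ≡ true) → Iso Δ Γ
two-iso {Δ = Δ} {X} {Y} L EX EY dis face⁻ face⁺ Γ Γ⁻ Γ⁺ = iso-from Δ Γ p p-inj covered push pull
  where
  module X = Enumeration EX
  module Y = Enumeration EY
  open Labelling L
  open Labelled L X.at X.at-inj Y.at Y.at-inj (λ i j eq → dis (X.at∈ i) (subst (_∈ Y) (sym eq) (Y.at∈ j)))
  covered : ∀ {σ x} → Δ σ ≡ true → x ∈ σ → ∃ λ i → p i ≡ x
  covered f h with x∈p∪q⁻ X Y (proj₁ (face⁻ f) h)
  ... | inj₁ i = reach (inj₁ (proj₁ (X.onto i))) (proj₂ (X.onto i))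
  ... | inj₂ i = reach (inj₂ (proj₁ (Y.onto i))) (proj₂ (Y.onto i))
  value∈ : ∀ y → value y ∈ X ∪ Y
  value∈ (inj₁ i) = ∈∪ˡ (X.at∈ i)
  value∈ (inj₂ j) = ∈∪ʳ {σ = X} (Y.at∈ j)
  push : ∀ {ρ} → Γ ρ ≡ true → Δ (image p ρ) ≡ true
  push {ρ} g = face⁺ sub (λ s → proj₁ (Γ⁻ g) (λ i → ∈push⁻ (inj₁ i) (s (X.at∈ i)))) (λ s → proj₂ (Γ⁻ g) (λ j → ∈push⁻ (inj₂ j) (s (Y.at∈ j))))
    where
    sub : image p ρ ⊆ X ∪ Y
    sub h with ∈image⁻ p {ρ} h
    ... | i , _ , refl = value∈ (lab i)
  pull : ∀ {σ} → Δ σ ≡ true → Γ (tabulate (λ i → lookup σ (p i))) ≡ true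
  pull {σ} f = Γ⁺ (λ h → proj₁ (proj₂ (face⁻ f)) (λ {x} i → subst (_∈ σ) (proj₂ (X.onto i)) (∈pull⁻ {σ} (inj₁ (proj₁ (X.onto i))) (h (proj₁ (X.onto i))))))
                  (λ h → proj₂ (proj₂ (face⁻ f)) (λ {x} i → subst (_∈ σ) (proj₂ (Y.onto i)) (∈pull⁻ {σ} (inj₂ (proj₁ (Y.onto i))) (h (proj₁ (Y.onto i))))))

not-full : ∀ {k} {σ : Subset k} → ¬ (∀ i → i ∈ σ) → not (σ ==S ⊤) ≡ true
not-full {σ = σ} h with σ ==S ⊤ in eq
... | true = ⊥-elim (h (λ i → subst (i ∈_) (sym (==S⁻ {σ = σ} eq)) ∈⊤))
... | false = refl

not-full⁻ : ∀ {k} {σ : Subset k} → not (σ ==S ⊤) ≡ true → ¬ (∀ i → i ∈ σ)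
not-full⁻ {σ = σ} e h = contra (==S⁺ (⊆-antisym {i = σ} {⊤} (λ _ → ∈⊤) (λ {x} _ → h x))) (bnot e)

∈take : ∀ a {b} (ρ : Subset (a +ℕ b)) i → lookup (take a ρ) i ≡ lookup ρ (Data.Fin.join a b (inj₁ i))
∈take (suc a) (x ∷ ρ) zero = refl
∈take (suc a) (x ∷ ρ) (suc i) = ∈take a ρ i

∈drop : ∀ a {b} (ρ : Subset (a +ℕ b)) i → lookup (drop a ρ) i ≡ lookup ρ (Data.Fin.join a b (inj₂ i))
∈drop zero ρ i = refl
∈drop (suc a) (x ∷ ρ) i = ∈drop a ρ i

module JoinPositions (a b : ℕ) where

  L : Labelling (a +ℕ b) a b
  L = split-labels a b refl
  open Labelling L public

  unlab-join : ∀ y → unlab y ≡ Data.Fin.join a b y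
  unlab-join y = cast-is-id refl (Data.Fin.join a b y)

  ∈take⁺ : ∀ {ρ i} → unlab (inj₁ i) ∈ ρ → i ∈ take a ρ
  ∈take⁺ {ρ} {i} h = mem⁻ (trans (∈take a ρ i) (mem (subst (_∈ ρ) (unlab-join (inj₁ i)) h)))

  ∈take⁻ : ∀ {ρ i} → i ∈ take a ρ → unlab (inj₁ i) ∈ ρ
  ∈take⁻ {ρ} {i} h = subst (_∈ ρ) (sym (unlab-join (inj₁ i))) (mem⁻ (trans (sym (∈take a ρ i)) (mem h)))

  ∈drop⁺ : ∀ {ρ i} → unlab (inj₂ i) ∈ ρ → i ∈ drop a ρ
  ∈drop⁺ {ρ} {i} h = mem⁻ (trans (∈drop a ρ i) (mem (subst (_∈ ρ) (unlab-join (inj₂ i)) h)))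

  ∈drop⁻ : ∀ {ρ i} → i ∈ drop a ρ → unlab (inj₂ i) ∈ ρ
  ∈drop⁻ {ρ} {i} h = subst (_∈ ρ) (sym (unlab-join (inj₂ i))) (mem⁻ (trans (sym (∈drop a ρ i)) (mem h)))

enumeration-size : ∀ {n k} {X : Subset n} → Enumeration X k → ∣ X ∣ ≡ k
enumeration-size {X = X} E = ℕP.≤-antisym (injective⇒≤ {f = λ i → proj₁ (E.onto (F.at∈ i))} (λ {i} {j} q → F.at-inj (trans (sym (proj₂ (E.onto (F.at∈ i)))) (trans (cong E.at q) (proj₂ (E.onto (F.at∈ j)))))))
                              (injective⇒≤ {f = λ i → proj₁ (F.onto (E.at∈ i))} (λ {i} {j} q → E.at-inj (trans (sym (proj₂ (F.onto (E.at∈ i)))) (trans (cong F.at q) (proj₂ (F.onto (E.at∈ j)))))))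
  where
  module E = Enumeration E
  module F = Enumeration (enumerate ∣ X ∣ {X = X} refl)

tail∈ : ∀ {m b} {ρ : Subset m} {k} → suc k ∈ b ∷ ρ → k ∈ ρ
tail∈ (there h) = h

Retriangulated : ∀ {n} → ℕ → Cx n → Set
Retriangulated d Δ = Σ[ m ∈ ℕ ] Σ[ S ∈ Cx m ] Σ[ τ ∈ Subset m ]
  (Stacked d m S × S τ ≡ true × 1 < ∣ τ ∣ × ∣ τ ∣ < d × Iso Δ (crtr d (st S τ) S))

inj₂? : ∀ {A A′ : Set} → A ⊎ A′ → Bool
inj₂? (inj₁ _) = false
inj₂? (inj₂ _) = true

inj₂?⁻ : ∀ {A A′ : Set} (y : A ⊎ A′) → inj₂? y ≡ true → ∃ λ j → y ≡ inj₂ j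
inj₂?⁻ (inj₂ j) _ = j , refl

-- The join of two simplex boundaries

module TwoBoundariesModel {n : ℕ} (s r : ℕ) (Δ : Cx n) (T : TwoBoundaries (4 +ℕ r +ℕ s) Δ) (s≡ : TwoBoundaries.s T ≡ s) (r≡ : TwoBoundaries.r T ≡ r) where

  open TwoBoundaries T hiding (s; r)

  d₀ d : ℕ
  d₀ = 3 +ℕ r +ℕ s
  d = suc d₀

  Eσ : Enumeration σ (3 +ℕ s)
  Eσ = enumerate (3 +ℕ s) (trans size-σ (cong (3 +ℕ_) s≡))

  EU : Enumeration U (3 +ℕ r)
  EU = enumerate (3 +ℕ r) (trans size-U (cong (3 +ℕ_) r≡))

  in-Gd : InGd d Δ
  in-Gd = inj₁ (2 +ℕ s , s≤s (s≤s z≤n) , ℕP.+-monoʳ-≤ 2 (ℕP.m≤n+m s r) , subst (λ k → Iso Δ (join (bdSimplex (2 +ℕ s)) (bdSimplex k))) (sym dim-U)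
      (two-iso L Eσ EU disjoint face⁻ face⁺ (join (bdSimplex (2 +ℕ s)) (bdSimplex (2 +ℕ r)))
         (λ {ρ} g → (λ h → not-full⁻ {σ = take (3 +ℕ s) ρ} (∧ˡ _ g) (λ i → ∈take⁺ (h i))) , (λ h → not-full⁻ {σ = drop (3 +ℕ s) ρ} (∧ʳ (not (take (3 +ℕ s) ρ ==S ⊤)) g) (λ i → ∈drop⁺ (h i))))
         (λ h h′ → ∧⁺ (not-full (λ k → h (λ i → ∈take⁻ (k i)))) (not-full (λ k → h′ (λ i → ∈drop⁻ (k i)))))))
    where
    open JoinPositions (3 +ℕ s) (3 +ℕ r)
    dim-U : d ∸ (2 +ℕ s) ≡ 2 +ℕ r
    dim-U = trans (cong (_∸ (2 +ℕ s)) (lem r s)) (ℕP.m+n∸m≡n (2 +ℕ s) (2 +ℕ r))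
      where
      lem : ∀ r s → 4 +ℕ r +ℕ s ≡ 2 +ℕ s +ℕ (2 +ℕ r)
      lem = ℕ-solve-∀

  -- Position 0, the new vertex of the retriangulation, is labelled by a vertex of U.
  L : Labelling (suc (suc d)) (3 +ℕ r) (3 +ℕ s)
  L = split-labels (3 +ℕ r) (3 +ℕ s) (lem r s)
    where
    lem : ∀ r s → 6 +ℕ r +ℕ s ≡ 3 +ℕ r +ℕ (3 +ℕ s)
    lem = ℕ-solve-∀
  open Labelling L

  -- The positions labelled by `σ`, shifted down by one because position 0 is the new vertex and
  -- does not belong to the sphere.
  τ : Subset (suc d)
  τ = tabulate (λ k → inj₂? (lab (suc k)))

  ∈τ⁻ : ∀ {k} → k ∈ τ → ∃ λ j → unlab (inj₂ j) ≡ suc k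
  ∈τ⁻ {k} h with inj₂?⁻ (lab (suc k)) (∈tab⁻ (λ k → inj₂? (lab (suc k))) h)
  ... | j , q = j , trans (cong unlab (sym q)) (unlab-lab (suc k))

  σ-position : ∀ j → ∃ λ k → suc k ≡ unlab (inj₂ j) × k ∈ τ
  σ-position j = k , eq , ∈tab (λ k → inj₂? (lab (suc k))) (cong inj₂? (trans (cong lab eq) (lab-unlab (inj₂ j))))
    where
    ne : zero ≢ unlab (inj₂ j)
    ne q = clash (trans (cong lab q) (lab-unlab (inj₂ j)))
      where
      clash : lab zero ≢ inj₂ j
      clash ()
    k = punchOut ne
    eq : suc k ≡ unlab (inj₂ j)
    eq = punchIn-punchOut ne

  size-τ : ∣ τ ∣ ≡ 3 +ℕ s
  size-τ = enumeration-size (record { at = λ j → proj₁ (σ-position j) ; at∈ = λ j → proj₂ (proj₂ (σ-position j))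
     ; at-inj = λ {i} {j} q → inj (trans (sym (lab-unlab (inj₂ i))) (trans (cong lab (trans (sym (proj₁ (proj₂ (σ-position i)))) (trans (cong suc q) (proj₁ (proj₂ (σ-position j)))))) (lab-unlab (inj₂ j))))
     ; onto = onto })
    where
    inj : ∀ {i j : Fin (3 +ℕ s)} → inj₂ {A = Fin (3 +ℕ r)} i ≡ inj₂ j → i ≡ j
    inj refl = refl
    onto : ∀ {k} → k ∈ τ → ∃ λ j → proj₁ (σ-position j) ≡ k
    onto {k} h with ∈τ⁻ h
    ... | j , q = j , Data.Fin.Properties.suc-injective (trans (proj₁ (proj₂ (σ-position j))) q)

  S : Cx (suc d)
  S = bdSimplex d

  S⁺ : ∀ {ρ k} → k ∉ ρ → S ρ ≡ true
  S⁺ {ρ} {k} h = not-full {σ = ρ} (λ all → h (all k))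

  S⁻ : ∀ {ρ} → S ρ ≡ true → ∃ λ k → k ∉ ρ
  S⁻ {ρ} h with not-⊆ {σ = ⊤} {ρ} (λ s → not-full⁻ {σ = ρ} h (λ i → s ∈⊤))
  ... | k , _ , nk = k , nk

  S-small : ∀ {ρ} → ∣ ρ ∣ ≤ d → S ρ ≡ true
  S-small {ρ} le with extra {σ = ρ} {ρ = ⊤} (ℕP.≤-trans (s≤s le) (ℕP.≤-reflexive (sym (∣⊤∣≡n (suc d)))))
  ... | k , _ , nk = S⁺ nk

  -- A ridge of the boundary of a simplex omits two vertices, and adding either one gives a facet.
  interior : ∀ {G} → τ ⊆ G → S G ≡ true → ∣ G ∣ ≡ d₀ → ♯ (λ v → not (lookup G v) ∧ S (G ▸ v)) ≢ 1ℤ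
  interior {G} s h e one with extra {σ = G} {ρ = ⊤} (ℕP.≤-trans (s≤s (ℕP.≤-trans (ℕP.≤-reflexive e) (ℕP.n≤1+n d₀))) (ℕP.≤-reflexive (sym (∣⊤∣≡n (suc d)))))
  ... | v , _ , nv with extra {σ = G ▸ v} {ρ = ⊤} (ℕP.≤-reflexive (trans (cong suc (trans (∣▸∣ nv) (cong suc e))) (sym (∣⊤∣≡n (suc d)))))
  ...   | v′ , _ , nv′ = absurd one (ℤP.≤-trans (ℤP.≤-reflexive (sym (cong₂ _+_ (cong ⟦_⟧ (out nv)) (cong ⟦_⟧ (out (λ i → nv′ (∈▸ˡ i)))))))
               (∑-≥₂ {f = λ v → ⟦ not (lookup G v) ∧ S (G ▸ v) ⟧} (λ v → 0≤⟦⟧ (not (lookup G v) ∧ S (G ▸ v))) {v} {v′} (λ { refl → nv′ (∈▸ʳ {σ = G}) })))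
    where
    absurd : ∀ {a} → a ≡ 1ℤ → pos 2 ≤ℤ a → Empty
    absurd refl (+≤+ (s≤s ()))
    out : ∀ {v} → v ∉ G → (not (lookup G v) ∧ S (G ▸ v)) ≡ true
    out {v} nv = ∧⁺ (cong not (nmem nv)) (S-small {G ▸ v} (ℕP.≤-reflexive (trans (∣▸∣ nv) (cong suc e))))

  link-mono : ∀ {ρ G} → ρ ⊆ G → S (G ∪ τ) ≡ true → S (ρ ∪ τ) ≡ true
  link-mono {ρ} {G} s h = let k , nk = S⁻ {G ∪ τ} h in S⁺ {k = k} (λ i → nk (∪-mono {σ = ρ} {G} s (λ x → x) i))

  in-facet : ∀ {ρ} → S (ρ ∪ τ) ≡ true → ∃ λ H → ρ ∪ τ ⊆ H × S H ≡ true × ∣ H ∣ ≡ d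
  in-facet {ρ} h = let k , nk = S⁻ {ρ ∪ τ} h in ⊤ ∖ k , (λ {x} i → ∈∖⁺ ∈⊤ (λ eq → nk (subst (_∈ ρ ∪ τ) eq i))) , S⁺ {k = k} (∉∖ {σ = ⊤}) , ∣∖∣-suc ∈⊤ (∣⊤∣≡n (suc d))

  size-bound : ∀ {F} → τ ⊆ F → S F ≡ true → ∣ F ∣ ≤ d
  size-bound {F} s h = let k , nk = S⁻ {F} h in ℕP.≤-pred (ℕP.≤-trans (ℕP.≤-reflexive (sym (∣▸∣ nk))) (∣p∣≤n (F ▸ k)))

  module R = Retriangulation d₀ S τ link-mono in-facet size-bound interior

  zero-label : unlab (inj₁ zero) ≡ zero
  zero-label = unlab-lab zero

  -- The new vertex belongs to the block of `U`. A face without it cannot fill that block; a face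
  -- with it that did would make `ρ ∪ τ` the whole vertex set of the simplex.
  crtr⁻ : ∀ {ρ} → R.C ρ ≡ true → ¬ (∀ i → unlab (inj₁ i) ∈ ρ) × ¬ (∀ j → unlab (inj₂ j) ∈ ρ)
  crtr⁻ {false ∷ ρ} h = (λ all → absurd (subst (_∈ false ∷ ρ) zero-label (all zero))) , (λ all → proj₂ (R.old⁻ {ρ} h) (λ i → let j , q = ∈τ⁻ i in tail∈ (subst (_∈ false ∷ ρ) q (all j))))
    where
    absurd : zero ∈ false ∷ ρ → Empty
    absurd ()
  crtr⁻ {true ∷ ρ} h = (λ all → let k , nk = S⁻ {ρ ∪ τ} (proj₁ (R.bdry⁻ {ρ} h)) in nk (cover all k (lab (suc k)) refl)) , (λ all → proj₂ (R.bdry⁻ {ρ} h) (λ i → let j , q = ∈τ⁻ i in tail∈ (subst (_∈ true ∷ ρ) q (all j))))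
    where
    cover : (∀ i → unlab (inj₁ i) ∈ true ∷ ρ) → ∀ k y → lab (suc k) ≡ y → k ∈ ρ ∪ τ
    cover all k (inj₁ i) q = ∈∪ˡ (tail∈ (subst (_∈ true ∷ ρ) (trans (cong unlab (sym q)) (unlab-lab (suc k))) (all i)))
    cover all k (inj₂ j) q = ∈∪ʳ {σ = ρ} (∈tab (λ k → inj₂? (lab (suc k))) (cong inj₂? q))

  σ-missing : ∀ {b ρ} → ¬ (∀ j → unlab (inj₂ j) ∈ b ∷ ρ) → ¬ (τ ⊆ ρ)
  σ-missing {b} {ρ} h s = h (λ j → let k , q , i = σ-position j in subst (_∈ b ∷ ρ) q (there (s i)))

  crtr⁺ : ∀ {ρ} → ¬ (∀ i → unlab (inj₁ i) ∈ ρ) → ¬ (∀ j → unlab (inj₂ j) ∈ ρ) → R.C ρ ≡ true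
  crtr⁺ {false ∷ ρ} h h′ = R.old⁺ {ρ} (let k , _ , nk = not-⊆ (σ-missing h′) in S⁺ {k = k} nk) (σ-missing h′)
  crtr⁺ {true ∷ ρ} h h′ = R.bdry⁺ {ρ} (not-full {σ = ρ ∪ τ} (λ all → h (λ i → each all i (unlab (inj₁ i)) refl))) (σ-missing h′)
    where
    each : (∀ k → k ∈ ρ ∪ τ) → ∀ i y → unlab (inj₁ i) ≡ y → y ∈ true ∷ ρ
    each all i zero q = here
    each all i (suc k) q with x∈p∪q⁻ ρ τ (all k)
    ... | inj₁ h = there h
    ... | inj₂ h with ∈τ⁻ h
    ...   | j , q′ = ⊥-elim (clash (trans (sym (lab-unlab (inj₁ i))) (trans (cong lab (trans q (sym q′))) (lab-unlab (inj₂ j)))))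
      where
      clash : inj₁ i ≢ inj₂ j
      clash ()

  retriangulated : Retriangulated d Δ
  retriangulated = suc d , S , τ , base , S-small {τ} (ℕP.≤-trans (ℕP.≤-reflexive size-τ) (ℕP.≤-trans small (ℕP.n≤1+n d₀))) , subst (1 <_) (sym size-τ) (s≤s (s≤s z≤n)) , subst (_< d) (sym size-τ) (s≤s small)
      , two-iso L EU Eσ (λ i j → disjoint j i) (λ {ρ} f → flip (face⁻ f)) (λ s h h′ → face⁺ (λ {x} i → subst (x ∈_) (∪-comm U σ) (s i)) h′ h) R.C crtr⁻ crtr⁺
    where
    small : 3 +ℕ s ≤ d₀
    small = ℕP.+-monoʳ-≤ 3 (ℕP.m≤n+m s r)
    flip : ∀ {ρ} → ρ ⊆ σ ∪ U × ¬ (σ ⊆ ρ) × ¬ (U ⊆ ρ) → ρ ⊆ U ∪ σ × ¬ (U ⊆ ρ) × ¬ (σ ⊆ ρ)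
    flip (s , h , h′) = (λ {x} i → subst (x ∈_) (∪-comm σ U) (s i)) , h′ , h

-- The join of a simplex boundary with a cycle

Sides : ∀ {M b} c → Labelling M c b → Subset M → Set
Sides c L ρ = ∃ λ i → ∃ λ j → i < c × Next c i j × (∀ k → Labelling.unlab L (inj₁ k) ∈ ρ → toℕ k ≡ i ⊎ toℕ k ≡ j)

next-bound : ∀ {c i j} → i < c → Next c i j → j < c
next-bound lt (inj₁ (_ , h)) = h
next-bound lt (inj₂ (_ , refl)) = ℕP.≤-trans (s≤s z≤n) lt

polygon-iso : ∀ {n M c b d} {Δ : Cx n} (P : BoundaryPolygon d Δ c) (L : Labelling (suc M) c b) → Enumeration (BoundaryPolygon.σ P) b → (Γ : Cx (suc M))
  → (∀ {ρ} → Γ ρ ≡ true → ¬ (∀ j → Labelling.unlab L (inj₂ j) ∈ ρ) × Sides c L ρ)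
  → (∀ {ρ} → ¬ (∀ j → Labelling.unlab L (inj₂ j) ∈ ρ) → Sides c L ρ → Γ ρ ≡ true) → Iso Δ Γ
polygon-iso {n} {c = c} {Δ = Δ} P L E Γ Γ⁻ Γ⁺ = iso-from Δ Γ p p-inj covered push pull
  where
  open BoundaryPolygon P
  module E = Enumeration E
  open Labelling L
  w-inj : ∀ {i j} → i < c → j < c → w i ≡ w j → i ≡ j
  w-inj {i} {j} li lj eq with ℕP.<-cmp i j
  ... | tri< lt _ _ = ⊥-elim (distinct lt lj eq)
  ... | tri≈ _ q _ = q
  ... | tri> _ _ gt = ⊥-elim (distinct gt li (sym eq))
  open Labelled L (λ k → w (toℕ k)) (λ {i} {j} eq → toℕ-injective (w-inj (toℕ<n i) (toℕ<n j) eq)) E.at E.at-inj (λ k j eq → w∉σ (toℕ<n k) (subst (_∈ σ) (sym eq) (E.at∈ j)))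
  w-reach : ∀ {i x} → i < c → x ≡ w i → ∃ λ y → p y ≡ x
  w-reach lt eq = reach (inj₁ (fromℕ< lt)) (trans (cong w (toℕ-fromℕ< lt)) (sym eq))
  covered : ∀ {ρ x} → Δ ρ ≡ true → x ∈ ρ → ∃ λ y → p y ≡ x
  covered f h with face⁻ f
  ... | _ , i , j , lt , nx , cov with cov h
  ...   | inj₁ q = reach (inj₂ (proj₁ (E.onto q))) (proj₂ (E.onto q))
  ...   | inj₂ (inj₁ q) = w-reach lt q
  ...   | inj₂ (inj₂ q) = w-reach (next-bound lt nx) q
  push : ∀ {ρ} → Γ ρ ≡ true → Δ (image p ρ) ≡ true
  push {ρ} g with Γ⁻ g
  ... | h , i , j , lt , nx , cov = face⁺ (λ s → h (λ k → ∈push⁻ (inj₂ k) (s (E.at∈ k)))) lt nx place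
    where
    at-label : ∀ y → unlab y ∈ ρ → value y ∈ σ ⊎ value y ≡ w i ⊎ value y ≡ w j
    at-label (inj₂ k) _ = inj₁ (E.at∈ k)
    at-label (inj₁ k) m with cov k m
    ... | inj₁ q = inj₂ (inj₁ (cong w q))
    ... | inj₂ q = inj₂ (inj₂ (cong w q))
    place : ∀ {x} → x ∈ image p ρ → x ∈ σ ⊎ x ≡ w i ⊎ x ≡ w j
    place h with ∈image⁻ p {ρ} h
    ... | y , m , refl = at-label (lab y) (subst (_∈ ρ) (sym (unlab-lab y)) m)
  pull : ∀ {ρ} → Δ ρ ≡ true → Γ (tabulate (λ y → lookup ρ (p y))) ≡ true
  pull {ρ} f with face⁻ f
  ... | h , i , j , lt , nx , cov = Γ⁺ (λ all → h (λ {x} m → subst (_∈ ρ) (proj₂ (E.onto m)) (∈pull⁻ {ρ} (inj₂ (proj₁ (E.onto m))) (all (proj₁ (E.onto m)))))) (i , j , lt , nx , sides)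
    where
    sides : ∀ k → unlab (inj₁ k) ∈ tabulate (λ y → lookup ρ (p y)) → toℕ k ≡ i ⊎ toℕ k ≡ j
    sides k m with cov (∈pull⁻ {ρ} (inj₁ k) m)
    ... | inj₁ q = ⊥-elim (w∉σ (toℕ<n k) q)
    ... | inj₂ (inj₁ q) = inj₁ (w-inj (toℕ<n k) lt q)
    ... | inj₂ (inj₂ q) = inj₂ (w-inj (toℕ<n k) (next-bound lt nx) q)

cnext-next : ∀ {c} (i : Fin (suc c)) → Next (suc c) (toℕ i) (toℕ (cnext i))
cnext-next {c} i with ℕP.m≤n⇒m<n∨m≡n (toℕ<n i)
... | inj₁ lt = inj₁ (sym e , subst (_< suc c) (sym e) lt)
  where
  e : toℕ (cnext i) ≡ suc (toℕ i)
  e = trans (toℕ-fromℕ< (m%n<n (suc (toℕ i)) (suc c))) (m<n⇒m%n≡m lt)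
... | inj₂ q = inj₂ (q , trans (toℕ-fromℕ< (m%n<n (suc (toℕ i)) (suc c))) (trans (cong (_% suc c) q) (n%n≡0 (suc c))))

next-unique : ∀ {c i j j′} → Next c i j → Next c i j′ → j ≡ j′
next-unique (inj₁ (p , _)) (inj₁ (q , _)) = trans (sym p) q
next-unique (inj₂ (_ , p)) (inj₂ (_ , q)) = trans p (sym q)
next-unique (inj₁ (refl , lt)) (inj₂ (q , _)) = ⊥-elim (ℕP.<⇒≢ lt q)
next-unique (inj₂ (q , _)) (inj₁ (refl , lt)) = ⊥-elim (ℕP.<⇒≢ lt q)

module _ {c : ℕ} where

  InSide : Subset (suc c) → Set
  InSide ρ = ∃ λ i → ∃ λ j → i < suc c × Next (suc c) i j × (∀ {k} → k ∈ ρ → toℕ k ≡ i ⊎ toℕ k ≡ j)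

  cycle⁻ : ∀ {ρ} → cycleCx (suc c) ρ ≡ true → InSide ρ
  cycle⁻ {ρ} h with ∨-true (∣ ρ ∣ ≤ᵇ 1) h
  ... | inj₂ q with any-allFin⁻ (λ i → ρ ==S (⁅ i ⁆ ∪ ⁅ cnext i ⁆)) q
  ...   | i , e = toℕ i , toℕ (cnext i) , toℕ<n i , cnext-next i , place
    where
    place : ∀ {k} → k ∈ ρ → toℕ k ≡ toℕ i ⊎ toℕ k ≡ toℕ (cnext i)
    place {k} m with x∈p∪q⁻ ⁅ i ⁆ ⁅ cnext i ⁆ (subst (k ∈_) (==S⁻ {σ = ρ} e) m)
    ... | inj₁ r = inj₁ (cong toℕ (x∈⁅y⁆⇒x≡y i r))
    ... | inj₂ r = inj₂ (cong toℕ (x∈⁅y⁆⇒x≡y (cnext i) r))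
  cycle⁻ {ρ} h | inj₁ q with find (lookup ρ)
  ... | inj₂ none = 0 , proj₁ (next-of {suc c} {0} (s≤s z≤n)) , s≤s z≤n , proj₁ (proj₂ (next-of (s≤s z≤n))) , λ {k} m → contra (mem m) (none k)
  ... | inj₁ (a , ia) = toℕ a , proj₁ (next-of (toℕ<n a)) , toℕ<n a , proj₁ (proj₂ (next-of (toℕ<n a))) , λ {k} m → inj₁ (cong toℕ (same k m))
    where
    same : ∀ k → k ∈ ρ → k ≡ a
    same k m with k ≟F a
    ... | yes e = e
    ... | no ne = ⊥-elim (ℕP.1+n≰n (ℕP.≤-trans (ℕP.≤-reflexive refl) (ℕP.≤-trans two (ℕP.≤ᵇ⇒≤ ∣ ρ ∣ 1 (Equivalence.from T-≡ q)))))
      where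
      two : 2 ≤ ∣ ρ ∣
      two = ℕP.≤-trans (s≤s (ℕP.≤-trans (s≤s z≤n) (ℕP.≤-reflexive (∣∖∣ {σ = ρ ∖ a} {k} (∈∖⁺ m ne))))) (ℕP.≤-reflexive (∣∖∣ {σ = ρ} {a} (mem⁻ ia)))

  -- Sets with at most one element are faces in any case, and a larger set contained in a side is
  -- that side.
  cycle⁺ : ∀ {ρ} → InSide ρ → cycleCx (suc c) ρ ≡ true
  cycle⁺ {ρ} (i , j , lt , nx , cov) with bcase (∣ ρ ∣ ≤ᵇ 1)
  ... | inj₁ q = cong (_∨ any (λ i → ρ ==S (⁅ i ⁆ ∪ ⁅ cnext i ⁆)) (allFin (suc c))) q
  ... | inj₂ q = ∨ʳ (∣ ρ ∣ ≤ᵇ 1) (any-allFin⁺ (λ i → ρ ==S (⁅ i ⁆ ∪ ⁅ cnext i ⁆)) a (==S⁺ (⊆-full sub le)))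
    where
    a : Fin (suc c)
    a = fromℕ< lt
    ta : toℕ a ≡ i
    ta = toℕ-fromℕ< lt
    tb : toℕ (cnext a) ≡ j
    tb = next-unique (cnext-next a) (subst (λ i → Next (suc c) i j) (sym ta) nx)
    sub : ρ ⊆ ⁅ a ⁆ ∪ ⁅ cnext a ⁆
    sub {k} m with cov m
    ... | inj₁ e = ∈∪ˡ (subst (λ z → k ∈ ⁅ z ⁆) (toℕ-injective (trans e (sym ta))) (x∈⁅x⁆ k))
    ... | inj₂ e = ∈∪ʳ {σ = ⁅ a ⁆} (subst (λ z → k ∈ ⁅ z ⁆) (toℕ-injective (trans e (sym tb))) (x∈⁅x⁆ k))
    le : ∣ ⁅ a ⁆ ∪ ⁅ cnext a ⁆ ∣ ≤ ∣ ρ ∣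
    le = ℕP.≤-trans (size (cnext a ∈? ⁅ a ⁆)) (ℕP.≰⇒> (λ h → contra (Equivalence.to T-≡ (ℕP.≤⇒≤ᵇ h)) q))
      where
      size : Dec (cnext a ∈ ⁅ a ⁆) → ∣ ⁅ a ⁆ ▸ cnext a ∣ ≤ 2
      size (no h) = ℕP.≤-reflexive (trans (∣▸∣ h) (cong suc (∣⁅x⁆∣≡1 a)))
      size (yes h) = ℕP.≤-trans (p⊆q⇒∣p∣≤∣q∣ (▸-⊆ (λ k → k) h)) (ℕP.≤-trans (ℕP.≤-reflexive (∣⁅x⁆∣≡1 a)) (s≤s z≤n))

-- The stacked sphere ∂(σ ∗ path): the path runs through positions 0, …, l + 1,
-- the remaining e positions are the vertices of σ, and each stacking prolongs the path at position 0.
module Chain (e : ℕ) where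

  τ : ∀ l → Subset (l +ℕ (2 +ℕ e))
  τ zero = false ∷ false ∷ ⊤
  τ (suc l) = false ∷ τ l

  F : ∀ l → Subset (l +ℕ (2 +ℕ e))
  F zero = true ∷ false ∷ ⊤
  F (suc l) = true ∷ τ l

  S : ∀ l → Cx (l +ℕ (2 +ℕ e))
  S zero = bdSimplex (suc e)
  S (suc l) = stackAt (S l) (F l)

  ∈τ⁻ : ∀ l {x} → x ∈ τ l → 2 +ℕ l ≤ toℕ x
  ∈τ⁻ zero (there (there _)) = s≤s (s≤s z≤n)
  ∈τ⁻ (suc l) (there h) = s≤s (∈τ⁻ l h)

  ∈τ⁺ : ∀ l {x} → 2 +ℕ l ≤ toℕ x → x ∈ τ l
  ∈τ⁺ zero {suc (suc x)} _ = there (there ∈⊤)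
  ∈τ⁺ zero {suc zero} (s≤s ())
  ∈τ⁺ (suc l) {suc x} (s≤s h) = there (∈τ⁺ l h)

  ∈F⁻ : ∀ l {x} → x ∈ F l → toℕ x ≡ 0 ⊎ 2 +ℕ l ≤ toℕ x
  ∈F⁻ zero here = inj₁ refl
  ∈F⁻ zero (there (there _)) = inj₂ (s≤s (s≤s z≤n))
  ∈F⁻ (suc l) here = inj₁ refl
  ∈F⁻ (suc l) (there h) = inj₂ (s≤s (∈τ⁻ l h))

  ∈F⁺ : ∀ l {x} → toℕ x ≡ 0 ⊎ 2 +ℕ l ≤ toℕ x → x ∈ F l
  ∈F⁺ zero {zero} _ = here
  ∈F⁺ zero {suc (suc x)} _ = there (there ∈⊤)
  ∈F⁺ zero {suc zero} (inj₂ (s≤s ()))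
  ∈F⁺ (suc l) {zero} _ = here
  ∈F⁺ (suc l) {suc x} (inj₂ (s≤s h)) = there (∈τ⁺ l h)

  τ⊆F : ∀ l → τ l ⊆ F l
  τ⊆F l h = ∈F⁺ l (inj₂ (∈τ⁻ l h))

  size-τ : ∀ l → ∣ τ l ∣ ≡ e
  size-τ zero = ∣⊤∣≡n e
  size-τ (suc l) = size-τ l

  size-F : ∀ l → ∣ F l ∣ ≡ suc e
  size-F zero = cong suc (∣⊤∣≡n e)
  size-F (suc l) = cong suc (size-τ l)

  end : ∀ {l} i → i < 2 +ℕ l → ∃ λ (x : Fin (l +ℕ (2 +ℕ e))) → toℕ x ≡ i
  end {l} i lt = fromℕ< lt′ , toℕ-fromℕ< lt′
    where
    lt′ : i < l +ℕ (2 +ℕ e)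
    lt′ = ℕP.≤-trans lt (ℕP.≤-trans (ℕP.≤-reflexive (ℕP.+-comm 2 l)) (ℕP.+-monoʳ-≤ l (ℕP.m≤m+n 2 e)))

  τ≢F : ∀ l → τ l ≢ F l
  τ≢F l eq = ℕP.1+n≢n (trans (sym (size-F l)) (trans (cong ∣_∣ (sym eq)) (size-τ l)))

  ≠ᵇ : ∀ {m} {ρ π : Subset m} → ρ ≢ π → not (ρ ==S π) ≡ true
  ≠ᵇ {ρ = ρ} {π} h = cong not (≢true {ρ ==S π} (λ q → h (==S⁻ q)))

  ≠ᵇ⁻ : ∀ {m} {ρ π : Subset m} → not (ρ ==S π) ≡ true → ρ ≢ π
  ≠ᵇ⁻ h eq = contra (==S⁺ eq) (bnot h)

  stacked : ∀ l → Stacked (suc e) (l +ℕ (2 +ℕ e)) (S l)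
  stacked zero = base
  stacked (suc l) = stack (F l) (stacked l) (in-S l) (size-F l)
    where
    in-S : ∀ l → S l (F l) ≡ true
    in-S zero = not-full {σ = F zero} (λ all → absurd (all (suc zero)))
      where
      absurd : ¬ (suc zero ∈ F zero)
      absurd (there ())
    in-S (suc l) = ∧⁺ (⊆ᵇ⁺ (τ⊆F l)) (≠ᵇ (τ≢F l))

  Sub : ∀ l → ℕ → Subset (l +ℕ (2 +ℕ e)) → Set
  Sub l i ρ = ∀ {x} → x ∈ ρ → toℕ x < 2 +ℕ l → toℕ x ≡ i ⊎ toℕ x ≡ suc i

  Path : ∀ l → Subset (l +ℕ (2 +ℕ e)) → Set
  Path l ρ = ∃ λ i → i ≤ l × Sub l i ρ

  off-tail : ∀ {l b ρ} → ¬ (τ (suc l) ⊆ b ∷ ρ) → ¬ (τ l ⊆ ρ)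
  off-tail h s = h (λ { (there i) → there (s i) })

  -- A stacking shifts the old path edges by one position and adds the edge from 0 to 1.
  path⁻ : ∀ l {ρ} → S l ρ ≡ true → Path l ρ
  path⁻ zero h = 0 , z≤n , λ { {zero} _ _ → inj₁ refl ; {suc zero} _ _ → inj₂ refl ; {suc (suc x)} _ (s≤s (s≤s ())) }
  path⁻ (suc l) {false ∷ ρ} h with path⁻ l {ρ} (∧ˡ (S l ρ) h)
  ... | i , le , sub = suc i , s≤s le , λ { (there m) (s≤s lt) → Data.Sum.map (cong suc) (cong suc) (sub m lt) }
  path⁻ (suc l) {true ∷ ρ} h = 0 , z≤n , sub
    where
    sub : Sub (suc l) 0 (true ∷ ρ)
    sub here _ = inj₁ refl
    sub (there m) (s≤s lt) with ∈F⁻ l (⊆ᵇ⁻ {σ = ρ} (∧ˡ (ρ ⊆ᵇ F l) h) m)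
    ... | inj₁ q = inj₂ (cong suc q)
    ... | inj₂ le = ⊥-elim (ℕP.<⇒≱ lt le)

  path⁺ : ∀ l {ρ} → ¬ (τ l ⊆ ρ) → Path l ρ → S l ρ ≡ true
  path⁺ zero {ρ} off _ = not-full {σ = ρ} (λ all → off (λ {x} _ → all x))
  path⁺ (suc l) {false ∷ ρ} off (i , le , sub) = ∧⁺ (path⁺ l (off-tail off) (lower i le sub)) (≠ᵇ {ρ = ρ} (λ eq → off-tail off (λ {x} m → subst (x ∈_) (sym eq) (τ⊆F l m))))
    where
    lower : ∀ i → i ≤ suc l → Sub (suc l) i (false ∷ ρ) → Path l ρ
    lower zero _ sub = 0 , z≤n , λ m lt → first (sub (there m) (s≤s lt))
      where
      first : ∀ {k} → suc k ≡ 0 ⊎ suc k ≡ 1 → k ≡ 0 ⊎ k ≡ 1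
      first (inj₂ q) = inj₁ (ℕP.suc-injective q)
    lower (suc i) (s≤s le) sub = i , le , λ m lt → Data.Sum.map ℕP.suc-injective ℕP.suc-injective (sub (there m) (s≤s lt))
  path⁺ (suc l) {true ∷ ρ} off (i , le , sub) = ∧⁺ (⊆ᵇ⁺ {σ = ρ} (λ {x} m → ∈F⁺ l (at m (ℕP.<-≤-connex (toℕ x) (2 +ℕ l))))) (≠ᵇ {ρ = ρ} (λ eq → off-tail off (λ {x} m → subst (x ∈_) (sym eq) (τ⊆F l m))))
    where
    i≡0 : 0 ≡ i ⊎ 0 ≡ suc i → i ≡ 0
    i≡0 (inj₁ q) = sym q
    at : ∀ {x} → x ∈ ρ → toℕ x < 2 +ℕ l ⊎ 2 +ℕ l ≤ toℕ x → toℕ x ≡ 0 ⊎ 2 +ℕ l ≤ toℕ x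
    at m (inj₂ le) = inj₂ le
    at {x} m (inj₁ lt) with i≡0 (sub here (s≤s z≤n)) | sub (there m) (s≤s lt)
    ... | refl | inj₂ q = inj₁ (ℕP.suc-injective q)

  -- The faces above `τ` use at most one path vertex, and only an end of the path: with an inner
  -- vertex, `τ` spans a facet removed by a stacking.
  End : ∀ l → Subset (l +ℕ (2 +ℕ e)) → Set
  End l μ = (∀ {x} → x ∈ μ → toℕ x < 2 +ℕ l → toℕ x ≡ 0) ⊎ (∀ {x} → x ∈ μ → toℕ x < 2 +ℕ l → toℕ x ≡ suc l)

  fills : ∀ l {μ} → τ l ⊆ μ → (∀ {x} → x ∈ μ → toℕ x < 2 +ℕ l → toℕ x ≡ 0) → (∃ λ x → x ∈ μ × toℕ x ≡ 0) → μ ≡ F l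
  fills l {μ} s P (a , ia , ea) = ⊆-antisym to from
    where
    to : μ ⊆ F l
    to {x} m with ℕP.<-≤-connex (toℕ x) (2 +ℕ l)
    ... | inj₁ lt = ∈F⁺ l (inj₁ (P m lt))
    ... | inj₂ le = ∈F⁺ l (inj₂ le)
    from : F l ⊆ μ
    from {x} m with ∈F⁻ l m
    ... | inj₁ q = subst (_∈ μ) (toℕ-injective (trans ea (sym q))) ia
    ... | inj₂ le = s (∈τ⁺ l le)

  -- The old end at position 0 becomes inner: together with `τ` it gives `F l`, which the stacking
  -- removes and does not join to the new vertex either.
  end⁻ : ∀ l {μ} → τ l ⊆ μ → S l μ ≡ true → End l μ
  end⁻ zero {μ} s h with zero ∈? μ | suc zero ∈? μ
  ... | no n0 | _ = inj₂ λ { {zero} m _ → ⊥-elim (n0 m) ; {suc zero} _ _ → refl ; {suc (suc x)} _ (s≤s (s≤s ())) }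
  ... | yes _ | no n1 = inj₁ λ { {zero} _ _ → refl ; {suc zero} m _ → ⊥-elim (n1 m) ; {suc (suc x)} _ (s≤s (s≤s ())) }
  ... | yes i0 | yes i1 = ⊥-elim (not-full⁻ {σ = μ} h λ { zero → i0 ; (suc zero) → i1 ; (suc (suc x)) → s (there (there ∈⊤)) })
  end⁻ (suc l) {false ∷ μ} s h with end⁻ l {μ} (λ i → tail∈ (s (there i))) (∧ˡ (S l μ) h)
  ... | inj₂ P = inj₂ λ { (there m) (s≤s lt) → cong suc (P m lt) }
  ... | inj₁ P = inj₁ λ { (there {i = x} m) (s≤s lt) → ⊥-elim (≠ᵇ⁻ {ρ = μ} (∧ʳ (S l μ) h) (fills l (λ i → tail∈ (s (there i))) P (x , m , P m lt))) }
  end⁻ (suc l) {true ∷ μ} s h = inj₁ λ { here _ → refl ; (there {i = x} m) (s≤s lt) → ⊥-elim (≠ᵇ⁻ {ρ = μ} (∧ʳ (μ ⊆ᵇ F l) h) (fills l (λ i → tail∈ (s (there i))) P (x , m , P m lt))) }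
    where
    P : ∀ {x} → x ∈ μ → toℕ x < 2 +ℕ l → toℕ x ≡ 0
    P m lt with ∈F⁻ l (⊆ᵇ⁻ {σ = μ} (∧ˡ (μ ⊆ᵇ F l) h) m)
    ... | inj₁ q = q
    ... | inj₂ le = ⊥-elim (ℕP.<⇒≱ lt le)

  end⁺ : ∀ l {μ} → τ l ⊆ μ → End l μ → S l μ ≡ true
  end⁺ zero {μ} s (inj₁ P) = not-full {σ = μ} (λ all → absurd (P (all (suc zero)) (s≤s (s≤s z≤n))))
    where
    absurd : 1 ≢ 0
    absurd ()
  end⁺ zero {μ} s (inj₂ P) = not-full {σ = μ} (λ all → absurd (P (all zero) (s≤s z≤n)))
    where
    absurd : 0 ≢ 1
    absurd ()
  end⁺ (suc l) {false ∷ μ} s E = ∧⁺ (end⁺ l (λ i → tail∈ (s (there i))) (lower E)) (≠ᵇ {ρ = μ} (differ E))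
    where
    lower : End (suc l) (false ∷ μ) → End l μ
    lower (inj₁ P) = inj₁ (λ m lt → ⊥-elim (ℕP.1+n≢0 (P (there m) (s≤s lt))))
    lower (inj₂ P) = inj₂ (λ m lt → ℕP.suc-injective (P (there m) (s≤s lt)))
    differ : End (suc l) (false ∷ μ) → μ ≢ F l
    differ E eq with end {l} 0 (s≤s z≤n)
    ... | x , ex with subst (x ∈_) (sym eq) (∈F⁺ l (inj₁ ex))
    ...   | m with E
    ...     | inj₁ P = ℕP.1+n≢0 (P (there m) (s≤s (subst (_< 2 +ℕ l) (sym ex) (s≤s z≤n))))
    ...     | inj₂ P = ℕP.1+n≢0 (trans (sym (ℕP.suc-injective (P (there m) (s≤s (subst (_< 2 +ℕ l) (sym ex) (s≤s z≤n)))))) ex)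
  end⁺ (suc l) {true ∷ μ} s (inj₂ P) = ⊥-elim (ℕP.1+n≢0 (sym (P here (s≤s z≤n))))
  end⁺ (suc l) {true ∷ μ} s (inj₁ P) = ∧⁺ (⊆ᵇ⁺ {σ = μ} sub) (≠ᵇ {ρ = μ} differ)
    where
    sub : μ ⊆ F l
    sub {x} m with ℕP.<-≤-connex (toℕ x) (2 +ℕ l)
    ... | inj₁ lt = ⊥-elim (ℕP.1+n≢0 (P (there m) (s≤s lt)))
    ... | inj₂ le = ∈F⁺ l (inj₂ le)
    differ : μ ≢ F l
    differ eq with end {l} 0 (s≤s z≤n)
    ... | x , ex = ℕP.1+n≢0 (P (there (subst (x ∈_) (sym eq) (∈F⁺ l (inj₁ ex)))) (s≤s (subst (_< 2 +ℕ l) (sym ex) (s≤s z≤n))))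

  module _ (l : ℕ) where

    apex : ∀ {i} → i ≡ 0 ⊎ i ≡ suc l → ∃ λ x → toℕ {l +ℕ (2 +ℕ e)} x ≡ i × x ∉ τ l × S l (τ l ▸ x) ≡ true
    apex {i} h = x , ex , x∉ , end⁺ l (λ k → ∈▸ˡ k) (ends h)
      where
      lt : i < 2 +ℕ l
      lt = bound h
        where
        bound : ∀ {i} → i ≡ 0 ⊎ i ≡ suc l → i < 2 +ℕ l
        bound (inj₁ refl) = s≤s z≤n
        bound (inj₂ refl) = ℕP.≤-refl
      x = proj₁ (end {l} i lt)
      ex = proj₂ (end {l} i lt)
      x∉ : x ∉ τ l
      x∉ m = ℕP.<⇒≱ (subst (_< 2 +ℕ l) (sym ex) lt) (∈τ⁻ l m)
      only : ∀ {y} → y ∈ τ l ▸ x → toℕ y < 2 +ℕ l → toℕ y ≡ i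
      only m lt with ∈▸⁻ m
      ... | inj₁ k = ⊥-elim (ℕP.<⇒≱ lt (∈τ⁻ l k))
      ... | inj₂ refl = ex
      ends : i ≡ 0 ⊎ i ≡ suc l → End l (τ l ▸ x)
      ends (inj₁ q) = inj₁ (λ m lt → trans (only m lt) q)
      ends (inj₂ q) = inj₂ (λ m lt → trans (only m lt) q)

    facet-over : ∀ {μ} → τ l ⊆ μ → S l μ ≡ true → ∃ λ x → μ ⊆ τ l ▸ x × x ∉ τ l × S l (τ l ▸ x) ≡ true
    facet-over {μ} s h with end⁻ l s h
    ... | inj₁ P = let x , ex , nx , f = apex (inj₁ refl) in x , inside ex P , nx , f
      where
      inside : ∀ {x} → toℕ x ≡ 0 → (∀ {y} → y ∈ μ → toℕ y < 2 +ℕ l → toℕ y ≡ 0) → μ ⊆ τ l ▸ x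
      inside {x} ex P {y} m with ℕP.<-≤-connex (toℕ y) (2 +ℕ l)
      ... | inj₁ lt = subst (_∈ τ l ▸ x) (toℕ-injective (trans ex (sym (P m lt)))) (∈▸ʳ {σ = τ l})
      ... | inj₂ le = ∈▸ˡ (∈τ⁺ l le)
    ... | inj₂ P = let x , ex , nx , f = apex (inj₂ refl) in x , inside ex P , nx , f
      where
      inside : ∀ {x} → toℕ x ≡ suc l → (∀ {y} → y ∈ μ → toℕ y < 2 +ℕ l → toℕ y ≡ suc l) → μ ⊆ τ l ▸ x
      inside {x} ex P {y} m with ℕP.<-≤-connex (toℕ y) (2 +ℕ l)
      ... | inj₁ lt = subst (_∈ τ l ▸ x) (toℕ-injective (trans ex (sym (P m lt)))) (∈▸ʳ {σ = τ l})
      ... | inj₂ le = ∈▸ˡ (∈τ⁺ l le)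

    -- Such a ridge is `τ l` itself, which lies in two facets, one at either end of the path.
    interior : ∀ {G} → τ l ⊆ G → S l G ≡ true → ∣ G ∣ ≡ e → ♯ (λ v → not (lookup G v) ∧ S l (G ▸ v)) ≢ 1ℤ
    interior {G} s h eG one with ⊆-full s (ℕP.≤-reflexive (trans eG (sym (size-τ l))))
    ... | refl with apex (inj₁ refl) | apex (inj₂ refl)
    ...   | x , ex , nx , fx | y , ey , ny , fy = absurd one (ℤP.≤-trans (ℤP.≤-reflexive (sym (cong₂ _+_ (cong ⟦_⟧ (∧⁺ (cong not (nmem nx)) fx)) (cong ⟦_⟧ (∧⁺ (cong not (nmem ny)) fy)))))
             (∑-≥₂ {f = λ v → ⟦ not (lookup (τ l) v) ∧ S l (τ l ▸ v) ⟧} (λ v → 0≤⟦⟧ (not (lookup (τ l) v) ∧ S l (τ l ▸ v))) {x} {y} (λ eq → ℕP.1+n≢0 (trans (sym ey) (trans (cong toℕ (sym eq)) ex)))))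
      where
      absurd : ∀ {a} → a ≡ 1ℤ → pos 2 ≤ℤ a → Empty
      absurd refl (+≤+ (s≤s ()))

    restrict : ∀ {ρ G} → ρ ⊆ G → End l (G ∪ τ l) → End l (ρ ∪ τ l)
    restrict {ρ} {G} s (inj₁ P) = inj₁ (λ m → P (∪-mono {σ = ρ} {G} s (λ i → i) m))
    restrict {ρ} {G} s (inj₂ P) = inj₂ (λ m → P (∪-mono {σ = ρ} {G} s (λ i → i) m))

    link-mono : ∀ {ρ G} → ρ ⊆ G → S l (G ∪ τ l) ≡ true → S l (ρ ∪ τ l) ≡ true
    link-mono {ρ} {G} s h = end⁺ l (λ i → ∈∪ʳ {σ = ρ} i) (restrict s (end⁻ l (λ i → ∈∪ʳ {σ = G} i) h))

    in-facet : ∀ {ρ} → S l (ρ ∪ τ l) ≡ true → ∃ λ H → ρ ∪ τ l ⊆ H × S l H ≡ true × ∣ H ∣ ≡ suc e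
    in-facet {ρ} h = let x , sub , nx , f = facet-over {ρ ∪ τ l} (λ i → ∈∪ʳ {σ = ρ} i) h in τ l ▸ x , sub , f , trans (∣▸∣ nx) (cong suc (size-τ l))

    size-bound : ∀ {G} → τ l ⊆ G → S l G ≡ true → ∣ G ∣ ≤ suc e
    size-bound s h = let x , sub , nx , f = facet-over s h in ℕP.≤-trans (p⊆q⇒∣p∣≤∣q∣ sub) (ℕP.≤-reflexive (trans (∣▸∣ nx) (cong suc (size-τ l))))

    module R = Retriangulation e (S l) (τ l) link-mono in-facet size-bound interior

module PolygonModel {n : ℕ} (s l : ℕ) (Δ : Cx n) (P : BoundaryPolygon (4 +ℕ s) Δ (3 +ℕ l)) (s≡ : BoundaryPolygon.s P ≡ s) where

  open BoundaryPolygon P hiding (s)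

  e c : ℕ
  e = 3 +ℕ s
  c = 3 +ℕ l

  Eσ : Enumeration σ e
  Eσ = enumerate e (trans size-σ (cong (3 +ℕ_) s≡))

  in-Gd : InGd (suc e) Δ
  in-Gd = inj₂ (c , s≤s (s≤s (s≤s z≤n)) , polygon-iso P (swap-labels L) Eσ (join (bdSimplex (2 +ℕ s)) (cycleCx c))
      (λ {ρ} g → (λ h → not-full⁻ {σ = take e ρ} (∧ˡ (not (take e ρ ==S ⊤)) g) (λ i → ∈take⁺ (h i))) , sides (cycle⁻ {ρ = drop e ρ} (∧ʳ (not (take e ρ ==S ⊤)) g)))
      (λ {ρ} h t → ∧⁺ (not-full {σ = take e ρ} (λ k → h (λ i → ∈take⁻ (k i)))) (cycle⁺ {ρ = drop e ρ} (sides⁻ t))))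
    where
    open JoinPositions e c
    sides : ∀ {ρ} → InSide (drop e ρ) → Sides c (swap-labels L) ρ
    sides (i , j , lt , nx , cov) = i , j , lt , nx , λ k m → cov (∈drop⁺ m)
    sides⁻ : ∀ {ρ} → Sides c (swap-labels L) ρ → InSide (drop e ρ)
    sides⁻ (i , j , lt , nx , cov) = i , j , lt , nx , λ {k} m → cov k (∈drop⁻ m)

  open Chain e

  M : ℕ
  M = l +ℕ (2 +ℕ e)

  positions : suc M ≡ c +ℕ e
  positions = lem l e
    where
    lem : ∀ l e → suc (l +ℕ (2 +ℕ e)) ≡ 3 +ℕ l +ℕ e
    lem = ℕ-solve-∀

  L : Labelling (suc M) c e
  L = split-labels c e positions
  open Labelling L

  cycle-position : ∀ k → toℕ (unlab (inj₁ k)) ≡ toℕ k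
  cycle-position k = trans (toℕ-cast (sym positions) (Data.Fin.join c e (inj₁ k))) (toℕ-↑ˡ k e)

  σ-position : ∀ j → c ≤ toℕ (unlab (inj₂ j))
  σ-position j = ℕP.≤-trans (ℕP.m≤m+n c (toℕ j)) (ℕP.≤-reflexive (sym (trans (toℕ-cast (sym positions) (Data.Fin.join c e (inj₂ j))) (toℕ-↑ʳ c j))))

  at-cycle : ∀ {x} → toℕ x < c → ∃ λ k → unlab (inj₁ k) ≡ x × toℕ k ≡ toℕ x
  at-cycle {x} lt = fromℕ< lt , toℕ-injective (trans (cycle-position (fromℕ< lt)) (toℕ-fromℕ< lt)) , toℕ-fromℕ< lt

  at-σ : ∀ {x} → c ≤ toℕ x → ∃ λ j → unlab (inj₂ j) ≡ x
  at-σ {x} le = from (lab x) (unlab-lab x)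
    where
    from : ∀ y → unlab y ≡ x → ∃ λ j → unlab (inj₂ j) ≡ x
    from (inj₁ k) q = ⊥-elim (ℕP.<⇒≱ (toℕ<n k) (ℕP.≤-trans le (ℕP.≤-reflexive (trans (cong toℕ (sym q)) (cycle-position k)))))
    from (inj₂ j) q = j , q

  σ-covered : ∀ {b ρ} → τ l ⊆ ρ → ∀ j → unlab (inj₂ j) ∈ b ∷ ρ
  σ-covered {b} {ρ} s j = go (unlab (inj₂ j)) (σ-position j)
    where
    go : ∀ x → c ≤ toℕ x → x ∈ b ∷ ρ
    go (suc x) (s≤s le) = there (s (∈τ⁺ l le))

  τ-covered : ∀ {b ρ} → (∀ j → unlab (inj₂ j) ∈ b ∷ ρ) → τ l ⊆ ρ
  τ-covered {b} {ρ} h m = let j , q = at-σ (s≤s (∈τ⁻ l m)) in tail∈ (subst (_∈ b ∷ ρ) q (h j))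

  -- Reading a face of the retriangulation: position 0 is the new vertex, and
  -- position suc x is position x of the stacked sphere.
  read : ∀ {b ρ i j} → (b ≡ true → 0 ≡ i ⊎ 0 ≡ j) → (∀ {x} → x ∈ ρ → toℕ x < 2 +ℕ l → suc (toℕ x) ≡ i ⊎ suc (toℕ x) ≡ j)
    → ∀ k → unlab (inj₁ k) ∈ b ∷ ρ → toℕ k ≡ i ⊎ toℕ k ≡ j
  read {b} {ρ} {i} {j} h0 hs k m = go (unlab (inj₁ k)) (cycle-position k) m
    where
    go : ∀ x → toℕ x ≡ toℕ k → x ∈ b ∷ ρ → toℕ k ≡ i ⊎ toℕ k ≡ j
    go zero q here = subst (λ t → t ≡ i ⊎ t ≡ j) q (h0 refl)
    go (suc x) q (there m) = subst (λ t → t ≡ i ⊎ t ≡ j) q (hs m (ℕP.≤-pred (ℕP.≤-trans (s≤s (ℕP.≤-reflexive q)) (toℕ<n k))))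

  write : ∀ {b ρ i j} → (∀ k → unlab (inj₁ k) ∈ b ∷ ρ → toℕ k ≡ i ⊎ toℕ k ≡ j) → ∀ {x} → x ∈ ρ → toℕ x < 2 +ℕ l → suc (toℕ x) ≡ i ⊎ suc (toℕ x) ≡ j
  write {b} {ρ} {i} {j} cov {x} m lt = let k , q , t = at-cycle {suc x} (s≤s lt) in subst (λ z → z ≡ i ⊎ z ≡ j) t (cov k (subst (_∈ b ∷ ρ) (sym q) (there m)))

  Spec : Subset (suc M) → Set
  Spec ρ = ¬ (∀ j → unlab (inj₂ j) ∈ ρ) × Sides c L ρ

  -- The new vertex 0 closes the path to a cycle: the boundary of the star joins it to the two path
  -- ends, which now sit at positions 1 and `2 +ℕ l`.
  crtr⁻ : ∀ {ρ} → R.C l ρ ≡ true → Spec ρ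
  crtr⁻ {false ∷ ρ} h = (λ all → proj₂ old (τ-covered all)) , from (path⁻ l (proj₁ old))
    where
    old = R.old⁻ l {ρ} h
    from : Path l ρ → Sides c L (false ∷ ρ)
    from (i , le , sub) = suc i , suc (suc i) , s≤s (s≤s (ℕP.≤-trans le (ℕP.n≤1+n l))) , inj₁ (refl , s≤s (s≤s (s≤s le))) , read (λ ()) (λ m lt → Data.Sum.map (cong suc) (cong suc) (sub m lt))
  crtr⁻ {true ∷ ρ} h = (λ all → proj₂ new (τ-covered all)) , from (end⁻ l (λ i → ∈∪ʳ {σ = ρ} i) (proj₁ new))
    where
    new = R.bdry⁻ l {ρ} h
    from : End l (ρ ∪ τ l) → Sides c L (true ∷ ρ)
    from (inj₁ E) = 0 , 1 , s≤s z≤n , inj₁ (refl , s≤s (s≤s z≤n)) , read (λ _ → inj₁ refl) (λ m lt → inj₂ (cong suc (E (∈∪ˡ m) lt)))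
    from (inj₂ E) = 2 +ℕ l , 0 , ℕP.≤-refl , inj₂ (refl , refl) , read (λ _ → inj₂ refl) (λ m lt → inj₁ (cong suc (E (∈∪ˡ m) lt)))

  crtr⁺ : ∀ {ρ} → ¬ (∀ j → unlab (inj₂ j) ∈ ρ) → Sides c L ρ → R.C l ρ ≡ true
  crtr⁺ {false ∷ ρ} h (i , j , lt , nx , cov) = R.old⁺ l {ρ} (path⁺ l uncovered (path i lt nx (write cov))) uncovered
    where
    uncovered : ¬ (τ l ⊆ ρ)
    uncovered s = h (σ-covered s)
    path : ∀ i {j} → i < c → Next c i j → (∀ {x} → x ∈ ρ → toℕ x < 2 +ℕ l → suc (toℕ x) ≡ i ⊎ suc (toℕ x) ≡ j) → Path l ρ
    path zero _ (inj₁ (refl , _)) W = 0 , z≤n , λ m lt → first (W m lt)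
      where
      first : ∀ {k} → suc k ≡ 0 ⊎ suc k ≡ 1 → k ≡ 0 ⊎ k ≡ 1
      first (inj₂ q) = inj₁ (ℕP.suc-injective q)
    path (suc i) _ (inj₁ (refl , s≤s (s≤s (s≤s le)))) W = i , le , λ m lt → Data.Sum.map ℕP.suc-injective ℕP.suc-injective (W m lt)
    path (suc .(suc l)) _ (inj₂ (refl , refl)) W = l , ℕP.≤-refl , λ m lt → last (W m lt)
      where
      last : ∀ {k} → suc k ≡ suc (suc l) ⊎ suc k ≡ 0 → k ≡ l ⊎ k ≡ suc l
      last (inj₁ q) = inj₂ (ℕP.suc-injective q)
  crtr⁺ {true ∷ ρ} h (i , j , lt , nx , cov) = R.bdry⁺ l {ρ} (end⁺ l (λ m → ∈∪ʳ {σ = ρ} m) (ends nx here₀ (write cov))) (λ s → h (σ-covered s))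
    where
    here₀ : 0 ≡ i ⊎ 0 ≡ j
    here₀ = let k , q , t = at-cycle {zero} (s≤s z≤n) in subst (λ z → z ≡ i ⊎ z ≡ j) t (cov k (subst (_∈ true ∷ ρ) (sym q) here))
    drop-τ : ∀ {x} → x ∈ ρ ∪ τ l → toℕ x < 2 +ℕ l → x ∈ ρ
    drop-τ m lt with x∈p∪q⁻ ρ (τ l) m
    ... | inj₁ k = k
    ... | inj₂ k = ⊥-elim (ℕP.<⇒≱ lt (∈τ⁻ l k))
    ends : ∀ {i j} → Next c i j → 0 ≡ i ⊎ 0 ≡ j → (∀ {x} → x ∈ ρ → toℕ x < 2 +ℕ l → suc (toℕ x) ≡ i ⊎ suc (toℕ x) ≡ j) → End l (ρ ∪ τ l)
    ends (inj₁ (refl , _)) (inj₁ refl) W = inj₁ (λ m lt → first (W (drop-τ m lt) lt))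
      where
      first : ∀ {k} → suc k ≡ 0 ⊎ suc k ≡ 1 → k ≡ 0
      first (inj₂ q) = ℕP.suc-injective q
    ends (inj₂ (refl , refl)) _ W = inj₂ (λ m lt → last (W (drop-τ m lt) lt))
      where
      last : ∀ {k} → suc k ≡ suc (suc l) ⊎ suc k ≡ 0 → k ≡ suc l
      last (inj₁ q) = ℕP.suc-injective q

  retriangulated : Retriangulated (suc e) Δ
  retriangulated = M , S l , τ l , stacked l , S-τ , subst (1 <_) (sym (size-τ l)) (s≤s (s≤s z≤n)) , subst (_< suc e) (sym (size-τ l)) ℕP.≤-refl
      , polygon-iso P L Eσ (R.C l) crtr⁻ crtr⁺
    where
    S-τ : S l (τ l) ≡ true
    S-τ = end⁺ l (λ m → m) (inj₁ (λ m lt → ⊥-elim (ℕP.<⇒≱ lt (∈τ⁻ l m))))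

two-boundaries-case : ∀ {n d} {Δ : Cx n} → TwoBoundaries d Δ → Retriangulated d Δ × InGd d Δ
two-boundaries-case {Δ = Δ} T@(record { s = s ; r = r ; dims = refl }) = Model.retriangulated , Model.in-Gd
  where
  module Model = TwoBoundariesModel s r Δ T refl refl

polygon-case : ∀ {n d c} {Δ : Cx n} → 3 ≤ c → BoundaryPolygon d Δ c → Retriangulated d Δ × InGd d Δ
polygon-case {c = suc (suc (suc l))} {Δ} (s≤s (s≤s (s≤s z≤n))) P@(record { s = s ; dims = refl }) = Model.retriangulated , Model.in-Gd
  where
  module Model = PolygonModel s l Δ P refl

open import Data.Integer using (+_)

theorem4p4 : (d n : ℕ) → 5 ≤ d → (Δ : Cx n)
    → NormalPM d Δ → Prime d Δ → gNum d Δ 2 ≡ + 1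
    → (Σ[ m ∈ ℕ ] Σ[ S ∈ Cx m ] Σ[ τ ∈ Subset m ]
    (Stacked d m S × S τ ≡ true × 1 < ∣ τ ∣ × ∣ τ ∣ < d
    × Iso Δ (crtr d (st S τ) S)))
    × InGd d Δ
theorem4p4 (suc d) n 5≤d Δ pm prime g₂ = cases (Shapes.shape (suc d) 5≤d Δ pm prime (trans (γ-g₂ pm) (cong (pos 2 *_) g₂)))
  where
  cases : TwoBoundaries (suc d) Δ ⊎ (∃ λ c → 3 ≤ c × BoundaryPolygon (suc d) Δ c) → Retriangulated (suc d) Δ × InGd (suc d) Δ
  cases (inj₁ T) = two-boundaries-case T
  cases (inj₂ (c , 3≤c , P)) = polygon-case 3≤c P
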